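{- Let $n\ge 3$ and consider the affine Weyl group $W_{\mathrm{aff}}$ of type $A_{n-1}^{(1)}$. Let $\mathbf d=(d_0,\dots,d_{n-1})>c$ be a degree (i.e. $d_i\ge1$ for all $i$ and $\mathbf d\ne c$) and let $m=\min\{d_0,\dots,d_{n-1}\}$. Write $z_{\mathbf d-mc}=s_{\gamma_1}s_{\gamma_2}\cdots s_{\gamma_k}$ ($k\ge0$), where $\gamma_1,\dots,\gamma_k\in\Pi_{\mathrm{aff}}^{\mathrm{re},+}$ are such that for all $i\ne j$ either $\operatorname{supp}(\gamma_i)$ and $\operatorname{supp}(\gamma_j)$ are disconnected, or both $\gamma_i\perp\gamma_j$ and $\gamma_i,\gamma_j$ are comparable. Let $\Pi_{\mathrm{aff}}^{\mathrm{re},+}(\mathbf d-mc)$ be the set of $\beta'\in\Pi_{\mathrm{aff}}^{\mathrm{re},+}$ such that $\beta'<c$ and, for every $i=1,\dots,k$, either $\beta'\cap\gamma_i=\emptyset$, or both $\beta'>\gamma_i$ and $\beta'\perp\gamma_i$. Then: (1) $\Gamma_{\mathbf d}(id)=\{t_{m\beta'}z_{\mathbf d-mc}:\beta'\in\Pi_{\mathrm{aff}}^{\mathrm{re},+}(\mathbf d-mc),\ \alpha_0\notin\operatorname{supp}(\beta')\}\cup\{t_{m(\beta'-c)}z_{\mathbf d-mc}:\beta'\in\Pi_{\mathrm{aff}}^{\mathrm{re},+}(\mathbf d-mc),\ \alpha_0\in\operatorname{supp}(\beta')\}$; (2) $|\Gamma_{\mathbf d}(id)|=|\Pi_{\mathrm{aff}}^{\mathrm{re},+}(\mathbf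 d-mc)|$; (3) $\ell(w)=2m(n-1)+\ell(z_{\mathbf d-mc})$ for all $w\in\Gamma_{\mathbf d}(id)$.
   Context: Roots. Let $n\ge 3$. Let $\alpha_0,\dots,\alpha_{n-1}$ (indices mod $n$) be the affine simple roots of type $A_{n-1}^{(1)}$, $Q_{\mathrm{aff}}=\bigoplus_{i=0}^{n-1}\mathbb Z\alpha_i$, with symmetric form $\langle\alpha_i,\alpha_i\rangle=2$, $\langle\alpha_i,\alpha_{i\pm1}\rangle=-1$, all other $\langle\alpha_i,\alpha_j\rangle=0$; $\perp$ refers to this form. For $a,b\in Q_{\mathrm{aff}}$, $a\le b$ means $b-a$ has non-negative coefficients, and $a<b$ means $a\le b$, $a\ne b$; comparable means $a\le b$ or $b\le a$. Put $c=\sum_{i=0}^{n-1}\alpha_i$ (identified with the imaginary root $\delta$). Let $\Pi=\Pi^+\sqcup\Pi^-$ be the finite root system of type $A_{n-1}$ with simple roots $\alpha_1,\dots,\alpha_{n-1}$. The affine real roots are $\alpha+mc$ with $\alpha\in\Pi$, $m\in\mathbb Z$; such a root is positive if $m>0$, or $m=0$ and $\alpha\in\Pi^+$. The set of positive real roots is $\Pi_{\mathrm{aff}}^{\mathrm{re},+}$. For $\alpha=\sum a_i\alpha_i$, $\operatorname{supp}(\alpha)=\{\alpha_i:a_i\ne0\}$. $\alpha\cap\beta=\emptyset$ means $\operatorname{supp}(\alpha)\cap\operatorname{supp}(\beta)=\emptyset$. Two supports are disconnected if they are disjoint and no simple root in one is adjacent (in the cyclic Dynkin diagram) to a simple root in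 the other. Weyl group. For a real root $\alpha$, $s_\alpha(\mu)=\mu-\langle\mu,\alpha\rangle\alpha$. $W_{\mathrm{aff}}$ is the group generated by $s_i=s_{\alpha_i}$, $0\le i\le n-1$ (a Coxeter group with these generators), with length $\ell$ and Bruhat order $\le$. One has $W_{\mathrm{aff}}=W\ltimes Q$, where $W=\langle s_1,\dots,s_{n-1}\rangle$ and $Q=\bigoplus_{i=1}^{n-1}\mathbb Z\alpha_i$ (root and coroot lattices identified); $t_\mu$ denotes the image of $\mu\in Q$, with $s_{\alpha+mc}=s_\alpha t_{m\alpha}$ for $\alpha\in\Pi$, $m\in\mathbb Z$ (so $t_\mu(\nu)=\nu-\langle\mu,\nu\rangle c$). For a positive real root $\beta'<c$: $\beta'\in Q$ if $\alpha_0\notin\operatorname{supp}(\beta')$, and $\beta'-c\in Q$ if $\alpha_0\in\operatorname{supp}(\beta')$. Hecke product: $u\cdot s_i=us_i$ if $\ell(us_i)>\ell(u)$ and $u\cdot s_i=u$ otherwise; $u\cdot v=u\cdot s_{i_1}\cdots s_{i_k}$ (applied left to right) for any reduced expression $v=s_{i_1}\cdots s_{i_k}$. This is a well-defined associative product. Degrees and $z_{\mathbf d}$. A degree is a tuple $\mathbf d=(d_0,\dots,d_{n-1})\in\mathbb Z_{\ge0}^n$, identified with $\sum d_i\alpha_i$; degrees are ordered componentwise. For a degree $\mathbf d$ with $d_i=0$ for some $i$: $z_{\mathbf 0}=id$, and for $\mathbf d\ne0$, $z_{\mathbf d}=s_\alpha\cdot z_{\mathbf d-\alpha}$ (Hecke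 product) where $\alpha$ is any maximal element of the set of positive real roots $\le\mathbf d$; this is independent of choices. An expression $z_{\mathbf d}=s_{\gamma_1}\cdots s_{\gamma_k}$ with the pairwise properties required in the claim always exists. Curve neighborhoods. The moment graph has vertex set $W_{\mathrm{aff}}$ and an edge $u\stackrel{\alpha}{\longrightarrow}us_\alpha$ of degree $\alpha$ for each $u\in W_{\mathrm{aff}}$, $\alpha\in\Pi_{\mathrm{aff}}^{\mathrm{re},+}$. The degree of a chain (a succession of adjacent edges, possibly empty) is the sum of the degrees of its edges. For $u\in W_{\mathrm{aff}}$, $\Gamma_{\mathbf d}(u)$ is the set of Bruhat-maximal elements of the set of all $v\in W_{\mathrm{aff}}$ that can be joined to some $u'\le u$ by a chain of degree $\le\mathbf d$. -}

module Defs where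

open import Data.Bool using (if_then_else_; _∧_)
open import Data.Fin as Fin using (Fin; toℕ)
open import Data.Integer as ℤ using (ℤ; +_; 0ℤ; 1ℤ; -1ℤ)
open import Data.Integer.Properties using (+-0-commutativeMonoid)
open import Data.List using (List; []; _∷_; _∷ʳ_; length)
open import Data.Nat as ℕ using (ℕ; suc)
open import Data.Product using (Σ; Σ-syntax; ∃; ∃-syntax; ∃₂; _×_; _,_; proj₁)
open import Data.Sum using (_⊎_)
open import Data.Vec.Functional using (Vector; foldr)
open import Function using (_∘_; id; Inverse)
open import Relation.Binary using (Rel; Setoid; Decidable)
open import Relation.Binary.Construct.Closure.ReflexiveTransitive using (Star; ε; _◅_)
open import Relation.Binary.PropositionalEquality as ≡ using (_≡_; _≢_; _≗_; _→-setoid_)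
open import Relation.Nullary using (¬_; does; _×-dec_; _⊎-dec_)
open import Relation.Unary using (Pred)
import Relation.Binary.Construct.On as On

open import Algebra.Properties.CommutativeMonoid.Sum +-0-commutativeMonoid using (sum)

private
  variable
    n : ℕ

------------------------------------------------------------------------
-- The affine root lattice of type A_{n-1}^{(1)}, n ≥ 3

-- An element is its coefficient vector in the basis α_0, …, α_{n-1}, and
-- is considered up to pointwise equality _≗_.
Q : ℕ → Set
Q n = Vector ℤ n

-- j = i + 1 modulo n
Next : Rel (Fin n) _
Next {n} i j = toℕ j ≡ suc (toℕ i) ⊎ (suc (toℕ i) ≡ n × toℕ j ≡ 0)

Adjacent : Rel (Fin n) _
Adjacent i j = Next i j ⊎ Next j i

next? : Decidable (Next {n})
next? {n} i j =
  (toℕ j ℕ.≟ suc (toℕ i)) ⊎-dec ((suc (toℕ i) ℕ.≟ n) ×-dec (toℕ j ℕ.≟ 0))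

adjacent? : Decidable (Adjacent {n})
adjacent? i j = next? i j ⊎-dec next? j i

cartan : Fin n → Fin n → ℤ
cartan i j =
  if does (i Fin.≟ j) then + 2 else
  if does (adjacent? i j) then -1ℤ else 0ℤ

⟨_,_⟩ : Q n → Q n → ℤ
⟨ μ , ν ⟩ = sum λ i → sum λ j → μ i ℤ.* cartan i j ℤ.* ν j

infix 4 _⊥_ _≤Q_ _<Q_

_⊥_ : Rel (Q n) _
μ ⊥ ν = ⟨ μ , ν ⟩ ≡ 0ℤ

_≤Q_ : Rel (Q n) _
a ≤Q b = ∀ i → a i ℤ.≤ b i

_<Q_ : Rel (Q n) _
a <Q b = a ≤Q b × ¬ (a ≗ b)

Comparable : Rel (Q n) _
Comparable a b = a ≤Q b ⊎ b ≤Q a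

infixl 6 _+Q_ _-Q_ _⊖c_
infixr 7 _*Q_

0Q : Q n
0Q _ = 0ℤ

_+Q_ _-Q_ : Q n → Q n → Q n
(a +Q b) i = a i ℤ.+ b i
(a -Q b) i = a i ℤ.- b i

_*Q_ : ℤ → Q n → Q n
(k *Q a) i = k ℤ.* a i

simple : Fin n → Q n
simple i j = if does (i Fin.≟ j) then 1ℤ else 0ℤ

c : Q n
c _ = 1ℤ

infix 4 _∈supp_ α₀∈supp_

_∈supp_ : Fin n → Q n → Set
i ∈supp a = a i ≢ 0ℤ

α₀∈supp_ : Pred (Q n) _
α₀∈supp a = ∃[ i ] toℕ i ≡ 0 × i ∈supp a

Disjoint : Rel (Q n) _
Disjoint a b = ∀ i → ¬ (i ∈supp a × i ∈supp b)

Disconnected : Rel (Q n) _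
Disconnected a b =
  Disjoint a b × (∀ i j → i ∈supp a → j ∈supp b → ¬ Adjacent i j)

------------------------------------------------------------------------
-- Roots

-- α_i + α_{i+1} + … + α_j
interval : Fin n → Fin n → Q n
interval i j k =
  if does (i Fin.≤? k) ∧ does (k Fin.≤? j) then 1ℤ else 0ℤ

-- The finite root system of type A_{n-1} with simple roots
-- α_1, …, α_{n-1}: its positive roots are the α_i + … + α_j with
-- 1 ≤ i ≤ j ≤ n-1.
FinitePositive : Pred (Q n) _
FinitePositive α =
  ∃₂ λ i j → 1 ℕ.≤ toℕ i × i Fin.≤ j × α ≗ interval i j

FiniteRoot : Pred (Q n) _
FiniteRoot α = FinitePositive α ⊎ FinitePositive (0Q -Q α)

PositiveReal : Pred (Q n) _
PositiveReal β =
  ∃₂ λ α m → (β ≗ α +Q m *Q c) ×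
    ((0ℤ ℤ.< m × FiniteRoot α) ⊎ (m ≡ 0ℤ × FinitePositive α))

------------------------------------------------------------------------
-- The affine Weyl group

Op : ℕ → Set
Op n = Q n → Q n

infix 4 _≐_

_≐_ : Rel (Op n) _
f ≐ g = ∀ μ → f μ ≗ g μ

opSetoid : ℕ → Setoid _ _
opSetoid n = record
  { Carrier       = Op n
  ; _≈_           = _≐_
  ; isEquivalence = record
    { refl  = λ μ i → ≡.refl
    ; sym   = λ p μ i → ≡.sym (p μ i)
    ; trans = λ p q μ i → ≡.trans (p μ i) (q μ i)
    }
  }

reflection : Q n → Op n
reflection α μ = μ -Q ⟨ μ , α ⟩ *Q α

translation : Q n → Op n
translation μ ν = ν -Q ⟨ μ , ν ⟩ *Q c

-- W_aff is the group of operators on the root lattice generated by the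
-- simple reflections.  As these are involutions, each element is given by
-- a word in them; words are identified when they act in the same way.
W : ℕ → Set
W n = List (Fin n)

⟦_⟧ : W n → Op n
⟦ []    ⟧ = id
⟦ i ∷ w ⟧ = reflection (simple i) ∘ ⟦ w ⟧

wSetoid : ℕ → Setoid _ _
wSetoid n = On.setoid (opSetoid n) ⟦_⟧

infix 4 _≈_

_≈_ : Rel (W n) _
u ≈ v = ⟦ u ⟧ ≐ ⟦ v ⟧

-- ℓ(u) = k
HasLength : W n → ℕ → Set
HasLength u k =
  (∃[ w ] w ≈ u × length w ≡ k) × (∀ w → w ≈ u → k ℕ.≤ length w)

Reduced : Pred (W n) _
Reduced w = HasLength w (length w)

infix 4 _<ℓ_ _≤B_

-- ℓ(u) < ℓ(v)
_<ℓ_ : Rel (W n) _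
u <ℓ v = ∃₂ λ k l → HasLength u k × HasLength v l × k ℕ.< l

-- Edges u → u s_α of the moment graph
Edge : Rel (W n) _
Edge u v = ∃[ α ] PositiveReal α × ⟦ v ⟧ ≐ ⟦ u ⟧ ∘ reflection α

-- The Bruhat order, generated by u < u s_α whenever ℓ(u) < ℓ(u s_α)
_≤B_ : Rel (W n) _
u ≤B v = ∃[ w ] Star (λ x y → Edge x y × x <ℓ y) u w × w ≈ v

------------------------------------------------------------------------
-- The Hecke product

-- u · s_i = v
HeckeStep : W n → Fin n → W n → Set
HeckeStep u i v =
  (u <ℓ u ∷ʳ i × v ≈ u ∷ʳ i) ⊎ (¬ (u <ℓ u ∷ʳ i) × v ≈ u)

-- (… (u · s_{i₁}) · …) · s_{iₖ} = v for the given word i₁ … iₖ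
data HeckeWord {n} : W n → List (Fin n) → W n → Set where
  []  : ∀ {u v} → v ≈ u → HeckeWord u [] v
  _∷_ : ∀ {u u′ v i is} →
        HeckeStep u i u′ → HeckeWord u′ is v → HeckeWord u (i ∷ is) v

-- u · v = w
Hecke : W n → W n → W n → Set
Hecke u v w = ∃[ r ] r ≈ v × Reduced r × HeckeWord u r w

------------------------------------------------------------------------
-- Degrees and z_d

Degree : ℕ → Set
Degree n = Vector ℕ n

fromDegree : Degree n → Q n
fromDegree d i = + d i

-- m = min {d_0, …, d_{n-1}}
IsMin : Degree n → ℕ → Set
IsMin d m = (∃[ i ] m ≡ d i) × (∀ i → m ℕ.≤ d i)

-- d - m c; the truncated subtraction is exact as soon as m ≤ d_i for all i.
_⊖c_ : Degree n → ℕ → Degree n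
(d ⊖c m) i = d i ℕ.∸ m

-- α is a maximal element of the set of positive real roots ≤ d.
MaximalRoot : Degree n → Pred (Q n) _
MaximalRoot d α =
  PositiveReal α × α ≤Q fromDegree d ×
  (∀ β → PositiveReal β → β ≤Q fromDegree d → α ≤Q β → α ≗ β)

-- w = z_d, as computed by some sequence of choices of maximal roots
data IsZ {n} : Degree n → W n → Set where
  z-zero : ∀ {d w} → (∀ i → d i ≡ 0) → w ≈ [] → IsZ d w
  z-step : ∀ {d d′ α u v w} →
           MaximalRoot d α → fromDegree d′ ≗ fromDegree d -Q α →
           ⟦ u ⟧ ≐ reflection α → IsZ d′ v → Hecke u v w → IsZ d w

------------------------------------------------------------------------
-- Curve neighborhoods

Chain : Rel (W n) _
Chain = Star Edge

chainDegree : ∀ {u v : W n} → Chain u v → Q n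
chainDegree ε              = 0Q
chainDegree ((α , _) ◅ es) = α +Q chainDegree es

Joined : Degree n → W n → Pred (W n) _
Joined d u v =
  ∃[ u′ ] u′ ≤B u × Σ[ es ∈ Chain u′ v ] chainDegree es ≤Q fromDegree d

Γ : Degree n → W n → Pred (W n) _
Γ d u v = Joined d u v × (∀ w → Joined d u w → v ≤B w → v ≈ w)

------------------------------------------------------------------------
-- Decompositions into reflections and the associated set of roots

reflections : ∀ {k} → Vector (Q n) k → Op n
reflections = foldr (λ α f → reflection α ∘ f) id

Separated : ∀ {k} → Vector (Q n) k → Set
Separated γ = ∀ i j → i ≢ j →
  Disconnected (γ i) (γ j) ⊎ (γ i ⊥ γ j × Comparable (γ i) (γ j))

-- The set Π_aff^{re,+}(d - m c), in terms of γ_1, …, γ_k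
Admissible : ∀ {k} → Vector (Q n) k → Pred (Q n) _
Admissible γ β =
  PositiveReal β × β <Q c ×
  (∀ i → Disjoint β (γ i) ⊎ (γ i <Q β × β ⊥ γ i))

------------------------------------------------------------------------
-- Subsets of setoids

subsetoid : ∀ {a ℓ p} (S : Setoid a ℓ) → Pred (Setoid.Carrier S) p → Setoid _ _
subsetoid S P = On.setoid {B = Σ (Setoid.Carrier S) P} S proj₁

HasCardinality : ∀ {a ℓ p} (S : Setoid a ℓ) → Pred (Setoid.Carrier S) p → ℕ → Set _
HasCardinality S P N = Inverse (subsetoid S P) (≡.setoid (Fin N))

qSetoid : ℕ → Setoid _ _
qSetoid n = Fin n →-setoid ℤ

{-# OPTIONS --safe #-}

-- The affine Weyl group acts on ℤ by affine permutations v, v (a + n) = v a + n, and the real roots are the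
-- differences e_a − e_b with e_{a+n} = e_a − c.  Let r_v(i, j) be the number of a ≤ i with v a > j.  The
-- Bruhat order is the pointwise order of these functions, the Hecke product is their min-plus product, and
-- a chain of degree ≤ d from the identity to v gives r_v(k, k) ≤ d_k for all k.  The recursion for
-- z = z_{d−mc} yields r_z(i, j) = min_l (d_l − m + (i − l)⁺ + (l − j)⁺), and the admissible roots turn out
-- to be the e_x − e_y with x ≢ y and d_x = d_{y−1} = m.
--
-- Let r_v(k, k) ≤ d_k for all k, and cut ℤ into blocks at the walls k with d_k = m.  Not every block can be
-- crossed entirely by m strands of v moving right, since a finite set of strands is not invariant under
-- translation by n; let x be the last position of a block that is not.  Likewise let y be the first
-- position of a block which is not crossed entirely by m strands moving left.  If x ≡ y, the block is a
-- single point, and two different strands would have to end there unless another choice is possible.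
-- Comparing ranks, v ≤ t_{m(e_x − e_y)} z.  These elements are reached by chains of degree ≤ d and all have
-- the same length, so they are exactly the maximal elements.

module Submission where

-- An element `v` reached by a chain is arbitrary, so `v ≤ t z` with `t = t_{m(e_x − e_y)}` cannot
-- be read off words; dominance of rank functions makes it a family of inequalities between
-- integers. For `i ≤ j` the class of `y` contributes nothing, because `y` opens a block preserved
-- by `z`, and only the class of `x` distinguishes `t z` from `z`. Let `E` be the signed number of
-- strands that this class contributes to `z`. If `E ≥ 0`, the translate gains the full `m`, which
-- is the slack between the bounds `d` on `v` and `d − m c` on `z`. If `E < 0`, only `(m + E)⁺` is
-- gained, so `v` has to be controlled by the strands that cross the whole block ending at `x` and
-- further periods; fewer than `m` across the block is exactly enough. Hence `i ≤ j` restricts `x`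
-- alone and `i > j` restricts `y` alone, and the reversal `a ↦ −a` reduces the second case to the
-- first. The only coupling is `x ≢ y`, without which `e_x − e_y` is not a real root. With floors in
-- place of counts, almost every step becomes a linear inequality over the integers, settled by a
-- certificate that is checked by computation.

open import Data.Nat as ℕ using (ℕ; zero; suc; z≤n; s≤s)

-- Certificates for linear arithmetic over the integers

module LinearArithmetic where

  open import Data.Bool using (Bool; true; false; _∧_; T)
  open import Data.Fin using (Fin; zero; suc)
  open import Data.Integer
  open import Data.Integer.Properties
  open import Data.List as List using (List; []; _∷_)
  open import Data.Nat as ℕ using (ℕ; zero; suc)
  open import Data.Product using (_×_; _,_)
  open import Data.Unit using (⊤; tt)
  open import Data.Empty using (⊥-elim)
  open import Data.Vec as Vec using (Vec; []; _∷_; lookup)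
  open import Data.Vec.N-ary using (N-ary; _$ⁿ_)
  open import Relation.Binary.PropositionalEquality
  open import Relation.Nullary using (yes; no; does; ¬_)
  open import Data.Integer.Tactic.RingSolver using (solve-∀)

  infixl 7 _:+_ _:-_
  infixl 8 _:*_
  infix 6 _:≤_ _:<_ _:≡_
  infixr 3 _⇒_
  infix 4 ⊢_

  data Expr (k : ℕ) : Set where
    var           : Fin k → Expr k
    con           : ℤ → Expr k
    _:+_ _:-_     : Expr k → Expr k → Expr k
    _:*_          : ℤ → Expr k → Expr k
    opp           : Expr k → Expr k

  data Fact (k : ℕ) : Set where
    _:≤_ _:<_ _:≡_ : Expr k → Expr k → Fact k

  data Sequent (k : ℕ) : Set where
    ⊢_  : Fact k → Sequent k
    _⇒_ : Fact k → Sequent k → Sequent k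

  private
    variable
      k : ℕ

  value : Vec ℤ k → Expr k → ℤ
  value ρ (var i)  = lookup ρ i
  value ρ (con c)  = c
  value ρ (e :+ f) = value ρ e + value ρ f
  value ρ (e :- f) = value ρ e - value ρ f
  value ρ (c :* e) = c * value ρ e
  value ρ (opp e)   = - value ρ e

  Holds : Vec ℤ k → Fact k → Set
  Holds ρ (e :≤ f) = value ρ e ≤ value ρ f
  Holds ρ (e :< f) = value ρ e < value ρ f
  Holds ρ (e :≡ f) = value ρ e ≡ value ρ f

  Valid : Vec ℤ k → Sequent k → Set
  Valid ρ (⊢ g)   = Holds ρ g
  Valid ρ (h ⇒ s) = Holds ρ h → Valid ρ s

  hypotheses : Sequent k → List (Fact k)
  hypotheses (⊢ g)   = []
  hypotheses (h ⇒ s) = h ∷ hypotheses s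

  conclusion : Sequent k → Fact k
  conclusion (⊢ g)   = g
  conclusion (h ⇒ s) = conclusion s

  Form : ℕ → Set
  Form k = ℤ × Vec ℤ k

  dot : Vec ℤ k → Vec ℤ k → ℤ
  dot []       []      = 0ℤ
  dot (c ∷ cs) (x ∷ ρ) = c * x + dot cs ρ

  at : Vec ℤ k → Form k → ℤ
  at ρ (c , cs) = c + dot cs ρ

  zeros : ∀ k → Vec ℤ k
  zeros k = Vec.replicate k 0ℤ

  scale : ℤ → Form k → Form k
  scale a (c , cs) = a * c , Vec.map (a *_) cs

  add : Form k → Form k → Form k
  add (c , cs) (d , ds) = c + d , Vec.zipWith _+_ cs ds

  unit : Fin k → Vec ℤ k
  unit {suc k} zero    = 1ℤ ∷ zeros k
  unit         (suc i) = 0ℤ ∷ unit i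

  form : Expr k → Form k
  form {k} (var i) = 0ℤ , unit i
  form {k} (con c) = c , zeros k
  form (e :+ f)    = add (form e) (form f)
  form (e :- f)    = add (form e) (scale -1ℤ (form f))
  form (c :* e)    = scale c (form e)
  form (opp e)      = scale -1ℤ (form e)

  dot-zeros : (ρ : Vec ℤ k) → dot (zeros k) ρ ≡ 0ℤ
  dot-zeros []      = refl
  dot-zeros (x ∷ ρ) = trans (+-identityˡ _) (dot-zeros ρ)

  dot-unit : (ρ : Vec ℤ k) (i : Fin k) → dot (unit i) ρ ≡ lookup ρ i
  dot-unit (x ∷ ρ) zero    = trans (cong₂ _+_ (*-identityˡ x) (dot-zeros ρ)) (+-identityʳ x)
  dot-unit (x ∷ ρ) (suc i) = trans (+-identityˡ _) (dot-unit ρ i)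

  dot-scale : ∀ a cs (ρ : Vec ℤ k) → dot (Vec.map (a *_) cs) ρ ≡ a * dot cs ρ
  dot-scale a []       []      = sym (*-zeroʳ a)
  dot-scale a (c ∷ cs) (x ∷ ρ) =
    trans (cong (λ t → a * c * x + t) (dot-scale a cs ρ)) (rearrange a c x (dot cs ρ))
    where
    rearrange : ∀ a c x d → a * c * x + a * d ≡ a * (c * x + d)
    rearrange = solve-∀

  dot-add : ∀ cs ds (ρ : Vec ℤ k) → dot (Vec.zipWith _+_ cs ds) ρ ≡ dot cs ρ + dot ds ρ
  dot-add []       []       []      = refl
  dot-add (c ∷ cs) (d ∷ ds) (x ∷ ρ) =
    trans (cong (λ t → (c + d) * x + t) (dot-add cs ds ρ)) (rearrange c d x (dot cs ρ) (dot ds ρ))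
    where
    rearrange : ∀ c d x a b → (c + d) * x + (a + b) ≡ c * x + a + (d * x + b)
    rearrange = solve-∀

  at-scale : ∀ (ρ : Vec ℤ k) a f → at ρ (scale a f) ≡ a * at ρ f
  at-scale ρ a (c , cs) =
    trans (cong (λ t → a * c + t) (dot-scale a cs ρ)) (sym (*-distribˡ-+ a c (dot cs ρ)))

  at-add : ∀ (ρ : Vec ℤ k) f g → at ρ (add f g) ≡ at ρ f + at ρ g
  at-add ρ (c , cs) (d , ds) =
    trans (cong (λ t → c + d + t) (dot-add cs ds ρ)) (rearrange c d (dot cs ρ) (dot ds ρ))
    where
    rearrange : ∀ c d a b → c + d + (a + b) ≡ c + a + (d + b)
    rearrange = solve-∀

  at-form : ∀ (ρ : Vec ℤ k) e → at ρ (form e) ≡ value ρ e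
  at-form ρ (var i)  = trans (+-identityˡ _) (dot-unit ρ i)
  at-form ρ (con c)  = trans (cong (λ t → c + t) (dot-zeros ρ)) (+-identityʳ c)
  at-form ρ (e :+ f) = trans (at-add ρ (form e) (form f)) (cong₂ _+_ (at-form ρ e) (at-form ρ f))
  at-form ρ (e :- f) =
    trans (at-add ρ (form e) _)
      (cong₂ _+_ (at-form ρ e)
        (trans (at-scale ρ -1ℤ (form f)) (trans (-1*i≡-i _) (cong -_ (at-form ρ f)))))
  at-form ρ (c :* e) = trans (at-scale ρ c (form e)) (cong (c *_) (at-form ρ e))
  at-form ρ (opp e)   = trans (at-scale ρ -1ℤ (form e)) (trans (-1*i≡-i _) (cong -_ (at-form ρ e)))

  diff : Expr k → Expr k → Form k
  diff e f = form (f :- e)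

  isNat : ℤ → Bool
  isNat (+ _)    = true
  isNat -[1+ _ ] = false

  -- A multiplier may be negative only when it is applied to an equation.
  admits : Fact k → ℤ → Bool
  admits (e :≤ f) c = isNat c
  admits (e :< f) c = isNat c
  admits (e :≡ f) c = true

  -- Over the integers `e < f` means `f − 1 − e ≥ 0`; this tightening by one gives combinations that
  -- fail over the rationals.
  slack : Fact k → Form k
  slack (e :≤ f) = diff e f
  slack (e :< f) = diff e (f :- con 1ℤ)
  slack (e :≡ f) = diff e f

  -- Multipliers that are not listed are 1.
  multiplier : List ℤ → ℤ
  multiplier []      = 1ℤ
  multiplier (c ∷ _) = c

  others : List ℤ → List ℤ
  others []       = []
  others (_ ∷ cs) = cs

  combine : List (Fact k) → List ℤ → Form k
  combine {k} []       cs = 0ℤ , zeros k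
  combine     (h ∷ hs) cs = add (scale (multiplier cs) (slack h)) (combine hs (others cs))

  admitsAll : List (Fact k) → List ℤ → Bool
  admitsAll []       cs = true
  admitsAll (h ∷ hs) cs = admits h (multiplier cs) ∧ admitsAll hs (others cs)

  allZero : Vec ℤ k → Bool
  allZero []       = true
  allZero (c ∷ cs) = does (c ≟ 0ℤ) ∧ allZero cs

  unsatisfiable : Form k → Bool
  unsatisfiable (-[1+ _ ] , cs) = allZero cs
  unsatisfiable (+ _      , cs) = false

  T-∧ : ∀ a {b} → T (a ∧ b) → T a × T b
  T-∧ true t = tt , t

  at-diff : ∀ (ρ : Vec ℤ k) e f → at ρ (diff e f) ≡ value ρ f - value ρ e
  at-diff ρ e f = at-form ρ (f :- e)

  slack≥0 : ∀ (ρ : Vec ℤ k) h c → T (admits h c) → Holds ρ h → 0ℤ ≤ c * at ρ (slack h)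
  slack≥0 ρ (e :≤ f) (+ n) _ p =
    subst (_≤ + n * at ρ (diff e f)) (*-zeroʳ (+ n))
      (*-monoˡ-≤-nonNeg (+ n) (subst (0ℤ ≤_) (sym (at-diff ρ e f)) (i≤j⇒0≤j-i p)))
  slack≥0 ρ (e :< f) (+ n) _ p =
    subst (_≤ + n * at ρ (diff e (f :- con 1ℤ))) (*-zeroʳ (+ n))
      (*-monoˡ-≤-nonNeg (+ n)
        (subst (0ℤ ≤_) (sym (at-diff ρ e (f :- con 1ℤ)))
          (i≤j⇒0≤j-i (subst (value ρ e ≤_) (+-comm -1ℤ (value ρ f)) (i<j⇒i≤pred[j] p)))))
  slack≥0 ρ (e :≡ f) c _ p = ≤-reflexive (sym (begin
    c * at ρ (diff e f)             ≡⟨ cong (c *_) (at-diff ρ e f) ⟩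
    c * (value ρ f - value ρ e)     ≡⟨ cong (λ x → c * (x - value ρ e)) (sym p) ⟩
    c * (value ρ e - value ρ e)     ≡⟨ cong (c *_) (+-inverseʳ (value ρ e)) ⟩
    c * 0ℤ                          ≡⟨ *-zeroʳ c ⟩
    0ℤ                              ∎))
    where open ≡-Reasoning

  AllHold : Vec ℤ k → List (Fact k) → Set
  AllHold ρ []       = ⊤
  AllHold ρ (h ∷ hs) = Holds ρ h × AllHold ρ hs

  combine≥0 : ∀ (ρ : Vec ℤ k) hs cs → T (admitsAll hs cs) → AllHold ρ hs → 0ℤ ≤ at ρ (combine hs cs)
  combine≥0 ρ []       cs _ _        = ≤-reflexive (sym (trans (+-identityˡ _) (dot-zeros ρ)))
  combine≥0 ρ (h ∷ hs) cs t (p , ps) =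
    let u , v = T-∧ (admits h (multiplier cs)) t in
    subst (0ℤ ≤_)
      (sym (trans (at-add ρ (scale (multiplier cs) (slack h)) (combine hs (others cs)))
                  (cong (_+ _) (at-scale ρ (multiplier cs) (slack h)))))
      (+-mono-≤ (slack≥0 ρ h (multiplier cs) u p) (combine≥0 ρ hs (others cs) v ps))

  allZero-dot : ∀ (cs ρ : Vec ℤ k) → T (allZero cs) → dot cs ρ ≡ 0ℤ
  allZero-dot []       []      _ = refl
  allZero-dot (c ∷ cs) (x ∷ ρ) t with c ≟ 0ℤ
  ... | yes refl = trans (+-identityˡ _) (allZero-dot cs ρ t)

  unsatisfiable-at : ∀ (ρ : Vec ℤ k) f → T (unsatisfiable f) → ¬ (0ℤ ≤ at ρ f)
  unsatisfiable-at ρ (-[1+ n ] , cs) t p = negsuc≱0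
    (subst (0ℤ ≤_) (trans (cong (λ t → -[1+ n ] + t) (allZero-dot cs ρ t)) (+-identityʳ -[1+ n ])) p)
    where
    negsuc≱0 : ¬ 0ℤ ≤ -[1+ n ]
    negsuc≱0 ()

  -- The easy half of Farkas' lemma: an admissible combination of true facts is nonnegative, whereas
  -- a negative constant form is not.
  refute : ∀ (ρ : Vec ℤ k) hs cs → T (admitsAll hs cs ∧ unsatisfiable (combine hs cs)) → ¬ AllHold ρ hs
  refute ρ hs cs t ps =
    let u , v = T-∧ (admitsAll hs cs) t in unsatisfiable-at ρ (combine hs cs) v (combine≥0 ρ hs cs u ps)

  -- byCombination cs: the negated conclusion and the hypotheses, weighted by cs, add up to 0 ≤ −1 − k.
  data Certificate : Set where
    byCombination : List ℤ → Certificate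
    byBoth        : List ℤ → List ℤ → Certificate

  -- If all hypotheses are equations, the two inequalities of the conclusion use the same
  -- multipliers up to sign; the leading 1 belongs to the negated conclusion.
  byEquations : List ℤ → Certificate
  byEquations cs = byBoth (1ℤ ∷ cs) (1ℤ ∷ List.map -_ cs)

  certifies : Certificate → List (Fact k) → Fact k → Bool
  certifies (byCombination cs) hs (e :≤ f) = admitsAll (f :< e ∷ hs) cs ∧ unsatisfiable (combine (f :< e ∷ hs) cs)
  certifies (byCombination cs) hs (e :< f) = admitsAll (f :≤ e ∷ hs) cs ∧ unsatisfiable (combine (f :≤ e ∷ hs) cs)
  certifies (byBoth cs ds)    hs (e :≡ f) =
    certifies (byCombination cs) hs (e :≤ f) ∧ certifies (byCombination ds) hs (f :≤ e)
  certifies _                 hs _        = false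

  certified : ∀ (ρ : Vec ℤ k) ct hs g → T (certifies ct hs g) → AllHold ρ hs → Holds ρ g
  certified ρ (byCombination cs) hs (e :≤ f) t ps with value ρ e ≤? value ρ f
  ... | yes p = p
  ... | no ¬p = ⊥-elim (refute ρ (f :< e ∷ hs) cs t (≰⇒> ¬p , ps))
  certified ρ (byCombination cs) hs (e :< f) t ps with value ρ e <? value ρ f
  ... | yes p = p
  ... | no ¬p = ⊥-elim (refute ρ (f :≤ e ∷ hs) cs t (≮⇒≥ ¬p , ps))
  certified ρ (byBoth cs ds) hs (e :≡ f) t ps =
    let u , v = T-∧ (certifies (byCombination cs) hs (e :≤ f)) t in
    ≤-antisym (certified ρ (byCombination cs) hs (e :≤ f) u ps)
              (certified ρ (byCombination ds) hs (f :≤ e) v ps)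

  curryAll : ∀ (ρ : Vec ℤ k) s → (AllHold ρ (hypotheses s) → Holds ρ (conclusion s)) → Valid ρ s
  curryAll ρ (⊢ g)   f = f tt
  curryAll ρ (h ⇒ s) f = λ p → curryAll ρ s (λ ps → f (p , ps))

  accepts : Certificate → Sequent k → Bool
  accepts ct s = certifies ct (hypotheses s) (conclusion s)

  default : List (Fact k) → Fact k → Certificate
  default hs (e :≡ f) = byEquations (List.map (λ _ → 1ℤ) hs)
  default hs _        = byCombination []

  variables : ∀ k → Vec (Expr k) k
  variables k = Vec.tabulate var

  linear-by : ∀ {k} ct (ρ : Vec ℤ k) (s : N-ary k (Expr k) (Sequent k)) →
              {_ : T (accepts ct (s $ⁿ variables k))} → Valid ρ (s $ⁿ variables k)
  linear-by {k} ct ρ s {t} =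
    curryAll ρ (s $ⁿ variables k) (certified ρ ct (hypotheses (s $ⁿ variables k)) (conclusion (s $ⁿ variables k)) t)

  -- Most inequalities are the plain sum of their hypotheses, so all multipliers are 1 here. The
  -- implicit argument is the check of the certificate, which computes to the unit type when it
  -- succeeds.
  linear : ∀ {k} (ρ : Vec ℤ k) (s : N-ary k (Expr k) (Sequent k)) →
           (let hs = hypotheses (s $ⁿ variables k) ; g = conclusion (s $ⁿ variables k)) →
           {_ : T (certifies (default hs g) hs g)} → Valid ρ (s $ⁿ variables k)
  linear {k} ρ s {t} = linear-by (default (hypotheses (s $ⁿ variables k)) (conclusion (s $ⁿ variables k))) ρ s {t}

  1≰0 : ¬ 1ℤ ≤ 0ℤ
  1≰0 (+≤+ ())

-- Cardinalities from enumerations of decidable subsets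

module Counting where

  open import Defs using (HasCardinality)
  open import Data.Empty using (⊥-elim)
  open import Data.Fin as Fin using (Fin)
  open import Data.Product using (∃-syntax; _,_)
  open import Function using (_∘_)
  open import Relation.Binary using (Setoid)
  open import Relation.Binary.PropositionalEquality
  open import Relation.Nullary using (yes; no; Dec)
  open import Relation.Unary using (Pred)

  -- A bijection of `Fin size` with the indices satisfying `P`, whatever their proofs; two sets
  -- coded by one enumeration have the same cardinality by construction.
  record Enumeration {M : ℕ} (P : Fin M → Set) : Set where
    field
      size       : ℕ
      index      : ∀ i → P i → Fin size
      element    : Fin size → Fin M
      satisfies  : ∀ k → P (element k)
      element-of : ∀ i p → element (index i p) ≡ i
      index-of   : ∀ k p → index (element k) p ≡ k

  enumerate : ∀ {M} (P : Fin M → Set) → (∀ i → Dec (P i)) → Enumeration P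
  enumerate {zero}  P P? = record
    { size = 0 ; index = λ () ; element = λ () ; satisfies = λ () ; element-of = λ () ; index-of = λ () }
  enumerate {suc M} P P? = go (P? Fin.zero)
    where
    open Enumeration (enumerate (P ∘ Fin.suc) (P? ∘ Fin.suc))
    go : Dec (P Fin.zero) → Enumeration P
    go (yes p₀) = record
      { size       = suc size
      ; index      = λ { Fin.zero p → Fin.zero ; (Fin.suc i) p → Fin.suc (index i p) }
      ; element    = λ { Fin.zero → Fin.zero ; (Fin.suc k) → Fin.suc (element k) }
      ; satisfies  = λ { Fin.zero → p₀ ; (Fin.suc k) → satisfies k }
      ; element-of = λ { Fin.zero p → refl ; (Fin.suc i) p → cong Fin.suc (element-of i p) }
      ; index-of   = λ { Fin.zero p → refl ; (Fin.suc k) p → cong Fin.suc (index-of k p) }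
      }
    go (no ¬p₀) = record
      { size       = size
      ; index      = λ { Fin.zero p → ⊥-elim (¬p₀ p) ; (Fin.suc i) p → index i p }
      ; element    = Fin.suc ∘ element
      ; satisfies  = satisfies
      ; element-of = λ { Fin.zero p → ⊥-elim (¬p₀ p) ; (Fin.suc i) p → cong Fin.suc (element-of i p) }
      ; index-of   = λ k p → index-of k p
      }

  module _ {a ℓ p} (S : Setoid a ℓ) {A : Pred (Setoid.Carrier S) p} {M : ℕ} {P : Fin M → Set} (E : Enumeration P)
    (encode : ∀ i → P i → Setoid.Carrier S) (encode-in : ∀ i p → A (encode i p))
    (irrelevant : ∀ i p q → Setoid._≈_ S (encode i p) (encode i q))
    (surjective : ∀ s → A s → ∃[ i ] ∃[ p ] Setoid._≈_ S s (encode i p))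
    (injective : ∀ i j p q → Setoid._≈_ S (encode i p) (encode j q) → i ≡ j) where
    open Enumeration E
    open Setoid S using (_≈_)

    -- The code of an index may be built from a proof of `P`, as happens for the elements of a curve
    -- neighborhood; `irrelevant` makes its class in the setoid independent of that proof.
    cardinality : HasCardinality S A size
    cardinality = record
      { to        = λ (s , m) → number s m
      ; from      = λ k → encode (element k) (satisfies k) , encode-in _ _
      ; to-cong   = λ {(s , m)} {(s′ , m′)} e → number-cong s m s′ m′ e
      ; from-cong = λ { refl → Setoid.refl S }
      ; inverse   = (λ { {k} {s , m} e → trans (number-cong s m _ (encode-in _ _) e) (number-encode k) })
                  , (λ { {s , m} refl → Setoid.sym S (encode-number s m) })
      }
      where
      number : ∀ s → A s → Fin size
      number s m = let i , p , _ = surjective s m in index i p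
      index-irrelevant : ∀ {i j} p q → i ≡ j → index i p ≡ index j q
      index-irrelevant {i} p q refl = trans (sym (index-of (index i p) (subst P (sym (element-of i p)) q))) (shift (element-of i p) q)
        where
        shift : ∀ {i j} (e : i ≡ j) (q : P j) → index i (subst P (sym e) q) ≡ index j q
        shift refl q = refl
      number-cong : ∀ s m s′ m′ → s ≈ s′ → number s m ≡ number s′ m′
      number-cong s m s′ m′ e =
        let i , p , f = surjective s m
            j , q , g = surjective s′ m′
        in index-irrelevant p q (injective i j p q (Setoid.trans S (Setoid.sym S f) (Setoid.trans S e g)))
      number-encode : ∀ k → number (encode (element k) (satisfies k)) (encode-in _ _) ≡ k
      number-encode k =
        let i , p , f = surjective (encode (element k) (satisfies k)) (encode-in _ _)
        in trans (index-irrelevant p (satisfies k) (injective i (element k) p (satisfies k) (Setoid.sym S f))) (index-of k (satisfies k))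
      encode-number : ∀ s m → s ≈ encode (element (number s m)) (satisfies (number s m))
      encode-number s m =
        let i , p , f = surjective s m
        in Setoid.trans S f (same (sym (element-of i p)) p (satisfies (number s m)))
        where
        same : ∀ {i j} → i ≡ j → ∀ p q → encode i p ≈ encode j q
        same {i} refl p q = irrelevant i p q

module Affine (n : ℕ) (3≤n : 3 ℕ.≤ n) where

  open LinearArithmetic
    using (linear; linear-by; byCombination; byBoth; byEquations; 1≰0; con; opp; _:+_; _:-_; _:*_; _:≤_; _:<_; _:≡_; ⊢_; _⇒_)
  open Counting
  open import Defs
  open import Data.Bool using (if_then_else_; _∧_)
  open import Data.Empty using (⊥-elim) renaming (⊥ to Empty)
  open import Data.Fin as Fin using (Fin; toℕ; fromℕ<; punchIn)
  open import Data.Fin.Permutation using (Permutation; permutation)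
  open import Data.Fin.Properties
    using (toℕ<n; toℕ-fromℕ<; toℕ-injective; punchInᵢ≢i; remQuot-combine; combine-remQuot)
  open import Data.Integer hiding (suc; pred; pos; NonZero; positive; negative; sign)
  open import Data.Integer.DivMod using (_/ℕ_; _%ℕ_; n%ℕd<d; a≡a%ℕn+[a/ℕn]*n)
  open import Data.Integer.Properties
  open import Data.Integer.Tactic.RingSolver using (solve-∀)
  open import Data.List using (List; []; _∷_; _∷ʳ_; _++_; length)
  import Data.Nat.Properties as ℕP
  import Data.Nat.Tactic.RingSolver as ℕSolver
  open import Data.Product using (Σ-syntax; ∃; ∃-syntax; _×_; _,_; proj₁; proj₂)
  open import Data.Sum using (_⊎_; inj₁; inj₂; [_,_]′)
  open import Data.Vec using ([]; _∷_)
  open import Data.Vec.Functional using (Vector)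
  open import Function using (_∘_; id; _⇔_; mk⇔)
  open import Relation.Binary using (tri<; tri≈; tri>)
  open import Relation.Binary.Construct.Closure.ReflexiveTransitive using (Star; ε; _◅_; _◅◅_)
  open import Relation.Binary.PropositionalEquality
  open import Relation.Nullary using (¬_; yes; no; Dec; does)
  open import Relation.Nullary.Decidable using (dec-true; dec-false)
  open import Algebra.Properties.CommutativeMonoid.Sum +-0-commutativeMonoid
    using (sum; sum-cong-≗; ∑-distrib-+; sum-permute; ∑-comm; sum-remove)

  -- Multiples of `n`

  abstract
    N : ℤ
    N = + n

    N≡n : N ≡ + n
    N≡n = refl

  infix 8 N·_

  abstract
    -- Kept opaque, so that linear arithmetic treats each multiple of `n` as an atom governed only
    -- by the laws below.
    N·_ : ℤ → ℤ
    N· q = q * + n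

    N·-+ : ∀ a b → N· (a + b) ≡ N· a + N· b
    N·-+ a b = *-distribʳ-+ (+ n) a b

    N·-neg : ∀ a → N· (- a) ≡ - (N· a)
    N·-neg a = sym (neg-distribˡ-* a (+ n))

    N·-1 : N· 1ℤ ≡ N
    N·-1 = *-identityˡ (+ n)

    N·-0 : N· 0ℤ ≡ 0ℤ
    N·-0 = *-zeroˡ (+ n)

    N·-mono : ∀ {a b} → a ≤ b → N· a ≤ N· b
    N·-mono = *-monoʳ-≤-nonNeg (+ n)

  N·-- : ∀ a b → N· (a - b) ≡ N· a - N· b
  N·-- a b = trans (N·-+ a (- b)) (cong (λ t → N· a + t) (N·-neg b))

  N·-−1 : N· -1ℤ ≡ - N
  N·-−1 = trans (N·-neg 1ℤ) (cong -_ N·-1)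

  N·-+1 : ∀ a → N· (a + 1ℤ) ≡ N· a + N
  N·-+1 a = linear (N· (a + 1ℤ) ∷ N· a ∷ N· 1ℤ ∷ N ∷ []) (λ x y z u → x :≡ y :+ z ⇒ z :≡ u ⇒ ⊢ x :≡ y :+ u)
      (N·-+ a 1ℤ) N·-1

  N·--1 : ∀ a → N· (a - 1ℤ) ≡ N· a - N
  N·--1 a = linear-by (byEquations (1ℤ ∷ -1ℤ ∷ [])) (N· (a - 1ℤ) ∷ N· a ∷ N· 1ℤ ∷ N ∷ [])
      (λ x y z u → x :≡ y :- z ⇒ z :≡ u ⇒ ⊢ x :≡ y :- u) (N·-- a 1ℤ) N·-1

  N·-suc : ∀ k → N· (+ suc k) ≡ N + N· (+ k)
  N·-suc k = trans (N·-+ 1ℤ (+ k)) (cong (λ t → t + N· (+ k)) N·-1)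

  N·-negsuc : ∀ k → N· -[1+ k ] ≡ - (N· (+ suc k))
  N·-negsuc k = N·-neg (+ suc k)

  N·-< : ∀ {q q′} → q < q′ → N· q + N ≤ N· q′
  N·-< {q} {q′} p = subst (_≤ N· q′) (N·-+1 q) (N·-mono
      (linear (q ∷ q′ ∷ []) (λ x y → x :< y ⇒ ⊢ x :+ con 1ℤ :≤ y) p))

  3≤N : + 3 ≤ N
  3≤N = subst (+ 3 ≤_) (sym N≡n) (+≤+ 3≤n)

  instance
    n≢0 : ℕ.NonZero n
    n≢0 = ℕ.>-nonZero (ℕP.≤-trans (s≤s z≤n) 3≤n)

  -- Division with remainder by `n`

  abstract
    φ : ℤ → ℤ
    φ a = a /ℕ n

    res : ℤ → ℕ
    res a = a %ℕ n

    division : ∀ a → a ≡ + res a + N· φ a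
    division a = a≡a%ℕn+[a/ℕn]*n a n

    res<n : ∀ a → res a ℕ.< n
    res<n a = n%ℕd<d a n

  res<N : ∀ a → + res a < N
  res<N a = subst (+ res a <_) (sym N≡n) (+<+ (res<n a))

  res≥0 : ∀ a → 0ℤ ≤ + res a
  res≥0 a = +≤+ z≤n

  quotient-unique : ∀ a q r → 0ℤ ≤ r → r < N → a ≡ r + N· q → φ a ≡ q
  quotient-unique a q r p p′ e with <-cmp (φ a) q
  ... | tri≈ _ e′ _ = e′
  ... | tri< l _ _ = ⊥-elim (1≰0 (linear-by (byCombination (1ℤ ∷ 1ℤ ∷ 1ℤ ∷ 1ℤ ∷ -1ℤ ∷ []))
      (N· φ a ∷ N ∷ N· q ∷ a ∷ + res a ∷ r ∷ []) (λ x y z u v w → x :+ y :≤ z ⇒ u :≡ v :+ x ⇒ v :< y ⇒ u :≡ w :+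
      z ⇒ con 0ℤ :≤ w ⇒ ⊢ con 1ℤ :≤ con 0ℤ) (N·-< l) (division a) (res<N a) e p))
  ... | tri> _ _ l = ⊥-elim (1≰0 (linear-by (byCombination (1ℤ ∷ 1ℤ ∷ -1ℤ ∷ []))
      (N· q ∷ N ∷ N· φ a ∷ a ∷ + res a ∷ r ∷ []) (λ x y z u v w → x :+ y :≤ z ⇒ u :≡ v :+ z ⇒ con 0ℤ :≤ v ⇒ u :≡
      w :+ x ⇒ w :< y ⇒ ⊢ con 1ℤ :≤ con 0ℤ) (N·-< l) (division a) (res≥0 a) e p′))

  φ-shift : ∀ a k → φ (a + N· k) ≡ φ a + k
  φ-shift a k = quotient-unique _ _ (+ res a) (res≥0 a) (res<N a)
    (linear-by (byEquations (1ℤ ∷ -1ℤ ∷ [])) (a ∷ + res a ∷ N· φ a ∷ N· (φ a + k) ∷ N· k ∷ [])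
        (λ x y z u v → x :≡ y :+ z ⇒ u :≡ z :+ v ⇒ ⊢ x :+ v :≡ y :+ u) (division a) (N·-+ (φ a) k))

  res-shift : ∀ a k → res (a + N· k) ≡ res a
  res-shift a k = +-injective
    (linear-by (byEquations (1ℤ ∷ -1ℤ ∷ -1ℤ ∷ -1ℤ ∷ [])) (a ∷ + res a ∷ N· φ a ∷ N· k ∷ + res (a + N· k) ∷ N· φ
        (a + N· k) ∷ N· (φ a + k) ∷ []) (λ x y z u v w p → x :≡ y :+ z ⇒ x :+ u :≡ v :+ w ⇒ p :≡ z :+ u ⇒ w :≡ p
        ⇒ ⊢ v :≡ y) (division a) (division (a + N· k)) (N·-+ (φ a) k) (cong N·_ (φ-shift a k)))

  φ-N : ∀ a → φ (a + N) ≡ φ a + 1ℤ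
  φ-N a = trans (cong (λ t → φ (a + t)) (sym N·-1)) (φ-shift a 1ℤ)

  φ-mono : ∀ {a b} → a ≤ b → φ a ≤ φ b
  φ-mono {a} {b} p with φ a ≤? φ b
  ... | yes q = q
  ... | no q = ⊥-elim (1≰0 (linear-by (byCombination (1ℤ ∷ 1ℤ ∷ 1ℤ ∷ -1ℤ ∷ []))
      (N· φ b ∷ N ∷ N· φ a ∷ a ∷ b ∷ + res a ∷ + res b ∷ []) (λ x y z u v w p → x :+ y :≤ z ⇒ u :≤ v ⇒ u :≡ w :+
      z ⇒ v :≡ p :+ x ⇒ p :< y ⇒ con 0ℤ :≤ w ⇒ ⊢ con 1ℤ :≤ con 0ℤ) (N·-< (≰⇒> q)) p (division a) (division b)
      (res<N b) (res≥0 a)))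

  φ-small : ∀ {a} → 0ℤ ≤ a → a < N → φ a ≡ 0ℤ
  φ-small {a} p q = quotient-unique a 0ℤ a p q (linear-by (byEquations (-1ℤ ∷ [])) (N· 0ℤ ∷ a ∷ [])
      (λ x y → x :≡ con 0ℤ ⇒ ⊢ y :≡ y :+ x) N·-0)

  φ-nonNeg : ∀ {a} → 0ℤ ≤ a → 0ℤ ≤ φ a
  φ-nonNeg {a} p = subst (_≤ φ a) (φ-small ≤-refl (linear (N ∷ []) (λ x → con (+ 3) :≤ x ⇒ ⊢ con 0ℤ :< x) 3≤N))
      (φ-mono p)

  φ-shift-unique : ∀ {a} q → N· q ≤ a → a < N· q + N → φ a ≡ q
  φ-shift-unique {a} q p p′ = quotient-unique a q (a - N· q) (linear (N· q ∷ a ∷ [])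
      (λ x y → x :≤ y ⇒ ⊢ con 0ℤ :≤ y :- x) p) (linear (a ∷ N· q ∷ N ∷ [])
      (λ x y z → x :< y :+ z ⇒ ⊢ x :- y :< z) p′) (linear (a ∷ N· q ∷ []) (λ x y → ⊢ x :≡ x :- y :+ y))

  -- The map `a ↦ −1 − a` reverses the remainders `0, …, n − 1`, hence it sends each period onto a
  -- period. A plain `a ↦ −a` would not respect floors.
  φ-compl : ∀ a → φ (-1ℤ - a) ≡ -1ℤ - φ a
  φ-compl a = φ-shift-unique (-1ℤ - φ a) (linear (N· (-1ℤ - φ a) ∷ N ∷ N· φ a ∷ a ∷ + res a ∷ [])
      (λ x y z u v → x :≡ opp y :- z ⇒ u :≡ v :+ z ⇒ v :< y ⇒ ⊢ x :≤ con -1ℤ :- u) e (division a) (res<N a))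
      (linear-by (byCombination (1ℤ ∷ -1ℤ ∷ -1ℤ ∷ [])) (N· (-1ℤ - φ a) ∷ N ∷ N· φ a ∷ a ∷ + res a ∷ [])
      (λ x y z u v → x :≡ opp y :- z ⇒ u :≡ v :+ z ⇒ con 0ℤ :≤ v ⇒ ⊢ con -1ℤ :- u :< x :+ y) e (division a)
      (res≥0 a))
    where
    e : N· (-1ℤ - φ a) ≡ - N - N· φ a
    e = linear (N· (-1ℤ - φ a) ∷ N· -1ℤ ∷ N· φ a ∷ N ∷ []) (λ x y z u → x :≡ y :- z ⇒ y :≡ opp u ⇒ ⊢ x :≡ opp u
        :- z) (N·-- -1ℤ (φ a)) N·-−1

  φ-neg : ∀ {a} → a < 0ℤ → φ a < 0ℤ
  φ-neg {a} p = linear (φ (-1ℤ - a) ∷ φ a ∷ []) (λ x y → x :≡ con -1ℤ :- y ⇒ con 0ℤ :≤ x ⇒ ⊢ y :< con 0ℤ)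
      (φ-compl a) (φ-nonNeg { -1ℤ - a} (linear (a ∷ []) (λ x → x :< con 0ℤ ⇒ ⊢ con 0ℤ :≤ con -1ℤ :- x) p))

  φ-lower : ∀ a → N· φ a ≤ a
  φ-lower a = linear-by (byCombination (1ℤ ∷ -1ℤ ∷ [])) (a ∷ + res a ∷ N· φ a ∷ [])
      (λ x y z → x :≡ y :+ z ⇒ con 0ℤ :≤ y ⇒ ⊢ z :≤ x) (division a) (res≥0 a)

  φ-upper : ∀ a → a < N· φ a + N
  φ-upper a = linear (a ∷ + res a ∷ N· φ a ∷ N ∷ []) (λ x y z u → x :≡ y :+ z ⇒ y :< u ⇒ ⊢ x :< z :+ u)
      (division a) (res<N a)

  -- Congruence modulo n is equality of residues.

  res-≡ : ∀ {a b} → res a ≡ res b → a ≡ b + N· (φ a - φ b)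
  res-≡ {a} {b} e = linear-by (byEquations (1ℤ ∷ -1ℤ ∷ 1ℤ ∷ -1ℤ ∷ []))
      (a ∷ + res a ∷ N· φ a ∷ b ∷ + res b ∷ N· φ b ∷ N· (φ a - φ b) ∷ [])
      (λ x y z u v w p → x :≡ y :+ z ⇒ u :≡ v :+ w ⇒ y :≡ v ⇒ p :≡ z :- w ⇒ ⊢ x :≡ u :+ p) (division a)
      (division b) (cong +_ e) f
    where
    f : N· (φ a - φ b) ≡ N· φ a - N· φ b
    f = N·-- (φ a) (φ b)

  res-N : ∀ a → res (a + N) ≡ res a
  res-N a = trans (cong (λ t → res (a + t)) (sym N·-1)) (res-shift a 1ℤ)

  res-+ : ∀ {a b} c → res a ≡ res b → res (a + c) ≡ res (b + c)
  res-+ {a} {b} c e = trans (cong res {a + c} {(b + c) + N· q}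
      (linear (a ∷ b ∷ N· q ∷ c ∷ []) (λ x y z u → x :≡ y :+ z ⇒ ⊢ x :+ u :≡ y :+ u :+ z) e′))
      (res-shift (b + c) q)
    where
    q = φ a - φ b
    e′ : a ≡ b + N· q
    e′ = res-≡ {a} {b} e

  res-cong-neg : ∀ {a b} → res a ≡ res b → res (- a) ≡ res (- b)
  res-cong-neg {a} {b} e =
    trans (sym (res-shift (- a) q)) (cong res {(- a) + N· q} {(- b)}
        (linear-by (byEquations (-1ℤ ∷ [])) (a ∷ b ∷ N· q ∷ []) (λ x y z → x :≡ y :+ z ⇒ ⊢ opp x :+ z :≡ opp y)
        e′))
    where
    q = φ a - φ b
    e′ : a ≡ b + N· q
    e′ = res-≡ {a} {b} e

  res-+-cancel : ∀ {a b} c → res (a + c) ≡ res (b + c) → res a ≡ res b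
  res-+-cancel {a} {b} c e =
    trans (cong res {a} {(a + c) + - c} (linear (a ∷ c ∷ []) (λ x y → ⊢ x :≡ x :+ y :+ opp y)))
        (trans (res-+ (- c) e) (cong res {(b + c) + - c} (linear (b ∷ c ∷ []) (λ x y → ⊢ x :+ y :+ opp y :≡ x))))

  res-id : ∀ {k} → k ℕ.< n → res (+ k) ≡ k
  res-id {k} p = +-injective (linear-by (byEquations (-1ℤ ∷ -1ℤ ∷ -1ℤ ∷ []))
      (+ k ∷ + res (+ k) ∷ N· φ (+ k) ∷ N· 0ℤ ∷ []) (λ x y z u → x :≡ y :+ z ⇒ z :≡ u ⇒ u :≡ con 0ℤ ⇒ ⊢ y :≡ x)
      (division (+ k)) (cong N·_ (φ-small {+ k} (+≤+ z≤n) (subst (+ k <_) (sym N≡n) (+<+ p)))) N·-0)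

  res-toℕ : (k : Fin n) → res (+ toℕ k) ≡ toℕ k
  res-toℕ k = res-id (toℕ<n k)

  cls : ℤ → Fin n
  cls a = fromℕ< (res<n a)

  toℕ-cls : ∀ a → toℕ (cls a) ≡ res a
  toℕ-cls a = toℕ-fromℕ< (res<n a)

  res≢-offset : ∀ {a b} → 0ℤ < b - a → b - a < N → res a ≢ res b
  res≢-offset {a} {b} p p′ e with <-cmp (φ b) (φ a)
  ... | tri< l _ _ = 1≰0 (linear-by (byCombination (1ℤ ∷ 1ℤ ∷ -1ℤ ∷ 1ℤ ∷ -1ℤ ∷ []))
      (N· φ b ∷ N ∷ N· φ a ∷ a ∷ + res a ∷ b ∷ + res b ∷ []) (λ x y z u v w p → x :+ y :≤ z ⇒ u :≡ v :+ z ⇒ w :≡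
      p :+ x ⇒ v :≡ p ⇒ con 0ℤ :< w :+ opp u ⇒ con (+ 3) :≤ y ⇒ ⊢ con 1ℤ :≤ con 0ℤ) (N·-< l) (division a)
      (division b) (cong +_ e) p 3≤N)
  ... | tri≈ _ f _ = 1≰0 (linear-by (byCombination (1ℤ ∷ 1ℤ ∷ -1ℤ ∷ 1ℤ ∷ -1ℤ ∷ []))
      (N· φ b ∷ N· φ a ∷ a ∷ + res a ∷ b ∷ + res b ∷ []) (λ x y z u v w → x :≡ y ⇒ z :≡ u :+ y ⇒ v :≡ w :+ x ⇒ u
      :≡ w ⇒ con 0ℤ :< v :+ opp z ⇒ ⊢ con 1ℤ :≤ con 0ℤ) (cong N·_ f) (division a) (division b) (cong +_ e) p)
  ... | tri> _ _ l = 1≰0 (linear-by (byCombination (1ℤ ∷ 1ℤ ∷ 1ℤ ∷ -1ℤ ∷ []))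
      (N· φ a ∷ N ∷ N· φ b ∷ a ∷ + res a ∷ b ∷ + res b ∷ []) (λ x y z u v w p → x :+ y :≤ z ⇒ u :≡ v :+ x ⇒ w :≡
      p :+ z ⇒ v :≡ p ⇒ w :+ opp u :< y ⇒ ⊢ con 1ℤ :≤ con 0ℤ) (N·-< l) (division a) (division b) (cong +_ e) p′)

  -- Together with `φ-step-no`: a floor jumps only in the class of `a`, so that moving a wall by one
  -- changes a single summand of a rank.
  φ-step-yes : ∀ k a → res k ≡ res a → φ (k - a) ≡ φ (k - 1ℤ - a) + 1ℤ
  φ-step-yes k a e = trans e₁ (linear-by (byEquations (-1ℤ ∷ [])) (φ (k - 1ℤ - a) ∷ q ∷ [])
      (λ x y → x :≡ y :- con 1ℤ ⇒ ⊢ y :≡ x :+ con 1ℤ) e₂)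
    where
    q = φ k - φ a
    e′ : k ≡ a + N· q
    e′ = res-≡ {k} {a} e
    0N : 0ℤ + N· q ≡ k - a
    0N = linear-by (byEquations (-1ℤ ∷ [])) (k ∷ a ∷ N· q ∷ []) (λ x y z → x :≡ y :+ z ⇒ ⊢ con 0ℤ :+ z :≡ x :- y)
        e′
    e₁ : φ (k - a) ≡ q
    e₁ = φ-shift-unique q (linear (N· q ∷ k ∷ a ∷ []) (λ x y z → con 0ℤ :+ x :≡ y :- z ⇒ ⊢ x :≤ y :- z) 0N)
        (linear-by (byCombination (1ℤ ∷ -1ℤ ∷ [])) (N· q ∷ k ∷ a ∷ N ∷ [])
        (λ x y z u → con 0ℤ :+ x :≡ y :- z ⇒ con (+ 3) :≤ u ⇒ ⊢ y :- z :< x :+ u) 0N 3≤N)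
    e₂ : φ (k - 1ℤ - a) ≡ q - 1ℤ
    e₂ = φ-shift-unique (q - 1ℤ) (linear (N· q ∷ k ∷ a ∷ N ∷ N· (q - 1ℤ) ∷ [])
        (λ x y z u v → con 0ℤ :+ x :≡ y :- z ⇒ con (+ 3) :≤ u ⇒ v :≡ x :- u ⇒ ⊢ v :≤ y :- con 1ℤ :- z) 0N 3≤N f)
        (linear-by (byCombination (1ℤ ∷ -1ℤ ∷ -1ℤ ∷ [])) (N· q ∷ k ∷ a ∷ N· (q - 1ℤ) ∷ N ∷ [])
        (λ x y z u v → con 0ℤ :+ x :≡ y :- z ⇒ u :≡ x :- v ⇒ ⊢ y :- con 1ℤ :- z :< u :+ v) 0N f)
      where
      f : N· (q - 1ℤ) ≡ N· q - N
      f = N·--1 q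

  φ-step-no : ∀ k a → res k ≢ res a → φ (k - a) ≡ φ (k - 1ℤ - a)
  φ-step-no k a ne = φ-shift-unique q (linear (N· q ∷ k ∷ a ∷ [])
      (λ x y z → x :≤ y :- con 1ℤ :- z ⇒ ⊢ x :≤ y :- z) lower) (decide (k - a ≟ N· q + N))
    where
    q = φ (k - 1ℤ - a)
    lower : N· q ≤ k - 1ℤ - a
    lower = φ-lower (k - 1ℤ - a)
    upper : k - 1ℤ - a < N· q + N
    upper = φ-upper (k - 1ℤ - a)
    decide : Dec (k - a ≡ N· q + N) → k - a < N· q + N
    decide (no p)  = ≤∧≢⇒< (linear (k ∷ a ∷ N· q ∷ N ∷ []) (λ x y z u → x :- con 1ℤ :- y :< z :+ u ⇒ ⊢ x :- y :≤
        z :+ u) upper) p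
    decide (yes p) = ⊥-elim (ne (trans (cong res {k} {a + N· (q + 1ℤ)}
        (linear-by (byEquations (1ℤ ∷ -1ℤ ∷ [])) (k ∷ a ∷ N· q ∷ N ∷ N· (q + 1ℤ) ∷ [])
        (λ x y z u v → x :- y :≡ z :+ u ⇒ v :≡ z :+ u ⇒ ⊢ x :≡ y :+ v) p (N·-+1 q))) (res-shift a (q + 1ℤ))))

  -- Positive parts

  infix 9 _⁺

  abstract
    _⁺ : ℤ → ℤ
    x ⁺ = 0ℤ ⊔ x

  Signed : ℤ → Set
  Signed x = (x ⁺ ≡ x × 0ℤ ≤ x) ⊎ (x ⁺ ≡ 0ℤ × x ≤ 0ℤ)

  abstract
    ⁺-cases : ∀ x → Signed x
    ⁺-cases x = [ (λ p → inj₁ (i≤j⇒i⊔j≡j p , p)) , (λ p → inj₂ (i≥j⇒i⊔j≡i p , p)) ]′ (≤-total 0ℤ x)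

  ⁺-nonNeg : ∀ x → 0ℤ ≤ x ⁺
  ⁺-nonNeg x = [ (λ (e , p) → linear-by (byCombination (1ℤ ∷ -1ℤ ∷ [])) (x ⁺ ∷ x ∷ [])
      (λ x y → x :≡ y ⇒ con 0ℤ :≤ y ⇒ ⊢ con 0ℤ :≤ x) e p) , (λ (e , p) → linear-by
      (byCombination (1ℤ ∷ -1ℤ ∷ [])) (x ⁺ ∷ []) (λ x → x :≡ con 0ℤ ⇒ ⊢ con 0ℤ :≤ x) e) ]′ (⁺-cases x)

  ⁺-upper : ∀ x → x ≤ x ⁺
  ⁺-upper x = [ (λ (e , p) → linear-by (byCombination (1ℤ ∷ -1ℤ ∷ [])) (x ⁺ ∷ x ∷ []) (λ x y → x :≡ y ⇒ ⊢ y :≤ x)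
      e) , (λ (e , p) → linear-by (byCombination (1ℤ ∷ -1ℤ ∷ [])) (x ⁺ ∷ x ∷ [])
      (λ x y → x :≡ con 0ℤ ⇒ y :≤ con 0ℤ ⇒ ⊢ y :≤ x) e p) ]′ (⁺-cases x)

  ⁺-least : ∀ {x y} → x ≤ y → 0ℤ ≤ y → x ⁺ ≤ y
  ⁺-least {x} {y} p q = [ (λ (e , _) → linear (x ⁺ ∷ x ∷ y ∷ []) (λ x y z → x :≡ y ⇒ y :≤ z ⇒ ⊢ x :≤ z) e p) ,
      (λ (e , _) → linear (x ⁺ ∷ y ∷ []) (λ x y → x :≡ con 0ℤ ⇒ con 0ℤ :≤ y ⇒ ⊢ x :≤ y) e q) ]′ (⁺-cases x)

  ⁺-mono : ∀ {x y} → x ≤ y → x ⁺ ≤ y ⁺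
  ⁺-mono {x} {y} p = ⁺-least (linear (x ∷ y ∷ y ⁺ ∷ []) (λ x y z → x :≤ y ⇒ y :≤ z ⇒ ⊢ x :≤ z) p (⁺-upper y))
      (⁺-nonNeg y)

  ⁺-pos : ∀ {x} → 0ℤ ≤ x → x ⁺ ≡ x
  ⁺-pos {x} p = ≤-antisym (⁺-least ≤-refl p) (⁺-upper x)

  ⁺-neg : ∀ {x} → x ≤ 0ℤ → x ⁺ ≡ 0ℤ
  ⁺-neg {x} p = ≤-antisym (⁺-least p ≤-refl) (⁺-nonNeg x)

  ⁺-sub : ∀ x → x ⁺ - (- x) ⁺ ≡ x
  ⁺-sub x = [ (λ (e , p) → linear-by (byEquations (1ℤ ∷ -1ℤ ∷ [])) (x ⁺ ∷ x ∷ (- x) ⁺ ∷ [])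
      (λ x y z → x :≡ y ⇒ z :≡ con 0ℤ ⇒ ⊢ x :- z :≡ y) e (⁺-neg { - x} (neg-mono-≤ p))) ,
      (λ (e , p) → linear-by (byEquations (1ℤ ∷ -1ℤ ∷ [])) (x ⁺ ∷ (- x) ⁺ ∷ x ∷ [])
      (λ x y z → x :≡ con 0ℤ ⇒ y :≡ opp z ⇒ ⊢ x :- y :≡ z) e (⁺-pos { - x} (neg-mono-≤ p))) ]′ (⁺-cases x)

  -- Sums over a set of representatives of the residue classes

  Periodic : (ℤ → ℤ) → Set
  Periodic F = ∀ a → F (a + N) ≡ F a

  periodic-shift-ℕ : ∀ {F} → Periodic F → ∀ k a → F (a + N· (+ k)) ≡ F a
  periodic-shift-ℕ {F} P zero    a = cong F (linear (N· 0ℤ ∷ a ∷ []) (λ x y → x :≡ con 0ℤ ⇒ ⊢ y :+ x :≡ y) N·-0)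
  periodic-shift-ℕ {F} P (suc k) a =
    trans (cong F {a + N· (+ suc k)} {(a + N) + N· (+ k)} (linear (N· (+ suc k) ∷ N ∷ N· (+ k) ∷ a ∷ [])
        (λ x y z u → x :≡ y :+ z ⇒ ⊢ u :+ x :≡ u :+ y :+ z) (N·-suc k)))
      (trans (periodic-shift-ℕ P k (a + N)) (P a))

  periodic-shift : ∀ {F} → Periodic F → ∀ k a → F (a + N· k) ≡ F a
  periodic-shift {F} P (+ k)      a = periodic-shift-ℕ P k a
  periodic-shift {F} P (-[1+ k ]) a =
    trans (sym (periodic-shift-ℕ P (suc k) (a + N· -[1+ k ])))
        (cong F (linear (N· -[1+ k ] ∷ N· (+ suc k) ∷ a ∷ []) (λ x y z → x :≡ opp y ⇒ ⊢ z :+ x :+ y :≡ z)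
        (N·-negsuc k)))

  periodic-cong : ∀ {F} → Periodic F → ∀ {a b} → res a ≡ res b → F a ≡ F b
  periodic-cong {F} P {a} {b} e = trans (cong F (res-≡ {a} {b} e)) (periodic-shift P (φ a - φ b) b)

  sum-mono : ∀ {m} {f g : Fin m → ℤ} → (∀ k → f k ≤ g k) → sum f ≤ sum g
  sum-mono {zero}  p = ≤-refl
  sum-mono {suc m} p = +-mono-≤ (p Fin.zero) (sum-mono (p ∘ Fin.suc))

  sum-nonNeg : ∀ {m} {f : Fin m → ℤ} → (∀ k → 0ℤ ≤ f k) → 0ℤ ≤ sum f
  sum-nonNeg {zero}  p = ≤-refl
  sum-nonNeg {suc m} p = +-mono-≤ (p Fin.zero) (sum-nonNeg (p ∘ Fin.suc))

  -- Unless the sum of the positive parts is zero, some entry is positive, and that entry loses one.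
  sum-drop : ∀ {m} (f : Fin m → ℤ) → sum (λ k → (f k - 1ℤ) ⁺) ≤ (sum (λ k → f k ⁺) - 1ℤ) ⁺
  sum-drop {zero}  f = ⁺-nonNeg (0ℤ - 1ℤ)
  sum-drop {suc m} f = go (⁺-cases (f Fin.zero - 1ℤ)) (⁺-cases (sum (λ k → f (Fin.suc k) ⁺) - 1ℤ))
      (sum-drop (f ∘ Fin.suc))
               (sum-nonNeg (λ k → ⁺-nonNeg (f (Fin.suc k))))
    where
    x = f Fin.zero
    go : ∀ {s t} → Signed (x - 1ℤ) → Signed (s - 1ℤ) →
         t ≤ (s - 1ℤ) ⁺ → 0ℤ ≤ s → (x - 1ℤ) ⁺ + t ≤ (x ⁺ + s - 1ℤ) ⁺
    go {s} {t} (inj₁ (e , p)) (inj₁ (e′ , p′)) q z = linear ((x - 1ℤ) ⁺ ∷ x ∷ (s - 1ℤ) ⁺ ∷ s ∷ t ∷ x ⁺ ∷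
        (x ⁺ + s - 1ℤ) ⁺ ∷ []) (λ x y z u v w p → x :≡ y :- con 1ℤ ⇒ z :≡ u :- con 1ℤ ⇒ v :≤ z ⇒ w :+ u :- con 1ℤ
        :≤ p ⇒ y :≤ w ⇒ ⊢ x :+ v :≤ p) e e′ q (⁺-upper (x ⁺ + s - 1ℤ)) (⁺-upper x)
    go {s} {t} (inj₁ (e , p)) (inj₂ (e′ , p′)) q z = linear ((x - 1ℤ) ⁺ ∷ x ∷ (s - 1ℤ) ⁺ ∷ t ∷ x ⁺ ∷ s ∷
        (x ⁺ + s - 1ℤ) ⁺ ∷ []) (λ x y z u v w p → x :≡ y :- con 1ℤ ⇒ z :≡ con 0ℤ ⇒ u :≤ z ⇒ v :+ w :- con 1ℤ :≤ p
        ⇒ y :≤ v ⇒ con 0ℤ :≤ w ⇒ ⊢ x :+ u :≤ p) e e′ q (⁺-upper (x ⁺ + s - 1ℤ)) (⁺-upper x) z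
    go {s} {t} (inj₂ (e , p)) (inj₁ (e′ , p′)) q z = linear ((x - 1ℤ) ⁺ ∷ (s - 1ℤ) ⁺ ∷ s ∷ t ∷ x ⁺ ∷
        (x ⁺ + s - 1ℤ) ⁺ ∷ []) (λ x y z u v w → x :≡ con 0ℤ ⇒ y :≡ z :- con 1ℤ ⇒ u :≤ y ⇒ v :+ z :- con 1ℤ :≤ w ⇒
        con 0ℤ :≤ v ⇒ ⊢ x :+ u :≤ w) e e′ q (⁺-upper (x ⁺ + s - 1ℤ)) (⁺-nonNeg x)
    go {s} {t} (inj₂ (e , p)) (inj₂ (e′ , p′)) q z = linear ((x - 1ℤ) ⁺ ∷ (s - 1ℤ) ⁺ ∷ t ∷ (x ⁺ + s - 1ℤ) ⁺ ∷ [])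
        (λ x y z u → x :≡ con 0ℤ ⇒ y :≡ con 0ℤ ⇒ z :≤ y ⇒ con 0ℤ :≤ u ⇒ ⊢ x :+ z :≤ u) e e′ q
        (⁺-nonNeg (x ⁺ + s - 1ℤ))

  sum-ext : ∀ {m} {f g : Fin m → ℤ} → (∀ k → f k ≡ g k) → sum f ≡ sum g
  sum-ext = sum-cong-≗

  sum-split : ∀ {m} (f : Fin (suc m) → ℤ) k → sum f ≡ f k + sum (λ j → f (punchIn k j))
  sum-split f k = sum-remove {i = k} f

  sum-update : ∀ {m} (f g : Fin m → ℤ) k → (∀ j → j ≢ k → f j ≡ g j) → sum f + g k ≡ sum g + f k
  sum-update {suc m} f g k p =
    linear-by (byEquations (1ℤ ∷ -1ℤ ∷ 1ℤ ∷ [])) (sum f ∷ f k ∷ sum (λ j → f (punchIn k j)) ∷ sum g ∷ g k ∷ sum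
        (λ j → g (punchIn k j)) ∷ []) (λ x y z u v w → x :≡ y :+ z ⇒ u :≡ v :+ w ⇒ z :≡ w ⇒ ⊢ x :+ v :≡ u :+ y)
        (sum-split f k) (sum-split g k) (sum-ext {f = λ j → f (punchIn k j)} {λ j → g (punchIn k j)}
        (λ j → p (punchIn k j) (punchInᵢ≢i k j)))

  sum-zero : ∀ m → sum {m} (λ _ → 0ℤ) ≡ 0ℤ
  sum-zero zero    = refl
  sum-zero (suc m) = cong (λ t → 0ℤ + t) (sum-zero m)

  abstract
    ΣR : (ℤ → ℤ) → ℤ
    ΣR F = sum {n} (λ k → F (+ toℕ k))

    ΣR-sum : ∀ F → ΣR F ≡ sum {n} (λ k → F (+ toℕ k))
    ΣR-sum F = refl

    ΣR-cong : ∀ {F G} → (∀ a → F a ≡ G a) → ΣR F ≡ ΣR G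
    ΣR-cong p = sum-ext {n} (λ k → p (+ toℕ k))

    ΣR-+ : ∀ F G → ΣR (λ a → F a + G a) ≡ ΣR F + ΣR G
    ΣR-+ F G = ∑-distrib-+ {n} (λ k → F (+ toℕ k)) (λ k → G (+ toℕ k))

    ΣR-mono : ∀ {F G} → (∀ a → F a ≤ G a) → ΣR F ≤ ΣR G
    ΣR-mono p = sum-mono {n} (λ k → p (+ toℕ k))

    ΣR-nonNeg : ∀ {F} → (∀ a → 0ℤ ≤ F a) → 0ℤ ≤ ΣR F
    ΣR-nonNeg p = sum-nonNeg {n} (λ k → p (+ toℕ k))

    ΣR-drop : (F : ℤ → ℤ) → ΣR (λ a → (F a - 1ℤ) ⁺) ≤ (ΣR (λ a → F a ⁺) - 1ℤ) ⁺
    ΣR-drop F = sum-drop {n} (λ k → F (+ toℕ k))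

    ΣR-update : ∀ {F G} → Periodic F → Periodic G → ∀ a → (∀ c → res c ≢ res a → F c ≡ G c) →
                ΣR F + G a ≡ ΣR G + F a
    ΣR-update {F} {G} P Q a p =
      linear-by (byEquations (1ℤ ∷ -1ℤ ∷ 1ℤ ∷ [])) (ΣR F ∷ G (+ toℕ (cls a)) ∷ ΣR G ∷ F (+ toℕ (cls a)) ∷ F a ∷ G
          a ∷ []) (λ x y z u v w → x :+ y :≡ z :+ u ⇒ v :≡ u ⇒ w :≡ y ⇒ ⊢ x :+ w :≡ z :+ v) u
          (periodic-cong P {a} {+ toℕ (cls a)} (sym e)) (periodic-cong Q {a} {+ toℕ (cls a)} (sym e))
      where
      e : res (+ toℕ (cls a)) ≡ res a
      e = trans (res-toℕ (cls a)) (toℕ-cls a)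
      q : ∀ j → j ≢ cls a → F (+ toℕ j) ≡ G (+ toℕ j)
      q j ne = p (+ toℕ j) (λ f → ne (toℕ-injective (trans (sym (res-toℕ j)) (trans f (sym (toℕ-cls a))))))
      u : ΣR F + G (+ toℕ (cls a)) ≡ ΣR G + F (+ toℕ (cls a))
      u = sum-update (λ k → F (+ toℕ k)) (λ k → G (+ toℕ k)) (cls a) q

    ΣR-member : ∀ {F} → Periodic F → (∀ a → 0ℤ ≤ F a) → ∀ a → F a ≤ ΣR F
    ΣR-member {F} P p a =
      subst (_≤ ΣR F) (sum-single) (sum-mono {f = λ k → pick k (k Fin.≟ cls a)} (λ k → bound k (k Fin.≟ cls a)))
      where
      e : res (+ toℕ (cls a)) ≡ res a
      e = trans (res-toℕ (cls a)) (toℕ-cls a)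
      pick : ∀ k → Dec (k ≡ cls a) → ℤ
      pick k (yes _) = F a
      pick k (no _)  = 0ℤ
      bound : ∀ k (d : Dec (k ≡ cls a)) → pick k d ≤ F (+ toℕ k)
      bound k (yes refl) = ≤-reflexive (periodic-cong P {a} {+ toℕ (cls a)} (sym e))
      bound k (no _)     = p (+ toℕ k)
      pick-yes : (d : Dec (cls a ≡ cls a)) → pick (cls a) d ≡ F a
      pick-yes (yes _) = refl
      pick-yes (no f)  = ⊥-elim (f refl)
      pick-no : ∀ k → k ≢ cls a → (d : Dec (k ≡ cls a)) → pick k d ≡ 0ℤ
      pick-no k f (yes g) = ⊥-elim (f g)
      pick-no k f (no _)  = refl
      u : sum (λ k → pick k (k Fin.≟ cls a)) + 0ℤ ≡ sum {n} (λ _ → 0ℤ) + pick (cls a) (cls a Fin.≟ cls a)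
      u = sum-update (λ k → pick k (k Fin.≟ cls a)) (λ _ → 0ℤ) (cls a) (λ j ne → pick-no j ne (j Fin.≟ cls a))
      ΣR-0′ : sum {n} (λ _ → 0ℤ) ≡ 0ℤ
      ΣR-0′ = sum-zero n
      sum-single : sum (λ k → pick k (k Fin.≟ cls a)) ≡ F a
      sum-single = linear (sum (λ k → pick k (k Fin.≟ cls a)) ∷ sum {n} (λ _ → 0ℤ) ∷ pick (cls a)
          (cls a Fin.≟ cls a) ∷ F a ∷ []) (λ x y z u → x :+ con 0ℤ :≡ y :+ z ⇒ z :≡ u ⇒ y :≡ con 0ℤ ⇒ ⊢ x :≡ u) u
          (pick-yes (cls a Fin.≟ cls a)) ΣR-0′

    -- Only the permutation induced on residue classes matters, hence congruences instead of
    -- equations between `h` and `h′`.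
    ΣR-reindex : ∀ {F} → Periodic F → (h h′ : ℤ → ℤ) →
                 (∀ {a b} → res a ≡ res b → res (h a) ≡ res (h b)) →
                 (∀ {a b} → res a ≡ res b → res (h′ a) ≡ res (h′ b)) →
                 (∀ a → res (h (h′ a)) ≡ res a) → (∀ a → res (h′ (h a)) ≡ res a) →
                 ΣR (F ∘ h) ≡ ΣR F
    ΣR-reindex {F} P h h′ hc hc′ hh′ h′h =
      trans (sum-ext {n} (λ k → periodic-cong P {h (+ toℕ k)} {+ toℕ (at h k)}
              (sym (trans (res-toℕ (at h k)) (toℕ-cls (h (+ toℕ k)))))))
            (sym (sum-permute {n} {n} (λ k → F (+ toℕ k)) π))
      where
      at : (ℤ → ℤ) → Fin n → Fin n
      at g k = cls (g (+ toℕ k))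
      inverse : ∀ g g′ → (∀ {a b} → res a ≡ res b → res (g a) ≡ res (g b)) →
                (∀ a → res (g (g′ a)) ≡ res a) → ∀ k → at g (at g′ k) ≡ k
      inverse g g′ gc gg′ k = toℕ-injective
        (trans (toℕ-cls (g (+ toℕ (at g′ k))))
          (trans (gc {+ toℕ (at g′ k)} {g′ (+ toℕ k)} (trans (res-toℕ (at g′ k)) (toℕ-cls (g′ (+ toℕ k)))))
            (trans (gg′ (+ toℕ k)) (res-toℕ k))))
      π : Permutation n n
      π = permutation (at h) (at h′) (inverse h h′ hc hh′) (inverse h′ h hc′ h′h)

  ΣR-- : ∀ F G → ΣR (λ a → F a - G a) ≡ ΣR F - ΣR G
  ΣR-- F G = linear-by (byEquations (-1ℤ ∷ -1ℤ ∷ [])) (ΣR (λ a → F a - G a + G a) ∷ ΣR (λ a → F a - G a) ∷ ΣR G ∷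
      ΣR F ∷ []) (λ x y z u → x :≡ y :+ z ⇒ u :≡ x ⇒ ⊢ y :≡ u :- z) (ΣR-+ (λ a → F a - G a) G)
      (ΣR-cong {F} {λ a → F a - G a + G a} (λ a → linear (F a ∷ G a ∷ []) (λ x y → ⊢ x :≡ x :- y :+ y)))

  ΣR-0 : ΣR (λ _ → 0ℤ) ≡ 0ℤ
  ΣR-0 = linear-by (byEquations (-1ℤ ∷ [])) (ΣR (λ z → 0ℤ) ∷ []) (λ x → x :≡ x :+ x ⇒ ⊢ x :≡ con 0ℤ) double
    where
    double : ΣR (λ _ → 0ℤ) ≡ ΣR (λ _ → 0ℤ) + ΣR (λ _ → 0ℤ)
    double = ΣR-+ (λ _ → 0ℤ) (λ _ → 0ℤ)

  ΣR-single : ∀ {F} → Periodic F → ∀ a → (∀ c → res c ≢ res a → F c ≡ 0ℤ) → ΣR F ≡ F a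
  ΣR-single {F} P a p = linear (ΣR F ∷ ΣR (λ z → 0ℤ) ∷ F a ∷ [])
      (λ x y z → x :+ con 0ℤ :≡ y :+ z ⇒ y :≡ con 0ℤ ⇒ ⊢ x :≡ z) (ΣR-update P (λ _ → refl) a p) ΣR-0

  ΣR-update₂ : ∀ {F G} → Periodic F → Periodic G → ∀ a b → res a ≢ res b →
               (∀ c → res c ≢ res a → res c ≢ res b → F c ≡ G c) →
               ΣR F + (G a + G b) ≡ ΣR G + (F a + F b)
  ΣR-update₂ {F} {G} P Q a b ne p =
    linear-by (byEquations (1ℤ ∷ 1ℤ ∷ 1ℤ ∷ -1ℤ ∷ [])) (ΣR F ∷ H b ∷ ΣR H ∷ F b ∷ G a ∷ ΣR G ∷ H a ∷ F a ∷ G b ∷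
        []) (λ x y z u v w p q r → x :+ y :≡ z :+ u ⇒ z :+ v :≡ w :+ p ⇒ p :≡ q ⇒ y :≡ r ⇒ ⊢ x :+ (v :+ r) :≡ w
        :+ (q :+ u)) (ΣR-update P R b off-b) (ΣR-update R Q a off-a) H-at-a H-at-b
    where
    pick : ∀ c → Dec (res c ≡ res b) → ℤ
    pick c (yes _) = G c
    pick c (no _)  = F c
    -- `H` is `G` on the class of `b` and `F` elsewhere, so that each of the two updates changes one
    -- class.
    H : ℤ → ℤ
    H c = pick c (res c ℕ.≟ res b)
    H-b : ∀ c → res c ≡ res b → H c ≡ G c
    H-b c e with res c ℕ.≟ res b
    ... | yes _ = refl
    ... | no f  = ⊥-elim (f e)
    H-o : ∀ c → res c ≢ res b → H c ≡ F c
    H-o c e with res c ℕ.≟ res b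
    ... | yes f = ⊥-elim (e f)
    ... | no _  = refl
    R : Periodic H
    R c = decide (res c ℕ.≟ res b)
      where
      decide : Dec (res c ≡ res b) → H (c + N) ≡ H c
      decide (yes e) = trans (H-b _ (trans (res-N c) e)) (trans (Q c) (sym (H-b c e)))
      decide (no e)  = trans (H-o _ (λ f → e (trans (sym (res-N c)) f))) (trans (P c) (sym (H-o c e)))
    off-b : ∀ c → res c ≢ res b → F c ≡ H c
    off-b c e = sym (H-o c e)
    off-a : ∀ c → res c ≢ res a → H c ≡ G c
    off-a c e = decide (res c ℕ.≟ res b)
      where
      decide : Dec (res c ≡ res b) → H c ≡ G c
      decide (yes f) = H-b c f
      decide (no f)  = trans (H-o c f) (p c e f)
    H-at-a : H a ≡ F a
    H-at-a = H-o a ne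
    H-at-b : H b ≡ G b
    H-at-b = H-b b refl

  -- Affine permutations

  record Perm : Set where
    field
      to      : ℤ → ℤ
      from    : ℤ → ℤ
      to-from : ∀ a → to (from a) ≡ a
      from-to : ∀ a → from (to a) ≡ a
      to-N    : ∀ a → to (a + N) ≡ to a + N

    from-N : ∀ a → from (a + N) ≡ from a + N
    from-N a = trans (cong from (trans (cong (λ t → t + N) (sym (to-from a))) (sym (to-N (from a)))))
                     (from-to (from a + N))

    displacement-periodic : Periodic (λ a → to a - a)
    displacement-periodic a = linear (to (a + N) ∷ to a ∷ N ∷ a ∷ [])
        (λ x y z u → x :≡ y :+ z ⇒ ⊢ x :- (u :+ z) :≡ y :- u) (to-N a)

    displacement-cong : ∀ {a b} → res a ≡ res b → to a - a ≡ to b - b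
    displacement-cong = periodic-cong displacement-periodic

    to-shift : ∀ k a → to (a + N· k) ≡ to a + N· k
    to-shift k a = linear (to (a + N· k) ∷ a ∷ N· k ∷ to a ∷ [])
        (λ x y z u → x :- (y :+ z) :≡ u :- y ⇒ ⊢ x :≡ u :+ z) (displacement-cong (res-shift a k))

    to-res : ∀ {a b} → res a ≡ res b → res (to a) ≡ res (to b)
    to-res {a} {b} e = trans (cong res {to a} {to b + N· (φ a - φ b)}
      (linear (a ∷ b ∷ N· (φ a - φ b) ∷ to a ∷ to b ∷ []) (λ x y z u v → x :≡ y :+ z ⇒ u :- x :≡ v :- y ⇒ ⊢ u :≡
          v :+ z) (res-≡ {a} {b} e) (displacement-cong {a} {b} e))) (res-shift (to b) (φ a - φ b))

  open Perm public

  inv : Perm → Perm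
  inv v = record { to = from v ; from = to v ; to-from = from-to v ; from-to = to-from v ; to-N = from-N v }

  1ₚ : Perm
  1ₚ = record { to = id ; from = id ; to-from = λ _ → refl ; from-to = λ _ → refl ; to-N = λ _ → refl }

  infixl 9 _·_
  _·_ : Perm → Perm → Perm
  u · v = record
    { to      = λ a → to u (to v a)
    ; from    = λ a → from v (from u a)
    ; to-from = λ a → trans (cong (to u) (to-from v _)) (to-from u a)
    ; from-to = λ a → trans (cong (from v) (from-to u _)) (from-to v a)
    ; to-N    = λ a → trans (cong (to u) (to-N v a)) (to-N u _)
    }

  infix 4 _≃_
  _≃_ : Perm → Perm → Set
  u ≃ v = ∀ a → to u a ≡ to v a

  ≃-from : ∀ {u v} → u ≃ v → ∀ a → from u a ≡ from v a
  ≃-from {u} {v} e a = trans (sym (from-to v _)) (cong (from v) (trans (sym (e (from u a))) (to-from u a)))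

  to-injective : ∀ v {a b} → to v a ≡ to v b → a ≡ b
  to-injective v {a} {b} e = trans (sym (from-to v a)) (trans (cong (from v) e) (from-to v b))

  to-res⁻¹ : ∀ v {a b} → res (to v a) ≡ res (to v b) → res a ≡ res b
  to-res⁻¹ v {a} {b} e = trans (cong res (sym (from-to v a))) (trans (to-res (inv v) e) (cong res (from-to v b)))

  ΣR-perm : ∀ {F} → Periodic F → ∀ v → ΣR (F ∘ to v) ≡ ΣR F
  ΣR-perm P v = ΣR-reindex P (to v) (from v) (to-res v) (to-res (inv v))
    (λ a → cong res (to-from v a)) (λ a → cong res (from-to v a))

  φ--N : ∀ i a → φ (i - (a + N)) ≡ φ (i - a) - 1ℤ
  φ--N i a = linear-by (byEquations (1ℤ ∷ -1ℤ ∷ [])) (φ (i - (a + N) + N) ∷ φ (i - a) ∷ φ (i - (a + N)) ∷ [])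
      (λ x y z → x :≡ y ⇒ x :≡ z :+ con 1ℤ ⇒ ⊢ z :≡ y :- con 1ℤ)
      (cong φ {i - (a + N) + N} {i - a} (linear (i ∷ a ∷ N ∷ []) (λ x y z → ⊢ x :- (y :+ z) :+ z :≡ x :- y)))
      (φ-N (i - (a + N)))

  -- When a and b are congruent, transpose a b is not a bijection.

  transpose : ℤ → ℤ → ℤ → ℤ
  transpose a b c with res c ℕ.≟ res a | res c ℕ.≟ res b
  ... | yes _ | _     = c + (b - a)
  ... | no _  | yes _ = c - (b - a)
  ... | no _  | no _  = c

  transpose-a : ∀ a b {c} → res c ≡ res a → transpose a b c ≡ c + (b - a)
  transpose-a a b {c} e with res c ℕ.≟ res a | res c ℕ.≟ res b
  ... | yes _ | _     = refl
  ... | no f  | _ = ⊥-elim (f e)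

  transpose-b : ∀ a b {c} → res a ≢ res b → res c ≡ res b → transpose a b c ≡ c - (b - a)
  transpose-b a b {c} ne e with res c ℕ.≟ res a | res c ℕ.≟ res b
  ... | yes f | _     = ⊥-elim (ne (trans (sym f) e))
  ... | no _  | yes _ = refl
  ... | no _  | no f  = ⊥-elim (f e)

  transpose-o : ∀ a b {c} → res c ≢ res a → res c ≢ res b → transpose a b c ≡ c
  transpose-o a b {c} p q with res c ℕ.≟ res a | res c ℕ.≟ res b
  ... | yes f | _     = ⊥-elim (p f)
  ... | no _  | yes f = ⊥-elim (q f)
  ... | no _  | no _  = refl

  data Class (a b c : ℤ) : Set where
    is-a  : res c ≡ res a → Class a b c
    is-b  : res c ≢ res a → res c ≡ res b → Class a b c
    other : res c ≢ res a → res c ≢ res b → Class a b c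

  classify : ∀ a b c → Class a b c
  classify a b c with res c ℕ.≟ res a | res c ℕ.≟ res b
  ... | yes e | _     = is-a e
  ... | no p  | yes e = is-b p e
  ... | no p  | no q  = other p q

  module _ (a b : ℤ) (ne : res a ≢ res b) where

    private
      t = transpose a b

      moved-a : ∀ {c} → res c ≡ res a → res (c + (b - a)) ≡ res b
      moved-a {c} e = trans (res-+ (b - a) e) (cong res {a + (b - a)} {b}
          (linear (a ∷ b ∷ []) (λ x y → ⊢ x :+ (y :- x) :≡ y)))

      moved-b : ∀ {c} → res c ≡ res b → res (c - (b - a)) ≡ res a
      moved-b {c} e = trans (res-+ (- (b - a)) e) (cong res {b - (b - a)} {a}
          (linear (b ∷ a ∷ []) (λ x y → ⊢ x :- (x :- y) :≡ y)))

    transpose-involutive : ∀ c → transpose a b (transpose a b c) ≡ c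
    transpose-involutive c = go (classify a b c)
      where
      go : Class a b c → t (t c) ≡ c
      go (is-a e)    = trans (cong t (transpose-a a b e))
        (trans (transpose-b a b ne (moved-a e)) (linear (c ∷ b ∷ a ∷ [])
            (λ x y z → ⊢ x :+ (y :- z) :- (y :- z) :≡ x)))
      go (is-b _ e)  = trans (cong t (transpose-b a b ne e))
        (trans (transpose-a a b (moved-b e)) (linear (c ∷ b ∷ a ∷ [])
            (λ x y z → ⊢ x :- (y :- z) :+ (y :- z) :≡ x)))
      go (other p q) = trans (cong t (transpose-o a b p q)) (transpose-o a b p q)

    transpose-N : ∀ c → transpose a b (c + N) ≡ transpose a b c + N
    transpose-N c = go (classify a b c)
      where
      go : Class a b c → transpose a b (c + N) ≡ transpose a b c + N
      go (is-a e)    = linear-by (byEquations (1ℤ ∷ -1ℤ ∷ []))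
          (transpose a b (c + N) ∷ c ∷ N ∷ b ∷ a ∷ transpose a b c ∷ [])
          (λ x y z u v w → x :≡ y :+ z :+ (u :- v) ⇒ w :≡ y :+ (u :- v) ⇒ ⊢ x :≡ w :+ z)
          (transpose-a a b (trans (res-N c) e)) (transpose-a a b e)
      go (is-b _ e)  = linear-by (byEquations (1ℤ ∷ -1ℤ ∷ []))
          (transpose a b (c + N) ∷ c ∷ N ∷ b ∷ a ∷ transpose a b c ∷ [])
          (λ x y z u v w → x :≡ y :+ z :- (u :- v) ⇒ w :≡ y :- (u :- v) ⇒ ⊢ x :≡ w :+ z)
          (transpose-b a b ne (trans (res-N c) e)) (transpose-b a b ne e)
      go (other p q) = linear-by (byEquations (1ℤ ∷ -1ℤ ∷ []))
          (transpose a b (c + N) ∷ c ∷ N ∷ transpose a b c ∷ [])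
          (λ x y z u → x :≡ y :+ z ⇒ u :≡ y ⇒ ⊢ x :≡ u :+ z) (transpose-o a b (p ∘ trans (sym (res-N c)))
          (q ∘ trans (sym (res-N c)))) (transpose-o a b p q)

    transposition : Perm
    transposition = record
      { to = t ; from = t ; to-from = transpose-involutive ; from-to = transpose-involutive ; to-N = transpose-N }

    transpose-at-a : transpose a b a ≡ b
    transpose-at-a = trans (transpose-a a b refl) (linear (a ∷ b ∷ []) (λ x y → ⊢ x :+ (y :- x) :≡ y))

    transpose-at-b : transpose a b b ≡ a
    transpose-at-b = trans (transpose-b a b ne refl) (linear (b ∷ a ∷ []) (λ x y → ⊢ x :- (x :- y) :≡ y))

    transpose-conj : ∀ v c → to v (transpose a b c) ≡ transpose (to v a) (to v b) (to v c)
    transpose-conj v c = go (classify a b c)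
      where
      a′ = to v a
      b′ = to v b
      ne′ : res a′ ≢ res b′
      ne′ e = ne (to-res⁻¹ v e)
      go : Class a b c → to v (transpose a b c) ≡ transpose (to v a) (to v b) (to v c)
      go (is-a e)    = trans (cong (to v) (transpose-a a b e))
        (linear-by (byEquations (1ℤ ∷ -1ℤ ∷ -1ℤ ∷ [])) (to v (c + (b - a)) ∷ c ∷ b ∷ a ∷ to v b ∷ to v c ∷ to v a
            ∷ transpose (to v a) (to v b) (to v c) ∷ []) (λ x y z u v w p q → x :- (y :+ (z :- u)) :≡ v :- z ⇒ w
            :- y :≡ p :- u ⇒ q :≡ w :+ (v :- p) ⇒ ⊢ x :≡ q) (displacement-cong v (moved-a e))
            (displacement-cong v e) (transpose-a (to v a) (to v b) (to-res v e)))
      go (is-b _ e)  = trans (cong (to v) (transpose-b a b ne e))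
        (linear-by (byEquations (1ℤ ∷ -1ℤ ∷ -1ℤ ∷ [])) (to v (c - (b - a)) ∷ c ∷ b ∷ a ∷ to v a ∷ to v c ∷ to v b
            ∷ transpose (to v a) (to v b) (to v c) ∷ []) (λ x y z u v w p q → x :- (y :- (z :- u)) :≡ v :- u ⇒ w
            :- y :≡ p :- z ⇒ q :≡ w :- (p :- v) ⇒ ⊢ x :≡ q) (displacement-cong v (moved-b e))
            (displacement-cong v e) (transpose-b (to v a) (to v b) ne′ (to-res v e)))
      go (other p q) = trans (cong (to v) (transpose-o a b p q))
        (sym (transpose-o (to v a) (to v b) (p ∘ to-res⁻¹ v) (q ∘ to-res⁻¹ v)))

  transpose-shift : ∀ {a b a′ b′} → res a ≢ res b → res a ≡ res a′ → b - a ≡ b′ - a′ →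
                    ∀ c → transpose a b c ≡ transpose a′ b′ c
  transpose-shift {a} {b} {a′} {b′} ne e d c = go (classify a b c)
    where
    e′ : res b ≡ res b′
    e′ = trans (cong res {b} {a + (b - a)} (linear (b ∷ a ∷ []) (λ x y → ⊢ x :≡ y :+ (x :- y))))
        (trans (res-+ (b - a) e)
           (cong res {a′ + (b - a)} {b′} (linear (b ∷ a ∷ b′ ∷ a′ ∷ [])
               (λ x y z u → x :- y :≡ z :- u ⇒ ⊢ u :+ (x :- y) :≡ z) d)))
    go : Class a b c → transpose a b c ≡ transpose a′ b′ c
    go (is-a f)    = linear-by (byEquations (1ℤ ∷ -1ℤ ∷ 1ℤ ∷ []))
        (transpose a b c ∷ c ∷ b ∷ a ∷ transpose a′ b′ c ∷ b′ ∷ a′ ∷ [])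
        (λ x y z u v w p → x :≡ y :+ (z :- u) ⇒ v :≡ y :+ (w :- p) ⇒ z :- u :≡ w :- p ⇒ ⊢ x :≡ v)
        (transpose-a a b f) (transpose-a a′ b′ (trans f e)) d
    go (is-b _ f)  = linear-by (byEquations (1ℤ ∷ -1ℤ ∷ -1ℤ ∷ []))
        (transpose a b c ∷ c ∷ b ∷ a ∷ transpose a′ b′ c ∷ b′ ∷ a′ ∷ [])
        (λ x y z u v w p → x :≡ y :- (z :- u) ⇒ v :≡ y :- (w :- p) ⇒ z :- u :≡ w :- p ⇒ ⊢ x :≡ v)
        (transpose-b a b ne f) (transpose-b a′ b′ (λ g → ne (trans e (trans g (sym e′)))) (trans f e′)) d
    go (other p q) = trans (transpose-o a b p q)
      (sym (transpose-o a′ b′ (λ g → p (trans g (sym e))) (λ g → q (trans g (sym e′)))))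

  -- rank v i j is the number of a ≤ i with v a > j; each class a + nℤ contributes one summand.

  rank : Perm → ℤ → ℤ → ℤ
  rank v i j = ΣR (λ a → (φ (i - a) - φ (j - to v a)) ⁺)

  rank-term-periodic : ∀ v i j → Periodic (λ a → φ (i - a) - φ (j - to v a))
  rank-term-periodic v i j a =
    linear-by (byEquations (1ℤ ∷ -1ℤ ∷ [])) (φ (i - (a + N)) ∷ φ (i - a) ∷ φ (j - to v (a + N)) ∷ φ (j - to v a)
        ∷ []) (λ x y z u → x :≡ y :- con 1ℤ ⇒ z :≡ u :- con 1ℤ ⇒ ⊢ x :- z :≡ y :- u) (φ--N i a)
        (trans (cong (λ t → φ (j - t)) (to-N v a)) (φ--N j (to v a)))

  rank-periodic : ∀ v i j → Periodic (λ a → (φ (i - a) - φ (j - to v a)) ⁺)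
  rank-periodic v i j a = cong _⁺ (rank-term-periodic v i j a)

  rank-nonNeg : ∀ v i j → 0ℤ ≤ rank v i j
  rank-nonNeg v i j = ΣR-nonNeg (λ a → ⁺-nonNeg _)

  rank-cong : ∀ {u v} → u ≃ v → ∀ i j → rank u i j ≡ rank v i j
  rank-cong e i j = ΣR-cong (λ a → cong (λ t → (φ (i - a) - φ (j - t)) ⁺) (e a))

  rank-mono : ∀ v {i i′ j j′} → i ≤ i′ → j′ ≤ j → rank v i j ≤ rank v i′ j′
  rank-mono v {i} {i′} {j} {j′} p q = ΣR-mono (λ a → ⁺-mono
    (linear (φ (i - a) ∷ φ (i′ - a) ∷ φ (j′ - to v a) ∷ φ (j - to v a) ∷ [])
        (λ x y z u → x :≤ y ⇒ z :≤ u ⇒ ⊢ x :- u :≤ y :- z) (φ-mono {i - a} {i′ - a}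
        (linear (i ∷ i′ ∷ a ∷ []) (λ x y z → x :≤ y ⇒ ⊢ x :- z :≤ y :- z) p))
        (φ-mono {j′ - to v a} {j - to v a} (linear (j′ ∷ j ∷ to v a ∷ []) (λ x y z → x :≤ y ⇒ ⊢ x :- z :≤ y :- z)
        q))))

  φ-+N· : ∀ i k a → φ (i + N· k - a) ≡ φ (i - a) + k
  φ-+N· i k a = trans (cong φ {i + N· k - a} {i - a + N· k} (linear (i ∷ N· k ∷ a ∷ [])
      (λ x y z → ⊢ x :+ y :- z :≡ x :- z :+ y))) (φ-shift (i - a) k)

  rank-shift : ∀ v k i j → rank v (i + N· k) (j + N· k) ≡ rank v i j
  rank-shift v k i j = ΣR-cong (λ a → cong _⁺ (linear-by (byEquations (1ℤ ∷ -1ℤ ∷ []))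
      (φ (i + N· k - a) ∷ φ (i - a) ∷ k ∷ φ (j + N· k - to v a) ∷ φ (j - to v a) ∷ [])
      (λ x y z u v → x :≡ y :+ z ⇒ u :≡ v :+ z ⇒ ⊢ x :- u :≡ y :- v) (φ-+N· i k a) (φ-+N· j k (to v a))))

  -- A summand is negative when the strands of its class go the other way, so the negative parts
  -- count the crossings of the inverse.
  rank-inv : ∀ v i j → rank (inv v) j i ≡ ΣR (λ a → (- (φ (i - a) - φ (j - to v a))) ⁺)
  rank-inv v i j =
    trans (sym (ΣR-perm (rank-periodic (inv v) j i) v))
      (ΣR-cong (λ a → cong _⁺ (linear-by (byEquations (-1ℤ ∷ []))
          (φ (i - to (inv v) (to v a)) ∷ φ (i - a) ∷ φ (j - to v a) ∷ [])
          (λ x y z → x :≡ y ⇒ ⊢ z :- x :≡ opp (y :- z)) (cong (λ t → φ (i - t)) {to (inv v) (to v a)} {a}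
          (from-to v a)))))

  neg-sub : ∀ x y → - (x - y) ≡ y - x
  neg-sub x y = linear (x ∷ y ∷ []) (λ x y → ⊢ opp (x :- y) :≡ y :- x)

  -- Indexing the classes by the values `p = v a` suits changes of `j` and translations applied
  -- after `v`.
  rank-values : ∀ v i j → rank v i j ≡ ΣR (λ p → (φ (i - from v p) - φ (j - p)) ⁺)
  rank-values v i j = trans (rank-inv (inv v) j i)
    (ΣR-cong (λ p → cong _⁺ (neg-sub (φ (j - p)) (φ (i - from v p)))))

  -- A strand counted on the left is, between `v` and `u`, either already beyond `k`, and then
  -- counted for `v`, or not yet, and then counted for `u`.
  rank-subadd : ∀ u v i k j → rank (u · v) i j ≤ rank v i k + rank u k j
  rank-subadd u v i k j =
    subst (rank (u · v) i j ≤_)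
      (trans (ΣR-+ (λ a → (φ (i - a) - φ (k - to v a)) ⁺) (λ a → (φ (k - to v a) - φ (j - to u (to v a))) ⁺))
             (cong (λ t → rank v i k + t) (ΣR-perm (rank-periodic u k j) v)))
      (ΣR-mono (λ a → ⁺-least
        (linear (φ (i - a) ∷ φ (k - to v a) ∷ (φ (i - a) - φ (k - to v a)) ⁺ ∷ φ (j - to u (to v a)) ∷
            (φ (k - to v a) - φ (j - to u (to v a))) ⁺ ∷ []) (λ x y z u v → x :- y :≤ z ⇒ y :- u :≤ v ⇒ ⊢ x :- u
            :≤ z :+ v) (⁺-upper (φ (i - a) - φ (k - to v a))) (⁺-upper (φ (k - to v a) - φ (j - to u (to v a)))))
        (linear ((φ (i - a) - φ (k - to v a)) ⁺ ∷ (φ (k - to v a) - φ (j - to u (to v a))) ⁺ ∷ [])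
            (λ x y → con 0ℤ :≤ x ⇒ con 0ℤ :≤ y ⇒ ⊢ con 0ℤ :≤ x :+ y) (⁺-nonNeg (φ (i - a) - φ (k - to v a)))
            (⁺-nonNeg (φ (k - to v a) - φ (j - to u (to v a)))))))

  module _ (v : Perm) (i j : ℤ) where
    private
      term : ℤ → ℤ → ℤ
      term i a = (φ (i - a) - φ (j - to v a)) ⁺

      off : ∀ c → res c ≢ res i → term i c ≡ term (i - 1ℤ) c
      off c ne = cong (λ t → (t - φ (j - to v c)) ⁺) (φ-step-no i c (ne ∘ sym))

      change : rank v i j + term (i - 1ℤ) i ≡ rank v (i - 1ℤ) j + term i i
      change = ΣR-update (rank-periodic v i j) (rank-periodic v (i - 1ℤ) j) i off

      φ0 : φ (i - i) ≡ 0ℤ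
      φ0 = φ-small (linear (i ∷ []) (λ x → ⊢ con 0ℤ :≤ x :- x))
          (linear (N ∷ i ∷ []) (λ x y → con (+ 3) :≤ x ⇒ ⊢ y :- y :< x) 3≤N)

      φ-1 : φ (i - 1ℤ - i) ≡ -1ℤ
      φ-1 = linear-by (byEquations (1ℤ ∷ -1ℤ ∷ [])) (φ (i - i) ∷ φ (i - 1ℤ - i) ∷ [])
          (λ x y → x :≡ con 0ℤ ⇒ x :≡ y :+ con 1ℤ ⇒ ⊢ y :≡ con -1ℤ) φ0 (φ-step-yes i i refl)

    -- The row `i` admits one strand more than the row `i − 1`, the one that starts at `i`; all
    -- other classes have unchanged floors.
    rank-row-yes : j < to v i → rank v i j ≡ rank v (i - 1ℤ) j + 1ℤ
    rank-row-yes p = linear-by (byEquations (1ℤ ∷ 1ℤ ∷ -1ℤ ∷ 1ℤ ∷ -1ℤ ∷ []))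
        (rank v i j ∷ term (i - 1ℤ) i ∷ rank v (i - 1ℤ) j ∷ term i i ∷ φ (i - i) ∷ φ (j - to v i) ∷ φ
        (i - 1ℤ - i) ∷ []) (λ x y z u v w p → x :+ y :≡ z :+ u ⇒ u :≡ v :- w ⇒ y :≡ p :- w ⇒ v :≡ con 0ℤ ⇒ p :≡
        con -1ℤ ⇒ ⊢ x :≡ z :+ con 1ℤ) change (⁺-pos {φ (i - i) - φ (j - to v i)}
        (linear-by (byCombination (1ℤ ∷ -1ℤ ∷ [])) (φ (i - i) ∷ φ (j - to v i) ∷ [])
        (λ x y → x :≡ con 0ℤ ⇒ y :< con 0ℤ ⇒ ⊢ con 0ℤ :≤ x :- y) φ0 q))
        (⁺-pos {φ (i - 1ℤ - i) - φ (j - to v i)} (linear-by (byCombination (1ℤ ∷ -1ℤ ∷ []))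
        (φ (i - 1ℤ - i) ∷ φ (j - to v i) ∷ []) (λ x y → x :≡ con -1ℤ ⇒ y :< con 0ℤ ⇒ ⊢ con 0ℤ :≤ x :- y) φ-1 q))
        φ0 φ-1
      where
      q : φ (j - to v i) < 0ℤ
      q = φ-neg (linear (j ∷ to v i ∷ []) (λ x y → x :< y ⇒ ⊢ x :- y :< con 0ℤ) p)

    rank-row-no : to v i ≤ j → rank v i j ≡ rank v (i - 1ℤ) j
    rank-row-no p = linear-by (byEquations (1ℤ ∷ 1ℤ ∷ -1ℤ ∷ []))
        (rank v i j ∷ term (i - 1ℤ) i ∷ rank v (i - 1ℤ) j ∷ term i i ∷ [])
        (λ x y z u → x :+ y :≡ z :+ u ⇒ u :≡ con 0ℤ ⇒ y :≡ con 0ℤ ⇒ ⊢ x :≡ z) change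
        (⁺-neg {φ (i - i) - φ (j - to v i)} (linear (φ (i - i) ∷ φ (j - to v i) ∷ [])
        (λ x y → x :≡ con 0ℤ ⇒ con 0ℤ :≤ y ⇒ ⊢ x :- y :≤ con 0ℤ) φ0 q))
        (⁺-neg {φ (i - 1ℤ - i) - φ (j - to v i)} (linear (φ (i - 1ℤ - i) ∷ φ (j - to v i) ∷ [])
        (λ x y → x :≡ con -1ℤ ⇒ con 0ℤ :≤ y ⇒ ⊢ x :- y :≤ con 0ℤ) φ-1 q))
      where
      q : 0ℤ ≤ φ (j - to v i)
      q = φ-nonNeg (linear (to v i ∷ j ∷ []) (λ x y → x :≤ y ⇒ ⊢ con 0ℤ :≤ y :- x) p)

  module _ (v : Perm) (i j : ℤ) where
    private
      term : ℤ → ℤ → ℤ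
      term j p = (φ (i - from v p) - φ (j - p)) ⁺

      periodic : ∀ j → Periodic (term j)
      periodic j p = cong _⁺ (linear-by (byEquations (1ℤ ∷ -1ℤ ∷ []))
          (φ (i - from v (p + N)) ∷ φ (i - from v p) ∷ φ (j - (p + N)) ∷ φ (j - p) ∷ [])
          (λ x y z u → x :≡ y :- con 1ℤ ⇒ z :≡ u :- con 1ℤ ⇒ ⊢ x :- z :≡ y :- u)
          (trans (cong (λ t → φ (i - t)) (from-N v p)) (φ--N i (from v p))) (φ--N j p))

      off : ∀ c → res c ≢ res j → term j c ≡ term (j - 1ℤ) c
      off c ne = cong (λ t → (φ (i - from v c) - t) ⁺) (φ-step-no j c (ne ∘ sym))

      change : rank v i j + term (j - 1ℤ) j ≡ rank v i (j - 1ℤ) + term j j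
      change = subst₂ (λ s t → s + term (j - 1ℤ) j ≡ t + term j j)
        (sym (rank-values v i j)) (sym (rank-values v i (j - 1ℤ)))
        (ΣR-update (periodic j) (periodic (j - 1ℤ)) j off)

      φ0 : φ (j - j) ≡ 0ℤ
      φ0 = φ-small (linear (j ∷ []) (λ x → ⊢ con 0ℤ :≤ x :- x))
          (linear (N ∷ j ∷ []) (λ x y → con (+ 3) :≤ x ⇒ ⊢ y :- y :< x) 3≤N)

      φ-1 : φ (j - 1ℤ - j) ≡ -1ℤ
      φ-1 = linear-by (byEquations (1ℤ ∷ -1ℤ ∷ [])) (φ (j - j) ∷ φ (j - 1ℤ - j) ∷ [])
          (λ x y → x :≡ con 0ℤ ⇒ x :≡ y :+ con 1ℤ ⇒ ⊢ y :≡ con -1ℤ) φ0 (φ-step-yes j j refl)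

    rank-column-yes : from v j ≤ i → rank v i (j - 1ℤ) ≡ rank v i j + 1ℤ
    rank-column-yes p = linear-by (byEquations (-1ℤ ∷ -1ℤ ∷ 1ℤ ∷ 1ℤ ∷ -1ℤ ∷ []))
        (rank v i j ∷ term (j - 1ℤ) j ∷ rank v i (j - 1ℤ) ∷ term j j ∷ φ (i - from v j) ∷ φ (j - j) ∷ φ
        (j - 1ℤ - j) ∷ []) (λ x y z u v w p → x :+ y :≡ z :+ u ⇒ u :≡ v :- w ⇒ y :≡ v :- p ⇒ w :≡ con 0ℤ ⇒ p :≡
        con -1ℤ ⇒ ⊢ z :≡ x :+ con 1ℤ) change (⁺-pos {φ (i - from v j) - φ (j - j)}
        (linear (φ (j - j) ∷ φ (i - from v j) ∷ []) (λ x y → x :≡ con 0ℤ ⇒ con 0ℤ :≤ y ⇒ ⊢ con 0ℤ :≤ y :- x) φ0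
        q)) (⁺-pos {φ (i - from v j) - φ (j - 1ℤ - j)} (linear (φ (j - 1ℤ - j) ∷ φ (i - from v j) ∷ [])
        (λ x y → x :≡ con -1ℤ ⇒ con 0ℤ :≤ y ⇒ ⊢ con 0ℤ :≤ y :- x) φ-1 q)) φ0 φ-1
      where
      q : 0ℤ ≤ φ (i - from v j)
      q = φ-nonNeg (linear (from v j ∷ i ∷ []) (λ x y → x :≤ y ⇒ ⊢ con 0ℤ :≤ y :- x) p)

    rank-column-no : i < from v j → rank v i (j - 1ℤ) ≡ rank v i j
    rank-column-no p = linear-by (byEquations (-1ℤ ∷ -1ℤ ∷ 1ℤ ∷ []))
        (rank v i j ∷ term (j - 1ℤ) j ∷ rank v i (j - 1ℤ) ∷ term j j ∷ [])
        (λ x y z u → x :+ y :≡ z :+ u ⇒ u :≡ con 0ℤ ⇒ y :≡ con 0ℤ ⇒ ⊢ z :≡ x) change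
        (⁺-neg {φ (i - from v j) - φ (j - j)} (linear-by (byCombination (1ℤ ∷ -1ℤ ∷ []))
        (φ (j - j) ∷ φ (i - from v j) ∷ []) (λ x y → x :≡ con 0ℤ ⇒ y :< con 0ℤ ⇒ ⊢ y :- x :≤ con 0ℤ) φ0 q))
        (⁺-neg {φ (i - from v j) - φ (j - 1ℤ - j)} (linear-by (byCombination (1ℤ ∷ -1ℤ ∷ []))
        (φ (j - 1ℤ - j) ∷ φ (i - from v j) ∷ []) (λ x y → x :≡ con -1ℤ ⇒ y :< con 0ℤ ⇒ ⊢ y :- x :≤ con 0ℤ) φ-1 q))
      where
      q : φ (i - from v j) < 0ℤ
      q = φ-neg (linear (i ∷ from v j ∷ []) (λ x y → x :< y ⇒ ⊢ x :- y :< con 0ℤ) p)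

  -- Balanced permutations are those with Σ (v a − a) = 0 over a window, that is, the elements of W_aff.

  defect : Perm → ℤ → ℤ → ℤ
  defect v i j = ΣR (λ a → φ (i - a) - φ (j - to v a))

  record Balanced (v : Perm) : Set where
    constructor balanced
    field
      balance : ∀ i j → defect v i j ≡ i - j

  open Balanced public

  -- Summing `x⁺ − (−x)⁺ = x` over the classes: the defect is the number of crossings to the right
  -- minus that of crossings to the left.
  rank-defect : ∀ v i j → rank v i j ≡ rank (inv v) j i + defect v i j
  rank-defect v i j = begin
    rank v i j
      ≡⟨ ΣR-cong (λ a → split (φ (i - a) - φ (j - to v a))) ⟩
    ΣR (λ a → (- (φ (i - a) - φ (j - to v a))) ⁺ + (φ (i - a) - φ (j - to v a)))
      ≡⟨ ΣR-+ _ _ ⟩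
    ΣR (λ a → (- (φ (i - a) - φ (j - to v a))) ⁺) + defect v i j
      ≡⟨ cong (λ t → t + defect v i j) (sym (rank-inv v i j)) ⟩
    rank (inv v) j i + defect v i j ∎
    where
    open ≡-Reasoning
    split : ∀ x → x ⁺ ≡ (- x) ⁺ + x
    split x = linear (x ⁺ ∷ (- x) ⁺ ∷ x ∷ []) (λ x y z → x :- y :≡ z ⇒ ⊢ x :≡ y :+ z) (⁺-sub x)

  rank-balance : ∀ {v} → Balanced v → ∀ i j → rank v i j ≡ rank (inv v) j i + (i - j)
  rank-balance {v} B i j = trans (rank-defect v i j) (cong (λ t → rank (inv v) j i + t) (balance B i j))

  defect-row : ∀ v i j → defect v i j ≡ defect v (i - 1ℤ) j + 1ℤ
  defect-row v i j = go (to v i ≤? j)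
    where
    go : Dec (to v i ≤ j) → defect v i j ≡ defect v (i - 1ℤ) j + 1ℤ
    go (yes p) = linear-by (byEquations (-1ℤ ∷ 1ℤ ∷ 1ℤ ∷ 1ℤ ∷ []))
        (rank v i j ∷ rank (inv v) j i ∷ defect v i j ∷ rank v (i - 1ℤ) j ∷ rank (inv v) j (i - 1ℤ) ∷ defect v
        (i - 1ℤ) j ∷ []) (λ x y z u v w → x :≡ y :+ z ⇒ u :≡ v :+ w ⇒ x :≡ u ⇒ v :≡ y :+ con 1ℤ ⇒ ⊢ z :≡ w :+ con
        1ℤ) (rank-defect v i j) (rank-defect v (i - 1ℤ) j) (rank-row-no v i j p) (rank-column-yes (inv v) j i p)
    go (no p)  = linear-by (byEquations (-1ℤ ∷ 1ℤ ∷ 1ℤ ∷ 1ℤ ∷ []))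
        (rank v i j ∷ rank (inv v) j i ∷ defect v i j ∷ rank v (i - 1ℤ) j ∷ rank (inv v) j (i - 1ℤ) ∷ defect v
        (i - 1ℤ) j ∷ []) (λ x y z u v w → x :≡ y :+ z ⇒ u :≡ v :+ w ⇒ x :≡ u :+ con 1ℤ ⇒ v :≡ y ⇒ ⊢ z :≡ w :+ con
        1ℤ) (rank-defect v i j) (rank-defect v (i - 1ℤ) j) (rank-row-yes v i j (≰⇒> p))
        (rank-column-no (inv v) j i (≰⇒> p))

  defect-column : ∀ v i j → defect v i (j - 1ℤ) ≡ defect v i j + 1ℤ
  defect-column v i j = go (from v j ≤? i)
    where
    go : Dec (from v j ≤ i) → defect v i (j - 1ℤ) ≡ defect v i j + 1ℤ
    go (yes p) = linear-by (byEquations (1ℤ ∷ -1ℤ ∷ 1ℤ ∷ 1ℤ ∷ []))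
        (rank v i j ∷ rank (inv v) j i ∷ defect v i j ∷ rank v i (j - 1ℤ) ∷ rank (inv v) (j - 1ℤ) i ∷ defect v i
        (j - 1ℤ) ∷ []) (λ x y z u v w → x :≡ y :+ z ⇒ u :≡ v :+ w ⇒ y :≡ v ⇒ u :≡ x :+ con 1ℤ ⇒ ⊢ w :≡ z :+ con
        1ℤ) (rank-defect v i j) (rank-defect v i (j - 1ℤ)) (rank-row-no (inv v) j i p) (rank-column-yes v i j p)
    go (no p)  = linear-by (byEquations (1ℤ ∷ -1ℤ ∷ 1ℤ ∷ 1ℤ ∷ []))
        (rank v i j ∷ rank (inv v) j i ∷ defect v i j ∷ rank v i (j - 1ℤ) ∷ rank (inv v) (j - 1ℤ) i ∷ defect v i
        (j - 1ℤ) ∷ []) (λ x y z u v w → x :≡ y :+ z ⇒ u :≡ v :+ w ⇒ y :≡ v :+ con 1ℤ ⇒ u :≡ x ⇒ ⊢ w :≡ z :+ con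
        1ℤ) (rank-defect v i j) (rank-defect v i (j - 1ℤ)) (rank-row-yes (inv v) j i (≰⇒> p))
        (rank-column-no v i j (≰⇒> p))

  unit-slope : (f : ℤ → ℤ) → (∀ i → f i ≡ f (i - 1ℤ) + 1ℤ) → ∀ i → f i ≡ f 0ℤ + i
  unit-slope f p (+ zero)       = linear (f (+ zero) ∷ []) (λ x → ⊢ x :≡ x :+ con 0ℤ)
  unit-slope f p (+ suc k)      = linear (f (+ suc k) ∷ f (+ suc k - 1ℤ) ∷ f (+ k) ∷ f 0ℤ ∷ + k ∷ [])
      (λ x y z u v → x :≡ y :+ con 1ℤ ⇒ y :≡ z ⇒ z :≡ u :+ v ⇒ ⊢ x :≡ u :+ (con 1ℤ :+ v)) (p (+ suc k)) e
      (unit-slope f p (+ k))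
    where
    e : f (+ suc k - 1ℤ) ≡ f (+ k)
    e = cong f {+ suc k - 1ℤ} {+ k} refl
  unit-slope f p (-[1+ zero ])  = linear-by (byEquations (-1ℤ ∷ [])) (f 0ℤ ∷ f (0ℤ - 1ℤ) ∷ [])
      (λ x y → x :≡ y :+ con 1ℤ ⇒ ⊢ y :≡ x :+ con -1ℤ) (p 0ℤ)
  unit-slope f p (-[1+ suc k ]) = linear-by (byEquations (-1ℤ ∷ 1ℤ ∷ []))
      (f -[1+ k ] ∷ f -[1+ suc k ] ∷ f 0ℤ ∷ + k ∷ []) (λ x y z u → x :≡ y :+ con 1ℤ ⇒ x :≡ z :+ opp (con 1ℤ :+ u)
      ⇒ ⊢ y :≡ z :+ opp (con 1ℤ :+ (con 1ℤ :+ u))) q (unit-slope f p -[1+ k ])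
    where
    q : f -[1+ k ] ≡ f -[1+ suc k ] + 1ℤ
    q = trans (p -[1+ k ]) (cong (λ t → f t + 1ℤ) { -[1+ k ] - 1ℤ} { -[1+ suc k ]}
        (cong (λ t → -[1+ suc t ]) (ℕP.+-identityʳ k)))
    e : -[1+ suc k ] ≡ -[1+ k ] - 1ℤ
    e = cong (λ t → -[1+ suc t ]) (sym (ℕP.+-identityʳ k))

  -- The defect has slope 1 in `i` and -1 in `j`, so that one value determines all.
  balanced-from-origin : ∀ v → defect v 0ℤ 0ℤ ≡ 0ℤ → Balanced v
  balanced-from-origin v e = balanced λ i j → linear-by (byEquations (1ℤ ∷ 1ℤ ∷ -1ℤ ∷ []))
      (defect v 0ℤ 0ℤ ∷ defect v i 0ℤ ∷ i ∷ defect v i j ∷ j ∷ [])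
      (λ x y z u v → x :≡ con 0ℤ ⇒ y :≡ x :+ z ⇒ opp u :≡ opp y :+ v ⇒ ⊢ u :≡ z :- v) e
      (unit-slope (λ i → defect v i 0ℤ) (λ i → defect-row v i 0ℤ) i)
      (unit-slope (λ j → - defect v i j) (λ j → linear (defect v i (j - 1ℤ) ∷ defect v i j ∷ [])
      (λ x y → x :≡ y :+ con 1ℤ ⇒ ⊢ opp y :≡ opp x :+ con 1ℤ) (defect-column v i j)) j)

  defect-· : ∀ u v i k j → defect (u · v) i j ≡ defect v i k + defect u k j
  defect-· u v i k j = begin
    defect (u · v) i j
      ≡⟨ ΣR-cong (λ a → split (φ (i - a)) (φ (k - to v a)) (φ (j - to u (to v a)))) ⟩
    ΣR (λ a → (φ (i - a) - φ (k - to v a)) + (φ (k - to v a) - φ (j - to u (to v a))))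
      ≡⟨ ΣR-+ _ _ ⟩
    defect v i k + ΣR (λ a → φ (k - to v a) - φ (j - to u (to v a)))
      ≡⟨ cong (λ t → defect v i k + t) (ΣR-perm (rank-term-periodic u k j) v) ⟩
    defect v i k + defect u k j ∎
    where
    open ≡-Reasoning
    split : ∀ x y z → x - z ≡ (x - y) + (y - z)
    split x y z = linear (x ∷ z ∷ y ∷ []) (λ x y z → ⊢ x :- y :≡ x :- z :+ (z :- y))

  balanced-· : ∀ {u v} → Balanced u → Balanced v → Balanced (u · v)
  balanced-· {u} {v} B C = balanced λ i j → linear (defect (u · v) i j ∷ defect v i j ∷ defect u j j ∷ i ∷ j ∷
      []) (λ x y z u v → x :≡ y :+ z ⇒ y :≡ u :- v ⇒ z :≡ v :- v ⇒ ⊢ x :≡ u :- v) (defect-· u v i j j)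
      (balance C i j) (balance B j j)

  balanced-1 : Balanced 1ₚ
  balanced-1 = balanced-from-origin 1ₚ (trans (ΣR-cong (λ a → +-inverseʳ (φ (0ℤ - a)))) ΣR-0)

  -- A transposition is its own inverse, so as many strands cross the origin to the right as to the
  -- left.
  balanced-transposition : ∀ a b ne → Balanced (transposition a b ne)
  balanced-transposition a b ne = balanced-from-origin (transposition a b ne)
    (linear-by (byEquations (-1ℤ ∷ -1ℤ ∷ [])) (rank (transposition a b ne) 0ℤ 0ℤ ∷ rank
        (inv (transposition a b ne)) 0ℤ 0ℤ ∷ defect (transposition a b ne) 0ℤ 0ℤ ∷ [])
        (λ x y z → x :≡ y :+ z ⇒ y :≡ x ⇒ ⊢ z :≡ con 0ℤ) (rank-defect (transposition a b ne) 0ℤ 0ℤ)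
        (rank-cong {inv (transposition a b ne)} {transposition a b ne} (λ _ → refl) 0ℤ 0ℤ))

  rank≥diff : ∀ {v} → Balanced v → ∀ i j → i - j ≤ rank v i j
  rank≥diff {v} B i j = linear-by (byCombination (1ℤ ∷ -1ℤ ∷ [])) (rank v i j ∷ rank (inv v) j i ∷ i ∷ j ∷ [])
      (λ x y z u → x :≡ y :+ (z :- u) ⇒ con 0ℤ :≤ y ⇒ ⊢ z :- u :≤ x) (rank-balance B i j)
      (rank-nonNeg (inv v) j i)

  rank≥diff⁺ : ∀ {v} → Balanced v → ∀ i j → (i - j) ⁺ ≤ rank v i j
  rank≥diff⁺ {v} B i j = ⁺-least (rank≥diff B i j) (rank-nonNeg v i j)

  rank-transposition : ∀ {a b} ne → a ≤ b → ∀ k → rank (transposition a b ne) k k ≡ φ (k - a) - φ (k - b)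
  rank-transposition {a} {b} ne p k =
    linear (ΣR (λ z → (φ (k - z) - φ (k - to t z)) ⁺) ∷ ΣR (λ z → 0ℤ) ∷ (φ (k - a) - φ (k - to t a)) ⁺ ∷
        (φ (k - b) - φ (k - to t b)) ⁺ ∷ φ (k - a) ∷ φ (k - b) ∷ [])
        (λ x y z u v w → x :+ (con 0ℤ :+ con 0ℤ) :≡ y :+ (z :+ u) ⇒ y :≡ con 0ℤ ⇒ z :≡ v :- w ⇒ u :≡ con 0ℤ ⇒ ⊢ x
        :≡ v :- w) (ΣR-update₂ (rank-periodic t k k) (λ _ → refl) a b ne off) ΣR-0 ta tb
    where
    t : Perm
    t = transposition a b ne
    off : ∀ c → res c ≢ res a → res c ≢ res b → (φ (k - c) - φ (k - transpose a b c)) ⁺ ≡ 0ℤ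
    off c q r = trans (cong _⁺ (trans (cong (λ t → φ (k - c) - φ (k - t)) (transpose-o a b q r))
        (+-inverseʳ (φ (k - c)))))
                      (⁺-pos ≤-refl)
    ge : φ (k - b) ≤ φ (k - a)
    ge = φ-mono {k - b} {k - a} (linear (a ∷ b ∷ k ∷ []) (λ x y z → x :≤ y ⇒ ⊢ z :- y :≤ z :- x) p)
    ta : (φ (k - a) - φ (k - to t a)) ⁺ ≡ φ (k - a) - φ (k - b)
    ta = trans (cong (λ t → (φ (k - a) - φ (k - t)) ⁺) (transpose-at-a a b ne))
        (⁺-pos (linear (φ (k - b) ∷ φ (k - a) ∷ []) (λ x y → x :≤ y ⇒ ⊢ con 0ℤ :≤ y :- x) ge))
    tb : (φ (k - b) - φ (k - to t b)) ⁺ ≡ 0ℤ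
    tb = trans (cong (λ t → (φ (k - b) - φ (k - t)) ⁺) (transpose-at-b a b ne))
        (⁺-neg (linear (φ (k - b) ∷ φ (k - a) ∷ []) (λ x y → x :≤ y ⇒ ⊢ x :- y :≤ con 0ℤ) ge))

  rank-pos : ∀ v {a i j} → a ≤ i → j < to v a → 1ℤ ≤ rank v i j
  rank-pos v {a} {i} {j} p q =
    linear-by (byCombination (1ℤ ∷ 1ℤ ∷ -1ℤ ∷ [])) (rank v a j ∷ rank v i j ∷ rank v (a - 1ℤ) j ∷ [])
        (λ x y z → x :≤ y ⇒ x :≡ z :+ con 1ℤ ⇒ con 0ℤ :≤ z ⇒ ⊢ con 1ℤ :≤ y)
        (rank-mono v {a} {i} {j} {j} p ≤-refl) (rank-row-yes v a j q) (rank-nonNeg v (a - 1ℤ) j)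

  -- The strand between `a` and `b` comes on top of the crossings that balance forces. For `k ≥ j`
  -- it is found in the inverse, at the position `(j, k)`, and balance then adds `k − j`.
  rank-transposition-inside : ∀ {a b} ne k j → a ≤ k → k < b → a ≤ j → j < b →
                              (k - j) ⁺ + 1ℤ ≤ rank (transposition a b ne) k j
  rank-transposition-inside {a} {b} ne k j ak kb aj jb = go (⁺-cases (k - j))
    where
    t : Perm
    t = transposition a b ne
    t-a : to t a ≡ b
    t-a = transpose-at-a a b ne
    go : Signed (k - j) → (k - j) ⁺ + 1ℤ ≤ rank (transposition a b ne) k j
    go (inj₁ (e , _)) = linear-by (byCombination (1ℤ ∷ 1ℤ ∷ 1ℤ ∷ -1ℤ ∷ []))
        ((k - j) ⁺ ∷ k ∷ j ∷ rank (inv t) j k ∷ rank (transposition a b ne) k j ∷ [])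
        (λ x y z u v → x :≡ y :- z ⇒ con 1ℤ :≤ u ⇒ v :≡ u :+ (y :- z) ⇒ ⊢ x :+ con 1ℤ :≤ v) e
        (rank-pos (inv t) {a} {j} {k} aj (subst (k <_) (sym t-a) kb))
        (rank-balance (balanced-transposition a b ne) k j)
    go (inj₂ (e , _)) = linear ((k - j) ⁺ ∷ rank t k j ∷ []) (λ x y → x :≡ con 0ℤ ⇒ con 1ℤ :≤ y ⇒ ⊢ x :+ con 1ℤ
        :≤ y) e (rank-pos t {a} {k} {j} ak (subst (j <_) (sym t-a) jb))

  -- Raising `j` by `n` removes one strand from every class that has one.
  rank-drop-one : ∀ v i j → rank v i (j + N) ≤ (rank v i j - 1ℤ) ⁺
  rank-drop-one v i j = subst (_≤ (rank v i j - 1ℤ) ⁺)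
    (ΣR-cong (λ a → cong _⁺ (step a)))
    (ΣR-drop (λ a → φ (i - a) - φ (j - to v a)))
    where
    step : ∀ a → φ (i - a) - φ (j - to v a) - 1ℤ ≡ φ (i - a) - φ (j + N - to v a)
    step a = linear (φ (j + N - to v a) ∷ φ (j - to v a + N) ∷ φ (j - to v a) ∷ φ (i - a) ∷ [])
        (λ x y z u → x :≡ y ⇒ y :≡ z :+ con 1ℤ ⇒ ⊢ u :- z :- con 1ℤ :≡ u :- x)
        (cong φ {j + N - to v a} {j - to v a + N} (linear (j ∷ N ∷ to v a ∷ [])
        (λ x y z → ⊢ x :+ y :- z :≡ x :- z :+ y))) (φ-N (j - to v a))

  rank-drop : ∀ v i j p → rank v i (j + N· (+ p)) ≤ (rank v i j - + p) ⁺
  rank-drop v i j zero    = linear (rank v i (j + N· 0ℤ) ∷ rank v i j ∷ (rank v i j - 0ℤ) ⁺ ∷ [])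
      (λ x y z → x :≡ y ⇒ y :- con 0ℤ :≤ z ⇒ ⊢ x :≤ z) (cong (rank v i) {j + N· 0ℤ} {j}
      (linear (N· 0ℤ ∷ j ∷ []) (λ x y → x :≡ con 0ℤ ⇒ ⊢ y :+ x :≡ y) N·-0)) (⁺-upper (rank v i j - 0ℤ))
  rank-drop v i j (suc p) = linear (rank v i (j + N· (+ suc p)) ∷ rank v i (j + N· (+ p) + N) ∷
      (rank v i (j + N· (+ p)) - 1ℤ) ⁺ ∷ (rank v i j - + suc p) ⁺ ∷ [])
      (λ x y z u → x :≡ y ⇒ y :≤ z ⇒ z :≤ u ⇒ ⊢ x :≤ u) e (rank-drop-one v i (j + N· (+ p)))
      (⁺-least {rank v i (j + N· (+ p)) - 1ℤ} {(rank v i j - + suc p) ⁺} (decide (⁺-cases (rank v i j - + p)))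
      (⁺-nonNeg (rank v i j - + suc p)))
    where
    e : rank v i (j + N· (+ suc p)) ≡ rank v i (j + N· (+ p) + N)
    e = cong (rank v i) {j + N· (+ suc p)} {j + N· (+ p) + N} (linear (N· (+ suc p) ∷ N ∷ N· (+ p) ∷ j ∷ [])
        (λ x y z u → x :≡ y :+ z ⇒ ⊢ u :+ x :≡ u :+ z :+ y) (N·-suc p))
    decide : Signed (rank v i j - + p) → rank v i (j + N· (+ p)) - 1ℤ ≤ (rank v i j - + suc p) ⁺
    decide (inj₁ (f , _)) = linear ((rank v i j - + p) ⁺ ∷ rank v i j ∷ + p ∷ rank v i (j + N· (+ p)) ∷
        (rank v i j - + suc p) ⁺ ∷ []) (λ x y z u v → x :≡ y :- z ⇒ u :≤ x ⇒ y :- (con 1ℤ :+ z) :≤ v ⇒ ⊢ u :- con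
        1ℤ :≤ v) f (rank-drop v i j p) (⁺-upper (rank v i j - + suc p))
    decide (inj₂ (f , _)) = linear ((rank v i j - + p) ⁺ ∷ rank v i (j + N· (+ p)) ∷ (rank v i j - + suc p) ⁺ ∷
        []) (λ x y z → x :≡ con 0ℤ ⇒ y :≤ x ⇒ con 0ℤ :≤ z ⇒ ⊢ y :- con 1ℤ :≤ z) f (rank-drop v i j p)
        (⁺-nonNeg (rank v i j - + suc p))

  -- Class by class this is convexity of the positive part: the two arguments on the right have the
  -- same sum and lie further apart. It glues strands that cross two adjacent blocks, at the price
  -- of the crossings of their common wall.
  rank-supermodular : ∀ v {a b c} → a ≤ b → b ≤ c → rank v a b + rank v b c ≤ rank v a c + rank v b b
  rank-supermodular v {a} {b} {c} p q =
    subst₂ _≤_ (ΣR-+ _ _) (ΣR-+ _ _)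
      (ΣR-mono (λ s → exchange (φ-mono {a - s} {b - s} (linear (a ∷ b ∷ s ∷ [])
          (λ x y z → x :≤ y ⇒ ⊢ x :- z :≤ y :- z) p)) (φ-mono {b - to v s} {c - to v s}
          (linear (b ∷ c ∷ to v s ∷ []) (λ x y z → x :≤ y ⇒ ⊢ x :- z :≤ y :- z) q))))
    where
    exchange : ∀ {x y u w} → x ≤ y → u ≤ w → (x - u) ⁺ + (y - w) ⁺ ≤ (x - w) ⁺ + (y - u) ⁺
    exchange {x} {y} {u} {w} p q = go (⁺-cases (x - u)) (⁺-cases (y - w))
      where
      go : Signed (x - u) → Signed (y - w) → (x - u) ⁺ + (y - w) ⁺ ≤ (x - w) ⁺ + (y - u) ⁺
      go (inj₁ (e , _)) (inj₁ (f , _)) = linear ((x - u) ⁺ ∷ x ∷ u ∷ (y - w) ⁺ ∷ y ∷ w ∷ (x - w) ⁺ ∷ (y - u) ⁺ ∷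
          []) (λ x y z u v w p q → x :≡ y :- z ⇒ u :≡ v :- w ⇒ y :- w :≤ p ⇒ v :- z :≤ q ⇒ ⊢ x :+ u :≤ p :+ q) e
          f (⁺-upper (x - w)) (⁺-upper (y - u))
      go (inj₁ (e , _)) (inj₂ (f , _)) = linear ((x - u) ⁺ ∷ x ∷ u ∷ (y - w) ⁺ ∷ (x - w) ⁺ ∷ y ∷ (y - u) ⁺ ∷ [])
          (λ x y z u v w p → x :≡ y :- z ⇒ u :≡ con 0ℤ ⇒ con 0ℤ :≤ v ⇒ w :- z :≤ p ⇒ y :≤ w ⇒ ⊢ x :+ u :≤ v :+ p)
          e f (⁺-nonNeg (x - w)) (⁺-upper (y - u)) p
      go (inj₂ (e , _)) (inj₁ (f , _)) = linear ((x - u) ⁺ ∷ (y - w) ⁺ ∷ y ∷ w ∷ (x - w) ⁺ ∷ u ∷ (y - u) ⁺ ∷ [])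
          (λ x y z u v w p → x :≡ con 0ℤ ⇒ y :≡ z :- u ⇒ con 0ℤ :≤ v ⇒ z :- w :≤ p ⇒ w :≤ u ⇒ ⊢ x :+ y :≤ v :+ p)
          e f (⁺-nonNeg (x - w)) (⁺-upper (y - u)) q
      go (inj₂ (e , _)) (inj₂ (f , _)) = linear ((x - u) ⁺ ∷ (y - w) ⁺ ∷ (x - w) ⁺ ∷ (y - u) ⁺ ∷ [])
          (λ x y z u → x :≡ con 0ℤ ⇒ y :≡ con 0ℤ ⇒ con 0ℤ :≤ z ⇒ con 0ℤ :≤ u ⇒ ⊢ x :+ y :≤ z :+ u) e f
          (⁺-nonNeg (x - w)) (⁺-nonNeg (y - u))

  rank-row-lip : ∀ v i j d → rank v (i + + d) j ≤ rank v i j + + d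
  rank-row-lip v i j zero    = ≤-reflexive (linear (rank v (i + 0ℤ) j ∷ rank v i j ∷ [])
      (λ x y → x :≡ y ⇒ ⊢ x :≡ y :+ con 0ℤ) (cong (λ t → rank v t j) {i + 0ℤ} {i}
      (linear (i ∷ []) (λ x → ⊢ x :+ con 0ℤ :≡ x))))
  rank-row-lip v i j (suc d) = go (to v (i + + suc d) ≤? j)
    where
    e : rank v (i + + suc d - 1ℤ) j ≡ rank v (i + + d) j
    e = cong (λ t → rank v t j) {i + + suc d - 1ℤ} {i + + d} (linear (+ d ∷ i ∷ [])
        (λ x y → ⊢ y :+ (con 1ℤ :+ x) :- con 1ℤ :≡ y :+ x))
    go : Dec (to v (i + + suc d) ≤ j) → rank v (i + + suc d) j ≤ rank v i j + + suc d
    go (yes p) = linear (rank v (i + + suc d) j ∷ rank v (i + + suc d - 1ℤ) j ∷ rank v (i + + d) j ∷ + d ∷ rank v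
        i j ∷ []) (λ x y z u v → x :≡ y ⇒ y :≡ z ⇒ z :≤ v :+ u ⇒ ⊢ x :≤ v :+ (con 1ℤ :+ u))
        (rank-row-no v (i + + suc d) j p) e (rank-row-lip v i j d)
    go (no p)  = linear (rank v (i + + suc d) j ∷ rank v (i + + suc d - 1ℤ) j ∷ rank v (i + + d) j ∷ + d ∷ rank v
        i j ∷ []) (λ x y z u v → x :≡ y :+ con 1ℤ ⇒ y :≡ z ⇒ z :≤ v :+ u ⇒ ⊢ x :≤ v :+ (con 1ℤ :+ u))
        (rank-row-yes v (i + + suc d) j (≰⇒> p)) e (rank-row-lip v i j d)

  rank-row-bound : ∀ v i k j → rank v i j ≤ rank v k j + (i - k) ⁺
  rank-row-bound v i k j = go (i - k) refl (⁺-cases (i - k))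
    where
    go : ∀ d → d ≡ i - k → Signed (i - k) → rank v i j ≤ rank v k j + (i - k) ⁺
    go d        e (inj₂ (f , p)) = linear-by (byCombination (1ℤ ∷ -1ℤ ∷ []))
        ((i - k) ⁺ ∷ rank v i j ∷ rank v k j ∷ []) (λ x y z → x :≡ con 0ℤ ⇒ y :≤ z ⇒ ⊢ y :≤ z :+ x) f
        (rank-mono v {i} {k} {j} {j} (linear (i ∷ k ∷ []) (λ x y → x :- y :≤ con 0ℤ ⇒ ⊢ x :≤ y) p) ≤-refl)
    go (+ d)    e (inj₁ (f , p)) = linear-by (byCombination (1ℤ ∷ -1ℤ ∷ 1ℤ ∷ -1ℤ ∷ []))
        ((i - k) ⁺ ∷ i ∷ k ∷ rank v (k + + d) j ∷ rank v k j ∷ + d ∷ rank v i j ∷ [])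
        (λ x y z u v w p → x :≡ y :- z ⇒ u :≤ v :+ w ⇒ u :≡ p ⇒ w :≡ y :- z ⇒ ⊢ p :≤ v :+ x) f
        (rank-row-lip v k j d) (cong (λ t → rank v t j) {k + + d} {i}
        (linear (+ d ∷ i ∷ k ∷ []) (λ x y z → x :≡ y :- z ⇒ ⊢ z :+ x :≡ y) e)) e
    go -[1+ d ] e (inj₁ (f , p)) = ⊥-elim (negsuc≱0 (subst (0ℤ ≤_) (sym e) p))
      where
      negsuc≱0 : ¬ 0ℤ ≤ -[1+ d ]
      negsuc≱0 ()

  -- The row bound for the inverse; the defects of the two columns differ by `l − j`, which turns
  -- `(j − l)⁺` into `(l − j)⁺`.
  rank-column-bound : ∀ v i l j → rank v i j ≤ rank v i l + (l - j) ⁺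
  rank-column-bound v i l j = linear-by (byCombination (1ℤ ∷ 1ℤ ∷ -1ℤ ∷ 1ℤ ∷ -1ℤ ∷ []))
      (rank v i j ∷ rank (inv v) j i ∷ defect v i j ∷ rank v i l ∷ rank (inv v) l i ∷ defect v i l ∷ (j - l) ⁺ ∷
      defect v i 0ℤ ∷ j ∷ l ∷ (l - j) ⁺ ∷ []) (λ x y z u v w p q r s x10 → x :≡ y :+ z ⇒ u :≡ v :+ w ⇒ y :≤ v :+
      p ⇒ opp z :≡ opp q :+ r ⇒ opp w :≡ opp q :+ s ⇒ p :+ (s :- r) :≡ x10 ⇒ ⊢ x :≤ u :+ x10) (rank-defect v i j)
      (rank-defect v i l) (rank-row-bound (inv v) j l i) (unit-slope (λ j → - defect v i j)
      (λ j → linear (defect v i (j - 1ℤ) ∷ defect v i j ∷ []) (λ x y → x :≡ y :+ con 1ℤ ⇒ ⊢ opp y :≡ opp x :+ con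
      1ℤ) (defect-column v i j)) j) (unit-slope (λ j → - defect v i j)
      (λ j → linear (defect v i (j - 1ℤ) ∷ defect v i j ∷ []) (λ x y → x :≡ y :+ con 1ℤ ⇒ ⊢ opp y :≡ opp x :+ con
      1ℤ) (defect-column v i j)) l) flip
    where
    flip : (j - l) ⁺ + (l - j) ≡ (l - j) ⁺
    flip = linear-by (byEquations (-1ℤ ∷ -1ℤ ∷ [])) ((l - j) ⁺ ∷ (- (l - j)) ⁺ ∷ l ∷ j ∷ (j - l) ⁺ ∷ [])
        (λ x y z u v → x :- y :≡ z :- u ⇒ y :≡ v ⇒ ⊢ v :+ (z :- u) :≡ x) (⁺-sub (l - j)) (cong _⁺ (neg-sub l j))

  rank-bound : ∀ v i j k → rank v i j ≤ rank v k k + (i - k) ⁺ + (k - j) ⁺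
  rank-bound v i j k = linear (rank v i j ∷ rank v k j ∷ (i - k) ⁺ ∷ rank v k k ∷ (k - j) ⁺ ∷ [])
      (λ x y z u v → x :≤ y :+ z ⇒ y :≤ u :+ v ⇒ ⊢ x :≤ u :+ z :+ v) (rank-row-bound v i k j)
      (rank-column-bound v k k j)

  -- rank v k k = 0 says that v preserves {a ≤ k}.

  module Uncrossed {v : Perm} (B : Balanced v) {k : ℤ} (z : rank v k k ≤ 0ℤ) where

    uncrossed-inv : rank (inv v) k k ≤ 0ℤ
    uncrossed-inv = linear-by (byCombination (1ℤ ∷ -1ℤ ∷ [])) (rank v k k ∷ rank (inv v) k k ∷ k ∷ [])
        (λ x y z → x :≡ y :+ (z :- z) ⇒ x :≤ con 0ℤ ⇒ ⊢ y :≤ con 0ℤ) (rank-balance B k k) z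

    to-≤ : ∀ {a} → a ≤ k → to v a ≤ k
    to-≤ {a} p = ≮⇒≥ (λ q → 1≰0 (linear (rank v k k ∷ []) (λ x → con 1ℤ :≤ x ⇒ x :≤ con 0ℤ ⇒ ⊢ con 1ℤ :≤ con 0ℤ)
        (rank-pos v {a} {k} {k} p q) z))

    from-≤ : ∀ {a} → a ≤ k → from v a ≤ k
    from-≤ {a} p = ≮⇒≥ (λ q → 1≰0 (linear (rank (inv v) k k ∷ [])
        (λ x → con 1ℤ :≤ x ⇒ x :≤ con 0ℤ ⇒ ⊢ con 1ℤ :≤ con 0ℤ) (rank-pos (inv v) {a} {k} {k} p q) uncrossed-inv))

    to-> : ∀ {a} → k < a → k < to v a
    to-> {a} p = ≰⇒> (λ q → 1≰0 (linear (k ∷ a ∷ []) (λ x y → x :< y ⇒ y :≤ x ⇒ ⊢ con 1ℤ :≤ con 0ℤ) p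
        (subst (_≤ k) (from-to v a) (from-≤ q))))

    from-> : ∀ {a} → k < a → k < from v a
    from-> {a} p = ≰⇒> (λ q → 1≰0 (linear (k ∷ a ∷ []) (λ x y → x :< y ⇒ y :≤ x ⇒ ⊢ con 1ℤ :≤ con 0ℤ) p
        (subst (_≤ k) (to-from v a) (to-≤ q))))

  -- The root lattice, with vectors extended periodically

  hat : Q n → ℤ → ℤ
  hat μ a = μ (cls a)

  hat-cong : ∀ μ {a b} → res a ≡ res b → hat μ a ≡ hat μ b
  hat-cong μ {a} {b} e = cong μ (toℕ-injective (trans (toℕ-cls a) (trans e (sym (toℕ-cls b)))))

  hat-periodic : ∀ μ → Periodic (hat μ)
  hat-periodic μ a = hat-cong μ (res-N a)

  cls-toℕ : ∀ i → cls (+ toℕ i) ≡ i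
  cls-toℕ i = toℕ-injective (trans (toℕ-cls _) (res-toℕ i))

  res-cls : ∀ a → res (+ toℕ (cls a)) ≡ res a
  res-cls a = trans (res-toℕ (cls a)) (toℕ-cls a)

  -- root a b = e_a − e_b, where e_{a+n} = e_a − c
  root : ℤ → ℤ → Q n
  root a b k = φ (+ toℕ k - a) - φ (+ toℕ k - b)

  hat-root : ∀ a b k → hat (root a b) k ≡ φ (k - a) - φ (k - b)
  hat-root a b k = sym (periodic-cong {λ k → φ (k - a) - φ (k - b)} P (sym (res-cls k)))
    where
    shift : ∀ k a → φ (k + N - a) ≡ φ (k - a) + 1ℤ
    shift k a = trans (cong φ {k + N - a} {k - a + N} (linear (k ∷ N ∷ a ∷ [])
        (λ x y z → ⊢ x :+ y :- z :≡ x :- z :+ y))) (φ-N (k - a))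
    P : Periodic (λ k → φ (k - a) - φ (k - b))
    P k = linear-by (byEquations (1ℤ ∷ -1ℤ ∷ [])) (φ (k + N - a) ∷ φ (k - a) ∷ φ (k + N - b) ∷ φ (k - b) ∷ [])
        (λ x y z u → x :≡ y :+ con 1ℤ ⇒ z :≡ u :+ con 1ℤ ⇒ ⊢ x :- z :≡ y :- u) (shift k a) (shift k b)

  δ : ℤ → ℤ → ℤ
  δ a b = if does (res a ℕ.≟ res b) then 1ℤ else 0ℤ

  δ-yes : ∀ {a b} → res a ≡ res b → δ a b ≡ 1ℤ
  δ-yes {a} {b} e = cong (λ t → if t then 1ℤ else 0ℤ) (dec-true (res a ℕ.≟ res b) e)

  δ-no : ∀ {a b} → res a ≢ res b → δ a b ≡ 0ℤ
  δ-no {a} {b} e = cong (λ t → if t then 1ℤ else 0ℤ) (dec-false (res a ℕ.≟ res b) e)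

  δ-cong : ∀ {a a′ b} → res a ≡ res a′ → δ a b ≡ δ a′ b
  δ-cong {b = b} e = cong (λ r → if does (r ℕ.≟ res b) then 1ℤ else 0ℤ) e

  δ-cong′ : ∀ {a b b′} → res b ≡ res b′ → δ a b ≡ δ a b′
  δ-cong′ {a} e = cong (λ r → if does (res a ℕ.≟ r) then 1ℤ else 0ℤ) e

  δ-range : ∀ a b → 0ℤ ≤ δ a b × δ a b ≤ 1ℤ
  δ-range a b = go (res a ℕ.≟ res b)
    where
    go : Dec (res a ≡ res b) → 0ℤ ≤ δ a b × δ a b ≤ 1ℤ
    go (yes e) = linear-by (byCombination (1ℤ ∷ -1ℤ ∷ [])) (δ a b ∷ []) (λ x → x :≡ con 1ℤ ⇒ ⊢ con 0ℤ :≤ x)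
        (δ-yes {a} {b} e) , linear (δ a b ∷ []) (λ x → x :≡ con 1ℤ ⇒ ⊢ x :≤ con 1ℤ) (δ-yes {a} {b} e)
    go (no e)  = linear-by (byCombination (1ℤ ∷ -1ℤ ∷ [])) (δ a b ∷ []) (λ x → x :≡ con 0ℤ ⇒ ⊢ con 0ℤ :≤ x)
        (δ-no {a} {b} e) , linear (δ a b ∷ []) (λ x → x :≡ con 0ℤ ⇒ ⊢ x :≤ con 1ℤ) (δ-no {a} {b} e)

  δ-one : ∀ {a b} → 1ℤ ≤ δ a b → res a ≡ res b
  δ-one {a} {b} p = go (res a ℕ.≟ res b)
    where
    go : Dec (res a ≡ res b) → res a ≡ res b
    go (yes e) = e
    go (no e)  = ⊥-elim (1≰0 (linear (δ a b ∷ []) (λ x → x :≡ con 0ℤ ⇒ con 1ℤ :≤ x ⇒ ⊢ con 1ℤ :≤ con 0ℤ)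
        (δ-no {a} {b} e) p))

  φ-δ : ∀ k a → φ (k - a) ≡ φ (k - 1ℤ - a) + δ k a
  φ-δ k a = go (res k ℕ.≟ res a)
    where
    go : Dec (res k ≡ res a) → φ (k - a) ≡ φ (k - 1ℤ - a) + δ k a
    go (yes e) = linear-by (byEquations (1ℤ ∷ -1ℤ ∷ [])) (φ (k - a) ∷ φ (k - 1ℤ - a) ∷ δ k a ∷ [])
        (λ x y z → x :≡ y :+ con 1ℤ ⇒ z :≡ con 1ℤ ⇒ ⊢ x :≡ y :+ z) (φ-step-yes k a e) (δ-yes {k} {a} e)
    go (no e)  = linear-by (byEquations (1ℤ ∷ -1ℤ ∷ [])) (φ (k - a) ∷ φ (k - 1ℤ - a) ∷ δ k a ∷ [])
        (λ x y z → x :≡ y ⇒ z :≡ con 0ℤ ⇒ ⊢ x :≡ y :+ z) (φ-step-no k a e) (δ-no {k} {a} e)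

  -- Serves to split off from a sum its few nonzero classes, one at a time.
  erase : ℤ → (ℤ → ℤ) → ℤ → ℤ
  erase a F c = if does (res c ℕ.≟ res a) then 0ℤ else F c

  erase-yes : ∀ {a c} F → res c ≡ res a → erase a F c ≡ 0ℤ
  erase-yes {a} {c} F e = cong (λ t → if t then 0ℤ else F c) (dec-true (res c ℕ.≟ res a) e)

  erase-no : ∀ {a c} F → res c ≢ res a → erase a F c ≡ F c
  erase-no {a} {c} F e = cong (λ t → if t then 0ℤ else F c) (dec-false (res c ℕ.≟ res a) e)

  erase-periodic : ∀ {F} a → Periodic F → Periodic (erase a F)
  erase-periodic {F} a P c = cong₂ (λ r x → if does (r ℕ.≟ res a) then 0ℤ else x) (res-N c) (P c)

  ΣR-erase : ∀ {F} → Periodic F → ∀ a → ΣR F ≡ F a + ΣR (erase a F)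
  ΣR-erase {F} P a = linear-by (byEquations (1ℤ ∷ -1ℤ ∷ [])) (ΣR F ∷ erase a F a ∷ ΣR (erase a F) ∷ F a ∷ [])
      (λ x y z u → x :+ y :≡ z :+ u ⇒ y :≡ con 0ℤ ⇒ ⊢ x :≡ u :+ z)
      (ΣR-update P (erase-periodic a P) a (λ c e → sym (erase-no F e))) (erase-yes {a} {a} F refl)

  -- The invariant form

  next-res : ∀ {i j : Fin n} → Next i j → res (+ toℕ j) ≡ res (+ toℕ i + 1ℤ)
  next-res {i} {j} (inj₁ e) = cong res (trans (cong +_ e) (+-comm 1ℤ (+ toℕ i)))
  next-res {i} {j} (inj₂ (e , f)) =
    trans (cong (λ t → res (+ t)) f) (trans (sym (res-N 0ℤ)) (cong res {0ℤ + N} {+ toℕ i + 1ℤ}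
        (linear (N ∷ + toℕ i ∷ []) (λ x y → x :≡ con 1ℤ :+ y ⇒ ⊢ con 0ℤ :+ x :≡ y :+ con 1ℤ)
        (trans N≡n (cong +_ (sym e))))))

  res-next : ∀ {i j : Fin n} → res (+ toℕ j) ≡ res (+ toℕ i + 1ℤ) → Next i j
  res-next {i} {j} e = go (ℕP.m≤n⇒m<n∨m≡n (toℕ<n i))
    where
    e₁ : + toℕ i + 1ℤ ≡ + suc (toℕ i)
    e₁ = +-comm (+ toℕ i) 1ℤ
    go : _ → Next i j
    go (inj₁ p) = inj₁ (trans (sym (res-toℕ j)) (trans e (trans (cong res e₁) (res-id p))))
    go (inj₂ p) = inj₂ (p , trans (sym (res-toℕ j)) (trans e
      (trans (cong res {+ toℕ i + 1ℤ} {0ℤ + N} (linear-by (byEquations (-1ℤ ∷ [])) (N ∷ + toℕ i ∷ [])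
          (λ x y → x :≡ con 1ℤ :+ y ⇒ ⊢ y :+ con 1ℤ :≡ con 0ℤ :+ x) (trans N≡n (cong +_ (sym p)))))
        (trans (res-N 0ℤ) (res-id (ℕP.≤-trans (s≤s z≤n) 3≤n))))))

  cartan-diagonal : (i : Fin n) → cartan i i ≡ + 2
  cartan-diagonal i = cong (λ t → if t then + 2 else (if does (adjacent? i i) then -1ℤ else 0ℤ))
      (dec-true (i Fin.≟ i) refl)

  cartan-adjacent : {i j : Fin n} → i ≢ j → Adjacent i j → cartan i j ≡ -1ℤ
  cartan-adjacent {i} {j} ne A =
    trans (cong (λ t → if t then + 2 else (if does (adjacent? i j) then -1ℤ else 0ℤ)) (dec-false (i Fin.≟ j) ne))
          (cong (λ t → if t then -1ℤ else 0ℤ) (dec-true (adjacent? i j) A))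

  cartan-far : {i j : Fin n} → i ≢ j → ¬ Adjacent i j → cartan i j ≡ 0ℤ
  cartan-far {i} {j} ne A =
    trans (cong (λ t → if t then + 2 else (if does (adjacent? i j) then -1ℤ else 0ℤ)) (dec-false (i Fin.≟ j) ne))
          (cong (λ t → if t then -1ℤ else 0ℤ) (dec-false (adjacent? i j) A))

  cartan-sym : (i j : Fin n) → cartan i j ≡ cartan j i
  cartan-sym i j = go (i Fin.≟ j) (adjacent? i j)
    where
    swap : ∀ {i j : Fin n} → Adjacent i j → Adjacent j i
    swap = [ inj₂ , inj₁ ]′
    go : Dec (i ≡ j) → Dec (Adjacent i j) → cartan i j ≡ cartan j i
    go (yes refl) _ = refl
    go (no ne) (yes A) = trans (cartan-adjacent ne A) (sym (cartan-adjacent (ne ∘ sym) (swap {i} {j} A)))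
    go (no ne) (no A)  = trans (cartan-far ne A) (sym (cartan-far (ne ∘ sym) (A ∘ swap {j} {i})))

  res-suc≢ : ∀ a → res a ≢ res (a + 1ℤ)
  res-suc≢ a = res≢-offset (linear (a ∷ []) (λ x → ⊢ con 0ℤ :< x :+ con 1ℤ :- x))
      (linear (N ∷ a ∷ []) (λ x y → con (+ 3) :≤ x ⇒ ⊢ y :+ con 1ℤ :- y :< x) 3≤N)

  -- The discrete Laplacian on a cycle, that is, the affine Cartan matrix applied to `ν`. Since
  -- `n ≥ 3`, the two neighbours of a node are different.
  Δ : Q n → ℤ → ℤ
  Δ ν a = + 2 * hat ν a - hat ν (a + 1ℤ) - hat ν (a - 1ℤ)

  cartan-row : (ν : Q n) (i : Fin n) → sum (λ j → cartan i j * ν j) ≡ Δ ν (+ toℕ i)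
  cartan-row ν i = begin
    sum (λ j → cartan i j * ν j)
      ≡⟨ sum-ext (λ j → cong (λ t → cartan i t * ν t) (sym (cls-toℕ j))) ⟩
    sum {n} (λ j → F (+ toℕ j))   ≡⟨ sym (ΣR-sum F) ⟩
    ΣR F                      ≡⟨ total ⟩
    Δ ν a                     ∎
    where
    open ≡-Reasoning
    a : ℤ
    a = + toℕ i
    F : ℤ → ℤ
    F x = cartan i (cls x) * hat ν x
    P : Periodic F
    P x = cong (λ t → cartan i t * ν t) (toℕ-injective (trans (toℕ-cls _) (trans (res-N x) (sym (toℕ-cls x)))))
    cls-≢ : ∀ {x} → res x ≢ res a → i ≢ cls x
    cls-≢ {x} ne e = ne (trans (sym (res-cls x)) (cong (λ t → res (+ toℕ t)) (sym e)))
    F-0 : F a ≡ + 2 * hat ν a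
    F-0 = cong (λ t → t * hat ν a) (trans (cong (cartan i) (cls-toℕ i)) (cartan-diagonal i))
    ne₊ : res (a + 1ℤ) ≢ res a
    ne₊ e = res-suc≢ a (sym e)
    ne₋ : res (a - 1ℤ) ≢ res a
    ne₋ = res≢-offset (linear (a ∷ []) (λ x → ⊢ con 0ℤ :< x :- (x :- con 1ℤ)))
        (linear (N ∷ a ∷ []) (λ x y → con (+ 3) :≤ x ⇒ ⊢ y :- (y :- con 1ℤ) :< x) 3≤N)
    ne± : res (a - 1ℤ) ≢ res (a + 1ℤ)
    ne± = res≢-offset (linear (a ∷ []) (λ x → ⊢ con 0ℤ :< x :+ con 1ℤ :- (x :- con 1ℤ)))
        (linear (N ∷ a ∷ []) (λ x y → con (+ 3) :≤ x ⇒ ⊢ y :+ con 1ℤ :- (y :- con 1ℤ) :< x) 3≤N)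
    F-+ : F (a + 1ℤ) ≡ - hat ν (a + 1ℤ)
    F-+ = trans (cong (λ t → t * hat ν (a + 1ℤ)) (cartan-adjacent (cls-≢ ne₊)
        (inj₁ (res-next (res-cls (a + 1ℤ))))))
                (-1*i≡-i _)
    F-- : F (a - 1ℤ) ≡ - hat ν (a - 1ℤ)
    F-- = trans (cong (λ t → t * hat ν (a - 1ℤ)) (cartan-adjacent (cls-≢ ne₋)
                  (inj₂ (res-next (trans (cong res {a} {a - 1ℤ + 1ℤ}
                      (linear (a ∷ []) (λ x → ⊢ x :≡ x :- con 1ℤ :+ con 1ℤ)))
                      (res-+ 1ℤ (sym (res-cls (a - 1ℤ)))))))))
                (-1*i≡-i _)
    F-far : ∀ x → res x ≢ res a → res x ≢ res (a + 1ℤ) → res x ≢ res (a - 1ℤ) → F x ≡ 0ℤ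
    F-far x p q r = trans (cong (λ t → t * hat ν x) (cartan-far (cls-≢ p) far)) (*-zeroˡ (hat ν x))
      where
      far : ¬ Adjacent i (cls x)
      far (inj₁ m) = q (trans (sym (res-cls x)) (next-res {i} {cls x} m))
      far (inj₂ m) = r (res-+-cancel 1ℤ (trans (res-+ 1ℤ (sym (res-cls x)))
        (trans (sym (next-res {cls x} {i} m)) (cong res {a} {a - 1ℤ + 1ℤ}
            (linear (a ∷ []) (λ x → ⊢ x :≡ x :- con 1ℤ :+ con 1ℤ))))))
    F₁ F₂ F₃ : ℤ → ℤ
    F₁ = erase a F
    F₂ = erase (a + 1ℤ) F₁
    F₃ = erase (a - 1ℤ) F₂
    F₃-0 : ∀ x → F₃ x ≡ 0ℤ
    F₃-0 x = go (res x ℕ.≟ res (a - 1ℤ)) (res x ℕ.≟ res (a + 1ℤ)) (res x ℕ.≟ res a)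
      where
      go : Dec (res x ≡ res (a - 1ℤ)) → Dec (res x ≡ res (a + 1ℤ)) → Dec (res x ≡ res a) → F₃ x ≡ 0ℤ
      go (yes e) _ _ = erase-yes F₂ e
      go (no p) (yes e) _ = trans (erase-no F₂ p) (erase-yes F₁ e)
      go (no p) (no q) (yes e) = trans (erase-no F₂ p) (trans (erase-no F₁ q) (erase-yes F e))
      go (no p) (no q) (no r) = trans (erase-no F₂ p) (trans (erase-no F₁ q)
          (trans (erase-no F r) (F-far x r q p)))
    P₁ : Periodic F₁
    P₁ = erase-periodic a P
    P₂ : Periodic F₂
    P₂ = erase-periodic (a + 1ℤ) P₁
    S₁ : ΣR F ≡ F a + ΣR F₁
    S₁ = ΣR-erase P a
    S₂ : ΣR F₁ ≡ F₁ (a + 1ℤ) + ΣR F₂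
    S₂ = ΣR-erase P₁ (a + 1ℤ)
    S₃ : ΣR F₂ ≡ F₂ (a - 1ℤ) + ΣR F₃
    S₃ = ΣR-erase P₂ (a - 1ℤ)
    S₄ : ΣR F₃ ≡ 0ℤ
    S₄ = trans (ΣR-cong F₃-0) ΣR-0
    F₁-+ : F₁ (a + 1ℤ) ≡ - hat ν (a + 1ℤ)
    F₁-+ = trans (erase-no F ne₊) F-+
    F₂-- : F₂ (a - 1ℤ) ≡ - hat ν (a - 1ℤ)
    F₂-- = trans (erase-no F₁ ne±) (trans (erase-no F ne₋) F--)
    total : ΣR F ≡ + 2 * hat ν a - hat ν (a + 1ℤ) - hat ν (a - 1ℤ)
    total = linear (ΣR F ∷ F a ∷ ΣR F₁ ∷ F₁ (a + 1ℤ) ∷ ΣR F₂ ∷ F₂ (a - 1ℤ) ∷ ΣR F₃ ∷ hat ν a ∷ hat ν (a + 1ℤ) ∷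
        hat ν (a - 1ℤ) ∷ []) (λ x y z u v w p q r s → x :≡ y :+ z ⇒ z :≡ u :+ v ⇒ v :≡ w :+ p ⇒ p :≡ con 0ℤ ⇒ y
        :≡ (+ 2) :* q ⇒ u :≡ opp r ⇒ w :≡ opp s ⇒ ⊢ x :≡ (+ 2) :* q :- r :- s) S₁ S₂ S₃ S₄ F-0 F₁-+ F₂--

  sum-scale : ∀ {m} k (f : Fin m → ℤ) → sum (λ i → k * f i) ≡ k * sum f
  sum-scale {zero}  k f = sym (*-zeroʳ k)
  sum-scale {suc m} k f = trans (cong (λ t → k * f Fin.zero + t) (sum-scale k (f ∘ Fin.suc)))
      (sym (*-distribˡ-+ k _ _))

  form-Δ : (μ ν : Q n) → ⟨ μ , ν ⟩ ≡ ΣR (λ a → hat μ a * Δ ν a)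
  form-Δ μ ν = begin
    sum (λ i → sum (λ j → μ i * cartan i j * ν j))
      ≡⟨ sum-ext (λ i → trans (sum-ext (λ j → *-assoc (μ i) (cartan i j) (ν j)))
          (trans (sum-scale (μ i) (λ j → cartan i j * ν j))
           (cong₂ _*_ (cong μ (sym (cls-toℕ i))) (cartan-row ν i)))) ⟩
    sum {n} (λ i → hat μ (+ toℕ i) * Δ ν (+ toℕ i)) ≡⟨ sym (ΣR-sum (λ a → hat μ a * Δ ν a)) ⟩
    ΣR (λ a → hat μ a * Δ ν a) ∎
    where open ≡-Reasoning

  form-sym : (μ ν : Q n) → ⟨ μ , ν ⟩ ≡ ⟨ ν , μ ⟩
  form-sym μ ν = trans (∑-comm {n} {n} (λ i j → μ i * cartan i j * ν j))
    (sum-ext (λ j → sum-ext (λ i → trans (flip (μ i) (cartan i j) (ν j))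
        (cong (λ t → ν j * t * μ i) (cartan-sym i j)))))
    where
    flip : ∀ x y z → x * y * z ≡ z * y * x
    flip = solve-∀

  form-Δ-cong : (μ : Q n) {ν ν′ : Q n} → (∀ a → Δ ν a ≡ Δ ν′ a) → ⟨ μ , ν ⟩ ≡ ⟨ μ , ν′ ⟩
  form-Δ-cong μ {ν} {ν′} p =
    trans (form-Δ μ ν) (trans (ΣR-cong (λ a → cong (λ t → hat μ a * t) (p a))) (sym (form-Δ μ ν′)))

  -- The first difference of `φ (k - a)` in `k` is `δ k a`, so second differences of a root are
  -- first differences of `δ`.
  Δ-root : ∀ a b k → Δ (root a b) k ≡ (δ k a - δ (k + 1ℤ) a) - (δ k b - δ (k + 1ℤ) b)
  Δ-root a b k = unfolded
    where
    step : ∀ a → φ (k + 1ℤ - a) ≡ φ (k - a) + δ (k + 1ℤ) a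
    step a = trans (φ-δ (k + 1ℤ) a) (cong (λ t → φ (t - a) + δ (k + 1ℤ) a) {k + 1ℤ - 1ℤ} {k}
        (linear (k ∷ []) (λ x → ⊢ x :+ con 1ℤ :- con 1ℤ :≡ x)))
    ν : Q n
    ν = root a b
    unfolded : + 2 * hat ν k - hat ν (k + 1ℤ) - hat ν (k - 1ℤ) ≡ (δ k a - δ (k + 1ℤ) a) - (δ k b - δ (k + 1ℤ) b)
    unfolded = linear-by (byEquations ((+ 2) ∷ -1ℤ ∷ -1ℤ ∷ 1ℤ ∷ -1ℤ ∷ -1ℤ ∷ 1ℤ ∷ []))
        (hat (root a b) k ∷ φ (k - a) ∷ φ (k - b) ∷ hat (root a b) (k + 1ℤ) ∷ φ (k + 1ℤ - a) ∷ φ (k + 1ℤ - b) ∷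
        hat (root a b) (k - 1ℤ) ∷ φ (k - 1ℤ - a) ∷ φ (k - 1ℤ - b) ∷ δ k a ∷ δ k b ∷ δ (k + 1ℤ) a ∷ δ (k + 1ℤ) b ∷
        []) (λ x y z u v w p q r s x10 x11 x12 → x :≡ y :- z ⇒ u :≡ v :- w ⇒ p :≡ q :- r ⇒ y :≡ q :+ s ⇒ z :≡ r
        :+ x10 ⇒ v :≡ y :+ x11 ⇒ w :≡ z :+ x12 ⇒ ⊢ (+ 2) :* x :- u :- p :≡ s :- x11 :- (x10 :- x12))
        (hat-root a b k) (hat-root a b (k + 1ℤ)) (hat-root a b (k - 1ℤ)) (φ-δ k a) (φ-δ k b) (step a) (step b)

  -- the pairing of μ with e_a
  jump : Q n → ℤ → ℤ
  jump μ a = hat μ a - hat μ (a - 1ℤ)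

  ΣR-jump : (μ : Q n) (a : ℤ) → ΣR (λ k → hat μ k * (δ k a - δ (k + 1ℤ) a)) ≡ jump μ a
  ΣR-jump μ a = begin
    ΣR (λ k → hat μ k * (δ k a - δ (k + 1ℤ) a))
      ≡⟨ ΣR-cong (λ k → distr (hat μ k) (δ k a) (δ (k + 1ℤ) a)) ⟩
    ΣR (λ k → hat μ k * δ k a - hat μ k * δ (k + 1ℤ) a)
      ≡⟨ ΣR-- (λ k → hat μ k * δ k a) (λ k → hat μ k * δ (k + 1ℤ) a) ⟩
    ΣR (λ k → hat μ k * δ k a) - ΣR (λ k → hat μ k * δ (k + 1ℤ) a)
      ≡⟨ cong₂ _-_ first second ⟩
    hat μ a - hat μ (a - 1ℤ) ∎
    where
    open ≡-Reasoning
    distr : ∀ x y z → x * (y - z) ≡ x * y - x * z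
    distr = solve-∀
    first : ΣR (λ k → hat μ k * δ k a) ≡ hat μ a
    first = trans (ΣR-single (λ k → cong₂ _*_ (hat-periodic μ k) (δ-cong {k + N} {k} {a} (res-N k))) a
        (λ k ne → trans (cong (λ t → hat μ k * t) (δ-no {k} {a} ne)) (*-zeroʳ (hat μ k))))
      (trans (cong (λ t → hat μ a * t) (δ-yes {a} {a} refl)) (*-identityʳ (hat μ a)))
    e : res (a - 1ℤ + 1ℤ) ≡ res a
    e = cong res {a - 1ℤ + 1ℤ} {a} (linear (a ∷ []) (λ x → ⊢ x :- con 1ℤ :+ con 1ℤ :≡ x))
    second : ΣR (λ k → hat μ k * δ (k + 1ℤ) a) ≡ hat μ (a - 1ℤ)
    second = trans (ΣR-single (λ k → cong₂ _*_ (hat-periodic μ k)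
        (δ-cong {k + N + 1ℤ} {k + 1ℤ} {a} (res-+ 1ℤ (res-N k)))) (a - 1ℤ)
        (λ k ne → trans (cong (λ t → hat μ k * t) (δ-no {k + 1ℤ} {a}
            (λ f → ne (res-+-cancel 1ℤ (trans f (sym e)))))) (*-zeroʳ (hat μ k))))
      (trans (cong (λ t → hat μ (a - 1ℤ) * t) (δ-yes {a - 1ℤ + 1ℤ} {a} e)) (*-identityʳ (hat μ (a - 1ℤ))))

  -- Summation by parts: the Laplacian of a root is a combination of four `δ`, each of which picks
  -- one value of `μ`.
  form-root : (μ : Q n) (a b : ℤ) → ⟨ μ , root a b ⟩ ≡ jump μ a - jump μ b
  form-root μ a b = begin
    ⟨ μ , root a b ⟩
      ≡⟨ form-Δ μ (root a b) ⟩
    ΣR (λ k → hat μ k * Δ (root a b) k)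
      ≡⟨ ΣR-cong (λ k → trans (cong (λ t → hat μ k * t) (Δ-root a b k))
           (distr (hat μ k) (δ k a - δ (k + 1ℤ) a) (δ k b - δ (k + 1ℤ) b))) ⟩
    ΣR (λ k → hat μ k * (δ k a - δ (k + 1ℤ) a) - hat μ k * (δ k b - δ (k + 1ℤ) b))
      ≡⟨ ΣR-- (λ k → hat μ k * (δ k a - δ (k + 1ℤ) a)) (λ k → hat μ k * (δ k b - δ (k + 1ℤ) b)) ⟩
    ΣR (λ k → hat μ k * (δ k a - δ (k + 1ℤ) a)) - ΣR (λ k → hat μ k * (δ k b - δ (k + 1ℤ) b))
      ≡⟨ cong₂ _-_ (ΣR-jump μ a) (ΣR-jump μ b) ⟩
    jump μ a - jump μ b ∎
    where
    open ≡-Reasoning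
    distr : ∀ x y z → x * (y - z) ≡ x * y - x * z
    distr = solve-∀

  jump-root : ∀ a b k → jump (root a b) k ≡ δ k a - δ k b
  jump-root a b k = unfolded
    where
    unfolded : hat (root a b) k - hat (root a b) (k - 1ℤ) ≡ δ k a - δ k b
    unfolded = linear-by (byEquations (1ℤ ∷ -1ℤ ∷ 1ℤ ∷ -1ℤ ∷ []))
        (hat (root a b) k ∷ φ (k - a) ∷ φ (k - b) ∷ hat (root a b) (k - 1ℤ) ∷ φ (k - 1ℤ - a) ∷ φ (k - 1ℤ - b) ∷ δ
        k a ∷ δ k b ∷ []) (λ x y z u v w p q → x :≡ y :- z ⇒ u :≡ v :- w ⇒ y :≡ v :+ p ⇒ z :≡ w :+ q ⇒ ⊢ x :- u
        :≡ p :- q) (hat-root a b k) (hat-root a b (k - 1ℤ)) (φ-δ k a) (φ-δ k b)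

  form-root-root : ∀ c d a b → ⟨ root c d , root a b ⟩ ≡ (δ a c - δ a d) - (δ b c - δ b d)
  form-root-root c d a b = linear-by (byEquations (1ℤ ∷ 1ℤ ∷ -1ℤ ∷ []))
      (⟨ root c d , root a b ⟩ ∷ jump (root c d) a ∷ jump (root c d) b ∷ δ a c ∷ δ a d ∷ δ b c ∷ δ b d ∷ [])
      (λ x y z u v w p → x :≡ y :- z ⇒ y :≡ u :- v ⇒ z :≡ w :- p ⇒ ⊢ x :≡ u :- v :- (w :- p))
      (form-root (root c d) a b) (jump-root c d a) (jump-root c d b)

  form-congʳ : (μ : Q n) {ν ν′ : Q n} → ν ≗ ν′ → ⟨ μ , ν ⟩ ≡ ⟨ μ , ν′ ⟩
  form-congʳ μ p = sum-ext (λ i → sum-ext (λ j → cong (λ t → μ i * cartan i j * t) (p j)))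

  form-congˡ : {μ μ′ : Q n} (ν : Q n) → μ ≗ μ′ → ⟨ μ , ν ⟩ ≡ ⟨ μ′ , ν ⟩
  form-congˡ ν p = sum-ext (λ i → sum-ext (λ j → cong (λ t → t * cartan i j * ν j) (p i)))

  -- Operators acting on roots through an affine permutation

  record Rep (f : Op n) (v : Perm) : Set where
    field
      f-cong : ∀ {μ ν} → μ ≗ ν → f μ ≗ f ν
      f-+    : ∀ μ ν → f (μ +Q ν) ≗ f μ +Q f ν
      f-*    : ∀ k μ → f (k *Q μ) ≗ k *Q f μ
      f-root : ∀ a b → f (root a b) ≗ root (to v a) (to v b)

  open Rep

  rep-id : Rep id 1ₚ
  rep-id = record { f-cong = id ; f-+ = λ _ _ _ → refl ; f-* = λ _ _ _ → refl ; f-root = λ _ _ _ → refl }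

  rep-∘ : ∀ {f g u v} → Rep f u → Rep g v → Rep (f ∘ g) (u · v)
  rep-∘ {f} {g} {u} {v} R S = record
    { f-cong = λ p → f-cong R (f-cong S p)
    ; f-+    = λ μ ν i → trans (f-cong R (f-+ S μ ν) i) (f-+ R (g μ) (g ν) i)
    ; f-*    = λ k μ i → trans (f-cong R (f-* S k μ) i) (f-* R k (g μ) i)
    ; f-root = λ a b i → trans (f-cong R (f-root S a b) i) (f-root R (to v a) (to v b) i)
    }

  jump-+ : ∀ (μ ν : Q n) a → jump (μ +Q ν) a ≡ jump μ a + jump ν a
  jump-+ μ ν a = regroup (hat μ a) (hat ν a) (hat μ (a - 1ℤ)) (hat ν (a - 1ℤ))
    where
    regroup : ∀ x y z w → x + y - (z + w) ≡ x - z + (y - w)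
    regroup = solve-∀

  jump-* : ∀ k (μ : Q n) a → jump (k *Q μ) a ≡ k * jump μ a
  jump-* k μ a = regroup k (hat μ a) (hat μ (a - 1ℤ))
    where
    regroup : ∀ k x y → k * x - k * y ≡ k * (x - y)
    regroup = solve-∀

  -- The function `x ↦ φ (x - c)` stands for `e_c`, and this is the reflection formula for it. It is
  -- not periodic, so `e_c` itself is no element of the root lattice; only differences are.
  φ-transpose : ∀ {a b} (ne : res a ≢ res b) c x →
                φ (x - transpose a b c) ≡ φ (x - c) - (δ a c - δ b c) * (φ (x - a) - φ (x - b))
  φ-transpose {a} {b} ne c x = go (classify a b c)
    where
    shifted : ∀ y z q → y ≡ z + N· q → φ (x - y) ≡ φ (x - z) - q
    shifted y z q e = trans (cong φ {x - y} {x - z + N· (- q)}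
        (linear-by (byEquations (-1ℤ ∷ -1ℤ ∷ [])) (y ∷ z ∷ N· q ∷ N· (- q) ∷ x ∷ [])
        (λ x y z u v → x :≡ y :+ z ⇒ u :≡ opp z ⇒ ⊢ v :- x :≡ v :- y :+ u) e (N·-neg q))) (φ-shift (x - z) (- q))
    go : Class a b c → φ (x - transpose a b c) ≡ φ (x - c) - (δ a c - δ b c) * (φ (x - a) - φ (x - b))
    go (is-a e) = trans (cong (λ t → φ (x - t)) (transpose-a a b e))
      (linear-by (byEquations (1ℤ ∷ -1ℤ ∷ 1ℤ ∷ [])) (φ (x - (c + (b - a))) ∷ φ (x - b) ∷ q ∷ φ (x - c) ∷ φ
          (x - a) ∷ (δ a c - δ b c) * (φ (x - a) - φ (x - b)) ∷ [])
          (λ x y z u v w → x :≡ y :- z ⇒ u :≡ v :- z ⇒ w :≡ v :- y ⇒ ⊢ x :≡ u :- w)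
          (shifted (c + (b - a)) b q (linear (c ∷ a ∷ N· q ∷ b ∷ [])
          (λ x y z u → x :≡ y :+ z ⇒ ⊢ x :+ (u :- y) :≡ u :+ z) e′)) (shifted c a q e′) m)
      where
      q : ℤ
      q = φ c - φ a
      e′ : c ≡ a + N· q
      e′ = res-≡ {c} {a} e
      m : (δ a c - δ b c) * (φ (x - a) - φ (x - b)) ≡ φ (x - a) - φ (x - b)
      m = trans (cong (λ t → t * (φ (x - a) - φ (x - b))) {δ a c - δ b c} {1ℤ}
            (linear-by (byEquations (1ℤ ∷ -1ℤ ∷ [])) (δ a c ∷ δ b c ∷ [])
                (λ x y → x :≡ con 1ℤ ⇒ y :≡ con 0ℤ ⇒ ⊢ x :- y :≡ con 1ℤ) (δ-yes {a} {c} (sym e))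
                (δ-no {b} {c} (λ f → ne (trans (sym e) (sym f)))))) (*-identityˡ _)
    go (is-b p e) = trans (cong (λ t → φ (x - t)) (transpose-b a b ne e))
      (linear-by (byEquations (1ℤ ∷ -1ℤ ∷ 1ℤ ∷ [])) (φ (x - (c - (b - a))) ∷ φ (x - a) ∷ q ∷ φ (x - c) ∷ φ
          (x - b) ∷ (δ a c - δ b c) * (φ (x - a) - φ (x - b)) ∷ [])
          (λ x y z u v w → x :≡ y :- z ⇒ u :≡ v :- z ⇒ w :≡ opp (y :- v) ⇒ ⊢ x :≡ u :- w)
          (shifted (c - (b - a)) a q (linear (c ∷ b ∷ N· q ∷ a ∷ [])
          (λ x y z u → x :≡ y :+ z ⇒ ⊢ x :- (y :- u) :≡ u :+ z) e′)) (shifted c b q e′) m)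
      where
      q : ℤ
      q = φ c - φ b
      e′ : c ≡ b + N· q
      e′ = res-≡ {c} {b} e
      m : (δ a c - δ b c) * (φ (x - a) - φ (x - b)) ≡ - (φ (x - a) - φ (x - b))
      m = trans (cong (λ t → t * (φ (x - a) - φ (x - b))) {δ a c - δ b c} { -1ℤ}
            (linear-by (byEquations (-1ℤ ∷ 1ℤ ∷ [])) (δ b c ∷ δ a c ∷ [])
                (λ x y → x :≡ con 1ℤ ⇒ y :≡ con 0ℤ ⇒ ⊢ y :- x :≡ con -1ℤ) (δ-yes {b} {c} (sym e))
                (δ-no {a} {c} (λ f → p (sym f))))) (-1*i≡-i _)
    go (other p q) = trans (cong (λ t → φ (x - t)) (transpose-o a b p q))
        (linear ((δ a c - δ b c) * (φ (x - a) - φ (x - b)) ∷ φ (x - c) ∷ [])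
        (λ x y → x :≡ con 0ℤ ⇒ ⊢ y :≡ y :- x) m)
      where
      m : (δ a c - δ b c) * (φ (x - a) - φ (x - b)) ≡ 0ℤ
      m = trans (cong (λ t → t * (φ (x - a) - φ (x - b))) {δ a c - δ b c} {0ℤ}
            (linear-by (byEquations (1ℤ ∷ -1ℤ ∷ [])) (δ a c ∷ δ b c ∷ [])
                (λ x y → x :≡ con 0ℤ ⇒ y :≡ con 0ℤ ⇒ ⊢ x :- y :≡ con 0ℤ) (δ-no {a} {c} (λ f → p (sym f)))
                (δ-no {b} {c} (λ f → q (sym f))))) (*-zeroˡ (φ (x - a) - φ (x - b)))

  rep-reflection : ∀ {α a b} (ne : res a ≢ res b) → α ≗ root a b → Rep (reflection α) (transposition a b ne)
  rep-reflection {α} {a} {b} ne e = record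
    { f-cong = λ {μ} {ν} p i → cong₂ (λ s t → s - t * α i) (p i) (form-congˡ {μ} {ν} α p)
    ; f-+    = λ μ ν i → trans (normal (μ +Q ν) i) (trans
        (cong (λ t → μ i + ν i - t * α i) (cong₂ _-_ (jump-+ μ ν a) (jump-+ μ ν b)))
        (trans (additive (μ i) (ν i) (jump μ a) (jump ν a) (jump μ b) (jump ν b) (α i))
          (sym (cong₂ _+_ (normal μ i) (normal ν i)))))
    ; f-*    = λ k μ i → trans (normal (k *Q μ) i) (trans
        (cong (λ t → k * μ i - t * α i) (cong₂ _-_ (jump-* k μ a) (jump-* k μ b)))
        (trans (homogeneous k (μ i) (jump μ a) (jump μ b) (α i)) (cong (λ t → k * t) (sym (normal μ i)))))
    ; f-root = λ c d i → trans (cong₂ (λ s t → root c d i - s * t)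
          (trans (form-congʳ (root c d) e) (form-root-root c d a b)) (e i))
        (trans (regroup (φ (+ toℕ i - c)) (φ (+ toℕ i - d)) (δ a c) (δ a d) (δ b c) (δ b d)
            (φ (+ toℕ i - a) - φ (+ toℕ i - b)))
          (sym (cong₂ _-_ (φ-transpose ne c (+ toℕ i)) (φ-transpose ne d (+ toℕ i)))))
    }
    where
    normal : ∀ μ i → reflection α μ i ≡ μ i - (jump μ a - jump μ b) * α i
    normal μ i = cong (λ t → μ i - t * α i) (trans (form-congʳ μ e) (form-root μ a b))
    additive : ∀ x y p q r s t → x + y - (p + q - (r + s)) * t ≡ (x - (p - r) * t) + (y - (q - s) * t)
    additive = solve-∀
    homogeneous : ∀ k x p q t → k * x - (k * p - k * q) * t ≡ k * (x - (p - q) * t)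
    homogeneous = solve-∀
    regroup : ∀ x y p q r s t → x - y - (p - q - (r - s)) * t ≡ x - (p - r) * t - (y - (q - s) * t)
    regroup = solve-∀

  simple-root : (i : Fin n) → simple i ≗ root (+ toℕ i) (+ toℕ i + 1ℤ)
  simple-root i k = go (i Fin.≟ k)
    where
    e : φ (+ toℕ k - (+ toℕ i + 1ℤ)) ≡ φ (+ toℕ k - 1ℤ - + toℕ i)
    e = cong φ (reorder (+ toℕ k) (+ toℕ i))
      where
      reorder : ∀ x y → x - (y + 1ℤ) ≡ x - 1ℤ - y
      reorder = solve-∀
    go : Dec (i ≡ k) → simple i k ≡ φ (+ toℕ k - + toℕ i) - φ (+ toℕ k - (+ toℕ i + 1ℤ))
    go (yes refl) = trans (cong (λ t → if t then 1ℤ else 0ℤ) (dec-true (i Fin.≟ i) refl))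
      (linear-by (byEquations (1ℤ ∷ -1ℤ ∷ -1ℤ ∷ [])) (φ (+ toℕ i - (+ toℕ i + 1ℤ)) ∷ φ (+ toℕ i - 1ℤ - + toℕ i) ∷
          φ (+ toℕ i - + toℕ i) ∷ δ (+ toℕ i) (+ toℕ i) ∷ []) (λ x y z u → x :≡ y ⇒ z :≡ y :+ u ⇒ u :≡ con 1ℤ ⇒ ⊢
          con 1ℤ :≡ z :- x) e (φ-δ (+ toℕ k) (+ toℕ i)) (δ-yes {+ toℕ k} {+ toℕ i} refl))
    go (no ne) = trans (cong (λ t → if t then 1ℤ else 0ℤ) (dec-false (i Fin.≟ k) ne))
      (linear-by (byEquations (1ℤ ∷ -1ℤ ∷ -1ℤ ∷ [])) (φ (+ toℕ k - (+ toℕ i + 1ℤ)) ∷ φ (+ toℕ k - 1ℤ - + toℕ i) ∷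
          φ (+ toℕ k - + toℕ i) ∷ δ (+ toℕ k) (+ toℕ i) ∷ []) (λ x y z u → x :≡ y ⇒ z :≡ y :+ u ⇒ u :≡ con 0ℤ ⇒ ⊢
          con 0ℤ :≡ z :- x) e (φ-δ (+ toℕ k) (+ toℕ i)) (δ-no {+ toℕ k} {+ toℕ i}
          (λ f → ne (toℕ-injective (trans (sym (res-toℕ i)) (trans (sym f) (res-toℕ k)))))))

  sumQ : ∀ {m} → (Fin m → Q n) → Q n
  sumQ F j = sum (λ i → F i j)

  rep-sumQ : ∀ {f v m} → Rep f v → (F : Fin m → Q n) → f (sumQ F) ≗ sumQ (f ∘ F)
  rep-sumQ {f} {m = zero}  R F j = trans (f-cong R {sumQ F} {0ℤ *Q sumQ F} (λ _ → refl) j)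
      (trans (f-* R 0ℤ (sumQ F) j) (*-zeroˡ (f (sumQ F) j)))
  rep-sumQ {f} {m = suc m} R F j =
    trans (f-+ R (F Fin.zero) (sumQ (F ∘ Fin.suc)) j) (cong (λ t → f (F Fin.zero) j + t)
        (rep-sumQ R (F ∘ Fin.suc) j))

  simple-basis : (μ : Q n) → μ ≗ sumQ (λ i → μ i *Q simple i)
  simple-basis μ j = linear-by (byEquations (-1ℤ ∷ -1ℤ ∷ -1ℤ ∷ []))
      (sum (λ i → μ i * simple i j) ∷ sum {n} (λ _ → 0ℤ) ∷ μ j * simple j j ∷ μ j ∷ [])
      (λ x y z u → x :+ con 0ℤ :≡ y :+ z ⇒ z :≡ u ⇒ y :≡ con 0ℤ ⇒ ⊢ u :≡ x)
      (sum-update (λ i → μ i * simple i j) (λ _ → 0ℤ) j off) at-j (sum-zero n)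
    where
    at-j : μ j * simple j j ≡ μ j
    at-j = trans (cong (λ t → μ j * (if t then 1ℤ else 0ℤ)) (dec-true (j Fin.≟ j) refl)) (*-identityʳ (μ j))
    off : ∀ i → i ≢ j → μ i * simple i j ≡ 0ℤ
    off i ne = trans (cong (λ t → μ i * (if t then 1ℤ else 0ℤ)) (dec-false (i Fin.≟ j) ne)) (*-zeroʳ (μ i))

  -- Both operators are linear and agree on the simple roots.
  rep-determines : ∀ {f g u v} → Rep f u → Rep g v → u ≃ v → f ≐ g
  rep-determines {f} {g} {u} {v} R S e μ j =
    trans (expand R) (trans (sum-ext (λ i → cong (λ t → μ i * t) (on-simple i))) (sym (expand S)))
    where
    expand : ∀ {f v} → Rep f v → f μ j ≡ sum (λ i → μ i * f (simple i) j)
    expand R = trans (f-cong R (simple-basis μ) j) (trans (rep-sumQ R (λ i → μ i *Q simple i) j)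
      (sum-ext (λ i → f-* R (μ i) (simple i) j)))
    on-simple : ∀ i → f (simple i) j ≡ g (simple i) j
    on-simple i = trans (f-cong R (simple-root i) j) (trans (f-root R _ _ j)
      (trans (cong₂ (λ s t → root s t j) (e (+ toℕ i)) (e (+ toℕ i + 1ℤ)))
        (sym (trans (f-cong S (simple-root i) j) (f-root S _ _ j)))))

  hat-≗ : ∀ {μ ν : Q n} → μ ≗ ν → ∀ a → hat μ a ≡ hat ν a
  hat-≗ p a = p (cls a)

  -- The jump at `a` is 1 on the left, and on the right a jump equal to 1 occurs only in the class
  -- of `a′`.
  root-determines : ∀ {a b a′ b′} → res a ≢ res b → root a b ≗ root a′ b′ → res a ≡ res a′
  root-determines {a} {b} {a′} {b′} ne e = δ-one {a} {a′} (linear-by (byCombination (1ℤ ∷ 1ℤ ∷ -1ℤ ∷ []))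
      (δ a a ∷ δ a b ∷ δ a a′ ∷ δ a b′ ∷ []) (λ x y z u → x :- y :≡ z :- u ⇒ x :≡ con 1ℤ ⇒ y :≡ con 0ℤ ⇒ con 0ℤ
      :≤ u ⇒ ⊢ con 1ℤ :≤ z) jumps (δ-yes {a} {a} refl) (δ-no {a} {b} ne) (proj₁ (δ-range a b′)))
    where
    jumps : δ a a - δ a b ≡ δ a a′ - δ a b′
    jumps = trans (sym (jump-root a b a)) (trans (cong₂ _-_ (hat-≗ e a) (hat-≗ e (a - 1ℤ))) (jump-root a′ b′ a))

  -- On roots a permutation is visible only up to a common shift of all values by a multiple of `n`;
  -- balance of both permutations makes this shift zero.
  rep-faithful : ∀ {f g u v} → Rep f u → Rep g v → Balanced u → Balanced v → f ≐ g → u ≃ v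
  rep-faithful {f} {g} {u} {v} R S B C e a = linear (to u a ∷ to v a ∷ N· q a ∷ N· 0ℤ ∷ [])
      (λ x y z u → x :≡ y :+ z ⇒ z :≡ u ⇒ u :≡ con 0ℤ ⇒ ⊢ x :≡ y) (shifted a) (cong N·_ (same-q a)) N·-0′
    where
    roots : ∀ a b → root (to u a) (to u b) ≗ root (to v a) (to v b)
    roots a b i = trans (sym (f-root R a b i)) (trans (e (root a b) i) (f-root S a b i))
    congruent : ∀ a → res (to u a) ≡ res (to v a)
    congruent a = root-determines {to u a} {to u (a + 1ℤ)} {to v a} {to v (a + 1ℤ)}
        (λ f → res-suc≢ a (to-res⁻¹ u f)) (roots a (a + 1ℤ))
    q : ℤ → ℤ
    q a = φ (to u a) - φ (to v a)
    shifted : ∀ a → to u a ≡ to v a + N· q a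
    shifted a = res-≡ {to u a} {to v a} (congruent a)
    φ-shifted : ∀ x a → φ (x - to u a) ≡ φ (x - to v a) - q a
    φ-shifted x a = trans (cong φ {x - to u a} {x - to v a + N· (- q a)}
        (linear-by (byEquations (-1ℤ ∷ -1ℤ ∷ [])) (to u a ∷ to v a ∷ N· q a ∷ N· (- q a) ∷ x ∷ [])
        (λ x y z u v → x :≡ y :+ z ⇒ u :≡ opp z ⇒ ⊢ v :- x :≡ v :- y :+ u) (shifted a) (N·-neg (q a))))
        (φ-shift (x - to v a) (- q a))
    constant : ∀ a b → q a ≡ q b
    constant a b = linear-by (byEquations (-1ℤ ∷ 1ℤ ∷ -1ℤ ∷ []))
        (φ (0ℤ - to u a) ∷ φ (0ℤ - to u b) ∷ φ (0ℤ - to v a) ∷ φ (0ℤ - to v b) ∷ q a ∷ q b ∷ [])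
        (λ x y z u v w → x :- y :≡ z :- u ⇒ x :≡ z :- v ⇒ y :≡ u :- w ⇒ ⊢ v :≡ w) h (φ-shifted 0ℤ a)
        (φ-shifted 0ℤ b)
      where
      h : φ (0ℤ - to u a) - φ (0ℤ - to u b) ≡ φ (0ℤ - to v a) - φ (0ℤ - to v b)
      h = trans (sym (hat-root (to u a) (to u b) 0ℤ)) (trans (hat-≗ (roots a b) 0ℤ)
          (hat-root (to v a) (to v b) 0ℤ))
    total : defect u 0ℤ 0ℤ ≡ defect v 0ℤ 0ℤ + ΣR (λ _ → q 0ℤ)
    total = trans (ΣR-cong {G = λ a → φ (0ℤ - a) - φ (0ℤ - to v a) + q 0ℤ}
        (λ a → linear-by (byEquations (-1ℤ ∷ 1ℤ ∷ [])) (φ (0ℤ - to u a) ∷ φ (0ℤ - to v a) ∷ q a ∷ q 0ℤ ∷ φ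
        (0ℤ - a) ∷ []) (λ x y z u v → x :≡ y :- z ⇒ z :≡ u ⇒ ⊢ v :- x :≡ v :- y :+ u) (φ-shifted 0ℤ a)
        (constant a 0ℤ))) (ΣR-+ (λ a → φ (0ℤ - a) - φ (0ℤ - to v a)) (λ _ → q 0ℤ))
    sum0 : ΣR (λ _ → q 0ℤ) ≡ 0ℤ
    sum0 = linear-by (byEquations (-1ℤ ∷ 1ℤ ∷ -1ℤ ∷ [])) (defect u 0ℤ 0ℤ ∷ defect v 0ℤ 0ℤ ∷ ΣR (λ z → q 0ℤ) ∷ [])
        (λ x y z → x :≡ y :+ z ⇒ x :≡ con 0ℤ :- con 0ℤ ⇒ y :≡ con 0ℤ :- con 0ℤ ⇒ ⊢ z :≡ con 0ℤ) total
        (balance B 0ℤ 0ℤ) (balance C 0ℤ 0ℤ)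
    const0 : ∀ x → ΣR (λ _ → x) ≡ 0ℤ → x ≡ 0ℤ
    const0 x s = go (<-cmp x 0ℤ)
      where
      go : _ → x ≡ 0ℤ
      go (tri≈ _ p _) = p
      go (tri> _ _ p) = ⊥-elim (1≰0 (linear (x ∷ ΣR (λ z → x) ∷ [])
          (λ x y → x :≤ y ⇒ y :≡ con 0ℤ ⇒ con 0ℤ :< x ⇒ ⊢ con 1ℤ :≤ con 0ℤ)
          (ΣR-member {λ _ → x} (λ _ → refl) (λ _ → <⇒≤ p) 0ℤ) s p))
      go (tri< p _ _) = ⊥-elim (1≰0 (linear-by (byCombination (1ℤ ∷ 1ℤ ∷ 1ℤ ∷ 1ℤ ∷ -1ℤ ∷ []))
          (x ∷ ΣR (λ z → 0ℤ - x) ∷ ΣR (λ z → 0ℤ) ∷ ΣR (λ z → x) ∷ [])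
          (λ x y z u → con 0ℤ :- x :≤ y ⇒ y :≡ z :- u ⇒ z :≡ con 0ℤ ⇒ u :≡ con 0ℤ ⇒ x :< con 0ℤ ⇒ ⊢ con 1ℤ :≤ con
          0ℤ) (ΣR-member {λ _ → 0ℤ - x} (λ _ → refl) (λ _ → linear (x ∷ [])
          (λ x → x :< con 0ℤ ⇒ ⊢ con 0ℤ :≤ con 0ℤ :- x) p) 0ℤ) (ΣR-- (λ _ → 0ℤ) (λ _ → x)) ΣR-0 s p))
    same-q : ∀ a → q a ≡ 0ℤ
    same-q a = trans (constant a 0ℤ) (const0 (q 0ℤ) sum0)
    N·-0′ : N· 0ℤ ≡ 0ℤ
    N·-0′ = N·-0

  -- Words

  simpleₚ : Fin n → Perm
  simpleₚ i = transposition (+ toℕ i) (+ toℕ i + 1ℤ) (res-suc≢ (+ toℕ i))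

  perm : W n → Perm
  perm []      = 1ₚ
  perm (i ∷ w) = simpleₚ i · perm w

  rep-word : ∀ w → Rep ⟦ w ⟧ (perm w)
  rep-word []      = rep-id
  rep-word (i ∷ w) = rep-∘ (rep-reflection (res-suc≢ (+ toℕ i)) (simple-root i)) (rep-word w)

  balanced-word : ∀ w → Balanced (perm w)
  balanced-word []      = balanced-1
  balanced-word (i ∷ w) = balanced-· (balanced-transposition _ _ (res-suc≢ (+ toℕ i))) (balanced-word w)

  ≈⇒≃ : ∀ {u v : W n} → u ≈ v → perm u ≃ perm v
  ≈⇒≃ {u} {v} = rep-faithful (rep-word u) (rep-word v) (balanced-word u) (balanced-word v)

  ≃⇒≈ : ∀ {u v : W n} → perm u ≃ perm v → u ≈ v
  ≃⇒≈ {u} {v} = rep-determines (rep-word u) (rep-word v)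

  -- Positive real roots

  φ-minus : ∀ {a} → - N ≤ a → a < 0ℤ → φ a ≡ -1ℤ
  φ-minus {a} p q = φ-shift-unique -1ℤ (linear (N· -1ℤ ∷ N ∷ a ∷ [])
      (λ x y z → x :≡ opp y ⇒ opp y :≤ z ⇒ ⊢ x :≤ z) N·-−1 p) (linear-by (byCombination (1ℤ ∷ -1ℤ ∷ []))
      (N· -1ℤ ∷ N ∷ a ∷ []) (λ x y z → x :≡ opp y ⇒ z :< con 0ℤ ⇒ ⊢ z :< x :+ y) N·-−1 q)

  interval-root : (i j : Fin n) → i Fin.≤ j → interval i j ≗ root (+ toℕ i) (+ toℕ j + 1ℤ)
  interval-root i j i≤j k = go (i Fin.≤? k) (k Fin.≤? j)
    where
    k≥0 : 0ℤ ≤ + toℕ k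
    k≥0 = +≤+ z≤n
    small : ∀ (l : Fin n) → + toℕ l < N
    small l = subst (+ toℕ l <_) (sym N≡n) (+<+ (toℕ<n l))
    goal : Set
    goal = interval i j k ≡ φ (+ toℕ k - + toℕ i) - φ (+ toℕ k - (+ toℕ j + 1ℤ))
    value : ∀ b b′ → does (i Fin.≤? k) ≡ b → does (k Fin.≤? j) ≡ b′ → interval i j k ≡ (if b ∧ b′ then 1ℤ else 0ℤ)
    value b b′ e f = cong₂ (λ s t → if s ∧ t then 1ℤ else 0ℤ) e f
    open import Data.Bool using (true; false)
    go : Dec (i Fin.≤ k) → Dec (k Fin.≤ j) → goal
    go (yes p) (yes q) = trans (value true true (dec-true (i Fin.≤? k) p) (dec-true (k Fin.≤? j) q))
      (linear-by (byEquations (-1ℤ ∷ 1ℤ ∷ [])) (φ (+ toℕ k - + toℕ i) ∷ φ (+ toℕ k - (+ toℕ j + 1ℤ)) ∷ [])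
          (λ x y → x :≡ con 0ℤ ⇒ y :≡ con -1ℤ ⇒ ⊢ con 1ℤ :≡ x :- y)
          (φ-small {+ toℕ k - + toℕ i} (linear (+ toℕ i ∷ + toℕ k ∷ []) (λ x y → x :≤ y ⇒ ⊢ con 0ℤ :≤ y :- x)
          (+≤+ p)) (linear (+ toℕ k ∷ N ∷ + toℕ i ∷ []) (λ x y z → x :< y ⇒ con 0ℤ :≤ z ⇒ ⊢ x :- z :< y)
          (small k) (+≤+ (z≤n {toℕ i})))) (φ-minus {+ toℕ k - (+ toℕ j + 1ℤ)}
          (linear (+ toℕ k ∷ + toℕ j ∷ N ∷ []) (λ x y z → con 0ℤ :≤ x ⇒ y :< z ⇒ ⊢ opp z :≤ x :- (y :+ con 1ℤ))
          k≥0 (small j)) (linear (+ toℕ k ∷ + toℕ j ∷ []) (λ x y → x :≤ y ⇒ ⊢ x :- (y :+ con 1ℤ) :< con 0ℤ)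
          (+≤+ q))))
    go (yes p) (no q) = trans (value true false (dec-true (i Fin.≤? k) p) (dec-false (k Fin.≤? j) q))
      (linear-by (byEquations (-1ℤ ∷ 1ℤ ∷ [])) (φ (+ toℕ k - + toℕ i) ∷ φ (+ toℕ k - (+ toℕ j + 1ℤ)) ∷ [])
          (λ x y → x :≡ con 0ℤ ⇒ y :≡ con 0ℤ ⇒ ⊢ con 0ℤ :≡ x :- y)
          (φ-small {+ toℕ k - + toℕ i} (linear (+ toℕ i ∷ + toℕ k ∷ []) (λ x y → x :≤ y ⇒ ⊢ con 0ℤ :≤ y :- x)
          (+≤+ p)) (linear (+ toℕ k ∷ N ∷ + toℕ i ∷ []) (λ x y z → x :< y ⇒ con 0ℤ :≤ z ⇒ ⊢ x :- z :< y)
          (small k) (+≤+ (z≤n {toℕ i})))) (φ-small {+ toℕ k - (+ toℕ j + 1ℤ)}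
          (linear (+ toℕ j ∷ + toℕ k ∷ []) (λ x y → x :< y ⇒ ⊢ con 0ℤ :≤ y :- (x :+ con 1ℤ)) (+<+ (ℕP.≰⇒> q)))
          (linear (+ toℕ k ∷ N ∷ + toℕ j ∷ []) (λ x y z → x :< y ⇒ con 0ℤ :≤ z ⇒ ⊢ x :- (z :+ con 1ℤ) :< y)
          (small k) (+≤+ (z≤n {toℕ j})))))
    go (no p) r = trans (trans (value false (does r′) (dec-false (i Fin.≤? k) p) refl) refl)
      (linear-by (byEquations (-1ℤ ∷ 1ℤ ∷ [])) (φ (+ toℕ k - + toℕ i) ∷ φ (+ toℕ k - (+ toℕ j + 1ℤ)) ∷ [])
          (λ x y → x :≡ con -1ℤ ⇒ y :≡ con -1ℤ ⇒ ⊢ con 0ℤ :≡ x :- y)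
          (φ-minus {+ toℕ k - + toℕ i} (linear (+ toℕ k ∷ + toℕ i ∷ N ∷ [])
          (λ x y z → con 0ℤ :≤ x ⇒ y :< z ⇒ ⊢ opp z :≤ x :- y) k≥0 (small i))
          (linear (+ toℕ k ∷ + toℕ i ∷ []) (λ x y → x :< y ⇒ ⊢ x :- y :< con 0ℤ) (+<+ (ℕP.≰⇒> p))))
          (φ-minus {+ toℕ k - (+ toℕ j + 1ℤ)} (linear (+ toℕ k ∷ + toℕ j ∷ N ∷ [])
          (λ x y z → con 0ℤ :≤ x ⇒ y :< z ⇒ ⊢ opp z :≤ x :- (y :+ con 1ℤ)) k≥0 (small j))
          (linear (+ toℕ k ∷ + toℕ i ∷ + toℕ j ∷ []) (λ x y z → x :< y ⇒ y :≤ z ⇒ ⊢ x :- (z :+ con 1ℤ) :< con 0ℤ)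
          (+<+ (ℕP.≰⇒> p)) (+≤+ i≤j))))
      where
      r′ : Dec (k Fin.≤ j)
      r′ = k Fin.≤? j

  φ--N· : ∀ x a m → φ (x - (a + N· m)) ≡ φ (x - a) - m
  φ--N· x a m = trans (cong φ {x - (a + N· m)} {x - a + N· (- m)}
      (linear-by (byEquations (-1ℤ ∷ [])) (N· (- m) ∷ N· m ∷ x ∷ a ∷ [])
      (λ x y z u → x :≡ opp y ⇒ ⊢ z :- (u :+ y) :≡ z :- u :+ x) (N·-neg m))) (φ-shift (x - a) (- m))

  root-+c : ∀ a b m → root a (b + N· m) ≗ root a b +Q m *Q c
  root-+c a b m k = unfolded (+ toℕ k)
    where
    unfolded : ∀ x → φ (x - a) - φ (x - (b + N· m)) ≡ φ (x - a) - φ (x - b) + m * 1ℤ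
    unfolded x = linear-by (byEquations (-1ℤ ∷ -1ℤ ∷ [])) (φ (x - (b + N· m)) ∷ φ (x - b) ∷ m ∷ m * 1ℤ ∷ φ
        (x - a) ∷ []) (λ x y z u v → x :≡ y :- z ⇒ u :≡ z ⇒ ⊢ v :- x :≡ v :- y :+ u) (φ--N· x b m) (*-identityʳ m)

  root-shift : ∀ a b m → root (a + N· m) (b + N· m) ≗ root a b
  root-shift a b m k = unfolded (+ toℕ k)
    where
    unfolded : ∀ x → φ (x - (a + N· m)) - φ (x - (b + N· m)) ≡ φ (x - a) - φ (x - b)
    unfolded x = linear-by (byEquations (1ℤ ∷ -1ℤ ∷ [])) (φ (x - (a + N· m)) ∷ φ (x - a) ∷ m ∷ φ (x - (b + N· m))
        ∷ φ (x - b) ∷ []) (λ x y z u v → x :≡ y :- z ⇒ u :≡ v :- z ⇒ ⊢ x :- u :≡ y :- v) (φ--N· x a m)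
        (φ--N· x b m)

  IsRoot : Q n → Set
  IsRoot β = ∃[ a ] ∃[ b ] a < b × res a ≢ res b × β ≗ root a b

  -- Adding `m c` to `e_i − e_{j+1}` moves the right end by `m n`. For a negative finite root the
  -- two ends are exchanged, and `m > 0` puts them back in order.
  positive⇒root : ∀ {β : Q n} → PositiveReal β → IsRoot β
  positive⇒root {β} (α , m , e , s) = go s
    where
    small : ∀ (l : Fin n) → + toℕ l < N
    small l = subst (+ toℕ l <_) (sym N≡n) (+<+ (toℕ<n l))
    nonneg : 0ℤ ≤ m → FinitePositive α → IsRoot β
    nonneg m≥0 (i , j , 1≤i , i≤j , f) =
      + toℕ i , + toℕ j + 1ℤ + N· m , linear-by (byCombination (1ℤ ∷ 1ℤ ∷ 1ℤ ∷ -1ℤ ∷ []))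
          (+ toℕ i ∷ + toℕ j ∷ N· 0ℤ ∷ N· m ∷ []) (λ x y z u → x :≤ y ⇒ z :≤ u ⇒ z :≡ con 0ℤ ⇒ ⊢ x :< y :+ con 1ℤ
          :+ u) (+≤+ i≤j) (N·-mono m≥0) N·-0 ,
      (λ r → res≢-offset {+ toℕ i} {+ toℕ j + 1ℤ} (linear (+ toℕ i ∷ + toℕ j ∷ [])
          (λ x y → x :≤ y ⇒ ⊢ con 0ℤ :< y :+ con 1ℤ :- x) (+≤+ i≤j))
          (linear (+ toℕ j ∷ N ∷ + toℕ i ∷ []) (λ x y z → x :< y ⇒ con 1ℤ :≤ z ⇒ ⊢ x :+ con 1ℤ :- z :< y)
          (small j) (+≤+ 1≤i)) (trans r (res-shift _ m))) ,
      λ k → trans (e k) (trans (cong (λ t → t + m * 1ℤ) (trans (f k) (interval-root i j i≤j k)))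
          (sym (root-+c (+ toℕ i) (+ toℕ j + 1ℤ) m k)))
    negat : 0ℤ < m → FinitePositive (0Q -Q α) → IsRoot β
    negat m>0 (i , j , 1≤i , i≤j , f) =
      + toℕ j + 1ℤ , + toℕ i + N· m , linear-by (byCombination (1ℤ ∷ 1ℤ ∷ 1ℤ ∷ 1ℤ ∷ -1ℤ ∷ []))
          (+ toℕ j ∷ N ∷ + toℕ i ∷ N· 0ℤ ∷ N· m ∷ []) (λ x y z u v → x :< y ⇒ con 1ℤ :≤ z ⇒ u :+ y :≤ v ⇒ u :≡
          con 0ℤ ⇒ ⊢ x :+ con 1ℤ :< z :+ v) (small j) (+≤+ 1≤i) (N·-< m>0) N·-0 ,
      (λ r → res≢-offset {+ toℕ i} {+ toℕ j + 1ℤ} (linear (+ toℕ i ∷ + toℕ j ∷ [])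
          (λ x y → x :≤ y ⇒ ⊢ con 0ℤ :< y :+ con 1ℤ :- x) (+≤+ i≤j))
          (linear (+ toℕ j ∷ N ∷ + toℕ i ∷ []) (λ x y z → x :< y ⇒ con 1ℤ :≤ z ⇒ ⊢ x :+ con 1ℤ :- z :< y)
          (small j) (+≤+ 1≤i)) (trans (sym (res-shift _ m)) (sym r))) ,
      λ k → trans (e k) (trans (cong (λ t → t + m * 1ℤ) (flip (α k) (φ (+ toℕ k - + toℕ i))
          (φ (+ toℕ k - (+ toℕ j + 1ℤ))) (trans (f k) (interval-root i j i≤j k))))
          (sym (root-+c (+ toℕ j + 1ℤ) (+ toℕ i) m k)))
      where
      flip : ∀ x y z → 0ℤ - x ≡ y - z → x ≡ z - y
      flip x y z e = linear-by (byEquations (-1ℤ ∷ [])) (x ∷ y ∷ z ∷ [])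
          (λ x y z → con 0ℤ :- x :≡ y :- z ⇒ ⊢ x :≡ z :- y) e
    go : _ → IsRoot β
    go (inj₁ (m>0 , inj₁ P)) = nonneg (<⇒≤ m>0) P
    go (inj₁ (m>0 , inj₂ P)) = negat m>0 P
    go (inj₂ (refl , P))     = nonneg ≤-refl P

  root⇒positive : ∀ {β : Q n} {a b} → a < b → res a ≢ res b → β ≗ root a b → PositiveReal β
  root⇒positive {β} {a} {b} a<b ne e = go (<-cmp a₁ b₁)
    where
    -- Representatives are taken in `1, …, n` instead of `0, …, n − 1`, since the finite positive
    -- roots are the `e_x − e_y` with `1 ≤ x < y ≤ n`.
    a₁ b₁ m : ℤ
    a₁ = + suc (res (a - 1ℤ))
    b₁ = + suc (res (b - 1ℤ))
    m = φ (b - 1ℤ) - φ (a - 1ℤ)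
    a₁≡ : a₁ ≡ 1ℤ + + res (a - 1ℤ)
    a₁≡ = refl
    b₁≡ : b₁ ≡ 1ℤ + + res (b - 1ℤ)
    b₁≡ = refl
    m≡ : m ≡ φ (b - 1ℤ) - φ (a - 1ℤ)
    m≡ = refl
    ea : a ≡ 1ℤ + + res (a - 1ℤ) + N· φ (a - 1ℤ)
    ea = linear (a ∷ + res (a - 1ℤ) ∷ N· φ (a - 1ℤ) ∷ []) (λ x y z → x :- con 1ℤ :≡ y :+ z ⇒ ⊢ x :≡ con 1ℤ :+ y
        :+ z) (division (a - 1ℤ))
    eb : b ≡ 1ℤ + + res (b - 1ℤ) + N· φ (a - 1ℤ) + N· m
    eb = linear-by (byEquations (1ℤ ∷ -1ℤ ∷ [])) (b ∷ + res (b - 1ℤ) ∷ N· φ (b - 1ℤ) ∷ N· m ∷ N· φ (a - 1ℤ) ∷ [])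
        (λ x y z u v → x :- con 1ℤ :≡ y :+ z ⇒ u :≡ z :- v ⇒ ⊢ x :≡ con 1ℤ :+ y :+ v :+ u) (division (b - 1ℤ)) nm
      where
      nm : N· m ≡ N· φ (b - 1ℤ) - N· φ (a - 1ℤ)
      nm = N·-- (φ (b - 1ℤ)) (φ (a - 1ℤ))
    shape : β ≗ root a₁ b₁ +Q m *Q c
    shape k = trans (e k) (trans (cong₂ (λ s t → root s t k) ea (trans eb
        (assoc (1ℤ + + res (b - 1ℤ)) (N· φ (a - 1ℤ)) (N· m))))
      (trans (root-shift a₁ (b₁ + N· m) (φ (a - 1ℤ)) k) (root-+c a₁ b₁ m k)))
      where
      assoc : ∀ x y z → x + y + z ≡ x + z + y
      assoc x y z = linear (x ∷ y ∷ z ∷ []) (λ x y z → ⊢ x :+ y :+ z :≡ x :+ z :+ y)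
    m≥0 : 0ℤ ≤ m
    m≥0 = linear-by (byCombination (1ℤ ∷ -1ℤ ∷ [])) (m ∷ φ (b - 1ℤ) ∷ φ (a - 1ℤ) ∷ [])
        (λ x y z → x :≡ y :- z ⇒ z :≤ y ⇒ ⊢ con 0ℤ :≤ x) m≡ (φ-mono {a - 1ℤ} {b - 1ℤ}
        (linear (a ∷ b ∷ []) (λ x y → x :< y ⇒ ⊢ x :- con 1ℤ :≤ y :- con 1ℤ) a<b))
    finite : ∀ x y → suc (res x) ℕ.< suc (res y) → FinitePositive (root (+ suc (res x)) (+ suc (res y)))
    finite x y (s≤s p) = i , cls y , subst (1 ℕ.≤_) (sym ti) (s≤s z≤n) , i≤j ,
      λ k → sym (trans (interval-root i (cls y) i≤j k) (cong₂ (λ s t → root s t k) (cong +_ ti)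
          (trans (cong (λ t → + t + 1ℤ) (toℕ-cls y)) (+-comm (+ res y) 1ℤ))))
      where
      i : Fin n
      i = fromℕ< (ℕP.≤-<-trans p (res<n y))
      ti : toℕ i ≡ suc (res x)
      ti = toℕ-fromℕ< _
      i≤j : i Fin.≤ cls y
      i≤j = subst₂ ℕ._≤_ (sym ti) (sym (toℕ-cls y)) p
    go : _ → PositiveReal β
    go (tri< (+<+ p) _ _) = root a₁ b₁ , m , shape , sgn (<-cmp 0ℤ m)
      where
      sgn : _ → _
      sgn (tri< q _ _) = inj₁ (q , inj₁ (finite (a - 1ℤ) (b - 1ℤ) p))
      sgn (tri≈ _ q _) = inj₂ (sym q , finite (a - 1ℤ) (b - 1ℤ) p)
      sgn (tri> _ _ q) = ⊥-elim (1≰0 (linear (m ∷ []) (λ x → x :< con 0ℤ ⇒ con 0ℤ :≤ x ⇒ ⊢ con 1ℤ :≤ con 0ℤ) q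
          m≥0))
    go (tri≈ _ p _) = ⊥-elim (ne (trans (cong res {a} {b + N· (- m)}
        (linear-by (byEquations (1ℤ ∷ -1ℤ ∷ 1ℤ ∷ -1ℤ ∷ [])) (a ∷ + res (a - 1ℤ) ∷ N· φ (a - 1ℤ) ∷ b ∷ + res
        (b - 1ℤ) ∷ N· m ∷ N· (- m) ∷ []) (λ x y z u v w p → x :≡ con 1ℤ :+ y :+ z ⇒ u :≡ con 1ℤ :+ v :+ z :+ w ⇒
        y :≡ v ⇒ p :≡ opp w ⇒ ⊢ x :≡ u :+ p) ea eb p′ (N·-neg m))) (res-shift b (- m))))
      where
      p′ : + res (a - 1ℤ) ≡ + res (b - 1ℤ)
      p′ = linear-by (byEquations (1ℤ ∷ -1ℤ ∷ 1ℤ ∷ [])) (a₁ ∷ b₁ ∷ + res (a - 1ℤ) ∷ + res (b - 1ℤ) ∷ [])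
          (λ x y z u → x :≡ y ⇒ x :≡ con 1ℤ :+ z ⇒ y :≡ con 1ℤ :+ u ⇒ ⊢ z :≡ u) p a₁≡ b₁≡
    go (tri> _ _ p@(+<+ p₁)) = root a₁ b₁ , m , shape , inj₁ (m>0 (<-cmp 0ℤ m) , inj₂
        (negated (finite (b - 1ℤ) (a - 1ℤ) p₁)))
      where
      m>0 : _ → 0ℤ < m
      m>0 (tri< q _ _) = q
      m>0 (tri≈ _ q _) = ⊥-elim (1≰0 (linear-by (byCombination (1ℤ ∷ -1ℤ ∷ 1ℤ ∷ -1ℤ ∷ []))
          (a ∷ + res (a - 1ℤ) ∷ N· φ (a - 1ℤ) ∷ b ∷ + res (b - 1ℤ) ∷ N· m ∷ N· 0ℤ ∷ [])
          (λ x y z u v w p → x :≡ con 1ℤ :+ y :+ z ⇒ u :≡ con 1ℤ :+ v :+ z :+ w ⇒ p :≡ w ⇒ p :≡ con 0ℤ ⇒ x :< u ⇒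
          con 1ℤ :+ v :< con 1ℤ :+ y ⇒ ⊢ con 1ℤ :≤ con 0ℤ) ea eb (cong N·_ q) N·-0 a<b p))
      m>0 (tri> _ _ q) = ⊥-elim (1≰0 (linear (m ∷ []) (λ x → x :< con 0ℤ ⇒ con 0ℤ :≤ x ⇒ ⊢ con 1ℤ :≤ con 0ℤ) q
          m≥0))
      negated : FinitePositive (root b₁ a₁) → FinitePositive (0Q -Q root a₁ b₁)
      negated (i , j , p , q , f) = i , j , p , q , λ k → trans (flip (φ (+ toℕ k - a₁)) (φ (+ toℕ k - b₁))) (f k)
        where
        flip : ∀ x y → 0ℤ - (x - y) ≡ y - x
        flip x y = linear (x ∷ y ∷ []) (λ x y → ⊢ con 0ℤ :- (x :- y) :≡ y :- x)

  -- Length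

  pt : Fin n → ℤ
  pt i = + toℕ i

  act : W n → ℤ → ℤ
  act w = to (perm w)

  pos : W n → ℤ → ℤ
  pos w = from (perm w)

  transpose-swap : ∀ {a b} → res a ≢ res b → ∀ c → transpose a b c ≡ transpose b a c
  transpose-swap {a} {b} ne c = go (classify a b c)
    where
    go : Class a b c → transpose a b c ≡ transpose b a c
    go (is-a e)    = linear-by (byEquations (1ℤ ∷ -1ℤ ∷ [])) (transpose a b c ∷ c ∷ b ∷ a ∷ transpose b a c ∷ [])
        (λ x y z u v → x :≡ y :+ (z :- u) ⇒ v :≡ y :- (u :- z) ⇒ ⊢ x :≡ v) (transpose-a a b e)
        (transpose-b b a (ne ∘ sym) e)
    go (is-b _ e)  = linear-by (byEquations (1ℤ ∷ -1ℤ ∷ [])) (transpose a b c ∷ c ∷ b ∷ a ∷ transpose b a c ∷ [])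
        (λ x y z u v → x :≡ y :- (z :- u) ⇒ v :≡ y :+ (u :- z) ⇒ ⊢ x :≡ v) (transpose-b a b ne e)
        (transpose-a b a e)
    go (other p q) = trans (transpose-o a b p q) (sym (transpose-o b a q p))

  simple-range : ∀ i c → (to (simpleₚ i) c ≡ c + 1ℤ × res c ≡ res (pt i)) ⊎
                         (to (simpleₚ i) c ≡ c - 1ℤ) ⊎ (to (simpleₚ i) c ≡ c)
  simple-range i c = go (classify (pt i) (pt i + 1ℤ) c)
    where
    a b : ℤ
    a = pt i
    b = pt i + 1ℤ
    d : b - a ≡ 1ℤ
    d = unfolded (pt i)
      where
      unfolded : ∀ x → x + 1ℤ - x ≡ 1ℤ
      unfolded x = linear (x ∷ []) (λ x → ⊢ x :+ con 1ℤ :- x :≡ con 1ℤ)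
    go : Class (pt i) (pt i + 1ℤ) c → _
    go (is-a e)    = inj₁ (trans (transpose-a a b e) (cong (λ t → c + t) d) , e)
    go (is-b _ e)  = inj₂ (inj₁ (trans (transpose-b a b (res-suc≢ a) e) (cong (λ t → c - t) d)))
    go (other p q) = inj₂ (inj₂ (transpose-o a b p q))

  -- A simple reflection moves every point by at most one, so it can reverse only neighbours.
  simple-reverses : ∀ i {p q} → p < q → to (simpleₚ i) q < to (simpleₚ i) p → res p ≡ res (pt i) × q ≡ p + 1ℤ
  simple-reverses i {p} {q} l l′ = go (simple-range i p) (simple-range i q)
    where
    go : _ → _ → res p ≡ res (pt i) × q ≡ p + 1ℤ
    go (inj₁ (e , r))  (inj₂ (inj₁ f)) = r , linear-by (byBoth (1ℤ ∷ 0ℤ ∷ 1ℤ ∷ 1ℤ ∷ -1ℤ ∷ [])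
        (1ℤ ∷ 1ℤ ∷ 0ℤ ∷ 0ℤ ∷ 0ℤ ∷ [])) (p ∷ q ∷ to (simpleₚ i) q ∷ to (simpleₚ i) p ∷ [])
        (λ x y z u → x :< y ⇒ z :< u ⇒ u :≡ x :+ con 1ℤ ⇒ z :≡ y :- con 1ℤ ⇒ ⊢ y :≡ x :+ con 1ℤ) l l′ e f
    go (inj₁ (e , r))  (inj₁ (f , _))  = ⊥-elim (1≰0
        (linear-by (byCombination (1ℤ ∷ 1ℤ ∷ 1ℤ ∷ 1ℤ ∷ -1ℤ ∷ []))
        (p ∷ q ∷ to (simpleₚ i) q ∷ to (simpleₚ i) p ∷ []) (λ x y z u → x :< y ⇒ z :< u ⇒ u :≡ x :+ con 1ℤ ⇒ z :≡
        y :+ con 1ℤ ⇒ ⊢ con 1ℤ :≤ con 0ℤ) l l′ e f))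
    go (inj₁ (e , r))  (inj₂ (inj₂ f)) = ⊥-elim (1≰0
        (linear-by (byCombination (1ℤ ∷ 1ℤ ∷ 1ℤ ∷ 1ℤ ∷ -1ℤ ∷ []))
        (p ∷ q ∷ to (simpleₚ i) q ∷ to (simpleₚ i) p ∷ []) (λ x y z u → x :< y ⇒ z :< u ⇒ u :≡ x :+ con 1ℤ ⇒ z :≡
        y ⇒ ⊢ con 1ℤ :≤ con 0ℤ) l l′ e f))
    go (inj₂ (inj₁ e)) (inj₁ (f , _))  = ⊥-elim (1≰0
        (linear-by (byCombination (1ℤ ∷ 1ℤ ∷ 1ℤ ∷ 1ℤ ∷ -1ℤ ∷ []))
        (p ∷ q ∷ to (simpleₚ i) q ∷ to (simpleₚ i) p ∷ []) (λ x y z u → x :< y ⇒ z :< u ⇒ u :≡ x :- con 1ℤ ⇒ z :≡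
        y :+ con 1ℤ ⇒ ⊢ con 1ℤ :≤ con 0ℤ) l l′ e f))
    go (inj₂ (inj₁ e)) (inj₂ (inj₁ f)) = ⊥-elim (1≰0
        (linear-by (byCombination (1ℤ ∷ 1ℤ ∷ 1ℤ ∷ 1ℤ ∷ -1ℤ ∷ []))
        (p ∷ q ∷ to (simpleₚ i) q ∷ to (simpleₚ i) p ∷ []) (λ x y z u → x :< y ⇒ z :< u ⇒ u :≡ x :- con 1ℤ ⇒ z :≡
        y :- con 1ℤ ⇒ ⊢ con 1ℤ :≤ con 0ℤ) l l′ e f))
    go (inj₂ (inj₁ e)) (inj₂ (inj₂ f)) = ⊥-elim (1≰0
        (linear-by (byCombination (1ℤ ∷ 1ℤ ∷ 1ℤ ∷ 1ℤ ∷ -1ℤ ∷ []))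
        (p ∷ q ∷ to (simpleₚ i) q ∷ to (simpleₚ i) p ∷ []) (λ x y z u → x :< y ⇒ z :< u ⇒ u :≡ x :- con 1ℤ ⇒ z :≡
        y ⇒ ⊢ con 1ℤ :≤ con 0ℤ) l l′ e f))
    go (inj₂ (inj₂ e)) (inj₁ (f , _))  = ⊥-elim (1≰0
        (linear-by (byCombination (1ℤ ∷ 1ℤ ∷ 1ℤ ∷ 1ℤ ∷ -1ℤ ∷ []))
        (p ∷ q ∷ to (simpleₚ i) q ∷ to (simpleₚ i) p ∷ []) (λ x y z u → x :< y ⇒ z :< u ⇒ u :≡ x ⇒ z :≡ y :+ con
        1ℤ ⇒ ⊢ con 1ℤ :≤ con 0ℤ) l l′ e f))
    go (inj₂ (inj₂ e)) (inj₂ (inj₁ f)) = ⊥-elim (same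
        (linear-by (byBoth (1ℤ ∷ 0ℤ ∷ 1ℤ ∷ 1ℤ ∷ -1ℤ ∷ []) (1ℤ ∷ 1ℤ ∷ 0ℤ ∷ 0ℤ ∷ 0ℤ ∷ []))
        (p ∷ q ∷ to (simpleₚ i) q ∷ to (simpleₚ i) p ∷ []) (λ x y z u → x :< y ⇒ z :< u ⇒ u :≡ x ⇒ z :≡ y :- con
        1ℤ ⇒ ⊢ y :≡ x :+ con 1ℤ) l l′ e f))
      where
      same : ¬ q ≡ p + 1ℤ
      same g = <-irrefl (cong (to (simpleₚ i)) {q} {p} (linear-by
          (byBoth (0ℤ ∷ 1ℤ ∷ -1ℤ ∷ 1ℤ ∷ -1ℤ ∷ []) (1ℤ ∷ 0ℤ ∷ 0ℤ ∷ 0ℤ ∷ -1ℤ ∷ []))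
          (to (simpleₚ i) p ∷ p ∷ to (simpleₚ i) q ∷ q ∷ []) (λ x y z u → x :≡ y ⇒ z :≡ u :- con 1ℤ ⇒ z :< x ⇒ u
          :≡ y :+ con 1ℤ ⇒ ⊢ u :≡ y) e f l′ g)) l′
    go (inj₂ (inj₂ e)) (inj₂ (inj₂ f)) = ⊥-elim (1≰0
        (linear-by (byCombination (1ℤ ∷ 1ℤ ∷ 1ℤ ∷ 1ℤ ∷ -1ℤ ∷ []))
        (p ∷ q ∷ to (simpleₚ i) q ∷ to (simpleₚ i) p ∷ []) (λ x y z u → x :< y ⇒ z :< u ⇒ u :≡ x ⇒ z :≡ y ⇒ ⊢ con
        1ℤ :≤ con 0ℤ) l l′ e f))

  simple-as-transpose : ∀ i {p q} → res p ≡ res (pt i) → q ≡ p + 1ℤ → ∀ c → transpose p q c ≡ to (simpleₚ i) c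
  simple-as-transpose i {p} {q} r e = transpose-shift
    (λ f → res-suc≢ p (trans f (cong res e))) r (linear (q ∷ p ∷ + toℕ i ∷ [])
        (λ x y z → x :≡ y :+ con 1ℤ ⇒ ⊢ x :- y :≡ z :+ con 1ℤ :- z) e)

  act-injective : ∀ w {a b} → act w a ≡ act w b → a ≡ b
  act-injective w = to-injective (perm w)

  -- The strong exchange condition. Some letter of the word reverses the images of `a` and `b`;
  -- these are then neighbours, so the letter acts as the conjugated transposition and deleting it
  -- has the desired effect.
  exchange : ∀ w a b → a < b → res a ≢ res b → act w b < act w a →
             ∃[ w′ ] suc (length w′) ≡ length w × (∀ c → act w′ c ≡ act w (transpose a b c))
  exchange []      a b l ne l′ = ⊥-elim (1≰0 (linear (a ∷ b ∷ []) (λ x y → x :< y ⇒ y :< x ⇒ ⊢ con 1ℤ :≤ con 0ℤ)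
      l l′))
  exchange (i ∷ w) a b l ne l′ = go (<-cmp (act w a) (act w b))
    where
    go : _ → _
    go (tri> _ _ m) = let w′ , e , f = exchange w a b l ne m in i ∷ w′ , cong suc e , λ c → cong (to (simpleₚ i)) (f c)
    go (tri≈ _ m _) = ⊥-elim (1≰0 (linear-by (byCombination (1ℤ ∷ -1ℤ ∷ [])) (a ∷ b ∷ [])
        (λ x y → x :≡ y ⇒ x :< y ⇒ ⊢ con 1ℤ :≤ con 0ℤ) (act-injective w m) l))
    go (tri< m _ _) = w , refl , λ c → sym (trans
        (cong (to (simpleₚ i)) (trans (transpose-conj a b ne (perm w) c)
          (simple-as-transpose i (proj₁ r) (proj₂ r) (act w c))))
        (transpose-involutive _ _ (res-suc≢ (pt i)) (act w c)))
      where
      r : res (act w a) ≡ res (pt i) × act w b ≡ act w a + 1ℤ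
      r = simple-reverses i m l′

  act-pos : ∀ w a → act w (pos w a) ≡ a
  act-pos w = to-from (perm w)

  pos-act : ∀ w a → pos w (act w a) ≡ a
  pos-act w = from-to (perm w)

  -- `Falls i w` says that `s_i` is a left descent of `w`, read off the inverse permutation.
  Rises Falls : Fin n → W n → Set
  Rises i w = pos w (pt i) < pos w (pt i + 1ℤ)
  Falls i w = pos w (pt i + 1ℤ) < pos w (pt i)

  rises-or-falls : ∀ i w → Rises i w ⊎ Falls i w
  rises-or-falls i w = go (<-cmp (pos w (pt i)) (pos w (pt i + 1ℤ)))
    where
    go : _ → Rises i w ⊎ Falls i w
    go (tri< p _ _) = inj₁ p
    go (tri≈ _ p _) = ⊥-elim (step (to-injective (inv (perm w)) p))
      where
      step : ¬ (pt i ≡ pt i + 1ℤ)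
      step e = 1≰0 (linear-by (byCombination (1ℤ ∷ -1ℤ ∷ [])) (pt i ∷ [])
          (λ x → x :≡ x :+ con 1ℤ ⇒ ⊢ con 1ℤ :≤ con 0ℤ) e)
    go (tri> _ _ p) = inj₂ p

  simple-at : ∀ i → to (simpleₚ i) (pt i) ≡ pt i + 1ℤ
  simple-at i = transpose-at-a _ _ (res-suc≢ (pt i))

  simple-at-suc : ∀ i → to (simpleₚ i) (pt i + 1ℤ) ≡ pt i
  simple-at-suc i = transpose-at-b _ _ (res-suc≢ (pt i))

  cons-rises : ∀ i w → Falls i w → Rises i (i ∷ w)
  cons-rises i w p = subst₂ _<_ (cong (pos w) (sym (simple-at i))) (cong (pos w) (sym (simple-at-suc i))) p

  cons-falls : ∀ i w → Rises i w → Falls i (i ∷ w)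
  cons-falls i w p = subst₂ _<_ (cong (pos w) (sym (simple-at-suc i))) (cong (pos w) (sym (simple-at i))) p

  pos-cong : ∀ {u v : W n} → u ≈ v → ∀ a → pos u a ≡ pos v a
  pos-cong {u} {v} e = ≃-from {perm u} {perm v} (≈⇒≃ {u} {v} e)

  falls-cong : ∀ {u v : W n} i → u ≈ v → Falls i u → Falls i v
  falls-cong {u} {v} i e = subst₂ _<_ (pos-cong {u} {v} e (pt i + 1ℤ)) (pos-cong {u} {v} e (pt i))

  rises-cong : ∀ {u v : W n} i → u ≈ v → Rises i u → Rises i v
  rises-cong {u} {v} i e = subst₂ _<_ (pos-cong {u} {v} e (pt i)) (pos-cong {u} {v} e (pt i + 1ℤ))

  ≈-refl : {u : W n} → u ≈ u
  ≈-refl μ i = refl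

  ≈-sym : {u v : W n} → u ≈ v → v ≈ u
  ≈-sym e μ i = sym (e μ i)

  ≈-trans : {u v w : W n} → u ≈ v → v ≈ w → u ≈ w
  ≈-trans e f μ i = trans (e μ i) (f μ i)

  cons-cong : ∀ i {u v : W n} → u ≈ v → i ∷ u ≈ i ∷ v
  cons-cong i {u} {v} e = ≃⇒≈ {i ∷ u} {i ∷ v} (λ a → cong (to (simpleₚ i)) (≈⇒≃ {u} {v} e a))

  cons-cons : ∀ i (w : W n) → i ∷ i ∷ w ≈ w
  cons-cons i w = ≃⇒≈ {i ∷ i ∷ w} {w} (λ a → transpose-involutive _ _ (res-suc≢ (pt i)) (act w a))

  cons-as-transpose : ∀ i w c → act w (transpose (pos w (pt i)) (pos w (pt i + 1ℤ)) c) ≡ act (i ∷ w) c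
  cons-as-transpose i w c =
    trans (transpose-conj _ _ ne (perm w) c) (cong₂ (λ s t → transpose s t (act w c)) (act-pos w (pt i))
        (act-pos w (pt i + 1ℤ)))
    where
    ne : res (pos w (pt i)) ≢ res (pos w (pt i + 1ℤ))
    ne e = res-suc≢ (pt i) (to-res⁻¹ (inv (perm w)) e)

  pos-ne : ∀ i w → res (pos w (pt i)) ≢ res (pos w (pt i + 1ℤ))
  pos-ne i w e = res-suc≢ (pt i) (to-res⁻¹ (inv (perm w)) e)

  falls-shorten : ∀ i w → Falls i w → ∃[ w′ ] suc (length w′) ≡ length w × w′ ≈ i ∷ w
  falls-shorten i w p = w′ , e , ≃⇒≈ {w′} {i ∷ w} (λ c → trans (f c) (trans
      (cong (act w) (sym (transpose-swap (pos-ne i w) c))) (cons-as-transpose i w c)))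
    where
    shorter : _
    shorter = exchange w (pos w (pt i + 1ℤ)) (pos w (pt i)) p (λ r → pos-ne i w (sym r))
      (subst₂ _<_ (sym (act-pos w (pt i))) (sym (act-pos w (pt i + 1ℤ))) (i<i+1 (pt i)))
      where
      i<i+1 : ∀ x → x < x + 1ℤ
      i<i+1 x = linear (x ∷ []) (λ x → ⊢ x :< x :+ con 1ℤ)
    w′ : W n
    w′ = proj₁ shorter
    e : suc (length w′) ≡ length w
    e = proj₁ (proj₂ shorter)
    f : ∀ c → act w′ c ≡ act w (transpose (pos w (pt i + 1ℤ)) (pos w (pt i)) c)
    f = proj₂ (proj₂ shorter)

  length-cong : ∀ {u v : W n} {k} → u ≈ v → HasLength u k → HasLength v k
  length-cong {u} {v} e ((w , f , l) , min) =
    (w , ≈-trans {w} {u} {v} f e , l) , λ y g → min y (≈-trans {y} {v} {u} g (≈-sym {u} {v} e))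

  length-unique : ∀ {u : W n} {k l} → HasLength u k → HasLength u l → k ≡ l
  length-unique ((w , f , refl) , min) ((w′ , f′ , refl) , min′) = ℕP.≤-antisym (min w′ f′) (min′ w f)

  -- Every word for `s_i w` has `s_i` as a left descent and shortens to a word for `w`, so it has at
  -- least one letter more.
  length-rises : ∀ i {w k} → Rises i w → HasLength w k → HasLength (i ∷ w) (suc k)
  length-rises i {w} {k} p ((w₀ , f , l) , min) = (i ∷ w₀ , cons-cong i {w₀} {w} f , cong suc l) , minimal
    where
    minimal : ∀ y → y ≈ i ∷ w → suc k ℕ.≤ length y
    minimal y e =
      let y′ , g , h = falls-shorten i y (falls-cong {i ∷ w} {y} i (≈-sym {y} {i ∷ w} e) (cons-falls i w p))
      in subst (suc k ℕ.≤_) g (s≤s (min y′ (≈-trans {y′} {i ∷ y} {w} h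
           (≈-trans {i ∷ y} {i ∷ i ∷ w} {w} (cons-cong i {y} {i ∷ w} e) (cons-cons i w)))))

  length-falls : ∀ i {w k} → Falls i w → HasLength w k → ∃[ k′ ] k ≡ suc k′ × HasLength (i ∷ w) k′
  length-falls i {w} {k} p ((w₀ , f , l) , min) =
    let w′ , g , h = falls-shorten i w₀ (falls-cong {w} {w₀} i (≈-sym {w₀} {w} f) p)
    in length w′ , trans (sym l) (sym g) ,
       ((w′ , ≈-trans {w′} {i ∷ w₀} {i ∷ w} h (cons-cong i {w₀} {w} f) , refl) ,
        λ y e → ℕP.≤-pred (subst (ℕ._≤ suc (length y)) (trans (sym l) (sym g)) (min (i ∷ y)
          (≈-trans {i ∷ y} {i ∷ i ∷ w} {w} (cons-cong i {y} {i ∷ w} e) (cons-cons i w)))))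

  length-[] : HasLength {n} [] 0
  length-[] = ([] , (λ _ _ → refl) , refl) , λ _ _ → z≤n

  length-exists : (w : W n) → ∃[ k ] HasLength w k
  length-exists []      = 0 , length-[]
  length-exists (i ∷ w) = go (rises-or-falls i w)
    where
    go : Rises i w ⊎ Falls i w → ∃[ k ] HasLength (i ∷ w) k
    go (inj₁ p) = _ , length-rises i {w} p (proj₂ (length-exists w))
    go (inj₂ p) = _ , proj₂ (proj₂ (length-falls i {w} p (proj₂ (length-exists w))))

  <ℓ-asym : {u v : W n} → u <ℓ v → ¬ (v <ℓ u)
  <ℓ-asym {u} {v} (k , l , p , q , r) (k′ , l′ , p′ , q′ , r′) =
    ℕP.<-asym r (subst₂ ℕ._<_ (length-unique {v} p′ q) (length-unique {u} q′ p) r′)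

  Reflects : W n → W n → ℤ → ℤ → Set
  Reflects u v a b = a < b × res a ≢ res b × (∀ c → act v c ≡ act u (transpose a b c))

  edge⇒reflects : {u v : W n} → (e : Edge u v) → ∃[ a ] ∃[ b ] Reflects u v a b × proj₁ e ≗ root a b
  edge⇒reflects {u} {v} (α , P , e) =
    let a , b , l , ne , f = positive⇒root P
    in a , b , (l , ne , rep-faithful (rep-word v) (rep-∘ (rep-word u) (rep-reflection ne f)) (balanced-word v)
         (balanced-· (balanced-word u) (balanced-transposition a b ne)) e) , f

  reflects⇒edge : {u v : W n} {a b : ℤ} → Reflects u v a b → Edge u v
  reflects⇒edge {u} {v} {a} {b} (l , ne , e) =
    root a b , root⇒positive l ne (λ _ → refl) ,
    rep-determines (rep-word v) (rep-∘ (rep-word u) (rep-reflection ne (λ _ → refl))) e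

  reflects-sym : {u v : W n} {a b : ℤ} → Reflects u v a b → Reflects v u a b
  reflects-sym {u} {v} {a} {b} (l , ne , e) = l , ne ,
    λ c → sym (trans (e (transpose a b c)) (cong (act u) (transpose-involutive a b ne c)))

  -- A reduced word of `v` inverts `a` and `b`; the exchange condition deletes a letter and leaves a
  -- word for `u`.
  ascent⇒<ℓ : {u v : W n} {a b : ℤ} → Reflects u v a b → act u a < act u b → u <ℓ v
  ascent⇒<ℓ {u} {v} {a} {b} (l , ne , e) p = go (length-exists u) (length-exists v)
    where
    go : _ → _ → u <ℓ v
    go (k , L) (k′ , L′@((v₀ , f , refl) , _)) = k , k′ , L , L′ ,
      subst (suc k ℕ.≤_) g (s≤s (proj₂ L w (≃⇒≈ {w} {u} (λ c → trans (h c)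
        (trans (v₀≃v _) (trans (e _) (cong (act u) (transpose-involutive a b ne c))))))))
      where
      v₀≃v : ∀ c → act v₀ c ≡ act v c
      v₀≃v = ≈⇒≃ {v₀} {v} f
      v₀a : act v₀ a ≡ act u b
      v₀a = trans (v₀≃v a) (trans (e a) (cong (act u) (transpose-at-a a b ne)))
      v₀b : act v₀ b ≡ act u a
      v₀b = trans (v₀≃v b) (trans (e b) (cong (act u) (transpose-at-b a b ne)))
      shorter : _
      shorter = exchange v₀ a b l ne (subst₂ _<_ (sym v₀b) (sym v₀a) p)
      w : W n
      w = proj₁ shorter
      g : suc (length w) ≡ length v₀
      g = proj₁ (proj₂ shorter)
      h : ∀ c → act w c ≡ act v₀ (transpose a b c)
      h = proj₂ (proj₂ shorter)

  <ℓ⇒ascent : {u v : W n} {a b : ℤ} → Reflects u v a b → u <ℓ v → act u a < act u b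
  <ℓ⇒ascent {u} {v} {a} {b} R@(l , ne , e) p = go (<-cmp (act u a) (act u b))
    where
    go : _ → act u a < act u b
    go (tri< q _ _) = q
    go (tri≈ _ q _) = ⊥-elim (1≰0 (linear-by (byCombination (1ℤ ∷ -1ℤ ∷ [])) (a ∷ b ∷ [])
        (λ x y → x :≡ y ⇒ x :< y ⇒ ⊢ con 1ℤ :≤ con 0ℤ) (act-injective u q) l))
    go (tri> _ _ q) = ⊥-elim (<ℓ-asym {u} {v} p (ascent⇒<ℓ {v} {u} (reflects-sym {u} {v} R)
      (subst₂ _<_ (sym (trans (e a) (cong (act u) (transpose-at-a a b ne))))
          (sym (trans (e b) (cong (act u) (transpose-at-b a b ne)))) q)))

  -- The Bruhat order

  Step : W n → W n → Set
  Step x y = Edge x y × x <ℓ y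

  ascent⇒step : {u v : W n} {a b : ℤ} → Reflects u v a b → act u a < act u b → Step u v
  ascent⇒step {u} {v} R p = reflects⇒edge {u} {v} R , ascent⇒<ℓ {u} {v} R p

  ≈⇒≤B : {u v : W n} → u ≈ v → u ≤B v
  ≈⇒≤B {u} e = u , ε , e

  step⇒≤B : {u v : W n} → Step u v → u ≤B v
  step⇒≤B {u} {v} s = v , s ◅ ε , ≈-refl {v}

  <ℓ-respˡ : {u u′ v : W n} → u ≈ u′ → u <ℓ v → u′ <ℓ v
  <ℓ-respˡ {u} {u′} e (k , l , p , q) = k , l , length-cong {u} {u′} e p , q

  step-respˡ : {u u′ v : W n} → u ≈ u′ → Step u v → Step u′ v
  step-respˡ {u} {u′} {v} e ((α , P , f) , l) =
    (α , P , λ μ i → trans (f μ i) (e (reflection α μ) i)) , <ℓ-respˡ {u} {u′} {v} e l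

  ≤B-respˡ : {u u′ v : W n} → u ≈ u′ → u ≤B v → u′ ≤B v
  ≤B-respˡ {u} {u′} {v} e (w , ε , f)                = u′ , ε , ≈-trans {u′} {u} {v} (≈-sym {u} {u′} e) f
  ≤B-respˡ {u} {u′} e (w , _◅_ {j = y} s ss , f) = w , step-respˡ {u} {u′} {y} e s ◅ ss , f

  ≤B-respʳ : {u v v′ : W n} → v ≈ v′ → u ≤B v → u ≤B v′
  ≤B-respʳ {u} {v} {v′} e (w , ss , f) = w , ss , ≈-trans {w} {v} {v′} f e

  ≤B-trans : {u v x : W n} → u ≤B v → v ≤B x → u ≤B x
  ≤B-trans {u} {v} {x} (w , ss , f) q =
    let w′ , ts , g = ≤B-respˡ {v} {w} {x} (≈-sym {w} {v} f) q in w′ , ss ◅◅ ts , g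

  ≤B⇒≈⊎<ℓ : {u v : W n} → u ≤B v → u ≈ v ⊎ u <ℓ v
  ≤B⇒≈⊎<ℓ {u} {v} (w , ss , f) = go ss f
    where
    <ℓ-trans : {x y z : W n} → x <ℓ y → y <ℓ z → x <ℓ z
    <ℓ-trans {y = y} (k , l , p , q , r) (k′ , l′ , p′ , q′ , r′) =
      k , l′ , p , q′ , ℕP.<-trans (subst (k ℕ.<_) (length-unique {y} q p′) r) r′
    go : ∀ {u} → Star Step u w → w ≈ v → u ≈ v ⊎ u <ℓ v
    go ε f = inj₁ f
    go {u} (_◅_ {j = y} (_ , l) ss) f = inj₂ ([ (λ e → moved e l) , <ℓ-trans {u} {y} {v} l ]′ (go ss f))
      where
      moved : y ≈ v → u <ℓ y → u <ℓ v
      moved e (k , l , p , q , r) = k , l , p , length-cong {y} {v} e q , r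

  cons-step : ∀ i w → Rises i w → Step w (i ∷ w)
  cons-step i w p = ascent⇒step {w} {i ∷ w} (p , pos-ne i w , λ c → sym (cons-as-transpose i w c))
    (subst₂ _<_ (sym (act-pos w (pt i))) (sym (act-pos w (pt i + 1ℤ))) (i<i+1 (pt i)))
    where
    i<i+1 : ∀ x → x < x + 1ℤ
    i<i+1 x = linear (x ∷ []) (λ x → ⊢ x :< x :+ con 1ℤ)

  -- The larger of `w` and `s_i w`, which is the Hecke product of `s_i` with `w`.
  raise : Fin n → W n → W n
  raise i w = [ (λ _ → i ∷ w) , (λ _ → w) ]′ (rises-or-falls i w)

  raise-rises : ∀ i w → Rises i w → raise i w ≡ i ∷ w
  raise-rises i w p with rises-or-falls i w
  ... | inj₁ _ = refl
  ... | inj₂ q = ⊥-elim (<-asym p q)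

  raise-falls : ∀ i w → Falls i w → raise i w ≡ w
  raise-falls i w p with rises-or-falls i w
  ... | inj₁ q = ⊥-elim (<-asym p q)
  ... | inj₂ _ = refl

  raise-≥ : ∀ i w → w ≤B raise i w
  raise-≥ i w with rises-or-falls i w
  ... | inj₁ p = step⇒≤B {w} {i ∷ w} (cons-step i w p)
  ... | inj₂ p = ≈⇒≤B {w} {w} (≈-refl {w})

  raise-≥-cons : ∀ i w → i ∷ w ≤B raise i w
  raise-≥-cons i w with rises-or-falls i w
  ... | inj₁ p = ≈⇒≤B {i ∷ w} {i ∷ w} (≈-refl {i ∷ w})
  ... | inj₂ p = ≤B-respʳ {i ∷ w} {i ∷ i ∷ w} {w} (cons-cons i w)
      (step⇒≤B {i ∷ w} {i ∷ i ∷ w} (cons-step i (i ∷ w) (cons-rises i w p)))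

  raise-cong : ∀ i {u v : W n} → u ≈ v → raise i u ≈ raise i v
  raise-cong i {u} {v} e with rises-or-falls i u | rises-or-falls i v
  ... | inj₁ p | inj₁ q = cons-cong i {u} {v} e
  ... | inj₁ p | inj₂ q = ⊥-elim (<-asym q (rises-cong {u} {v} i e p))
  ... | inj₂ p | inj₁ q = ⊥-elim (<-asym q (falls-cong {u} {v} i e p))
  ... | inj₂ p | inj₂ q = e

  -- The lifting property. Left multiplication by `s_i` preserves an ascent unless it reverses the
  -- two values in question; then these are neighbours and `y = s_i x`.
  raise-step : ∀ i {x y} → Step x y → raise i x ≤B raise i y
  raise-step i {x} {y} s@(ed , l) = go (edge⇒reflects {x} {y} ed)
    where
    go : _ → raise i x ≤B raise i y
    go (a , b , R@(a<b , ne , e) , _) = decide (<-cmp (to (simpleₚ i) (act x a)) (to (simpleₚ i) (act x b)))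
      where
      up : act x a < act x b
      up = <ℓ⇒ascent {x} {y} R l
      both : Step (i ∷ x) (i ∷ y) → Rises i x ⊎ Falls i x → raise i x ≤B raise i y
      both t (inj₁ p) = subst (_≤B raise i y) (sym (raise-rises i x p))
        (≤B-trans {i ∷ x} {i ∷ y} {raise i y} (step⇒≤B {i ∷ x} {i ∷ y} t) (raise-≥-cons i y))
      both t (inj₂ p) = subst (_≤B raise i y) (sym (raise-falls i x p))
        (≤B-trans {x} {y} {raise i y} (step⇒≤B {x} {y} s) (raise-≥ i y))
      decide : _ → raise i x ≤B raise i y
      decide (tri< q _ _) = both (ascent⇒step {i ∷ x} {i ∷ y} (a<b , ne , λ c → cong (to (simpleₚ i)) (e c)) q)
          (rises-or-falls i x)
      decide (tri≈ _ q _) = ⊥-elim (1≰0 (linear-by (byCombination (1ℤ ∷ -1ℤ ∷ [])) (a ∷ b ∷ [])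
          (λ x y → x :≡ y ⇒ x :< y ⇒ ⊢ con 1ℤ :≤ con 0ℤ) (act-injective (i ∷ x) q) a<b))
      decide (tri> _ _ q) = subst (_≤B raise i y) (sym (raise-rises i x rises))
        (≤B-respˡ {y} {i ∷ x} {raise i y} (≃⇒≈ {y} {i ∷ x} swapped) (raise-≥ i y))
        where
        r : res (act x a) ≡ res (pt i) × act x b ≡ act x a + 1ℤ
        r = simple-reverses i up q
        swapped : ∀ c → act y c ≡ to (simpleₚ i) (act x c)
        swapped c = trans (e c) (trans (transpose-conj a b ne (perm x) c)
            (simple-as-transpose i (proj₁ r) (proj₂ r) (act x c)))
        rises : Rises i x
        rises = linear-by (byCombination (1ℤ ∷ 1ℤ ∷ -1ℤ ∷ 1ℤ ∷ -1ℤ ∷ []))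
            (to (inv (perm x)) (pt i) ∷ pt i ∷ to (inv (perm x)) (act x a) ∷ act x a ∷ to (inv (perm x))
            (pt i + 1ℤ) ∷ to (inv (perm x)) (act x a + 1ℤ) ∷ a ∷ b ∷ [])
            (λ x y z u v w p q → x :- y :≡ z :- u ⇒ v :- (y :+ con 1ℤ) :≡ w :- (u :+ con 1ℤ) ⇒ z :≡ p ⇒ w :≡ q ⇒
            p :< q ⇒ ⊢ x :< v) (displacement-cong (inv (perm x)) {pt i} {act x a} (sym (proj₁ r)))
            (displacement-cong (inv (perm x)) {pt i + 1ℤ} {act x a + 1ℤ} (res-+ 1ℤ (sym (proj₁ r))))
            (pos-act x a) (trans (cong (pos x) (sym (proj₂ r))) (pos-act x b)) a<b

  raise-mono : ∀ i {x y} → x ≤B y → raise i x ≤B raise i y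
  raise-mono i {x} {y} (w , ss , f) = ≤B-respʳ {raise i x} {raise i w} {raise i y} (raise-cong i {w} {y} f)
      (go ss)
    where
    go : ∀ {x} → Star Step x w → raise i x ≤B raise i w
    go {x} ε = ≈⇒≤B {raise i x} {raise i x} (≈-refl {raise i x})
    go {x} (_◅_ {j = y} s ss) = ≤B-trans {raise i x} {raise i y} {raise i w} (raise-step i {x} {y} s) (go ss)

  -- Rank functions under multiplication by a simple reflection

  rank-simple-other : ∀ i {j} → res j ≢ res (pt i) → rank (simpleₚ i) j j ≡ 0ℤ
  rank-simple-other i {j} ne = trans (rank-transposition (res-suc≢ (pt i)) (≤-suc (pt i)) j) (flat j (pt i) ne)
    where
    ≤-suc : ∀ x → x ≤ x + 1ℤ
    ≤-suc x = linear (x ∷ []) (λ x → ⊢ x :≤ x :+ con 1ℤ)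
    flat : ∀ x a → res x ≢ res a → φ (x - a) - φ (x - (a + 1ℤ)) ≡ 0ℤ
    flat x a ne = linear-by (byEquations (1ℤ ∷ -1ℤ ∷ [])) (φ (x - a) ∷ φ (x - 1ℤ - a) ∷ φ (x - (a + 1ℤ)) ∷ [])
        (λ x y z → x :≡ y ⇒ z :≡ y ⇒ ⊢ x :- z :≡ con 0ℤ) (φ-step-no x a ne)
        (cong φ {x - (a + 1ℤ)} {x - 1ℤ - a} (linear (x ∷ a ∷ [])
        (λ x y → ⊢ x :- (y :+ con 1ℤ) :≡ x :- con 1ℤ :- y)))

  -- A simple reflection crosses only the walls congruent to `i`. Subadditivity gives one
  -- inequality, and the other one after multiplying by `s_i` again.
  rank-cons-other : ∀ i v k {j} → res j ≢ res (pt i) → rank (simpleₚ i · v) k j ≡ rank v k j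
  rank-cons-other i v k {j} ne = ≤-antisym
    (linear (rank (simpleₚ i · v) k j ∷ rank v k j ∷ rank (simpleₚ i) j j ∷ [])
        (λ x y z → x :≤ y :+ z ⇒ z :≡ con 0ℤ ⇒ ⊢ x :≤ y) (rank-subadd (simpleₚ i) v k j j)
        (rank-simple-other i {j} ne))
    (linear-by (byCombination (1ℤ ∷ 1ℤ ∷ 1ℤ ∷ -1ℤ ∷ [])) (rank (simpleₚ i · (simpleₚ i · v)) k j ∷ rank
        (simpleₚ i · v) k j ∷ rank (simpleₚ i) j j ∷ rank v k j ∷ [])
        (λ x y z u → x :≤ y :+ z ⇒ z :≡ con 0ℤ ⇒ x :≡ u ⇒ ⊢ u :≤ y)
        (rank-subadd (simpleₚ i) (simpleₚ i · v) k j j) (rank-simple-other i {j} ne)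
        (rank-cong {simpleₚ i · (simpleₚ i · v)} {v} (λ a → transpose-involutive _ _ (res-suc≢ (pt i)) (to v a))
        k j))

  rank-snoc-other : ∀ i v j {k} → res k ≢ res (pt i) → rank (v · simpleₚ i) k j ≡ rank v k j
  rank-snoc-other i v j {k} ne = ≤-antisym
    (linear (rank (v · simpleₚ i) k j ∷ rank (simpleₚ i) k k ∷ rank v k j ∷ [])
        (λ x y z → x :≤ y :+ z ⇒ y :≡ con 0ℤ ⇒ ⊢ x :≤ z) (rank-subadd v (simpleₚ i) k k j)
        (rank-simple-other i {k} ne))
    (linear-by (byCombination (1ℤ ∷ 1ℤ ∷ 1ℤ ∷ -1ℤ ∷ [])) (rank (v · simpleₚ i · simpleₚ i) k j ∷ rank (simpleₚ i)
        k k ∷ rank (v · simpleₚ i) k j ∷ rank v k j ∷ []) (λ x y z u → x :≤ y :+ z ⇒ y :≡ con 0ℤ ⇒ x :≡ u ⇒ ⊢ u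
        :≤ z) (rank-subadd (v · simpleₚ i) (simpleₚ i) k k j) (rank-simple-other i {k} ne)
        (rank-cong {v · simpleₚ i · simpleₚ i} {v} (λ a → cong (to v)
        (transpose-involutive _ _ (res-suc≢ (pt i)) a)) k j))

  rank-column-mono : ∀ v k j → rank v k (j + 1ℤ) ≤ rank v k j
  rank-column-mono v k j = rank-mono v {k} {k} {j + 1ℤ} {j} ≤-refl (linear (j ∷ []) (λ x → ⊢ x :≤ x :+ con 1ℤ))

  rank-column-step : ∀ v k j → rank v k (j - 1ℤ) ≤ rank v k j + 1ℤ
  rank-column-step v k j = linear (rank v k (j - 1ℤ) ∷ rank v k j ∷ (j - (j - 1ℤ)) ⁺ ∷ 1ℤ ⁺ ∷ [])
      (λ x y z u → x :≤ y :+ z ⇒ z :≡ u ⇒ u :≡ con 1ℤ ⇒ ⊢ x :≤ y :+ con 1ℤ) (rank-column-bound v k j (j - 1ℤ))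
      (cong _⁺ {j - (j - 1ℤ)} {1ℤ} (linear (j ∷ []) (λ x → ⊢ x :- (x :- con 1ℤ) :≡ con 1ℤ)))
      (⁺-pos {1ℤ} (+≤+ z≤n))

  rank-row-step : ∀ v k j → rank v (k + 1ℤ) j ≤ rank v k j + 1ℤ
  rank-row-step v k j = rank-row-lip v k j 1

  j+1-1 : ∀ j → j + 1ℤ - 1ℤ ≡ j
  j+1-1 j = linear (j ∷ []) (λ x → ⊢ x :+ con 1ℤ :- con 1ℤ :≡ x)

  -- Consecutive columns differ by 0 or 1. If `j` comes from further left than `j + 1`, the value at
  -- `j` is the smallest one that its neighbours allow; in the opposite case, `rank-column-peak`, it
  -- is the largest.
  rank-column-valley : ∀ v k j → from v j < from v (j + 1ℤ) →
                       rank v k j ≡ rank v k (j - 1ℤ) - 1ℤ ⊎ rank v k j ≡ rank v k (j + 1ℤ)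
  rank-column-valley v k j p = go (from v j ≤? k)
    where
    go : Dec (from v j ≤ k) → rank v k j ≡ rank v k (j - 1ℤ) - 1ℤ ⊎ rank v k j ≡ rank v k (j + 1ℤ)
    go (yes q) = inj₁ (linear-by (byEquations (-1ℤ ∷ [])) (rank v k (j - 1ℤ) ∷ rank v k j ∷ [])
        (λ x y → x :≡ y :+ con 1ℤ ⇒ ⊢ y :≡ x :- con 1ℤ) (rank-column-yes v k j q))
    go (no q)  = inj₂ (linear-by (byEquations (1ℤ ∷ -1ℤ ∷ []))
        (rank v k (j + 1ℤ - 1ℤ) ∷ rank v k (j + 1ℤ) ∷ rank v k j ∷ []) (λ x y z → x :≡ y ⇒ x :≡ z ⇒ ⊢ z :≡ y)
        (rank-column-no v k (j + 1ℤ) (linear (k ∷ from v j ∷ from v (j + 1ℤ) ∷ [])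
        (λ x y z → x :< y ⇒ y :< z ⇒ ⊢ x :< z) (≰⇒> q) p)) (cong (rank v k) (j+1-1 j)))

  rank-column-peak : ∀ v k j → from v (j + 1ℤ) < from v j →
                     rank v k j ≡ rank v k (j - 1ℤ) ⊎ rank v k j ≡ rank v k (j + 1ℤ) + 1ℤ
  rank-column-peak v k j p = go (from v j ≤? k)
    where
    go : Dec (from v j ≤ k) → rank v k j ≡ rank v k (j - 1ℤ) ⊎ rank v k j ≡ rank v k (j + 1ℤ) + 1ℤ
    go (yes q) = inj₂ (linear-by (byEquations (1ℤ ∷ -1ℤ ∷ []))
        (rank v k (j + 1ℤ - 1ℤ) ∷ rank v k (j + 1ℤ) ∷ rank v k j ∷ [])
        (λ x y z → x :≡ y :+ con 1ℤ ⇒ x :≡ z ⇒ ⊢ z :≡ y :+ con 1ℤ)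
        (rank-column-yes v k (j + 1ℤ) (linear (from v j ∷ k ∷ from v (j + 1ℤ) ∷ [])
        (λ x y z → x :≤ y ⇒ z :< x ⇒ ⊢ z :≤ y) q p)) (cong (rank v k) (j+1-1 j)))
    go (no q)  = inj₁ (linear-by (byEquations (-1ℤ ∷ [])) (rank v k (j - 1ℤ) ∷ rank v k j ∷ [])
        (λ x y → x :≡ y ⇒ ⊢ y :≡ x) (rank-column-no v k j (≰⇒> q)))

  rank-row-peak : ∀ v k j → to v (k + 1ℤ) < to v k →
                  rank v k j ≡ rank v (k - 1ℤ) j + 1ℤ ⊎ rank v k j ≡ rank v (k + 1ℤ) j
  rank-row-peak v k j p = go (to v k ≤? j)
    where
    go : Dec (to v k ≤ j) → rank v k j ≡ rank v (k - 1ℤ) j + 1ℤ ⊎ rank v k j ≡ rank v (k + 1ℤ) j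
    go (yes q) = inj₂ (linear-by (byEquations (-1ℤ ∷ -1ℤ ∷ []))
        (rank v (k + 1ℤ) j ∷ rank v (k + 1ℤ - 1ℤ) j ∷ rank v k j ∷ []) (λ x y z → x :≡ y ⇒ y :≡ z ⇒ ⊢ z :≡ x)
        (rank-row-no v (k + 1ℤ) j (linear (to v k ∷ j ∷ to v (k + 1ℤ) ∷ [])
        (λ x y z → x :≤ y ⇒ z :< x ⇒ ⊢ z :≤ y) q p)) (cong (λ t → rank v t j) (j+1-1 k)))
    go (no q)  = inj₁ (rank-row-yes v k j (≰⇒> q))

  order-class : ∀ v {a b} → res a ≡ res b → to v a < to v (a + 1ℤ) → to v b < to v (b + 1ℤ)
  order-class v {a} {b} e p = linear-by (byCombination (1ℤ ∷ 1ℤ ∷ -1ℤ ∷ []))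
      (to v a ∷ to v (a + 1ℤ) ∷ a ∷ to v b ∷ b ∷ to v (b + 1ℤ) ∷ [])
      (λ x y z u v w → x :< y ⇒ x :- z :≡ u :- v ⇒ y :- (z :+ con 1ℤ) :≡ w :- (v :+ con 1ℤ) ⇒ ⊢ u :< w) p
      (displacement-cong v {a} {b} e) (displacement-cong v {a + 1ℤ} {b + 1ℤ} (res-+ 1ℤ e))

  order-class′ : ∀ v {a b} → res a ≡ res b → to v (a + 1ℤ) < to v a → to v (b + 1ℤ) < to v b
  order-class′ v {a} {b} e p = linear-by (byCombination (1ℤ ∷ 1ℤ ∷ 1ℤ ∷ -1ℤ ∷ []))
      (to v (a + 1ℤ) ∷ to v a ∷ a ∷ to v b ∷ b ∷ to v (b + 1ℤ) ∷ [])
      (λ x y z u v w → x :< y ⇒ y :- z :≡ u :- v ⇒ x :- (z :+ con 1ℤ) :≡ w :- (v :+ con 1ℤ) ⇒ ⊢ w :< u) p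
      (displacement-cong v {a} {b} e) (displacement-cong v {a + 1ℤ} {b + 1ℤ} (res-+ 1ℤ e))

  next≢ : ∀ {j x} → res j ≡ res x → res (j + 1ℤ) ≢ res x
  next≢ {j} e f = res-suc≢ j (trans e (sym f))

  prev≢ : ∀ {j x} → res j ≡ res x → res (j - 1ℤ) ≢ res x
  prev≢ {j} e f = res-suc≢ (j - 1ℤ) (trans f (trans (sym e)
      (cong res {j} {j - 1ℤ + 1ℤ} (linear (j ∷ []) (λ x → ⊢ x :≡ x :- con 1ℤ :+ con 1ℤ)))))

  -- Dominance implies the Bruhat order: by induction on a reduced word i ∷ r of v, the larger of u and
  -- s_i u can be lowered along with v, because dominance survives when s_i is removed from both.

  infix 4 _⊑_
  _⊑_ : Perm → Perm → Set
  u ⊑ v = ∀ k j → rank u k j ≤ rank v k j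

  reduced-tail : ∀ (i : Fin n) r → Reduced (i ∷ r) → Rises i r × Reduced r
  reduced-tail i r (_ , min) = go (rises-or-falls i r) , ((r , ≈-refl {r} , refl) , λ y e → ℕP.≤-pred
      (min (i ∷ y) (cons-cong i {y} {r} e)))
    where
    go : Rises i r ⊎ Falls i r → Rises i r
    go (inj₁ p) = p
    go (inj₂ p) = let y , e , f = falls-shorten i r p in
      ⊥-elim (ℕP.<-irrefl refl (ℕP.≤-trans (ℕP.m≤n⇒m≤1+n (min y f)) (ℕP.≤-reflexive e)))

  rank-1 : ∀ k → rank 1ₚ k k ≡ 0ℤ
  rank-1 k = trans (ΣR-cong (λ a → trans (cong _⁺ (+-inverseʳ (φ (k - a)))) (⁺-pos ≤-refl))) ΣR-0

  -- Off the class of `i` the ranks of `r` and `s_i r` agree. In that class the rank of `u` is the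
  -- smallest its neighbours allow, so it cannot exceed that of `r`.
  lower-⊑ : ∀ i u r → Rises i u → Rises i r → perm u ⊑ perm (i ∷ r) → perm u ⊑ perm r
  lower-⊑ i u r p q d k j = go (res j ℕ.≟ res (pt i))
    where
    U R : Perm
    U = perm u
    R = perm r
    elsewhere : ∀ j → res j ≢ res (pt i) → rank (perm u) k j ≤ rank (perm r) k j
    elsewhere j ne = linear (rank (perm u) k j ∷ rank (perm (i ∷ r)) k j ∷ rank R k j ∷ [])
        (λ x y z → x :≤ y ⇒ y :≡ z ⇒ ⊢ x :≤ z) (d k j) (rank-cons-other i R k {j} ne)
    go : Dec (res j ≡ res (pt i)) → rank (perm u) k j ≤ rank (perm r) k j
    go (no ne) = elsewhere j ne
    go (yes e) = case (rank-column-valley U k j (order-class (inv U) {pt i} {j} (sym e) p))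
      where
      case : _ → rank (perm u) k j ≤ rank (perm r) k j
      case (inj₁ f) = linear (rank U k j ∷ rank U k (j - 1ℤ) ∷ rank (perm r) k (j - 1ℤ) ∷ rank R k j ∷ [])
          (λ x y z u → x :≡ y :- con 1ℤ ⇒ y :≤ z ⇒ z :≤ u :+ con 1ℤ ⇒ ⊢ x :≤ u) f (elsewhere (j - 1ℤ) (prev≢ e))
          (rank-column-step R k j)
      case (inj₂ f) = linear (rank U k j ∷ rank U k (j + 1ℤ) ∷ rank (perm r) k (j + 1ℤ) ∷ rank R k j ∷ [])
          (λ x y z u → x :≡ y ⇒ y :≤ z ⇒ z :≤ u ⇒ ⊢ x :≤ u) f (elsewhere (j + 1ℤ) (next≢ e))
          (rank-column-mono R k j)

  ⊑⇒≤B-reduced : ∀ r → Reduced r → ∀ u → perm u ⊑ perm r → u ≤B r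
  -- No wall is crossed by `u`, so `u` and its inverse preserve every half-line, and `u` is the
  -- identity.
  ⊑⇒≤B-reduced []      _ u d = ≈⇒≤B {u} {[]} (≃⇒≈ {u} {[]}
      (λ a → ≤-antisym (Uncrossed.to-≤ (balanced-word u) (flat a) ≤-refl)
      (subst (_≤ act u a) (pos-act u a) (Uncrossed.from-≤ (balanced-word u) (flat (act u a)) ≤-refl))))
    where
    flat : ∀ k → rank (perm u) k k ≤ 0ℤ
    flat k = linear (rank (perm u) k k ∷ rank (perm []) k k ∷ []) (λ x y → x :≤ y ⇒ y :≡ con 0ℤ ⇒ ⊢ x :≤ con 0ℤ)
        (d k k) (rank-1 k)
  ⊑⇒≤B-reduced (i ∷ r) R u d = go (rises-or-falls i u)
    where
    rises : Rises i r
    rises = proj₁ (reduced-tail i r R)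
    below : ∀ u′ → Rises i u′ → perm u′ ⊑ perm (i ∷ r) → raise i u′ ≤B i ∷ r
    below u′ p d′ = subst (raise i u′ ≤B_) (raise-rises i r rises)
      (raise-mono i {u′} {r} (⊑⇒≤B-reduced r (proj₂ (reduced-tail i r R)) u′ (lower-⊑ i u′ r p rises d′)))
    go : Rises i u ⊎ Falls i u → u ≤B i ∷ r
    go (inj₁ p) = ≤B-trans {u} {raise i u} {i ∷ r} (raise-≥ i u) (below u p d)
    go (inj₂ p) = ≤B-trans {u} {raise i (i ∷ u)} {i ∷ r}
      (subst (u ≤B_) (sym (raise-rises i (i ∷ u) q)) (≈⇒≤B {u} {i ∷ i ∷ u}
          (≈-sym {i ∷ i ∷ u} {u} (cons-cons i u))))
      (below (i ∷ u) q d′)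
      where
      q : Rises i (i ∷ u)
      q = cons-rises i u p
      d′ : perm (i ∷ u) ⊑ perm (i ∷ r)
      d′ k j = decide (res j ℕ.≟ res (pt i))
        where
        elsewhere : ∀ j → res j ≢ res (pt i) → rank (perm (i ∷ u)) k j ≤ rank (perm (i ∷ r)) k j
        elsewhere j ne = linear (rank (perm u) k j ∷ rank (perm (i ∷ r)) k j ∷ rank (simpleₚ i · perm u) k j ∷
            []) (λ x y z → x :≤ y ⇒ z :≡ x ⇒ ⊢ z :≤ y) (d k j) (rank-cons-other i (perm u) k {j} ne)
        decide : Dec (res j ≡ res (pt i)) → rank (perm (i ∷ u)) k j ≤ rank (perm (i ∷ r)) k j
        decide (no ne) = elsewhere j ne
        decide (yes e) = case (rank-column-valley (perm (i ∷ u)) k j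
            (order-class (inv (perm (i ∷ u))) {pt i} {j} (sym e) q))
          where
          case : _ → rank (perm (i ∷ u)) k j ≤ rank (perm (i ∷ r)) k j
          case (inj₁ f) = linear (rank (perm (i ∷ u)) k j ∷ rank (perm (i ∷ u)) k (j - 1ℤ) ∷ rank (perm (i ∷ r))
              k (j - 1ℤ) ∷ rank (perm (i ∷ r)) k j ∷ []) (λ x y z u → x :≡ y :- con 1ℤ ⇒ y :≤ z ⇒ z :≤ u :+ con
              1ℤ ⇒ ⊢ x :≤ u) f (elsewhere (j - 1ℤ) (prev≢ e)) (rank-column-step (perm (i ∷ r)) k j)
          case (inj₂ f) = linear (rank (perm (i ∷ u)) k j ∷ rank (perm (i ∷ u)) k (j + 1ℤ) ∷ rank (perm (i ∷ r))
              k (j + 1ℤ) ∷ rank (perm (i ∷ r)) k j ∷ []) (λ x y z u → x :≡ y ⇒ y :≤ z ⇒ z :≤ u ⇒ ⊢ x :≤ u) f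
              (elsewhere (j + 1ℤ) (next≢ e)) (rank-column-mono (perm (i ∷ r)) k j)

  ⊑⇒≤B : ∀ u v → perm u ⊑ perm v → u ≤B v
  ⊑⇒≤B u v d = go (length-exists v)
    where
    go : _ → u ≤B v
    go (k , L@((r , e , refl) , min)) = ≤B-respʳ {u} {r} {v} e
      (⊑⇒≤B-reduced r (length-cong {v} {r} (≈-sym {r} {v} e) L) u
        (λ k j → subst (rank (perm u) k j ≤_) (sym (rank-cong {perm r} {perm v} (≈⇒≃ {r} {v} e) k j)) (d k j)))

  -- The Hecke product is the min-plus product of rank functions.

  act-snoc : ∀ u i a → act (u ∷ʳ i) a ≡ act u (to (simpleₚ i) a)
  act-snoc []      i a = refl
  act-snoc (j ∷ u) i a = cong (to (simpleₚ j)) (act-snoc u i a)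

  snoc-reflects : ∀ u i → Reflects u (u ∷ʳ i) (pt i) (pt i + 1ℤ)
  snoc-reflects u i = <-suc (pt i) , res-suc≢ (pt i) , act-snoc u i
    where
    <-suc : ∀ x → x < x + 1ℤ
    <-suc x = linear (x ∷ []) (λ x → ⊢ x :< x :+ con 1ℤ)

  module _ (u : W n) (i : Fin n) (v : W n) (h : HeckeStep u i v) where

    hecke-other : ∀ {k} b → res k ≢ res (pt i) → rank (perm v) k b ≡ rank (perm u) k b
    hecke-other {k} b ne = go h
      where
      go : HeckeStep u i v → rank (perm v) k b ≡ rank (perm u) k b
      go (inj₁ (_ , e)) = trans (rank-cong {perm v} {perm u · simpleₚ i}
          (λ a → trans (≈⇒≃ {v} {u ∷ʳ i} e a) (act-snoc u i a)) k b)
                                (rank-snoc-other i (perm u) b ne)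
      go (inj₂ (_ , e)) = rank-cong {perm v} {perm u} (≈⇒≃ {v} {u} e) k b

    hecke-descends : act v (pt i + 1ℤ) < act v (pt i)
    hecke-descends = go h
      where
      go : HeckeStep u i v → act v (pt i + 1ℤ) < act v (pt i)
      go (inj₁ (l , e)) = subst₂ _<_ (sym (trans (≈⇒≃ {v} {u ∷ʳ i} e _)
          (trans (act-snoc u i _) (cong (act u) (simple-at-suc i)))))
                                     (sym (trans (≈⇒≃ {v} {u ∷ʳ i} e _)
                                         (trans (act-snoc u i _) (cong (act u) (simple-at i)))))
        (<ℓ⇒ascent {u} {u ∷ʳ i} (snoc-reflects u i) l)
      go (inj₂ (l , e)) = subst₂ _<_ (sym (≈⇒≃ {v} {u} e _)) (sym (≈⇒≃ {v} {u} e _))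
          (decide (<-cmp (act u (pt i)) (act u (pt i + 1ℤ))))
        where
        decide : _ → act u (pt i + 1ℤ) < act u (pt i)
        decide (tri< q _ _) = ⊥-elim (l (ascent⇒<ℓ {u} {u ∷ʳ i} (snoc-reflects u i) q))
        decide (tri≈ _ q _) = ⊥-elim (x≢x+1 (pt i) (act-injective u q))
          where
          x≢x+1 : ∀ x → ¬ x ≡ x + 1ℤ
          x≢x+1 x e = 1≰0 (linear-by (byCombination (1ℤ ∷ -1ℤ ∷ [])) (x ∷ [])
              (λ x → x :≡ x :+ con 1ℤ ⇒ ⊢ con 1ℤ :≤ con 0ℤ) e)
        decide (tri> _ _ q) = q

  -- A cut `k` in the class of `i` is moved to `k − 1` or `k + 1`, where multiplication by `s_i`
  -- leaves both ranks alone. Since `u · s_i` has a right descent at `i`, its rank is a peak along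
  -- the rows and one of the two moves does not increase the sum.
  hecke-lower : ∀ {u is w} → HeckeWord u is w → ∀ a b → ∃[ k ] rank (perm is) a k + rank (perm u) k b ≤ rank
      (perm w) a b
  hecke-lower {u} {_} {w} ([] e) a b = a , linear-by (byCombination (1ℤ ∷ 1ℤ ∷ -1ℤ ∷ []))
      (rank 1ₚ a a ∷ rank (perm w) a b ∷ rank (perm u) a b ∷ []) (λ x y z → x :≡ con 0ℤ ⇒ y :≡ z ⇒ ⊢ x :+ z :≤ y)
      (rank-1 a) (rank-cong {perm w} {perm u} (≈⇒≃ {w} {u} e) a b)
  hecke-lower {u} {i ∷ is} {w} (_∷_ {u′ = u′} h hs) a b = go (hecke-lower hs a b)
    where
    go : _ → ∃[ k ] rank (perm (i ∷ is)) a k + rank (perm u) k b ≤ rank (perm w) a b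
    go (k , p) = decide (res k ℕ.≟ res (pt i))
      where
      at-other : ∀ k → res k ≢ res (pt i) → rank (perm is) a k + rank (perm u′) k b ≤ rank (perm w) a b →
                 ∃[ k ] rank (perm (i ∷ is)) a k + rank (perm u) k b ≤ rank (perm w) a b
      at-other k ne p = k , linear-by (byCombination (1ℤ ∷ 1ℤ ∷ 1ℤ ∷ -1ℤ ∷ []))
          (rank (perm is) a k ∷ rank (perm u′) k b ∷ rank (perm w) a b ∷ rank (simpleₚ i · perm is) a k ∷ rank
          (perm u) k b ∷ []) (λ x y z u v → x :+ y :≤ z ⇒ u :≡ x ⇒ y :≡ v ⇒ ⊢ u :+ v :≤ z) p
          (rank-cons-other i (perm is) a {k} ne) (hecke-other u i u′ h {k} b ne)
      decide : Dec (res k ≡ res (pt i)) → ∃[ k ] rank (perm (i ∷ is)) a k + rank (perm u) k b ≤ rank (perm w) a b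
      decide (no ne) = at-other k ne p
      decide (yes e) = case (rank-row-peak (perm u′) k b (order-class′ (perm u′) {pt i} {k} (sym e)
          (hecke-descends u i u′ h)))
        where
        case : _ → ∃[ k ] rank (perm (i ∷ is)) a k + rank (perm u) k b ≤ rank (perm w) a b
        case (inj₁ f) = at-other (k - 1ℤ) (prev≢ e) (linear-by (byCombination (1ℤ ∷ 1ℤ ∷ -1ℤ ∷ []))
            (rank (perm is) a k ∷ rank (perm u′) k b ∷ rank (perm w) a b ∷ rank (perm u′) (k - 1ℤ) b ∷ rank
            (perm is) a (k - 1ℤ) ∷ []) (λ x y z u v → x :+ y :≤ z ⇒ y :≡ u :+ con 1ℤ ⇒ v :≤ x :+ con 1ℤ ⇒ ⊢ v :+
            u :≤ z) p f (rank-column-step (perm is) a k))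
        case (inj₂ f) = at-other (k + 1ℤ) (next≢ e) (linear-by (byCombination (1ℤ ∷ 1ℤ ∷ -1ℤ ∷ []))
            (rank (perm is) a k ∷ rank (perm u′) k b ∷ rank (perm w) a b ∷ rank (perm u′) (k + 1ℤ) b ∷ rank
            (perm is) a (k + 1ℤ) ∷ []) (λ x y z u v → x :+ y :≤ z ⇒ y :≡ u ⇒ v :≤ x ⇒ ⊢ v :+ u :≤ z) p f
            (rank-column-mono (perm is) a k))

  -- Reducedness makes the first letter a left descent of the word, so its rank is a peak along the
  -- columns; a cut in the class of that letter is then no better than one of its neighbours.
  hecke-upper : ∀ {u is w} → Reduced is → HeckeWord u is w → ∀ a k b → rank (perm w) a b ≤ rank (perm is) a k +
      rank (perm u) k b
  hecke-upper {u} {_} {w} _ ([] e) a k b = linear (rank (perm u · 1ₚ) a b ∷ rank 1ₚ a k ∷ rank (perm u) k b ∷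
      rank (perm w) a b ∷ []) (λ x y z u → x :≤ y :+ z ⇒ u :≡ x ⇒ ⊢ u :≤ y :+ z) (rank-subadd (perm u) 1ₚ a k b)
      (rank-cong {perm w} {perm u · 1ₚ} (≈⇒≃ {w} {u} e) a b)
  hecke-upper {u} {i ∷ is} {w} R (_∷_ {u′ = u′} h hs) a k b = decide (res k ℕ.≟ res (pt i))
    where
    rises : Rises i is
    rises = proj₁ (reduced-tail i is R)
    at-other : ∀ k → res k ≢ res (pt i) → rank (perm w) a b ≤ rank (perm (i ∷ is)) a k + rank (perm u) k b
    at-other k ne = linear-by (byCombination (1ℤ ∷ 1ℤ ∷ -1ℤ ∷ []))
        (rank (perm w) a b ∷ rank (perm is) a k ∷ rank (perm u′) k b ∷ rank (simpleₚ i · perm is) a k ∷ rank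
        (perm u) k b ∷ []) (λ x y z u v → x :≤ y :+ z ⇒ u :≡ y ⇒ z :≡ v ⇒ ⊢ x :≤ u :+ v)
        (hecke-upper (proj₂ (reduced-tail i is R)) hs a k b) (rank-cons-other i (perm is) a {k} ne)
        (hecke-other u i u′ h {k} b ne)
    decide : Dec (res k ≡ res (pt i)) → rank (perm w) a b ≤ rank (perm (i ∷ is)) a k + rank (perm u) k b
    decide (no ne) = at-other k ne
    decide (yes e) = case (rank-column-peak (perm (i ∷ is)) a k
        (order-class′ (inv (perm (i ∷ is))) {pt i} {k} (sym e) (cons-falls i is rises)))
      where
      case : _ → rank (perm w) a b ≤ rank (perm (i ∷ is)) a k + rank (perm u) k b
      case (inj₁ f) = linear-by (byCombination (1ℤ ∷ -1ℤ ∷ []))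
          (rank (perm (i ∷ is)) a k ∷ rank (perm (i ∷ is)) a (k - 1ℤ) ∷ rank (perm w) a b ∷ rank (perm u)
          (k - 1ℤ) b ∷ rank (perm u) k b ∷ []) (λ x y z u v → x :≡ y ⇒ z :≤ y :+ u ⇒ u :≤ v ⇒ ⊢ z :≤ x :+ v) f
          (at-other (k - 1ℤ) (prev≢ e)) (rank-mono (perm u) {k - 1ℤ} {k} {b} {b}
          (linear (k ∷ []) (λ x → ⊢ x :- con 1ℤ :≤ x)) ≤-refl)
      case (inj₂ f) = linear-by (byCombination (1ℤ ∷ -1ℤ ∷ []))
          (rank (perm (i ∷ is)) a k ∷ rank (perm (i ∷ is)) a (k + 1ℤ) ∷ rank (perm w) a b ∷ rank (perm u)
          (k + 1ℤ) b ∷ rank (perm u) k b ∷ []) (λ x y z u v → x :≡ y :+ con 1ℤ ⇒ z :≤ y :+ u ⇒ u :≤ v :+ con 1ℤ ⇒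
          ⊢ z :≤ x :+ v) f (at-other (k + 1ℤ) (next≢ e)) (rank-row-step (perm u) k b)

  -- The rank function of z_d

  deg : Degree n → ℤ → ℤ
  deg d k = + d (cls k)

  deg-cong : ∀ d {a b} → res a ≡ res b → deg d a ≡ deg d b
  deg-cong d {a} {b} e = cong (λ t → + d t) (toℕ-injective′ (trans (toℕ-cls a) (trans e (sym (toℕ-cls b)))))
    where
    open import Data.Fin.Properties renaming (toℕ-injective to toℕ-injective′)

  deg≥0 : ∀ d a → 0ℤ ≤ deg d a
  deg≥0 d a = +≤+ z≤n

  -- rank v i j = min_l (d_l + (i - l)⁺ + (l - j)⁺)
  record RankIs (d : Degree n) (v : Perm) : Set where
    field
      flux   : ∀ k → rank v k k ≤ deg d k
      attain : ∀ i j → ∃[ l ] deg d l + (i - l) ⁺ + (l - j) ⁺ ≤ rank v i j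

  open RankIs public

  root-nonNeg : ∀ {a b} → a ≤ b → ∀ k → 0ℤ ≤ φ (k - a) - φ (k - b)
  root-nonNeg {a} {b} p k = linear (φ (k - b) ∷ φ (k - a) ∷ []) (λ x y → x :≤ y ⇒ ⊢ con 0ℤ :≤ y :- x)
      (φ-mono {k - b} {k - a} (linear (a ∷ b ∷ k ∷ []) (λ x y z → x :≤ y ⇒ ⊢ z :- y :≤ z :- x) p))

  root-extendʳ : ∀ p q k → φ (k - p) - φ (k - (q + 1ℤ)) ≡ φ (k - p) - φ (k - q) + δ k q
  root-extendʳ p q k = linear-by (byEquations (1ℤ ∷ -1ℤ ∷ []))
      (φ (k - q) ∷ φ (k - 1ℤ - q) ∷ δ k q ∷ φ (k - (q + 1ℤ)) ∷ φ (k - p) ∷ [])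
      (λ x y z u v → x :≡ y :+ z ⇒ u :≡ y ⇒ ⊢ v :- u :≡ v :- x :+ z) (φ-δ k q)
      (cong φ {k - (q + 1ℤ)} {k - 1ℤ - q} (linear (k ∷ q ∷ [])
      (λ x y → ⊢ x :- (y :+ con 1ℤ) :≡ x :- con 1ℤ :- y)))

  root-extendˡ : ∀ p q k → φ (k - (p - 1ℤ)) - φ (k - q) ≡ φ (k - p) - φ (k - q) + δ k (p - 1ℤ)
  root-extendˡ p q k = linear (φ (k - (p - 1ℤ)) ∷ φ (k - 1ℤ - (p - 1ℤ)) ∷ δ k (p - 1ℤ) ∷ φ (k - p) ∷ φ (k - q) ∷
      []) (λ x y z u v → x :≡ y :+ z ⇒ y :≡ u ⇒ ⊢ x :- v :≡ u :- v :+ z) (φ-δ k (p - 1ℤ))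
      (cong φ {k - 1ℤ - (p - 1ℤ)} {k - p} (linear (k ∷ p ∷ [])
      (λ x y → ⊢ x :- con 1ℤ :- (y :- con 1ℤ) :≡ x :- y)))

  -- Maximal roots below a degree with a zero

  module _ {d : Degree n} {α : Q n} (M : MaximalRoot d α) (k₀ : ℤ) (zero₀ : deg d k₀ ≡ 0ℤ)
           {p q : ℤ} (p<q : p < q) (ne : res p ≢ res q) (α≗ : α ≗ root p q) where

    private
      hatα : ∀ k → hat α k ≡ φ (k - p) - φ (k - q)
      hatα k = trans (α≗ (cls k)) (hat-root p q k)

      below : ∀ k → φ (k - p) - φ (k - q) ≤ deg d k
      below k = subst (_≤ deg d k) (hatα k) (proj₁ (proj₂ M) (cls k))

      flat : φ (k₀ - p) ≡ φ (k₀ - q)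
      flat = linear-by (byBoth (1ℤ ∷ 1ℤ ∷ 1ℤ ∷ 0ℤ ∷ []) (1ℤ ∷ 0ℤ ∷ 0ℤ ∷ []))
          (φ (k₀ - p) ∷ φ (k₀ - q) ∷ deg d k₀ ∷ []) (λ x y z → x :- y :≤ z ⇒ z :≡ con 0ℤ ⇒ con 0ℤ :≤ x :- y ⇒ ⊢ x
          :≡ y) (below k₀) zero₀ (root-nonNeg {p} {q} (<⇒≤ p<q) k₀)

    -- An interval with at least `n` elements meets every class, but `d` vanishes at `k₀`.
    maximal-short : q < p + N
    maximal-short = ≰⇒> (λ l → 1≰0 (linear (φ (k₀ - p) ∷ φ (k₀ - q) ∷ φ (k₀ - (p + N)) ∷ [])
        (λ x y z → x :≡ y ⇒ y :≤ z ⇒ z :≡ x :- con 1ℤ ⇒ ⊢ con 1ℤ :≤ con 0ℤ) flat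
        (φ-mono {k₀ - q} {k₀ - (p + N)} (linear (p ∷ N ∷ q ∷ k₀ ∷ [])
        (λ x y z u → x :+ y :≤ z ⇒ ⊢ u :- z :≤ u :- (x :+ y)) l)) (φ--N k₀ p)))

    private
      at-q : φ (q - p) - φ (q - q) ≡ 0ℤ
      at-q = linear-by (byEquations (1ℤ ∷ -1ℤ ∷ [])) (φ (q - p) ∷ φ (q - q) ∷ [])
          (λ x y → x :≡ con 0ℤ ⇒ y :≡ con 0ℤ ⇒ ⊢ x :- y :≡ con 0ℤ)
          (φ-small {q - p} (linear (p ∷ q ∷ []) (λ x y → x :< y ⇒ ⊢ con 0ℤ :≤ y :- x) p<q)
          (linear (q ∷ p ∷ N ∷ []) (λ x y z → x :< y :+ z ⇒ ⊢ x :- y :< z) maximal-short))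
          (φ-small {q - q} (linear (q ∷ []) (λ x → ⊢ con 0ℤ :≤ x :- x))
          (linear (N ∷ q ∷ []) (λ x y → con (+ 3) :≤ x ⇒ ⊢ y :- y :< x) 3≤N))

      at-p : φ (p - 1ℤ - p) - φ (p - 1ℤ - q) ≡ 0ℤ
      at-p = linear-by (byEquations (1ℤ ∷ -1ℤ ∷ [])) (φ (p - 1ℤ - p) ∷ φ (p - 1ℤ - q) ∷ [])
          (λ x y → x :≡ con -1ℤ ⇒ y :≡ con -1ℤ ⇒ ⊢ x :- y :≡ con 0ℤ)
          (φ-minus {p - 1ℤ - p} (linear (N ∷ p ∷ []) (λ x y → con (+ 3) :≤ x ⇒ ⊢ opp x :≤ y :- con 1ℤ :- y) 3≤N)
          (linear (p ∷ []) (λ x → ⊢ x :- con 1ℤ :- x :< con 0ℤ)))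
          (φ-minus {p - 1ℤ - q} (linear (q ∷ p ∷ N ∷ []) (λ x y z → x :< y :+ z ⇒ ⊢ opp z :≤ y :- con 1ℤ :- x)
          maximal-short) (linear (p ∷ q ∷ []) (λ x y → x :< y ⇒ ⊢ x :- con 1ℤ :- y :< con 0ℤ) p<q))

      -- Here the interval misses the class of `q` only, and `k₀` is missed.
      wrap : res p ≡ res (q + 1ℤ) → res k₀ ≡ res q
      wrap e = res-+-cancel 1ℤ (trans (δ-one {k₀ + 1ℤ} {p} (linear
          (φ (k₀ + 1ℤ - p) ∷ φ (k₀ - p) ∷ δ (k₀ + 1ℤ) p ∷ φ (k₀ - q) ∷ [])
          (λ x y z u → x :≡ y :+ z ⇒ y :≡ u ⇒ u :≡ x :- con 1ℤ ⇒ ⊢ con 1ℤ :≤ z) step flat moved)) e)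
        where
        step : φ (k₀ + 1ℤ - p) ≡ φ (k₀ - p) + δ (k₀ + 1ℤ) p
        step = trans (φ-δ (k₀ + 1ℤ) p) (cong (λ t → φ (t - p) + δ (k₀ + 1ℤ) p) {k₀ + 1ℤ - 1ℤ} {k₀}
            (linear (k₀ ∷ []) (λ x → ⊢ x :+ con 1ℤ :- con 1ℤ :≡ x)))
        q+1 : q + 1ℤ ≡ p + N
        q+1 = decide (<-cmp (q + 1ℤ) (p + N))
          where
          decide : _ → q + 1ℤ ≡ p + N
          decide (tri< l _ _) = ⊥-elim (res≢-offset {p} {q + 1ℤ}
              (linear (p ∷ q ∷ []) (λ x y → x :< y ⇒ ⊢ con 0ℤ :< y :+ con 1ℤ :- x) p<q)
              (linear (q ∷ p ∷ N ∷ []) (λ x y z → x :+ con 1ℤ :< y :+ z ⇒ ⊢ x :+ con 1ℤ :- y :< z) l) e)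
          decide (tri≈ _ f _) = f
          decide (tri> _ _ l) = ⊥-elim (1≰0 (linear (p ∷ N ∷ q ∷ [])
              (λ x y z → x :+ y :< z :+ con 1ℤ ⇒ z :< x :+ y ⇒ ⊢ con 1ℤ :≤ con 0ℤ) l maximal-short))
        moved : φ (k₀ - q) ≡ φ (k₀ + 1ℤ - p) - 1ℤ
        moved = trans (cong φ {k₀ - q} {k₀ + 1ℤ - (p + N)} (linear-by (byEquations (-1ℤ ∷ []))
            (q ∷ p ∷ N ∷ k₀ ∷ []) (λ x y z u → x :+ con 1ℤ :≡ y :+ z ⇒ ⊢ u :- x :≡ u :+ con 1ℤ :- (y :+ z)) q+1))
            (φ--N (k₀ + 1ℤ) p)

      -- If `d` were positive at `s`, the root enlarged by the simple root at `s` would still be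
      -- below `d`, against maximality.
      no-extension : ∀ {p′ q′} → p′ < q′ → res p′ ≢ res q′ → ∀ s →
        (∀ k → φ (k - p′) - φ (k - q′) ≡ φ (k - p) - φ (k - q) + δ k s) →
        φ (s - p) - φ (s - q) ≡ 0ℤ → deg d s ≡ 0ℤ
      no-extension {p′} {q′} l ne′ s grow at-s = decide (deg d s ≟ 0ℤ)
        where
        β : Q n
        β = root p′ q′
        hatβ : ∀ k → hat β k ≡ φ (k - p) - φ (k - q) + δ k s
        hatβ k = trans (hat-root p′ q′ k) (grow k)
        decide : Dec (deg d s ≡ 0ℤ) → deg d s ≡ 0ℤ
        decide (yes e) = e
        decide (no e)  = ⊥-elim (1≢0 (linear-by (byBoth (0ℤ ∷ -1ℤ ∷ -1ℤ ∷ 1ℤ ∷ -1ℤ ∷ [])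
            (0ℤ ∷ -1ℤ ∷ -1ℤ ∷ 1ℤ ∷ -1ℤ ∷ [])) (hat α s ∷ hat β s ∷ φ (s - p) ∷ φ (s - q) ∷ δ s s ∷ [])
            (λ x y z u v → x :≡ y ⇒ y :≡ z :- u :+ v ⇒ x :≡ z :- u ⇒ v :≡ con 1ℤ ⇒ ⊢ con 1ℤ :≡ con 0ℤ) (equal s)
            (hatβ s) (hatα s) (δ-yes {s} {s} refl)))
          where
          1≢0 : ¬ 1ℤ ≡ 0ℤ
          1≢0 ()
          positive : 1ℤ ≤ deg d s
          positive = i<j⇒suc[i]≤j (≤∧≢⇒< (deg≥0 d s) (e ∘ sym))
          β≤d : ∀ k → hat β k ≤ deg d k
          β≤d k = go (res k ℕ.≟ res s)
            where
            go : Dec (res k ≡ res s) → hat β k ≤ deg d k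
            go (yes f) = linear-by (byCombination (1ℤ ∷ 1ℤ ∷ 1ℤ ∷ 1ℤ ∷ 1ℤ ∷ -1ℤ ∷ []))
                (hat β k ∷ hat β s ∷ φ (s - p) ∷ φ (s - q) ∷ δ s s ∷ deg d k ∷ deg d s ∷ [])
                (λ x y z u v w p → x :≡ y ⇒ y :≡ z :- u :+ v ⇒ z :- u :≡ con 0ℤ ⇒ v :≡ con 1ℤ ⇒ w :≡ p ⇒ con 1ℤ
                :≤ p ⇒ ⊢ x :≤ w) (hat-cong β {k} {s} f) (hatβ s) at-s (δ-yes {s} {s} refl) (deg-cong d {k} {s} f)
                positive
            go (no f)  = linear (hat β k ∷ φ (k - p) ∷ φ (k - q) ∷ δ k s ∷ deg d k ∷ [])
                (λ x y z u v → x :≡ y :- z :+ u ⇒ u :≡ con 0ℤ ⇒ y :- z :≤ v ⇒ ⊢ x :≤ v) (hatβ k) (δ-no {k} {s} f)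
                (below k)
          α≤β : ∀ k → hat α k ≤ hat β k
          α≤β k = linear-by (byCombination (1ℤ ∷ 1ℤ ∷ -1ℤ ∷ []))
              (hat α k ∷ φ (k - p) ∷ φ (k - q) ∷ hat β k ∷ δ k s ∷ [])
              (λ x y z u v → x :≡ y :- z ⇒ u :≡ y :- z :+ v ⇒ con 0ℤ :≤ v ⇒ ⊢ x :≤ u) (hatα k) (hatβ k)
              (proj₁ (δ-range k s))
          unhat : ∀ {μ : Q n} {f : ℤ → ℤ} (R : ℤ → ℤ → Set) → (∀ k → R (hat μ k) (f k)) → ∀ i → R (μ i) (f (pt i))
          unhat {μ} {f} R h i = subst (λ t → R (μ t) (f (pt i))) (cls-toℕ i) (h (pt i))
          equal : ∀ k → hat α k ≡ hat β k
          equal k = proj₂ (proj₂ M) β (root⇒positive l ne′ (λ _ → refl))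
            (λ i → subst (λ t → β i ≤ + d t) (cls-toℕ i) (unhat {β} {deg d} _≤_ β≤d i))
            (λ i → subst (λ t → α i ≤ β t) (cls-toℕ i) (unhat {α} {hat β} _≤_ α≤β i)) (cls k)

    -- Extension to the right by one element is excluded by maximality, unless it closes the cycle
    -- and gives no real root; then `q` is congruent to `k₀`.
    maximal-right : deg d q ≡ 0ℤ
    maximal-right = go (res p ℕ.≟ res (q + 1ℤ))
      where
      go : Dec (res p ≡ res (q + 1ℤ)) → deg d q ≡ 0ℤ
      go (yes e) = trans (sym (deg-cong d {k₀} {q} (wrap e))) zero₀
      go (no e)  = no-extension {p} {q + 1ℤ} (linear (p ∷ q ∷ []) (λ x y → x :< y ⇒ ⊢ x :< y :+ con 1ℤ) p<q) e q
          (root-extendʳ p q) at-q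

    maximal-left : deg d (p - 1ℤ) ≡ 0ℤ
    maximal-left = go (res p ℕ.≟ res (q + 1ℤ))
      where
      p-1+1 : p - 1ℤ + 1ℤ ≡ p
      p-1+1 = linear (p ∷ []) (λ x → ⊢ x :- con 1ℤ :+ con 1ℤ :≡ x)
      go : Dec (res p ≡ res (q + 1ℤ)) → deg d (p - 1ℤ) ≡ 0ℤ
      go (yes e) = trans (deg-cong d {p - 1ℤ} {q} (res-+-cancel 1ℤ (trans (cong res p-1+1) e))) maximal-right
      go (no e)  = no-extension {p - 1ℤ} {q} (linear (p ∷ q ∷ []) (λ x y → x :< y ⇒ ⊢ x :- con 1ℤ :< y) p<q)
        (λ f → e (trans (cong res (sym p-1+1)) (res-+ 1ℤ f))) (p - 1ℤ) (root-extendˡ p q) at-p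

  ⁺-triangle : ∀ x y z → (x - z) ⁺ ≤ (x - y) ⁺ + (y - z) ⁺
  ⁺-triangle x y z = ⁺-least (linear (x ∷ y ∷ (x - y) ⁺ ∷ z ∷ (y - z) ⁺ ∷ [])
      (λ x y z u v → x :- y :≤ z ⇒ y :- u :≤ v ⇒ ⊢ x :- u :≤ z :+ v) (⁺-upper (x - y)) (⁺-upper (y - z)))
      (linear ((x - y) ⁺ ∷ (y - z) ⁺ ∷ []) (λ x y → con 0ℤ :≤ x ⇒ con 0ℤ :≤ y ⇒ ⊢ con 0ℤ :≤ x :+ y)
      (⁺-nonNeg (x - y)) (⁺-nonNeg (y - z)))

  -- The core of the recursion for z_d: d = d′ + [p,q) with d zero at both ends.
  attain-step : ∀ (D D′ : ℤ → ℤ) {p q} (ne : res p ≢ res q) → p < q → q < p + N →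
    (∀ k → D k ≡ D′ k + (φ (k - p) - φ (k - q))) → (∀ k → 0ℤ ≤ D′ k) →
    (∀ {a b} → res a ≡ res b → D a ≡ D b) → D (p - 1ℤ) ≡ 0ℤ → D q ≡ 0ℤ →
    ∀ i k j l → ∃[ l′ ] D l′ + (i - l′) ⁺ + (l′ - j) ⁺ ≤
      D′ l + (i - l) ⁺ + (l - k) ⁺ + rank (transposition p q ne) k j
  attain-step D D′ {p} {q} ne p<q short D≡ D′≥0 Dcong Dp Dq i k j l = go (φ (l - p) ≟ φ (l - q))
    where
    S≥ : (k - j) ⁺ ≤ rank (transposition p q ne) k j
    S≥ = rank≥diff⁺ (balanced-transposition p q ne) k j
    Goal : Set
    Goal = ∃[ l′ ] D l′ + (i - l′) ⁺ + (l′ - j) ⁺ ≤ D′ l + (i - l) ⁺ + (l - k) ⁺ + rank (transposition p q ne) k j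
    go : Dec (φ (l - p) ≡ φ (l - q)) → Goal
    -- `l` lies outside the translates of the interval, so `D` and `D′` agree there.
    go (yes e) = l , linear (D l ∷ D′ l ∷ φ (l - p) ∷ φ (l - q) ∷ (l - j) ⁺ ∷ (l - k) ⁺ ∷ (k - j) ⁺ ∷ rank
        (transposition p q ne) k j ∷ (i - l) ⁺ ∷ []) (λ x y z u v w p q r → x :≡ y :+ (z :- u) ⇒ z :≡ u ⇒ v :≤ w
        :+ p ⇒ p :≤ q ⇒ ⊢ x :+ r :+ v :≤ y :+ r :+ w :+ q) (D≡ l) e (⁺-triangle l k j) S≥
    go (no e)  = cases (k <? p′) (k <? q′) (j <? p′) (j <? q′)
      where
      -- The translate `[p′, q′)` of the interval is the one that contains `l`.
      t p′ q′ : ℤ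
      t = φ (l - p)
      p′ = p + N· t
      q′ = q + N· t
      p′≡ : p′ ≡ p + N· t
      p′≡ = refl
      q′≡ : q′ ≡ q + N· t
      q′≡ = refl
      low : φ (l - q) ≡ t - 1ℤ
      low = ≤-antisym (linear-by (byCombination (1ℤ ∷ 1ℤ ∷ -1ℤ ∷ [])) (φ (l - q) ∷ φ (l - p) ∷ t ∷ [])
          (λ x y z → x :< y ⇒ z :≡ y ⇒ ⊢ x :≤ z :- con 1ℤ) (≤∧≢⇒<
          (φ-mono {l - q} {l - p} (linear (p ∷ q ∷ l ∷ []) (λ x y z → x :< y ⇒ ⊢ z :- y :≤ z :- x) p<q))
          (λ f → e (sym f))) t≡)
        (linear-by (byCombination (1ℤ ∷ 1ℤ ∷ -1ℤ ∷ [])) (t ∷ φ (l - p) ∷ φ (l - (p + N)) ∷ φ (l - q) ∷ [])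
            (λ x y z u → x :≡ y ⇒ z :≡ y :- con 1ℤ ⇒ z :≤ u ⇒ ⊢ x :- con 1ℤ :≤ u) t≡ (φ--N l p)
            (φ-mono {l - (p + N)} {l - q} (linear (q ∷ p ∷ N ∷ l ∷ [])
            (λ x y z u → x :< y :+ z ⇒ ⊢ u :- (y :+ z) :≤ u :- x) short)))
        where
        t≡ : t ≡ φ (l - p)
        t≡ = refl
      p′≤l : p′ ≤ l
      p′≤l = linear (p′ ∷ p ∷ N· t ∷ l ∷ []) (λ x y z u → x :≡ y :+ z ⇒ z :≤ u :- y ⇒ ⊢ x :≤ u) p′≡ lower
        where
        lower : N· t ≤ l - p
        lower = φ-lower (l - p)
      l<q′ : l < q′
      l<q′ = linear-by (byCombination (1ℤ ∷ -1ℤ ∷ [])) (q′ ∷ q ∷ N· t ∷ l ∷ N· φ (l - q) ∷ N ∷ N· (t - 1ℤ) ∷ [])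
          (λ x y z u v w p → x :≡ y :+ z ⇒ u :- y :< v :+ w ⇒ v :≡ p ⇒ p :≡ z :- w ⇒ ⊢ u :< x) q′≡
          (φ-upper (l - q)) (cong N·_ low) (N·--1 t)
      D-l : D l ≡ D′ l + 1ℤ
      D-l = linear-by (byEquations (1ℤ ∷ -1ℤ ∷ -1ℤ ∷ [])) (D l ∷ D′ l ∷ φ (l - p) ∷ φ (l - q) ∷ t ∷ [])
          (λ x y z u v → x :≡ y :+ (z :- u) ⇒ u :≡ v :- con 1ℤ ⇒ v :≡ z ⇒ ⊢ x :≡ y :+ con 1ℤ) (D≡ l) low t≡
        where
        t≡ : t ≡ φ (l - p)
        t≡ = refl
      D-p′ : D (p′ - 1ℤ) ≡ 0ℤ
      D-p′ = trans (Dcong {p′ - 1ℤ} {p - 1ℤ} (res-+ -1ℤ (res-shift p t))) Dp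
      D-q′ : D q′ ≡ 0ℤ
      D-q′ = trans (Dcong {q′} {q} (res-shift q t)) Dq
      ne′ : res p′ ≢ res q′
      ne′ f = ne (trans (sym (res-shift p t)) (trans f (res-shift q t)))
      S≡ : rank (transposition p q ne) k j ≡ rank (transposition p′ q′ ne′) k j
      S≡ = rank-cong {transposition p q ne} {transposition p′ q′ ne′}
        (transpose-shift ne (sym (res-shift p t)) (linear-by (byEquations (1ℤ ∷ -1ℤ ∷ []))
            (p′ ∷ p ∷ N· t ∷ q′ ∷ q ∷ []) (λ x y z u v → x :≡ y :+ z ⇒ u :≡ v :+ z ⇒ ⊢ v :- y :≡ u :- x) p′≡
            q′≡)) k j
      right : k ≡ k → (q′ - j) ⁺ ≤ (k - j) ⁺ ⊎ (q′ ≤ j) → Goal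
      right _ (inj₁ f) = q′ , linear (D q′ ∷ D′ l ∷ (i - q′) ⁺ ∷ (i - l) ⁺ ∷ (q′ - j) ⁺ ∷ (k - j) ⁺ ∷ rank
          (transposition p q ne) k j ∷ (l - k) ⁺ ∷ []) (λ x y z u v w p q → x :≡ con 0ℤ ⇒ con 0ℤ :≤ y ⇒ z :≤ u ⇒
          v :≤ w ⇒ w :≤ p ⇒ con 0ℤ :≤ q ⇒ ⊢ x :+ z :+ v :≤ y :+ u :+ q :+ p) D-q′ (D′≥0 l)
          (⁺-mono {i - q′} {i - l} (linear (l ∷ q′ ∷ i ∷ []) (λ x y z → x :< y ⇒ ⊢ z :- y :≤ z :- x) l<q′)) f S≥
          (⁺-nonNeg (l - k))
      right _ (inj₂ f) = q′ , linear (D q′ ∷ D′ l ∷ (i - q′) ⁺ ∷ (i - l) ⁺ ∷ (q′ - j) ⁺ ∷ (k - j) ⁺ ∷ rank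
          (transposition p q ne) k j ∷ (l - k) ⁺ ∷ []) (λ x y z u v w p q → x :≡ con 0ℤ ⇒ con 0ℤ :≤ y ⇒ z :≤ u ⇒
          v :≡ con 0ℤ ⇒ w :≤ p ⇒ con 0ℤ :≤ q ⇒ con 0ℤ :≤ w ⇒ ⊢ x :+ z :+ v :≤ y :+ u :+ q :+ p) D-q′ (D′≥0 l)
          (⁺-mono {i - q′} {i - l} (linear (l ∷ q′ ∷ i ∷ []) (λ x y z → x :< y ⇒ ⊢ z :- y :≤ z :- x) l<q′))
          (⁺-neg {q′ - j} (linear (q′ ∷ j ∷ []) (λ x y → x :≤ y ⇒ ⊢ x :- y :≤ con 0ℤ) f)) S≥ (⁺-nonNeg (l - k))
          (⁺-nonNeg (k - j))
      -- `D` vanishes at `p′ − 1` and at `q′`, and one of these replaces `l` as soon as `k`, or else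
      -- `j`, lies outside the interval on that side. If both lie inside, `l` is kept, and the
      -- strand of the reflection that joins the two ends pays for the extra unit in `D l`.
      cases : Dec (k < p′) → Dec (k < q′) → Dec (j < p′) → Dec (j < q′) → Goal
      cases (yes kp) _ _ _ = p′ - 1ℤ , linear-by (byCombination (1ℤ ∷ 1ℤ ∷ 1ℤ ∷ 1ℤ ∷ 1ℤ ∷ -1ℤ ∷ []))
          (D (p′ - 1ℤ) ∷ D′ l ∷ (k - j) ⁺ ∷ rank (transposition p q ne) k j ∷ (i - (p′ - 1ℤ)) ⁺ ∷ (i - l) ⁺ ∷ l ∷
          p′ ∷ (l - k) ⁺ ∷ k ∷ (p′ - 1ℤ - j) ⁺ ∷ []) (λ x y z u v w p q r s x10 → x :≡ con 0ℤ ⇒ con 0ℤ :≤ y ⇒ z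
          :≤ u ⇒ v :≤ w :+ (p :- (q :- con 1ℤ)) ⇒ r :≡ p :- s ⇒ x10 :≤ q :- con 1ℤ :- s :+ z ⇒ ⊢ x :+ v :+ x10 :≤
          y :+ w :+ r :+ u) D-p′ (D′≥0 l) S≥ (⁺-least {i - (p′ - 1ℤ)} {(i - l) ⁺ + (l - (p′ - 1ℤ))}
          (linear (i ∷ l ∷ (i - l) ⁺ ∷ p′ ∷ []) (λ x y z u → x :- y :≤ z ⇒ ⊢ x :- (u :- con 1ℤ) :≤ z :+
          (y :- (u :- con 1ℤ))) (⁺-upper (i - l))) (linear ((i - l) ⁺ ∷ p′ ∷ l ∷ [])
          (λ x y z → con 0ℤ :≤ x ⇒ y :≤ z ⇒ ⊢ con 0ℤ :≤ x :+ (z :- (y :- con 1ℤ))) (⁺-nonNeg (i - l)) p′≤l))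
          (⁺-pos {l - k} (linear (p′ ∷ l ∷ k ∷ []) (λ x y z → x :≤ y ⇒ z :< x ⇒ ⊢ con 0ℤ :≤ y :- z) p′≤l kp))
          (⁺-least {p′ - 1ℤ - j} {p′ - 1ℤ - k + (k - j) ⁺} (linear (k ∷ j ∷ (k - j) ⁺ ∷ p′ ∷ [])
          (λ x y z u → x :- y :≤ z ⇒ ⊢ u :- con 1ℤ :- y :≤ u :- con 1ℤ :- x :+ z) (⁺-upper (k - j)))
          (linear (k ∷ p′ ∷ (k - j) ⁺ ∷ []) (λ x y z → x :< y ⇒ con 0ℤ :≤ z ⇒ ⊢ con 0ℤ :≤ y :- con 1ℤ :- x :+ z)
          kp (⁺-nonNeg (k - j))))
      cases (no _) (no kq) _ _ = right refl (inj₁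
          (⁺-mono {q′ - j} {k - j} (linear (q′ ∷ k ∷ j ∷ []) (λ x y z → x :≤ y ⇒ ⊢ x :- z :≤ y :- z) (≮⇒≥ kq))))
      cases (no kp) (yes kq) (yes jp) _ = p′ - 1ℤ , linear (D (p′ - 1ℤ) ∷ D′ l ∷ (k - j) ⁺ ∷ rank
          (transposition p q ne) k j ∷ (i - (p′ - 1ℤ)) ⁺ ∷ (i - l) ⁺ ∷ (l - k) ⁺ ∷ k ∷ p′ ∷ j ∷ (p′ - 1ℤ - j) ⁺ ∷
          []) (λ x y z u v w p q r s x10 → x :≡ con 0ℤ ⇒ con 0ℤ :≤ y ⇒ z :≤ u ⇒ v :≤ w :+ p :+
          (q :- (r :- con 1ℤ)) ⇒ q :- s :≤ z ⇒ x10 :≡ r :- con 1ℤ :- s ⇒ ⊢ x :+ v :+ x10 :≤ y :+ w :+ p :+ u)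
          D-p′ (D′≥0 l) S≥ (⁺-least {i - (p′ - 1ℤ)} {(i - l) ⁺ + (l - k) ⁺ + (k - (p′ - 1ℤ))}
          (linear (i ∷ l ∷ (i - l) ⁺ ∷ k ∷ (l - k) ⁺ ∷ p′ ∷ [])
          (λ x y z u v w → x :- y :≤ z ⇒ y :- u :≤ v ⇒ ⊢ x :- (w :- con 1ℤ) :≤ z :+ v :+ (u :- (w :- con 1ℤ)))
          (⁺-upper (i - l)) (⁺-upper (l - k))) (linear ((i - l) ⁺ ∷ (l - k) ⁺ ∷ p′ ∷ k ∷ [])
          (λ x y z u → con 0ℤ :≤ x ⇒ con 0ℤ :≤ y ⇒ z :≤ u ⇒ ⊢ con 0ℤ :≤ x :+ y :+ (u :- (z :- con 1ℤ)))
          (⁺-nonNeg (i - l)) (⁺-nonNeg (l - k)) (≮⇒≥ kp))) (⁺-upper (k - j))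
          (⁺-pos {p′ - 1ℤ - j} (linear (j ∷ p′ ∷ []) (λ x y → x :< y ⇒ ⊢ con 0ℤ :≤ y :- con 1ℤ :- x) jp))
      cases (no kp) (yes kq) (no jp) (no jq) = right refl (inj₂ (≮⇒≥ jq))
      cases (no kp) (yes kq) (no jp) (yes jq) = l , linear-by (byCombination (1ℤ ∷ 1ℤ ∷ -1ℤ ∷ []))
          (D l ∷ D′ l ∷ rank (transposition p q ne) k j ∷ rank (transposition p′ q′ ne′) k j ∷ (l - j) ⁺ ∷
          (l - k) ⁺ ∷ (k - j) ⁺ ∷ (i - l) ⁺ ∷ []) (λ x y z u v w p q → x :≡ y :+ con 1ℤ ⇒ z :≡ u ⇒ v :≤ w :+ p ⇒
          p :+ con 1ℤ :≤ u ⇒ ⊢ x :+ q :+ v :≤ y :+ q :+ w :+ z) D-l S≡ (⁺-triangle l k j)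
          (rank-transposition-inside ne′ k j (≮⇒≥ kp) kq (≮⇒≥ jp) jq)

  rep⇒≃ : ∀ {u : W n} {α p q} (ne : res p ≢ res q) → α ≗ root p q → ⟦ u ⟧ ≐ reflection α → perm u ≃ transposition
      p q ne
  rep⇒≃ {u} {α} {p} {q} ne f e = rep-faithful (rep-word u) (rep-reflection ne f) (balanced-word u)
      (balanced-transposition p q ne) e

  -- The Hecke product is a min-plus product: the cut `k` itself gives the bound on the diagonal,
  -- and `attain-step` gives the attained value. Since the outcome mentions `d` alone, the choices
  -- of maximal roots leave no trace. The zero `k₀` survives the recursion because roots have
  -- nonnegative coefficients.
  z-rank : ∀ {d w} → IsZ d w → ∀ k₀ → deg d k₀ ≡ 0ℤ → RankIs d (perm w)
  z-rank {d} {w} (z-zero z e) k₀ zero₀ = record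
    { flux   = λ k → linear (rank (perm w) k k ∷ rank 1ₚ k k ∷ deg d k ∷ [])
        (λ x y z → x :≡ y ⇒ y :≡ con 0ℤ ⇒ con 0ℤ :≤ z ⇒ ⊢ x :≤ z) (w≃1 k k) (rank-1 k) (deg≥0 d k)
    ; attain = λ i j → i , linear-by (byCombination (1ℤ ∷ 1ℤ ∷ 1ℤ ∷ 1ℤ ∷ -1ℤ ∷ []))
        (+ d (cls i) ∷ (i + - i) ⁺ ∷ (+ 0) ⁺ ∷ rank (perm w) i j ∷ rank 1ₚ i j ∷ (i - j) ⁺ ∷ [])
        (λ x y z u v w → x :≡ con 0ℤ ⇒ y :≡ z ⇒ z :≡ con 0ℤ ⇒ u :≡ v ⇒ w :≤ v ⇒ ⊢ x :+ y :+ w :≤ u)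
        (cong +_ (z (cls i))) (cong _⁺ (+-inverseʳ i)) (⁺-pos {0ℤ} ≤-refl) (w≃1 i j) (rank≥diff⁺ balanced-1 i j)
    }
    where
    w≃1 : ∀ i j → rank (perm w) i j ≡ rank 1ₚ i j
    w≃1 = rank-cong {perm w} {1ₚ} (≈⇒≃ {w} {[]} e)
  z-rank {d} {w} (z-step {d′ = d′} {α = α} {u = u} {v = v} M e f z (r , r≈v , R , H)) k₀ zero₀ = go
      (positive⇒root (proj₁ M))
    where
    go : IsRoot α → RankIs d (perm w)
    go (p , q , p<q , ne , α≗) = record { flux = flux′ ; attain = attain′ }
      where
      u≃ : ∀ i j → rank (perm u) i j ≡ rank (transposition p q ne) i j
      u≃ = rank-cong {perm u} {transposition p q ne} (rep⇒≃ {u} ne α≗ f)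
      r≃ : ∀ i j → rank (perm r) i j ≡ rank (perm v) i j
      r≃ = rank-cong {perm r} {perm v} (≈⇒≃ {r} {v} r≈v)
      D≡ : ∀ k → deg d k ≡ deg d′ k + (φ (k - p) - φ (k - q))
      D≡ k = linear-by (byEquations (-1ℤ ∷ 1ℤ ∷ [])) (deg d′ k ∷ deg d k ∷ α (cls k) ∷ φ (k - p) ∷ φ (k - q) ∷
          []) (λ x y z u v → x :≡ y :- z ⇒ z :≡ u :- v ⇒ ⊢ y :≡ x :+ (u :- v)) e′
          (trans (α≗ (cls k)) (hat-root p q k))
        where
        e′ : deg d′ k ≡ deg d k - α (cls k)
        e′ = e (cls k)
      IH : RankIs d′ (perm v)
      IH = z-rank z k₀ (linear-by (byBoth (1ℤ ∷ 1ℤ ∷ -1ℤ ∷ 0ℤ ∷ []) (1ℤ ∷ 0ℤ ∷ 0ℤ ∷ 1ℤ ∷ 0ℤ ∷ []))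
          (deg d k₀ ∷ deg d′ k₀ ∷ φ (k₀ - p) ∷ φ (k₀ - q) ∷ [])
          (λ x y z u → x :≡ con 0ℤ ⇒ x :≡ y :+ (z :- u) ⇒ con 0ℤ :≤ y ⇒ con 0ℤ :≤ z :- u ⇒ ⊢ y :≡ con 0ℤ) zero₀
          (D≡ k₀) (deg≥0 d′ k₀) (root-nonNeg {p} {q} (<⇒≤ p<q) k₀))
      flux′ : ∀ k → rank (perm w) k k ≤ deg d k
      flux′ k = linear-by (byCombination (1ℤ ∷ 1ℤ ∷ 1ℤ ∷ 1ℤ ∷ 1ℤ ∷ 1ℤ ∷ -1ℤ ∷ []))
          (rank (perm w) k k ∷ rank (perm r) k k ∷ rank (perm u) k k ∷ rank (perm v) k k ∷ rank
          (transposition p q ne) k k ∷ deg d′ k ∷ φ (k - p) ∷ φ (k - q) ∷ deg d k ∷ [])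
          (λ x y z u v w p q r → x :≤ y :+ z ⇒ y :≡ u ⇒ z :≡ v ⇒ u :≤ w ⇒ v :≡ p :- q ⇒ r :≡ w :+ (p :- q) ⇒ ⊢ x
          :≤ r) (hecke-upper {u} {r} {w} R H k k k) (r≃ k k) (u≃ k k) (flux IH k)
          (rank-transposition ne (<⇒≤ p<q) k) (D≡ k)
      attain′ : ∀ i j → ∃[ l ] deg d l + (i - l) ⁺ + (l - j) ⁺ ≤ rank (perm w) i j
      attain′ i j = combine (hecke-lower {u} {r} {w} H i j)
        where
        combine : _ → ∃[ l ] deg d l + (i - l) ⁺ + (l - j) ⁺ ≤ rank (perm w) i j
        combine (k , low) = choose (attain IH i k)
          where
          choose : (∃[ l ] deg d′ l + (i - l) ⁺ + (l - k) ⁺ ≤ rank (perm v) i k) → ∃[ l ] deg d l + (i - l) ⁺ +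
              (l - j) ⁺ ≤ rank (perm w) i j
          choose (l , at) =
            let l′ , bound = attain-step (deg d) (deg d′) ne p<q (maximal-short M k₀ zero₀ p<q ne α≗) D≡ (deg≥0 d′)
                   (deg-cong d) (maximal-left M k₀ zero₀ p<q ne α≗) (maximal-right M k₀ zero₀ p<q ne α≗) i k j l
            in l′ , linear-by (byCombination (1ℤ ∷ 1ℤ ∷ 1ℤ ∷ 1ℤ ∷ -1ℤ ∷ -1ℤ ∷ []))
                (deg d l′ ∷ (i - l′) ⁺ ∷ (l′ - j) ⁺ ∷ deg d′ l ∷ (i - l) ⁺ ∷ (l - k) ⁺ ∷ rank
                (transposition p q ne) k j ∷ rank (perm v) i k ∷ rank (perm r) i k ∷ rank (perm u) k j ∷ rank
                (perm w) i j ∷ []) (λ x y z u v w p q r s x10 → x :+ y :+ z :≤ u :+ v :+ w :+ p ⇒ u :+ v :+ w :≤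
                q ⇒ r :+ s :≤ x10 ⇒ r :≡ q ⇒ s :≡ p ⇒ ⊢ x :+ y :+ z :≤ x10) bound at low (r≃ i k) (u≃ k j)

  -- Reversal of ℤ

  rev : Perm → Perm
  rev v = record
    { to      = λ a → - to v (- a)
    ; from    = λ a → - from v (- a)
    ; to-from = λ a → trans (cong (λ t → - to v t) (neg-involutive (from v (- a))))
        (trans (cong -_ (to-from v (- a))) (neg-involutive a))
    ; from-to = λ a → trans (cong (λ t → - from v t) (neg-involutive (to v (- a))))
        (trans (cong -_ (from-to v (- a))) (neg-involutive a))
    ; to-N    = λ a → linear-by (byEquations (-1ℤ ∷ [])) (to v (- (a + N)) ∷ a ∷ N ∷ to v (- a) ∷ [])
        (λ x y z u → x :- opp (y :+ z) :≡ u :- opp y ⇒ ⊢ opp x :≡ opp u :+ z)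
        (displacement v { - (a + N)} { - a} (neg-N a))
    }
    where
    displacement : ∀ v {a b} → res a ≡ res b → to v a - a ≡ to v b - b
    displacement v = displacement-cong v
    neg-N : ∀ a → res (- (a + N)) ≡ res (- a)
    neg-N a = trans (sym (res-N (- (a + N)))) (cong res { - (a + N) + N} { - a}
        (linear (a ∷ N ∷ []) (λ x y → ⊢ opp (x :+ y) :+ y :≡ opp x)))

  ΣR-neg : ∀ {F} → Periodic F → ΣR (λ a → F (- a)) ≡ ΣR F
  ΣR-neg P = ΣR-reindex P -_ -_ (λ {a} {b} → res-cong-neg {a} {b}) (λ {a} {b} → res-cong-neg {a} {b})
    (λ a → cong res (neg-involutive a)) (λ a → cong res (neg-involutive a))

  -- The wall `k` separates `k` from `k + 1`, so `a ↦ −a` moves it to `−1 − k`; strands going right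
  -- become strands going left, which the inverse counts.
  rank-rev : ∀ v i j → rank (rev v) i j ≡ rank (inv v) (-1ℤ - j) (-1ℤ - i)
  rank-rev v i j = trans (sym (ΣR-neg (rank-periodic (rev v) i j)))
    (trans (ΣR-cong (λ b → cong _⁺ (flip b))) (sym (rank-inv v (-1ℤ - i) (-1ℤ - j))))
    where
    reflect : ∀ i b → φ (i - - b) ≡ -1ℤ - φ (-1ℤ - i - b)
    reflect i b = trans (cong φ {i - - b} { -1ℤ - (-1ℤ - i - b)}
        (linear (i ∷ b ∷ []) (λ x y → ⊢ x :- opp y :≡ con -1ℤ :- (con -1ℤ :- x :- y)))) (φ-compl (-1ℤ - i - b))
    flip : ∀ b → φ (i - - b) - φ (j - to (rev v) (- b)) ≡ - (φ (-1ℤ - i - b) - φ (-1ℤ - j - to v b))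
    flip b = linear-by (byEquations (1ℤ ∷ -1ℤ ∷ -1ℤ ∷ [])) (φ (i - - b) ∷ φ (-1ℤ - i - b) ∷ φ (j - - to v b) ∷ φ
        (-1ℤ - j - to v b) ∷ φ (j - - to v (- (- b))) ∷ []) (λ x y z u v → x :≡ con -1ℤ :- y ⇒ z :≡ con -1ℤ :- u
        ⇒ v :≡ z ⇒ ⊢ x :- v :≡ opp (y :- u)) (reflect i b) (reflect j (to v b))
        (cong (λ t → φ (j - - to v t)) (neg-involutive b))

  balanced-rev : ∀ {v} → Balanced v → Balanced (rev v)
  balanced-rev {v} B = balanced-from-origin (rev v)
    (linear-by (byEquations (-1ℤ ∷ 1ℤ ∷ -1ℤ ∷ -1ℤ ∷ [])) (rank (rev v) 0ℤ 0ℤ ∷ rank (inv (rev v)) 0ℤ 0ℤ ∷ defect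
        (rev v) 0ℤ 0ℤ ∷ rank (inv v) (-1ℤ - 0ℤ) (-1ℤ - 0ℤ) ∷ rank (inv (inv v)) (-1ℤ - 0ℤ) (-1ℤ - 0ℤ) ∷ [])
        (λ x y z u v → x :≡ y :+ z ⇒ x :≡ u ⇒ y :≡ v ⇒ v :≡ u :+ (con -1ℤ :- con 0ℤ :- (con -1ℤ :- con 0ℤ)) ⇒ ⊢ z
        :≡ con 0ℤ) (rank-defect (rev v) 0ℤ 0ℤ) (rank-rev v 0ℤ 0ℤ) (rank-rev (inv v) 0ℤ 0ℤ)
        (rank-balance B (-1ℤ - 0ℤ) (-1ℤ - 0ℤ)))

  -- t_{m(e_x − e_y)} moves the class of x by mn and the class of y by −mn.
  weight : ℕ → ℤ → ℤ → ℤ → ℤ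
  weight m x y p = + m * (δ p x - δ p y)

  module _ (m : ℕ) {x y : ℤ} (ne : res x ≢ res y) where

    weight-x : ∀ {p} → res p ≡ res x → weight m x y p ≡ + m
    weight-x {p} e = trans (cong (λ t → + m * t) {δ p x - δ p y} {1ℤ}
        (linear-by (byEquations (1ℤ ∷ -1ℤ ∷ [])) (δ p x ∷ δ p y ∷ [])
        (λ x y → x :≡ con 1ℤ ⇒ y :≡ con 0ℤ ⇒ ⊢ x :- y :≡ con 1ℤ) (δ-yes {p} {x} e)
        (δ-no {p} {y} (λ f → ne (trans (sym e) f)))))
      (*-identityʳ (+ m))

    weight-y : ∀ {p} → res p ≡ res y → weight m x y p ≡ - + m
    weight-y {p} e = trans (cong (λ t → + m * t) {δ p x - δ p y} { -1ℤ}
        (linear-by (byEquations (-1ℤ ∷ 1ℤ ∷ [])) (δ p y ∷ δ p x ∷ [])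
        (λ x y → x :≡ con 1ℤ ⇒ y :≡ con 0ℤ ⇒ ⊢ y :- x :≡ con -1ℤ) (δ-yes {p} {y} e)
        (δ-no {p} {x} (λ f → ne (trans (sym f) e)))))
      (trans (*-comm (+ m) -1ℤ) (-1*i≡-i (+ m)))

  weight-o : ∀ m {x y p} → res p ≢ res x → res p ≢ res y → weight m x y p ≡ 0ℤ
  weight-o m {x} {y} {p} f g = trans (cong (λ t → + m * t) {δ p x - δ p y} {0ℤ}
      (linear-by (byEquations (1ℤ ∷ -1ℤ ∷ [])) (δ p x ∷ δ p y ∷ [])
      (λ x y → x :≡ con 0ℤ ⇒ y :≡ con 0ℤ ⇒ ⊢ x :- y :≡ con 0ℤ) (δ-no {p} {x} f) (δ-no {p} {y} g))) (*-zeroʳ (+ m))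

  weight-cong : ∀ m x y {p q} → res p ≡ res q → weight m x y p ≡ weight m x y q
  weight-cong m x y {p} {q} e = cong₂ (λ s t → + m * (s - t)) (δ-cong {p} {q} {x} e) (δ-cong {p} {q} {y} e)

  Translates : Perm → Perm → ℕ → ℤ → ℤ → Set
  Translates w z m x y = ∀ a → to w a ≡ to z a + N· weight m x y (to z a)

  -- Indexed by the values of `z`, a translation shifts each signed summand by its weight, before
  -- the positive part is taken.
  rank-translated : ∀ {w z m x y} → Translates w z m x y → ∀ i j →
    rank w i j ≡ ΣR (λ p → (φ (i - from z p) - φ (j - p) + weight m x y p) ⁺)
  rank-translated {w} {z} {m} {x} {y} T i j = begin
    rank w i j
      ≡⟨ ΣR-cong (λ a → cong _⁺ (term a)) ⟩
    ΣR (λ a → (φ (i - from z (to z a)) - φ (j - to z a) + weight m x y (to z a)) ⁺)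
      ≡⟨ ΣR-perm periodic z ⟩
    ΣR (λ p → (φ (i - from z p) - φ (j - p) + weight m x y p) ⁺) ∎
    where
    open ≡-Reasoning
    term : ∀ a → φ (i - a) - φ (j - to w a) ≡ φ (i - from z (to z a)) - φ (j - to z a) + weight m x y (to z a)
    term a = linear-by (byEquations (-1ℤ ∷ -1ℤ ∷ -1ℤ ∷ [])) (φ (i - from z (to z a)) ∷ φ (i - a) ∷ φ (j - to w a)
        ∷ φ (j - (to z a + N· weight m x y (to z a))) ∷ φ (j - to z a) ∷ weight m x y (to z a) ∷ [])
        (λ x y z u v w → x :≡ y ⇒ z :≡ u ⇒ u :≡ v :- w ⇒ ⊢ y :- z :≡ x :- v :+ w)
        (cong (λ t → φ (i - t)) (from-to z a)) (cong (λ t → φ (j - t)) (T a))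
        (φ--N· j (to z a) (weight m x y (to z a)))
    periodic : Periodic (λ p → (φ (i - from z p) - φ (j - p) + weight m x y p) ⁺)
    periodic p = cong _⁺ (linear-by (byEquations (1ℤ ∷ 1ℤ ∷ -1ℤ ∷ 1ℤ ∷ []))
        (φ (i - from z (p + N)) ∷ φ (i - (from z p + N)) ∷ φ (i - from z p) ∷ φ (j - (p + N)) ∷ φ (j - p) ∷
        weight m x y (p + N) ∷ weight m x y p ∷ []) (λ x y z u v w p → x :≡ y ⇒ y :≡ z :- con 1ℤ ⇒ u :≡ v :- con
        1ℤ ⇒ w :≡ p ⇒ ⊢ x :- u :+ w :≡ z :- v :+ p) (cong (λ t → φ (i - t)) (from-N z p)) (φ--N i (from z p))
        (φ--N j p) (weight-cong m x y (res-N p)))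

  -- The data that the domination argument consumes, with `D = d − m c`. They are isolated because
  -- the argument runs a second time, for the reversed permutations.
  record Setting (v z : Perm) (m : ℕ) (D : ℤ → ℤ) : Set where
    field
      v-balanced : Balanced v
      z-balanced : Balanced z
      m-positive : 1ℤ ≤ + m
      D-nonNeg   : ∀ k → 0ℤ ≤ D k
      D-cong     : ∀ {a b} → res a ≡ res b → D a ≡ D b
      v-flux     : ∀ k → rank v k k ≤ + m + D k
      z-flux     : ∀ k → rank z k k ≤ D k
      z-attain   : ∀ i j → ∃[ l ] D l + (i - l) ⁺ + (l - j) ⁺ ≤ rank z i j

  rev-setting : ∀ {v z m D} → Setting v z m D → Setting (rev v) (rev z) m (λ k → D (-1ℤ - k))
  rev-setting {v} {z} {m} {D} S = record
    { v-balanced = balanced-rev v-balanced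
    ; z-balanced = balanced-rev z-balanced
    ; m-positive = m-positive
    ; D-nonNeg   = λ k → D-nonNeg (-1ℤ - k)
    ; D-cong     = λ {a} {b} e → D-cong (negate {a} {b} e)
    ; v-flux     = λ k → linear-by (byCombination (1ℤ ∷ 1ℤ ∷ -1ℤ ∷ []))
        (rank (rev v) k k ∷ rank (inv v) (-1ℤ - k) (-1ℤ - k) ∷ rank v (-1ℤ - k) (-1ℤ - k) ∷ k ∷ + m ∷ D (-1ℤ - k)
        ∷ []) (λ x y z u v w → x :≡ y ⇒ z :≡ y :+ (con -1ℤ :- u :- (con -1ℤ :- u)) ⇒ z :≤ v :+ w ⇒ ⊢ x :≤ v :+ w)
        (rank-rev v k k) (rank-balance v-balanced (-1ℤ - k) (-1ℤ - k)) (v-flux (-1ℤ - k))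
    ; z-flux     = λ k → linear-by (byCombination (1ℤ ∷ 1ℤ ∷ -1ℤ ∷ []))
        (rank (rev z) k k ∷ rank (inv z) (-1ℤ - k) (-1ℤ - k) ∷ rank z (-1ℤ - k) (-1ℤ - k) ∷ k ∷ D (-1ℤ - k) ∷ [])
        (λ x y z u v → x :≡ y ⇒ z :≡ y :+ (con -1ℤ :- u :- (con -1ℤ :- u)) ⇒ z :≤ v ⇒ ⊢ x :≤ v) (rank-rev z k k)
        (rank-balance z-balanced (-1ℤ - k) (-1ℤ - k)) (z-flux (-1ℤ - k))
    ; z-attain   = attain′
    }
    where
    open Setting S
    negate : ∀ {a b} → res a ≡ res b → res (-1ℤ - a) ≡ res (-1ℤ - b)
    negate {a} {b} e = trans (cong res (+-comm -1ℤ (- a))) (trans (res-+ -1ℤ (res-cong-neg {a} {b} e))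
        (cong res (+-comm (- b) -1ℤ)))
    attain′ : ∀ i j → ∃[ l ] D (-1ℤ - l) + (i - l) ⁺ + (l - j) ⁺ ≤ rank (rev z) i j
    attain′ i j = go (z-attain (-1ℤ - i) (-1ℤ - j))
      where
      go : (∃[ l ] D l + (-1ℤ - i - l) ⁺ + (l - (-1ℤ - j)) ⁺ ≤ rank z (-1ℤ - i) (-1ℤ - j)) →
           ∃[ l ] D (-1ℤ - l) + (i - l) ⁺ + (l - j) ⁺ ≤ rank (rev z) i j
      go (l , p) = -1ℤ - l , linear-by (byCombination (1ℤ ∷ 1ℤ ∷ -1ℤ ∷ 1ℤ ∷ -1ℤ ∷ -1ℤ ∷ -1ℤ ∷ -1ℤ ∷ -1ℤ ∷ []))
          (D l ∷ (-1ℤ - i - l) ⁺ ∷ (l - (-1ℤ - j)) ⁺ ∷ rank z (-1ℤ - i) (-1ℤ - j) ∷ rank (rev z) i j ∷ rank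
          (inv z) (-1ℤ - j) (-1ℤ - i) ∷ i ∷ j ∷ D (-1ℤ - (-1ℤ - l)) ∷ (- (-1ℤ - i - l)) ⁺ ∷ l ∷ (i - (-1ℤ - l)) ⁺
          ∷ (- (l - (-1ℤ - j))) ⁺ ∷ (-1ℤ - l - j) ⁺ ∷ []) (λ x y z u v w p q r s x10 x11 x12 x13 → x :+ y :+ z :≤
          u ⇒ v :≡ w ⇒ u :≡ w :+ (con -1ℤ :- p :- (con -1ℤ :- q)) ⇒ x :≡ r ⇒ y :- s :≡ con -1ℤ :- p :- x10 ⇒ s :≡
          x11 ⇒ z :- x12 :≡ x10 :- (con -1ℤ :- q) ⇒ x12 :≡ x13 ⇒ ⊢ r :+ x11 :+ x13 :≤ v) p (rank-rev z i j)
          (rank-balance z-balanced (-1ℤ - i) (-1ℤ - j)) (cong D {l} { -1ℤ - (-1ℤ - l)}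
          (linear (l ∷ []) (λ x → ⊢ x :≡ con -1ℤ :- (con -1ℤ :- x)))) (⁺-sub (-1ℤ - i - l))
          (cong _⁺ { - (-1ℤ - i - l)} {i - (-1ℤ - l)} (linear (i ∷ l ∷ [])
          (λ x y → ⊢ opp (con -1ℤ :- x :- y) :≡ x :- (con -1ℤ :- y)))) (⁺-sub (l - (-1ℤ - j)))
          (cong _⁺ { - (l - (-1ℤ - j))} { -1ℤ - l - j} (linear (l ∷ j ∷ [])
          (λ x y → ⊢ opp (x :- (con -1ℤ :- y)) :≡ con -1ℤ :- x :- y)))

  -- Domination on the side `i ≤ j`

  module RightHalf {v z : Perm} {m : ℕ} {D : ℤ → ℤ} (S : Setting v z m D) where
    open Setting S

    uncrossed : ∀ {k} → D k ≡ 0ℤ → rank z k k ≤ 0ℤ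
    uncrossed {k} e = linear (rank z k k ∷ D k ∷ []) (λ x y → x :≤ y ⇒ y :≡ con 0ℤ ⇒ ⊢ x :≤ con 0ℤ) (z-flux k) e

    module Wall {k} (e : D k ≡ 0ℤ) = Uncrossed z-balanced {k} (uncrossed e)

    -- For a zero `x` of `D` this is the preceding zero: `from z x` is the first position of the
    -- block that ends at `x`.
    prev : ℤ → ℤ
    prev x = from z x - 1ℤ

    from≤ : ∀ {x} → D x ≡ 0ℤ → from z x ≤ x
    from≤ e = Wall.from-≤ e ≤-refl

    -- z exchanges the two ends of each block between consecutive zeros of D.
    prev-zero : ∀ {x} → D x ≡ 0ℤ → D (from z x - 1ℤ) ≡ 0ℤ
    prev-zero {x} e = go (z-attain (prev x) (x - 1ℤ))
      where
      -- The value `x` is taken at `from z x`, just beyond the row, so the column `x − 1` counts no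
      -- more than the column `x`, where the wall bounds the count by 0.
      empty : rank z (from z x - 1ℤ) (x - 1ℤ) ≤ 0ℤ
      empty = linear (rank z (from z x - 1ℤ) (x - 1ℤ) ∷ rank z (from z x - 1ℤ) x ∷ rank z x x ∷ [])
          (λ x y z → x :≡ y ⇒ y :≤ z ⇒ z :≤ con 0ℤ ⇒ ⊢ x :≤ con 0ℤ)
          (rank-column-no z (from z x - 1ℤ) x (linear (from z x ∷ []) (λ x → ⊢ x :- con 1ℤ :< x)))
          (rank-mono z {from z x - 1ℤ} {x} {x} {x} (linear (from z x ∷ x ∷ [])
          (λ x y → x :≤ y ⇒ ⊢ x :- con 1ℤ :≤ y) (from≤ e)) ≤-refl) (uncrossed e)
      go : _ → D (from z x - 1ℤ) ≡ 0ℤ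
      go (l , p) = trans (cong D {from z x - 1ℤ} {l} at) D-l
        where
        p′ : D l + (from z x - 1ℤ - l) ⁺ + (l - (x - 1ℤ)) ⁺ ≤ 0ℤ
        p′ = linear (D l ∷ (prev x - l) ⁺ ∷ (l - (x - 1ℤ)) ⁺ ∷ rank z (prev x) (x - 1ℤ) ∷ [])
            (λ x y z u → x :+ y :+ z :≤ u ⇒ u :≤ con 0ℤ ⇒ ⊢ x :+ y :+ z :≤ con 0ℤ) p empty
        D-l : D l ≡ 0ℤ
        D-l = ≤-antisym (linear (D l ∷ (from z x - 1ℤ - l) ⁺ ∷ (l - (x - 1ℤ)) ⁺ ∷ [])
            (λ x y z → x :+ y :+ z :≤ con 0ℤ ⇒ con 0ℤ :≤ y ⇒ con 0ℤ :≤ z ⇒ ⊢ x :≤ con 0ℤ) p′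
            (⁺-nonNeg (from z x - 1ℤ - l)) (⁺-nonNeg (l - (x - 1ℤ)))) (D-nonNeg l)
        at : from z x - 1ℤ ≡ l
        at = ≤-antisym (linear (D l ∷ (from z x - 1ℤ - l) ⁺ ∷ (l - (x - 1ℤ)) ⁺ ∷ from z x ∷ l ∷ [])
            (λ x y z u v → x :+ y :+ z :≤ con 0ℤ ⇒ con 0ℤ :≤ x ⇒ u :- con 1ℤ :- v :≤ y ⇒ con 0ℤ :≤ z ⇒ ⊢ u :- con
            1ℤ :≤ v) p′ (D-nonNeg l) (⁺-upper (from z x - 1ℤ - l)) (⁺-nonNeg (l - (x - 1ℤ))))
          (≮⇒≥ λ q → crossed (linear (from z x ∷ l ∷ []) (λ x y → x :- con 1ℤ :< y ⇒ ⊢ x :≤ y) q))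
          where
          l<x : l < x
          l<x = linear (D l ∷ (from z x - 1ℤ - l) ⁺ ∷ (l - (x - 1ℤ)) ⁺ ∷ l ∷ x ∷ [])
              (λ x y z u v → x :+ y :+ z :≤ con 0ℤ ⇒ con 0ℤ :≤ x ⇒ con 0ℤ :≤ y ⇒ u :- (v :- con 1ℤ) :≤ z ⇒ ⊢ u :<
              v) p′ (D-nonNeg l) (⁺-nonNeg (from z x - 1ℤ - l)) (⁺-upper (l - (x - 1ℤ)))
          -- A zero of `D` strictly inside the block would separate `from z x` from its image `x`.
          crossed : ¬ from z x ≤ l
          crossed q = 1≰0 (linear-by (byCombination (1ℤ ∷ 1ℤ ∷ -1ℤ ∷ [])) (to z (from z x) ∷ l ∷ x ∷ [])
              (λ x y z → x :≤ y ⇒ x :≡ z ⇒ y :< z ⇒ ⊢ con 1ℤ :≤ con 0ℤ) (Wall.to-≤ D-l q) (to-from z x) l<x)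

    -- Fewer than `m` strands of `v` cross the whole block that ends at `x`; such an `x` can serve
    -- as the positive end of the translation.
    Good : ℤ → Set
    Good x = D x ≡ 0ℤ × rank v (from z x - 1ℤ) x ≤ + m - 1ℤ

    -- The last component is the invariant of the search to the left: `m` strands cross everything
    -- between `x` and `x₀`.
    Found : ℤ → Set
    Found x₀ = ∃[ x ] Good x × x ≤ x₀ × (x < x₀ → + m ≤ rank v x x₀)

    -- If no block between a zero x and x₀ were good, m strands would cross all of it; with
    -- arbitrarily distant x this is impossible.
    search : ∀ {x₀} → D x₀ ≡ 0ℤ → ∀ fuel x → D x ≡ 0ℤ → x ≤ x₀ → (x < x₀ → + m ≤ rank v x x₀) →
             x ≤ x₀ - N· (+ m) + + fuel → Found x₀
    -- At a distance of `m n`, translation makes the `m` strands start at or before `x₀` and end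
    -- beyond `x₀ + m n`. But at most `m` strands cross the wall `x₀`, and each of the `m` periods
    -- takes one away unless none is left.
    search {x₀} e₀ zero x e l far short = ⊥-elim (1≰0
        (linear-by (byCombination (1ℤ ∷ 1ℤ ∷ 1ℤ ∷ -1ℤ ∷ [])) (+ m ∷ rank v x x₀ ∷ rank v (x₀ - N· (+ m)) x₀ ∷
        rank v (x₀ - N· (+ m) + N· (+ m)) (x₀ + N· (+ m)) ∷ rank v x₀ (x₀ + N· (+ m)) ∷ (rank v x₀ x₀ - + m) ⁺ ∷
        []) (λ x y z u v w → x :≤ y ⇒ y :≤ z ⇒ u :≡ z ⇒ u :≡ v ⇒ v :≤ w ⇒ w :≡ con 0ℤ ⇒ con 1ℤ :≤ x ⇒ ⊢ con 1ℤ :≤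
        con 0ℤ) (far (linear (x ∷ x₀ ∷ N· (+ m) ∷ N ∷ []) (λ x y z u → x :≤ y :- z :+ con 0ℤ ⇒ u :≤ z ⇒ con (+ 3)
        :≤ u ⇒ ⊢ x :< y) short N·m 3≤N)) (rank-mono v {x} {x₀ - N· (+ m)} {x₀} {x₀}
        (linear (x ∷ x₀ ∷ N· (+ m) ∷ []) (λ x y z → x :≤ y :- z :+ con 0ℤ ⇒ ⊢ x :≤ y :- z) short) ≤-refl)
        (rank-shift v (+ m) (x₀ - N· (+ m)) x₀) (cong (λ t → rank v t (x₀ + N· (+ m))) {x₀ - N· (+ m) + N· (+ m)}
        {x₀} (linear (x₀ ∷ N· (+ m) ∷ []) (λ x y → ⊢ x :- y :+ y :≡ x))) (rank-drop v x₀ x₀ m)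
        (⁺-neg {rank v x₀ x₀ - + m} (linear (rank v x₀ x₀ ∷ + m ∷ D x₀ ∷ [])
        (λ x y z → x :≤ y :+ z ⇒ z :≡ con 0ℤ ⇒ ⊢ x :- y :≤ con 0ℤ) (v-flux x₀) e₀)) m-positive))
      where
      N·m : N ≤ N· (+ m)
      N·m = linear-by (byCombination (1ℤ ∷ 1ℤ ∷ -1ℤ ∷ [])) (N· 1ℤ ∷ N· (+ m) ∷ N ∷ [])
          (λ x y z → x :≤ y ⇒ x :≡ z ⇒ ⊢ z :≤ y) (N·-mono m-positive) N·-1
    search {x₀} e₀ (suc fuel) x e l far short = go (rank v (from z x - 1ℤ) x ≤? + m - 1ℤ)
      where
      go : Dec (rank v (from z x - 1ℤ) x ≤ + m - 1ℤ) → Found x₀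
      go (yes p) = x , (e , p) , l , far
      go (no p)  = search e₀ fuel (from z x - 1ℤ) (prev-zero e)
          (linear (from z x ∷ x ∷ x₀ ∷ []) (λ x y z → x :≤ y ⇒ y :≤ z ⇒ ⊢ x :- con 1ℤ :≤ z) (from≤ e) l)
          (λ _ → far′ (x <? x₀)) (linear (from z x ∷ x ∷ x₀ ∷ N· (+ m) ∷ + fuel ∷ [])
          (λ x y z u v → x :≤ y ⇒ y :≤ z :- u :+ (con 1ℤ :+ v) ⇒ ⊢ x :- con 1ℤ :≤ z :- u :+ v) (from≤ e) short)
        where
        far′ : Dec (x < x₀) → + m ≤ rank v (from z x - 1ℤ) x₀
        -- At least `m` strands cross the new block and at least `m` the stretch beyond it, while at
        -- most `m` cross the wall `x` between them; supermodularity leaves `m` that cross both.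
        far′ (yes q) = linear (rank v (from z x - 1ℤ) x ∷ rank v x x₀ ∷ rank v (from z x - 1ℤ) x₀ ∷ rank v x x ∷
            + m ∷ D x ∷ []) (λ x y z u v w → x :+ y :≤ z :+ u ⇒ v :≤ y ⇒ v :- con 1ℤ :< x ⇒ u :≤ v :+ w ⇒ w :≡
            con 0ℤ ⇒ ⊢ v :≤ z) (rank-supermodular v {from z x - 1ℤ} {x} {x₀}
            (linear (from z x ∷ x ∷ []) (λ x y → x :≤ y ⇒ ⊢ x :- con 1ℤ :≤ y) (from≤ e)) l) (far q) (≰⇒> p)
            (v-flux x) e
        far′ (no q)  = linear (rank v (from z x - 1ℤ) x ∷ rank v (from z x - 1ℤ) x₀ ∷ + m ∷ [])
            (λ x y z → x :≡ y ⇒ z :- con 1ℤ :< x ⇒ ⊢ z :≤ y) (cong (rank v (from z x - 1ℤ))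
            (≤-antisym l (≮⇒≥ q))) (≰⇒> p)

    -- Every step goes left by at least one, so `m n` units of fuel reach the distance at which the
    -- search must have stopped.
    found : ∀ {x₀} → D x₀ ≡ 0ℤ → Found x₀
    found {x₀} e = search e (∣ N· (+ m) ∣) x₀ e ≤-refl (λ l → ⊥-elim
        (1≰0 (linear (x₀ ∷ []) (λ x → x :< x ⇒ ⊢ con 1ℤ :≤ con 0ℤ) l)))
        (linear-by (byCombination (1ℤ ∷ -1ℤ ∷ [])) (+ ∣ N· (+ m) ∣ ∷ N· (+ m) ∷ x₀ ∷ [])
        (λ x y z → x :≡ y ⇒ ⊢ z :≤ z :- y :+ x) (0≤i⇒+∣i∣≡i {N· (+ m)}
        (linear-by (byCombination (1ℤ ∷ 1ℤ ∷ -1ℤ ∷ [])) (N· 0ℤ ∷ N· (+ m) ∷ [])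
        (λ x y → x :≤ y ⇒ x :≡ con 0ℤ ⇒ ⊢ con 0ℤ :≤ y) (N·-mono {0ℤ} {+ m} (+≤+ z≤n)) N·-0)))

    -- The block is the single point `x`. If the next search stops only in the class of `x`, then
    -- `m` strands cross from a full period before up to beyond `x − 1`, and by translation `m`
    -- strands cross the wall `x − 1`. Fewer than `m` of these pass beyond `x`, so one of them ends
    -- at `x` and comes from the left.
    good-again : ∀ {x} → Good x → D (x - 1ℤ) ≡ 0ℤ → (∃[ x′ ] Good x′ × res x′ ≢ res x) ⊎ from v x ≤ x - 1ℤ
    good-again {x} (e , g) e′ = go (found e′)
      where
      fixed : from z x ≡ x
      fixed = ≤-antisym (from≤ e) (linear (x ∷ from z x ∷ []) (λ x y → x :- con 1ℤ :< y ⇒ ⊢ x :≤ y)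
          (Wall.from-> e′ {x} (linear (x ∷ []) (λ x → ⊢ x :- con 1ℤ :< x))))
      go : Found (x - 1ℤ) → (∃[ x′ ] Good x′ × res x′ ≢ res x) ⊎ from v x ≤ x - 1ℤ
      go (x′ , G , l , far) = decide (res x′ ℕ.≟ res x)
        where
        decide : Dec (res x′ ≡ res x) → (∃[ x′ ] Good x′ × res x′ ≢ res x) ⊎ from v x ≤ x - 1ℤ
        decide (no ne) = inj₁ (x′ , G , ne)
        decide (yes r) = inj₂ (≮⇒≥ λ q → 1≰0 (linear-by (byCombination (1ℤ ∷ 1ℤ ∷ 1ℤ ∷ 1ℤ ∷ -1ℤ ∷ []))
            (rank v (x - 1ℤ) (x - 1ℤ) ∷ rank v (x - 1ℤ) x ∷ + m ∷ rank v (from z x - 1ℤ) x ∷ [])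
            (λ x y z u → x :≡ y ⇒ z :≤ x ⇒ u :≤ z :- con 1ℤ ⇒ u :≡ y ⇒ ⊢ con 1ℤ :≤ con 0ℤ)
            (rank-column-no v (x - 1ℤ) x q) full g (cong (λ t → rank v (t - 1ℤ) x) fixed)))
          where
          distant : x′ ≤ x - N
          distant = ≮⇒≥ λ q → res≢-offset {x′} {x} (linear (x′ ∷ x ∷ [])
              (λ x y → x :≤ y :- con 1ℤ ⇒ ⊢ con 0ℤ :< y :- x) l)
              (linear (x ∷ N ∷ x′ ∷ []) (λ x y z → x :- y :< z ⇒ ⊢ x :- z :< y) q) r
          full : + m ≤ rank v (x - 1ℤ) (x - 1ℤ)
          full = linear-by (byCombination (1ℤ ∷ 1ℤ ∷ 1ℤ ∷ -1ℤ ∷ []))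
              (+ m ∷ rank v x′ (x - 1ℤ) ∷ rank v (x - N) (x - 1ℤ) ∷ rank v (x - N + N· 1ℤ) (x - 1ℤ + N· 1ℤ) ∷
              rank v x (x - 1ℤ + N· 1ℤ) ∷ rank v (x - 1ℤ + N· 1ℤ) (x - 1ℤ + N· 1ℤ) ∷ rank v (x - 1ℤ) (x - 1ℤ) ∷
              []) (λ x y z u v w p → x :≤ y ⇒ y :≤ z ⇒ u :≡ z ⇒ u :≡ v ⇒ v :≤ w ⇒ w :≡ p ⇒ ⊢ x :≤ p)
              (far (linear (x′ ∷ x ∷ N ∷ []) (λ x y z → x :≤ y :- z ⇒ con (+ 3) :≤ z ⇒ ⊢ x :< y :- con 1ℤ)
              distant 3≤N)) (rank-mono v {x′} {x - N} {x - 1ℤ} {x - 1ℤ} distant ≤-refl)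
              (rank-shift v 1ℤ (x - N) (x - 1ℤ)) (cong (λ t → rank v t (x - 1ℤ + N· 1ℤ)) {x - N + N· 1ℤ} {x}
              (linear (N· 1ℤ ∷ N ∷ x ∷ []) (λ x y z → x :≡ y ⇒ ⊢ z :- y :+ x :≡ z) N·-1))
              (rank-mono v {x} {x - 1ℤ + N· 1ℤ} {x - 1ℤ + N· 1ℤ} {x - 1ℤ + N· 1ℤ}
              (linear-by (byCombination (1ℤ ∷ -1ℤ ∷ [])) (N· 1ℤ ∷ N ∷ x ∷ [])
              (λ x y z → x :≡ y ⇒ con (+ 3) :≤ y ⇒ ⊢ z :≤ z :- con 1ℤ :+ x) N·-1 3≤N) ≤-refl)
              (rank-shift v 1ℤ (x - 1ℤ) (x - 1ℤ))

    dominated : ∀ {x y} → Good x → D (y - 1ℤ) ≡ 0ℤ → res x ≢ res y → ∀ {w} → Translates w z m x y →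
                ∀ {i j} → i ≤ j → rank v i j ≤ rank w i j
    dominated {x} {y} (e , g) e′ ne {w} T {i} {j} i≤j = subst (rank v i j ≤_)
        (sym (rank-translated {w} {z} {m} {x} {y} T i j)) bound
      where
      F : ℤ → ℤ
      F p = (φ (i - from z p) - φ (j - p) + weight m x y p) ⁺
      H : ℤ → ℤ
      H p = (φ (i - from z p) - φ (j - p)) ⁺
      step : ∀ p → φ (i - from z (p + N)) - φ (j - (p + N)) ≡ φ (i - from z p) - φ (j - p)
      step p = linear-by (byEquations (1ℤ ∷ 1ℤ ∷ -1ℤ ∷ [])) (φ (i - from z (p + N)) ∷ φ (i - (from z p + N)) ∷ φ
          (i - from z p) ∷ φ (j - (p + N)) ∷ φ (j - p) ∷ []) (λ x y z u v → x :≡ y ⇒ y :≡ z :- con 1ℤ ⇒ u :≡ v :-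
          con 1ℤ ⇒ ⊢ x :- u :≡ z :- v) (cong (λ t → φ (i - t)) (from-N z p)) (φ--N i (from z p)) (φ--N j p)
      F-periodic : Periodic F
      F-periodic p = cong _⁺ (cong₂ _+_ (step p) (weight-cong m x y (res-N p)))
      H-periodic : Periodic H
      H-periodic p = cong _⁺ (step p)
      -- `p` opens a block, so its preimage under `z` is not to its left; for `i ≤ j` the summand is
      -- then at most 0, and lowering it by `m` does not affect its positive part.
      left-end : ∀ p → res p ≡ res y → φ (i - from z p) - φ (j - p) ≤ 0ℤ
      left-end p f = linear (φ (i - from z p) ∷ φ (j - p) ∷ []) (λ x y → x :≤ y ⇒ ⊢ x :- y :≤ con 0ℤ)
          (φ-mono {i - from z p} {j - p} (linear (i ∷ j ∷ p ∷ from z p ∷ [])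
          (λ x y z u → x :≤ y ⇒ z :- con 1ℤ :< u ⇒ ⊢ x :- u :≤ y :- z) i≤j
          (Wall.from-> D-p {p} (linear (p ∷ []) (λ x → ⊢ x :- con 1ℤ :< x)))))
        where
        D-p : D (p - 1ℤ) ≡ 0ℤ
        D-p = trans (D-cong {p - 1ℤ} {y - 1ℤ} (res-+ -1ℤ f)) e′
      off : ∀ p → res p ≢ res x → F p ≡ H p
      off p f = decide (res p ℕ.≟ res y)
        where
        decide : Dec (res p ≡ res y) → F p ≡ H p
        decide (yes h) = trans (⁺-neg (linear (φ (i - from z p) ∷ φ (j - p) ∷ weight m x y p ∷ + m ∷ [])
            (λ x y z u → x :- y :≤ con 0ℤ ⇒ z :≡ opp u ⇒ con 1ℤ :≤ u ⇒ ⊢ x :- y :+ z :≤ con 0ℤ) (left-end p h)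
            (weight-y m ne h) m-positive)) (sym (⁺-neg (left-end p h)))
        decide (no h)  = cong _⁺ (linear (weight m x y p ∷ φ (i - from z p) ∷ φ (j - p) ∷ [])
            (λ x y z → x :≡ con 0ℤ ⇒ ⊢ y :- z :+ x :≡ y :- z) (weight-o m {x} {y} {p} f h))
      total : ΣR F + (φ (i - from z x) - φ (j - x)) ⁺ ≡ rank z i j + (φ (i - from z x) - φ (j - x) + + m) ⁺
      total = trans (ΣR-update F-periodic H-periodic x off)
        (cong₂ _+_ (sym (rank-values z i j)) (cong (λ t → (φ (i - from z x) - φ (j - x) + t) ⁺)
            (weight-x m ne {x} refl)))
      bound : rank v i j ≤ ΣR F
      bound = decide (⁺-cases (φ (i - from z x) - φ (j - x)))
        where
        -- The class of `x` gains the full `m`. The wall `l` at which the rank of `z` is attained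
        -- bounds the rank of `v` by the same expression plus `m`.
        near : φ (i - from z x) - φ (j - x) ≡ (φ (i - from z x) - φ (j - x)) ⁺ → rank v i j ≤ ΣR F
        near f = combine (z-attain i j)
          where
          combine : _ → rank v i j ≤ ΣR F
          combine (l , at) = linear-by (byCombination (1ℤ ∷ -1ℤ ∷ -1ℤ ∷ []))
              (ΣR F ∷ (φ (i - from z x) - φ (j - x)) ⁺ ∷ rank z i j ∷ (φ (i - from z x) - φ (j - x) + + m) ⁺ ∷ φ
              (i - from z x) ∷ φ (j - x) ∷ + m ∷ rank v i j ∷ rank v l l ∷ (i - l) ⁺ ∷ (l - j) ⁺ ∷ D l ∷ [])
              (λ x y z u v w p q r s x10 x11 → x :+ y :≡ z :+ u ⇒ v :- w :≡ y ⇒ v :- w :+ p :≤ u ⇒ q :≤ r :+ s :+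
              x10 ⇒ r :≤ p :+ x11 ⇒ x11 :+ s :+ x10 :≤ z ⇒ ⊢ q :≤ x) total f
              (⁺-upper (φ (i - from z x) - φ (j - x) + + m)) (rank-bound v i j l) (v-flux l) at
        far : ∀ p → p ≡ φ (j - x) - φ (i - from z x) → φ (i - from z x) - φ (j - x) ≤ 0ℤ → rank v i j ≤ ΣR F
        far -[1+ p ] h s = ⊥-elim (1≰0 (linear-by (byCombination (1ℤ ∷ -1ℤ ∷ []))
            (+ p ∷ φ (j - x) ∷ φ (i - from z x) ∷ []) (λ x y z → opp (con 1ℤ :+ x) :≡ y :- z ⇒ z :- y :≤ con 0ℤ ⇒
            con 0ℤ :≤ x ⇒ ⊢ con 1ℤ :≤ con 0ℤ) h s (+≤+ (z≤n {p}))))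
        far (+ zero) h s = near (sym (trans (⁺-neg s) (linear-by (byEquations (-1ℤ ∷ []))
            (φ (j - x) ∷ φ (i - from z x) ∷ []) (λ x y → con 0ℤ :≡ x :- y ⇒ ⊢ con 0ℤ :≡ y :- x) h)))
        -- The summand of `x` is `−(p + 1)`, so the gain is `(m − 1 − p)⁺`. After a translation the
        -- strands of `v` cross the block that ends at `x` and `p` periods more: at most `m − 1`
        -- cross the block, and `rank-drop` removes one per period.
        far (+ suc p) h s = linear-by (byCombination (1ℤ ∷ -1ℤ ∷ []))
            (ΣR F ∷ (φ (i - from z x) - φ (j - x)) ⁺ ∷ rank z i j ∷ (φ (i - from z x) - φ (j - x) + + m) ⁺ ∷ rank
            v i j ∷ rank v (from z x - 1ℤ + N· q) (x + N· q′) ∷ rank v (from z x - 1ℤ) (x + N· (+ p)) ∷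
            (rank v (from z x - 1ℤ) x - + p) ⁺ ∷ []) (λ x y z u v w p q → x :+ y :≡ z :+ u ⇒ y :≡ con 0ℤ ⇒ con 0ℤ
            :≤ z ⇒ v :≤ w ⇒ w :≡ p ⇒ p :≤ q ⇒ q :≤ u ⇒ ⊢ v :≤ x) total (⁺-neg s) (rank-nonNeg z i j) ends shifted
            (rank-drop v (from z x - 1ℤ) x p) final
          where
          -- The translate of `prev x` by `n q` is the first one not below `i`, and the translate of
          -- `x` by `n q′` is the last one not above `j`.
          q q′ : ℤ
          q  = φ (i - from z x) + 1ℤ
          q′ = φ (j - x)
          q′≡ : q′ ≡ + p + q
          q′≡ = linear-by (byEquations (-1ℤ ∷ -1ℤ ∷ [])) (+ p ∷ q′ ∷ φ (i - from z x) ∷ q ∷ [])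
              (λ x y z u → con 1ℤ :+ x :≡ y :- z ⇒ u :≡ z :+ con 1ℤ ⇒ ⊢ y :≡ x :+ u) h′ q≡
            where
            h′ : + suc p ≡ q′ - φ (i - from z x)
            h′ = h
            q≡ : q ≡ φ (i - from z x) + 1ℤ
            q≡ = refl
          i-end : i ≤ from z x - 1ℤ + N· q
          i-end = linear-by (byCombination (1ℤ ∷ 1ℤ ∷ -1ℤ ∷ []))
              (i ∷ from z x ∷ N· φ (i - from z x) ∷ N ∷ N· q ∷ [])
              (λ x y z u v → x :- y :< z :+ u ⇒ v :≡ z :+ u ⇒ ⊢ x :≤ y :- con 1ℤ :+ v) (φ-upper (i - from z x))
              N·q
            where
            N·q : N· q ≡ N· φ (i - from z x) + N
            N·q = N·-+1 (φ (i - from z x))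
          j-end : x + N· q′ ≤ j
          j-end = linear (N· q′ ∷ j ∷ x ∷ []) (λ x y z → x :≤ y :- z ⇒ ⊢ z :+ x :≤ y) low
            where
            low : N· q′ ≤ j - x
            low = φ-lower (j - x)
          ends : rank v i j ≤ rank v (from z x - 1ℤ + N· q) (x + N· q′)
          ends = rank-mono v {i} {from z x - 1ℤ + N· q} {j} {x + N· q′} i-end j-end
          shifted : rank v (from z x - 1ℤ + N· q) (x + N· q′) ≡ rank v (from z x - 1ℤ) (x + N· (+ p))
          shifted = trans (cong (rank v (from z x - 1ℤ + N· q)) {x + N· q′} {x + N· (+ p) + N· q}
              (linear (N· q′ ∷ N· (+ p + q) ∷ N· (+ p) ∷ N· q ∷ x ∷ [])
                  (λ x y z u v → x :≡ y ⇒ y :≡ z :+ u ⇒ ⊢ v :+ x :≡ v :+ z :+ u) (cong N·_ q′≡) (N·-+ (+ p) q)))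
            (rank-shift v q (from z x - 1ℤ) (x + N· (+ p)))
          final : (rank v (from z x - 1ℤ) x - + p) ⁺ ≤ (φ (i - from z x) - φ (j - x) + + m) ⁺
          final = ⁺-mono (linear-by (byCombination (1ℤ ∷ 1ℤ ∷ -1ℤ ∷ []))
              (rank v (from z x - 1ℤ) x ∷ + m ∷ + p ∷ φ (j - x) ∷ φ (i - from z x) ∷ [])
              (λ x y z u v → x :≤ y :- con 1ℤ ⇒ con 1ℤ :+ z :≡ u :- v ⇒ ⊢ x :- z :≤ v :- u :+ y) g h)
        decide : Signed (φ (i - from z x) - φ (j - x)) → rank v i j ≤ ΣR F
        decide (inj₁ (f , _)) = near (sym f)
        decide (inj₂ (_ , s)) = far (φ (j - x) - φ (i - from z x)) refl s

  -- The right end comes from a search in the given picture, the left end from one in the reversed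
  -- picture. For `i > j` balance replaces both ranks by those of the inverses, which are ranks of
  -- the reversals with the order of the walls restored.
  dominating-translate : ∀ {v z m D} → Setting v z m D → ∀ {x₀} → D x₀ ≡ 0ℤ →
    ∃[ x ] ∃[ y ] D x ≡ 0ℤ × D (y - 1ℤ) ≡ 0ℤ × res x ≢ res y ×
      (∀ {w} → Balanced w → Translates w z m x y → v ⊑ w)
  dominating-translate {v} {z} {m} {D} S {x₀} e₀ = start (R.found e₀)
      (L.found (trans (cong D { -1ℤ - (-1ℤ - x₀)} {x₀} (linear (x₀ ∷ [])
      (λ x → ⊢ con -1ℤ :- (con -1ℤ :- x) :≡ x))) e₀))
    where
    open Setting S
    module R = RightHalf S
    module L = RightHalf (rev-setting S)
    Answer : Set
    Answer = ∃[ x ] ∃[ y ] D x ≡ 0ℤ × D (y - 1ℤ) ≡ 0ℤ × res x ≢ res y ×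
      (∀ {w} → Balanced w → Translates w z m x y → v ⊑ w)
    wall : ∀ y → D (-1ℤ - y) ≡ 0ℤ → D (- y - 1ℤ) ≡ 0ℤ
    wall y e = trans (cong D {(- y) - 1ℤ} { -1ℤ - y} (linear (y ∷ []) (λ x → ⊢ opp x :- con 1ℤ :≡ con -1ℤ :- x)))
        e
    -- `y` belongs to the reversed picture; the left end of the translation is `- y`.
    combine : ∀ {x y} → R.Good x → L.Good y → res x ≢ res (- y) → Answer
    combine {x} {y} Gx Gy ne = x , - y , proj₁ Gx , wall y (proj₁ Gy) , ne , below
      where
      ne′ : res y ≢ res (- x)
      ne′ f = ne (trans (cong res (sym (neg-involutive x))) (res-cong-neg { - x} {y} (sym f)))
      below : ∀ {w} → Balanced w → Translates w z m x (- y) → v ⊑ w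
      below {w} Bw T i j = go (i ≤? j)
        where
        T′ : Translates (rev w) (rev z) m y (- x)
        T′ a = opposite
          where
          t : ℤ
          t = to z (- a)
          δ-neg : ∀ p q → δ (- p) q ≡ δ p (- q)
          δ-neg p q = go (res p ℕ.≟ res (- q))
            where
            go : Dec (res p ≡ res (- q)) → δ (- p) q ≡ δ p (- q)
            go (yes e) = trans (δ-yes { - p} {q} (trans (res-cong-neg {p} { - q} e)
                (cong res (neg-involutive q)))) (sym (δ-yes {p} { - q} e))
            go (no e)  = trans (δ-no { - p} {q} (λ f → e
                (trans (cong res (sym (neg-involutive p))) (res-cong-neg { - p} {q} f))))
                (sym (δ-no {p} { - q} e))
          flipped : weight m y (- x) (- to z (- a)) ≡ - weight m x (- y) (to z (- a))
          flipped = trans (cong₂ (λ s t → + m * (s - t)) (δ-neg (to z (- a)) y)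
              (trans (δ-neg (to z (- a)) (- x)) (cong (δ (to z (- a))) (neg-involutive x))))
            (trans (cong (λ t → + m * t) (sym (neg-sub (δ (to z (- a)) x) (δ (to z (- a)) (- y)))))
                (sym (neg-distribʳ-* (+ m) _)))
          opposite : - to w (- a) ≡ - to z (- a) + N· weight m y (- x) (- to z (- a))
          opposite = linear-by (byEquations (-1ℤ ∷ -1ℤ ∷ [])) (to w (- a) ∷ to z (- a) ∷ N· weight m x (- y)
              (to z (- a)) ∷ N· weight m y (- x) (- to z (- a)) ∷ [])
              (λ x y z u → x :≡ y :+ z ⇒ u :≡ opp z ⇒ ⊢ opp x :≡ opp y :+ u) (T (- a))
              (trans (cong N·_ flipped) (N·-neg (weight m x (- y) (to z (- a)))))
        go : Dec (i ≤ j) → rank v i j ≤ rank w i j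
        go (yes p) = R.dominated {x} { - y} Gx (wall y (proj₁ Gy)) ne {w} T p
        go (no p)  = linear-by (byCombination (1ℤ ∷ 1ℤ ∷ -1ℤ ∷ -1ℤ ∷ []))
            (rank v i j ∷ rank (inv v) j i ∷ i ∷ j ∷ rank w i j ∷ rank (inv w) j i ∷ rank (rev v) (-1ℤ - i)
            (-1ℤ - j) ∷ rank (rev w) (-1ℤ - i) (-1ℤ - j) ∷ [])
            (λ x y z u v w p q → x :≡ y :+ (z :- u) ⇒ v :≡ w :+ (z :- u) ⇒ p :≡ y ⇒ q :≡ w ⇒ p :≤ q ⇒ ⊢ x :≤ v)
            (rank-balance v-balanced i j) (rank-balance Bw i j) (reversed v) (reversed w)
            (L.dominated {y} { - x} Gy (trans (cong D { -1ℤ - (- x - 1ℤ)} {x}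
            (linear (x ∷ []) (λ x → ⊢ con -1ℤ :- (opp x :- con 1ℤ) :≡ x))) (proj₁ Gx)) ne′ {rev w} T′ { -1ℤ - i}
            { -1ℤ - j} (linear (j ∷ i ∷ []) (λ x y → x :< y ⇒ ⊢ con -1ℤ :- y :≤ con -1ℤ :- x) (≰⇒> p)))
          where
          reversed : ∀ v → rank (rev v) (-1ℤ - i) (-1ℤ - j) ≡ rank (inv v) j i
          reversed v = trans (rank-rev v (-1ℤ - i) (-1ℤ - j))
            (cong₂ (rank (inv v)) { -1ℤ - (-1ℤ - j)} {j} { -1ℤ - (-1ℤ - i)} {i}
                (linear (j ∷ []) (λ x → ⊢ con -1ℤ :- (con -1ℤ :- x) :≡ x))
                (linear (i ∷ []) (λ x → ⊢ con -1ℤ :- (con -1ℤ :- x) :≡ x)))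
    start : R.Found x₀ → L.Found (-1ℤ - x₀) → Answer
    start (x , Gx , _) (y , Gy , _) = decide (res x ℕ.≟ res (- y))
      where
      decide : Dec (res x ≡ res (- y)) → Answer
      decide (no ne) = combine {x} {y} Gx Gy ne
      decide (yes e) = again (R.good-again Gx (trans (D-cong {x - 1ℤ} { - y - 1ℤ} (res-+ -1ℤ e))
          (wall y (proj₁ Gy))))
                             (L.good-again Gy (trans (cong D { -1ℤ - (y - 1ℤ)} { - y}
                                 (linear (y ∷ []) (λ x → ⊢ con -1ℤ :- (x :- con 1ℤ) :≡ opp x)))
                                 (trans (D-cong { - y} {x} (sym e)) (proj₁ Gx))))
        where
        again : _ → _ → Answer
        again (inj₁ (x′ , G , ne)) _ = combine {x′} {y} G Gy (λ f → ne (trans f (sym e)))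
        again _ (inj₁ (y′ , G , ne)) = combine {x} {y′} Gx G
          (λ f → ne (trans (cong res (sym (neg-involutive y′)))
              (trans (res-cong-neg { - y′} { - y} (trans (sym f) e)) (cong res (neg-involutive y)))))
        -- Up to translation, the strand that ends at `x` would start both to the left and to the
        -- right of it.
        again (inj₂ p) (inj₂ q) = ⊥-elim (1≰0 (linear-by (byCombination (1ℤ ∷ 1ℤ ∷ 1ℤ ∷ -1ℤ ∷ []))
            (from v x ∷ x ∷ from v (- y) ∷ y ∷ []) (λ x y z u → x :≤ y :- con 1ℤ ⇒ opp z :≤ u :- con 1ℤ ⇒ x :- y
            :≡ z :- opp u ⇒ ⊢ con 1ℤ :≤ con 0ℤ) p q′ (displacement-cong (inv v) {x} { - y} e)))
          where
          q′ : - from v (- y) ≤ y - 1ℤ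
          q′ = q

  -- Counting inversions

  inversions : Perm → ℤ
  inversions v = ΣR (λ p → ΣR (λ q → (φ (p - q) - φ (from v p - from v q)) ⁺))

  φ-+N : ∀ p q → φ (p + N - q) ≡ φ (p - q) + 1ℤ
  φ-+N p q = trans (cong φ {p + N - q} {p - q + N} (linear (p ∷ N ∷ q ∷ [])
      (λ x y z → ⊢ x :+ y :- z :≡ x :- z :+ y))) (φ-N (p - q))

  inversion-periodicʳ : ∀ v p → Periodic (λ q → (φ (p - q) - φ (from v p - from v q)) ⁺)
  inversion-periodicʳ v p q = cong _⁺ (linear-by (byEquations (1ℤ ∷ -1ℤ ∷ -1ℤ ∷ []))
      (φ (p - (q + N)) ∷ φ (p - q) ∷ φ (from v p - from v (q + N)) ∷ φ (from v p - (from v q + N)) ∷ φ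
      (from v p - from v q) ∷ []) (λ x y z u v → x :≡ y :- con 1ℤ ⇒ z :≡ u ⇒ u :≡ v :- con 1ℤ ⇒ ⊢ x :- z :≡ y :-
      v) (φ--N p q) (cong (λ t → φ (from v p - t)) (from-N v q)) (φ--N (from v p) (from v q)))

  inversion-periodicˡ : ∀ v q → Periodic (λ p → (φ (p - q) - φ (from v p - from v q)) ⁺)
  inversion-periodicˡ v q p = cong _⁺ (linear-by (byEquations (1ℤ ∷ -1ℤ ∷ -1ℤ ∷ []))
      (φ (p + N - q) ∷ φ (p - q) ∷ φ (from v (p + N) - from v q) ∷ φ (from v p + N - from v q) ∷ φ
      (from v p - from v q) ∷ []) (λ x y z u v → x :≡ y :+ con 1ℤ ⇒ z :≡ u ⇒ u :≡ v :+ con 1ℤ ⇒ ⊢ x :- z :≡ y :-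
      v) (φ-+N p q) (cong (λ t → φ (t - from v q)) (from-N v p)) (φ-+N (from v p) (from v q)))

  inversions-cong : ∀ {u v} → u ≃ v → inversions u ≡ inversions v
  inversions-cong {u} {v} e = ΣR-cong (λ p → ΣR-cong (λ q →
    cong₂ (λ s t → (φ (p - q) - φ (s - t)) ⁺) (≃-from {u} {v} e p) (≃-from {u} {v} e q)))

  module _ (i : Fin n) (v : Perm) (rises : from v (pt i) < from v (pt i + 1ℤ)) where

    private
      a b : ℤ
      a = pt i
      b = pt i + 1ℤ
      ne : res a ≢ res b
      ne = res-suc≢ (pt i)
      b≡ : b ≡ a + 1ℤ
      b≡ = refl

      -- `K` is the summand for `s_i v` after both indices are moved by `s_i`, `K₀` the one for `v`;
      -- the preimages in them agree.
      K K₀ : ℤ → ℤ → ℤ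
      K p q  = (φ (to (simpleₚ i) p - to (simpleₚ i) q) - φ (from v p - from v q)) ⁺
      K₀ p q = (φ (p - q) - φ (from v p - from v q)) ⁺

      K-periodicʳ : ∀ p → Periodic (K p)
      K-periodicʳ p q = cong _⁺ (linear-by (byEquations (1ℤ ∷ 1ℤ ∷ -1ℤ ∷ -1ℤ ∷ []))
          (φ (to (simpleₚ i) p - to (simpleₚ i) (q + N)) ∷ φ (to (simpleₚ i) p - (to (simpleₚ i) q + N)) ∷ φ
          (to (simpleₚ i) p - to (simpleₚ i) q) ∷ φ (from v p - from v (q + N)) ∷ φ (from v p - (from v q + N)) ∷
          φ (from v p - from v q) ∷ []) (λ x y z u v w → x :≡ y ⇒ y :≡ z :- con 1ℤ ⇒ u :≡ v ⇒ v :≡ w :- con 1ℤ ⇒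
          ⊢ x :- u :≡ z :- w) (cong (λ t → φ (to (simpleₚ i) p - t)) (to-N (simpleₚ i) q))
          (φ--N (to (simpleₚ i) p) (to (simpleₚ i) q)) (cong (λ t → φ (from v p - t)) (from-N v q))
          (φ--N (from v p) (from v q)))

      K-periodicˡ : ∀ q → Periodic (λ p → K p q)
      K-periodicˡ q p = cong _⁺ (linear-by (byEquations (1ℤ ∷ 1ℤ ∷ -1ℤ ∷ -1ℤ ∷ []))
          (φ (to (simpleₚ i) (p + N) - to (simpleₚ i) q) ∷ φ (to (simpleₚ i) p + N - to (simpleₚ i) q) ∷ φ
          (to (simpleₚ i) p - to (simpleₚ i) q) ∷ φ (from v (p + N) - from v q) ∷ φ (from v p + N - from v q) ∷ φ
          (from v p - from v q) ∷ []) (λ x y z u v w → x :≡ y ⇒ y :≡ z :+ con 1ℤ ⇒ u :≡ v ⇒ v :≡ w :+ con 1ℤ ⇒ ⊢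
          x :- u :≡ z :- w) (cong (λ t → φ (t - to (simpleₚ i) q)) (to-N (simpleₚ i) p))
          (φ-+N (to (simpleₚ i) p) (to (simpleₚ i) q)) (cong (λ t → φ (t - from v q)) (from-N v p))
          (φ-+N (from v p) (from v q)))

      reindexed : inversions (simpleₚ i · v) ≡ ΣR (λ p → ΣR (K p))
      reindexed = sym (trans (sym (ΣR-perm (λ p → ΣR-cong (λ q → K-periodicˡ q p)) (simpleₚ i)))
        (ΣR-cong (λ p → trans (sym (ΣR-perm (K-periodicʳ (to (simpleₚ i) p)) (simpleₚ i)))
          (ΣR-cong (λ q → cong₂ (λ x y → (φ (x - y) - φ (from v (to (simpleₚ i) p) - from v (to (simpleₚ i) q)))
              ⁺)
            (transpose-involutive a b ne p) (transpose-involutive a b ne q))))))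

      s-a : ∀ {c} → res c ≡ res a → to (simpleₚ i) c ≡ c + 1ℤ
      s-a {c} e = linear (transpose a b c ∷ c ∷ b ∷ a ∷ []) (λ x y z u → x :≡ y :+ (z :- u) ⇒ z :≡ u :+ con 1ℤ ⇒
          ⊢ x :≡ y :+ con 1ℤ) (transpose-a a b e) b≡

      s-b : ∀ {c} → res c ≡ res b → to (simpleₚ i) c ≡ c - 1ℤ
      s-b {c} e = linear-by (byEquations (1ℤ ∷ -1ℤ ∷ [])) (transpose a b c ∷ c ∷ b ∷ a ∷ [])
          (λ x y z u → x :≡ y :- (z :- u) ⇒ z :≡ u :+ con 1ℤ ⇒ ⊢ x :≡ y :- con 1ℤ) (transpose-b a b ne e) b≡

      step : ∀ p q → res (p + 1ℤ) ≢ res q → φ (p + 1ℤ - q) ≡ φ (p - q)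
      step p q e = trans (φ-step-no (p + 1ℤ) q e) (cong (λ t → φ (t - q)) {p + 1ℤ - 1ℤ} {p}
          (linear (p ∷ []) (λ x → ⊢ x :+ con 1ℤ :- con 1ℤ :≡ x)))

      order-row : ∀ {p} → res p ≢ res a → res p ≢ res b → ∀ q → φ (to (simpleₚ i) p - to (simpleₚ i) q) ≡ φ
          (p - q)
      order-row {p} f g q = trans (cong (λ t → φ (t - to (simpleₚ i) q)) (transpose-o a b f g))
          (go (classify a b q))
        where
        go : Class a b q → φ (p - to (simpleₚ i) q) ≡ φ (p - q)
        go (is-a e)    = linear-by (byEquations (1ℤ ∷ 1ℤ ∷ -1ℤ ∷ []))
            (φ (p - to (simpleₚ i) q) ∷ φ (p - (q + 1ℤ)) ∷ φ (p - 1ℤ - q) ∷ φ (p - q) ∷ [])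
            (λ x y z u → x :≡ y ⇒ y :≡ z ⇒ u :≡ z ⇒ ⊢ x :≡ u) (cong (λ t → φ (p - t)) (s-a e))
            (cong φ {p - (q + 1ℤ)} {p - 1ℤ - q} (linear (p ∷ q ∷ [])
            (λ x y → ⊢ x :- (y :+ con 1ℤ) :≡ x :- con 1ℤ :- y))) (φ-step-no p q (λ h → f (trans h e)))
        go (is-b _ e)  = linear (φ (p - to (simpleₚ i) q) ∷ φ (p - (q - 1ℤ)) ∷ φ (p + 1ℤ - q) ∷ φ (p - q) ∷ [])
            (λ x y z u → x :≡ y ⇒ y :≡ z ⇒ z :≡ u ⇒ ⊢ x :≡ u) (cong (λ t → φ (p - t)) (s-b e))
            (cong φ {p - (q - 1ℤ)} {p + 1ℤ - q} (linear (p ∷ q ∷ [])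
            (λ x y → ⊢ x :- (y :- con 1ℤ) :≡ x :+ con 1ℤ :- y)))
            (step p q (λ h → f (res-+-cancel 1ℤ (trans h e))))
        go (other h k) = cong (λ t → φ (p - t)) (transpose-o a b h k)

      order-a : ∀ q → res q ≢ res b → φ (to (simpleₚ i) a - to (simpleₚ i) q) ≡ φ (a - q)
      order-a q g = trans (cong (λ t → φ (t - to (simpleₚ i) q)) (s-a refl)) (go (classify a b q))
        where
        go : Class a b q → φ (a + 1ℤ - to (simpleₚ i) q) ≡ φ (a - q)
        go (is-a e)    = trans (cong (λ t → φ (a + 1ℤ - t)) (s-a e))
            (cong φ {a + 1ℤ - (q + 1ℤ)} {a - q} (linear (a ∷ q ∷ [])
            (λ x y → ⊢ x :+ con 1ℤ :- (y :+ con 1ℤ) :≡ x :- y)))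
        go (is-b _ e)  = ⊥-elim (g e)
        go (other h k) = trans (cong (λ t → φ (a + 1ℤ - t)) (transpose-o a b h k)) (step a q (λ e → k (sym e)))

      order-b : ∀ q → res q ≢ res a → φ (to (simpleₚ i) b - to (simpleₚ i) q) ≡ φ (b - q)
      order-b q g = trans (cong (λ t → φ (t - to (simpleₚ i) q)) (s-b refl)) (go (classify a b q))
        where
        go : Class a b q → φ (b - 1ℤ - to (simpleₚ i) q) ≡ φ (b - q)
        go (is-a e)    = ⊥-elim (g e)
        go (is-b _ e)  = trans (cong (λ t → φ (b - 1ℤ - t)) (s-b e))
            (cong φ {b - 1ℤ - (q - 1ℤ)} {b - q} (linear (b ∷ q ∷ [])
            (λ x y → ⊢ x :- con 1ℤ :- (y :- con 1ℤ) :≡ x :- y)))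
        go (other h k) = trans (cong (λ t → φ (b - 1ℤ - t)) (transpose-o a b h k))
            (sym (φ-step-no b q (λ e → k (sym e))))

      cell : ∀ {p q} → φ (to (simpleₚ i) p - to (simpleₚ i) q) ≡ φ (p - q) → K p q ≡ K₀ p q
      cell {p} {q} e = cong (λ t → (t - φ (from v p - from v q)) ⁺) e

      φ1 : φ (b - a) ≡ 0ℤ
      φ1 = φ-small (linear-by (byCombination (1ℤ ∷ -1ℤ ∷ [])) (b ∷ a ∷ [])
          (λ x y → x :≡ y :+ con 1ℤ ⇒ ⊢ con 0ℤ :≤ x :- y) b≡) (linear (b ∷ a ∷ N ∷ [])
          (λ x y z → x :≡ y :+ con 1ℤ ⇒ con (+ 3) :≤ z ⇒ ⊢ x :- y :< z) b≡ 3≤N)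

      φ-1 : φ (a - b) ≡ -1ℤ
      φ-1 = φ-minus (linear (b ∷ a ∷ N ∷ []) (λ x y z → x :≡ y :+ con 1ℤ ⇒ con (+ 3) :≤ z ⇒ ⊢ opp z :≤ y :- x) b≡
          3≤N) (linear-by (byCombination (1ℤ ∷ -1ℤ ∷ [])) (b ∷ a ∷ [])
          (λ x y → x :≡ y :+ con 1ℤ ⇒ ⊢ y :- x :< con 0ℤ) b≡)

      K-ab : K a b ≡ K₀ a b + 1ℤ
      K-ab = linear-by (byEquations (1ℤ ∷ -1ℤ ∷ 1ℤ ∷ -1ℤ ∷ 1ℤ ∷ -1ℤ ∷ []))
          ((φ (to (simpleₚ i) a - to (simpleₚ i) b) - φ (from v a - from v b)) ⁺ ∷ φ
          (to (simpleₚ i) a - to (simpleₚ i) b) ∷ φ (from v a - from v b) ∷ (φ (a - b) - φ (from v a - from v b))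
          ⁺ ∷ φ (a - b) ∷ K a b ∷ K₀ a b ∷ []) (λ x y z u v w p → x :≡ y :- z ⇒ u :≡ v :- z ⇒ y :≡ con 0ℤ ⇒ v :≡
          con -1ℤ ⇒ w :≡ x ⇒ p :≡ u ⇒ ⊢ w :≡ p :+ con 1ℤ) (⁺-pos
          {φ (to (simpleₚ i) a - to (simpleₚ i) b) - φ (from v a - from v b)}
          (linear-by (byCombination (1ℤ ∷ -1ℤ ∷ [])) (φ (to (simpleₚ i) a - to (simpleₚ i) b) ∷ φ
          (from v a - from v b) ∷ []) (λ x y → x :≡ con 0ℤ ⇒ y :< con 0ℤ ⇒ ⊢ con 0ℤ :≤ x :- y) swapped X))
          (⁺-pos {φ (a - b) - φ (from v a - from v b)} (linear-by (byCombination (1ℤ ∷ -1ℤ ∷ []))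
          (φ (a - b) ∷ φ (from v a - from v b) ∷ []) (λ x y → x :≡ con -1ℤ ⇒ y :< con 0ℤ ⇒ ⊢ con 0ℤ :≤ x :- y)
          φ-1 X)) swapped φ-1 Kab K₀ab
        where
        X : φ (from v a - from v b) < 0ℤ
        X = φ-neg (linear (from v (pt i) ∷ from v (pt i + 1ℤ) ∷ []) (λ x y → x :< y ⇒ ⊢ x :- y :< con 0ℤ) rises)
        swapped : φ (to (simpleₚ i) a - to (simpleₚ i) b) ≡ 0ℤ
        swapped = trans (cong₂ (λ x y → φ (x - y)) (simple-at i) (simple-at-suc i)) φ1
        Kab : K a b ≡ (φ (to (simpleₚ i) a - to (simpleₚ i) b) - φ (from v a - from v b)) ⁺
        Kab = refl
        K₀ab : K₀ a b ≡ (φ (a - b) - φ (from v a - from v b)) ⁺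
        K₀ab = refl

      K-ba : K b a ≡ K₀ b a
      K-ba = trans (⁺-neg {φ (to (simpleₚ i) b - to (simpleₚ i) a) - φ (from v b - from v a)}
          (linear (φ (to (simpleₚ i) b - to (simpleₚ i) a) ∷ φ (from v b - from v a) ∷ [])
          (λ x y → x :≡ con -1ℤ ⇒ con 0ℤ :≤ y ⇒ ⊢ x :- y :≤ con 0ℤ) swapped Y))
                   (sym (⁺-neg {φ (b - a) - φ (from v b - from v a)}
                       (linear (φ (b - a) ∷ φ (from v b - from v a) ∷ [])
                       (λ x y → x :≡ con 0ℤ ⇒ con 0ℤ :≤ y ⇒ ⊢ x :- y :≤ con 0ℤ) φ1 Y)))
        where
        Y : 0ℤ ≤ φ (from v b - from v a)
        Y = φ-nonNeg (linear (from v (pt i) ∷ from v (pt i + 1ℤ) ∷ []) (λ x y → x :< y ⇒ ⊢ con 0ℤ :≤ y :- x)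
            rises)
        swapped : φ (to (simpleₚ i) b - to (simpleₚ i) a) ≡ -1ℤ
        swapped = trans (cong₂ (λ x y → φ (x - y)) (simple-at-suc i) (simple-at i)) φ-1

      row-a : ΣR (K a) ≡ ΣR (K₀ a) + 1ℤ
      row-a = linear (ΣR (K a) ∷ (φ (a - b) - φ (from v a - from v b)) ⁺ ∷ ΣR
          (λ z → (φ (a - z) - φ (from v a - from v z)) ⁺) ∷ K a b ∷ [])
          (λ x y z u → x :+ y :≡ z :+ u ⇒ u :≡ y :+ con 1ℤ ⇒ ⊢ x :≡ z :+ con 1ℤ)
          (ΣR-update (K-periodicʳ a) (inversion-periodicʳ v a) b (λ q g → cell {a} {q} (order-a q g))) K-ab

      row-b : ΣR (K b) ≡ ΣR (K₀ b)
      row-b = linear (ΣR (K b) ∷ (φ (b - a) - φ (from v b - from v a)) ⁺ ∷ ΣR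
          (λ z → (φ (b - z) - φ (from v b - from v z)) ⁺) ∷ K b a ∷ [])
          (λ x y z u → x :+ y :≡ z :+ u ⇒ u :≡ y ⇒ ⊢ x :≡ z) (ΣR-update (K-periodicʳ b) (inversion-periodicʳ v b)
          a (λ q g → cell {b} {q} (order-b q g))) K-ba

    -- The summand of `p, q` counts the translates `q′` of `q` with `q′ ≤ p` and preimage beyond
    -- that of `p`, so `inversions` counts inversions up to translation. After reindexing by `s_i`,
    -- only the ordered pair of the classes of `i` and `i + 1` contributes differently, namely one
    -- more.
    inversions-rises : inversions (simpleₚ i · v) ≡ inversions v + 1ℤ
    inversions-rises = trans reindexed (linear (ΣR (λ p → ΣR (K p)) ∷ ΣR (K₀ a) ∷ ΣR (K₀ b) ∷ inversions v ∷ ΣR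
        (K a) ∷ ΣR (K b) ∷ []) (λ x y z u v w → x :+ (y :+ z) :≡ u :+ (v :+ w) ⇒ v :≡ y :+ con 1ℤ ⇒ w :≡ z ⇒ ⊢ x
        :≡ u :+ con 1ℤ) rows row-a row-b)
      where
      rows : ΣR (λ p → ΣR (K p)) + (ΣR (K₀ a) + ΣR (K₀ b)) ≡ inversions v + (ΣR (K a) + ΣR (K b))
      rows = ΣR-update₂ (λ p → ΣR-cong (λ q → K-periodicˡ q p)) (λ p → ΣR-cong (λ q → inversion-periodicˡ v q p))
          a b ne
        (λ p f g → ΣR-cong (λ q → cell {p} {q} (order-row f g q)))

  inversions-1 : inversions 1ₚ ≡ 0ℤ
  inversions-1 = trans (ΣR-cong (λ p → trans (ΣR-cong (λ q → self p q)) ΣR-0)) ΣR-0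
    where
    self : ∀ p q → (φ (p - q) - φ (p - q)) ⁺ ≡ 0ℤ
    self p q = trans (cong _⁺ (+-inverseʳ (φ (p - q)))) (⁺-pos ≤-refl)

  Counted : W n → Set
  Counted w = ∃[ k ] HasLength w k × + k ≡ inversions (perm w)

  length-inversions : ∀ w → Counted w
  length-inversions []      = 0 , length-[] , sym inversions-1
  length-inversions (i ∷ w) = go (rises-or-falls i w) (length-inversions w)
    where
    up : Rises i w → inversions (perm (i ∷ w)) ≡ inversions (perm w) + 1ℤ
    up = inversions-rises i (perm w)
    down : Falls i w → inversions (perm w) ≡ inversions (perm (i ∷ w)) + 1ℤ
    down p = trans (sym (inversions-cong {perm (i ∷ i ∷ w)} {perm w} (≈⇒≃ {i ∷ i ∷ w} {w} (cons-cons i w))))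
      (inversions-rises i (perm (i ∷ w)) (cons-rises i w p))
    go : Rises i w ⊎ Falls i w → Counted w → Counted (i ∷ w)
    go (inj₁ p) (k , L , e) = suc k , length-rises i {w} p L , linear-by (byEquations (1ℤ ∷ -1ℤ ∷ []))
        (+ k ∷ inversions (perm w) ∷ inversions (perm (i ∷ w)) ∷ [])
        (λ x y z → x :≡ y ⇒ z :≡ y :+ con 1ℤ ⇒ ⊢ con 1ℤ :+ x :≡ z) e (up p)
    go (inj₂ p) (k , L , e) =
      let k′ , f , L′ = length-falls i {w} p L
      in k′ , L′ , linear-by (byEquations (-1ℤ ∷ 1ℤ ∷ 1ℤ ∷ []))
          (+ k ∷ + k′ ∷ inversions (perm w) ∷ inversions (perm (i ∷ w)) ∷ [])
          (λ x y z u → x :≡ con 1ℤ :+ y ⇒ x :≡ z ⇒ z :≡ u :+ con 1ℤ ⇒ ⊢ y :≡ u) (cong +_ f) e (down p)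

  hasLength-inversions : ∀ {w k} → HasLength w k → + k ≡ inversions (perm w)
  hasLength-inversions {w} L = let k′ , L′ , e = length-inversions w in trans (cong +_ (length-unique {w} L L′)) e

  -- The length of a translate

  module TranslateLength {z : Perm} (Bz : Balanced z) {m : ℕ} {x y : ℤ}
    (flat-x : rank z x x ≤ 0ℤ) (flat-y : rank z (y - 1ℤ) (y - 1ℤ) ≤ 0ℤ) (ne : res x ≢ res y) where

    private
      flat-class : ∀ {j k} → res j ≡ res k → rank z k k ≤ 0ℤ → rank z j j ≤ 0ℤ
      flat-class {j} {k} e f = linear (rank z k k ∷ rank z (k + N· (φ j - φ k)) (k + N· (φ j - φ k)) ∷ rank z j j
          ∷ []) (λ x y z → x :≤ con 0ℤ ⇒ y :≡ x ⇒ z :≡ y ⇒ ⊢ z :≤ con 0ℤ) f (rank-shift z (φ j - φ k) k k)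
          (cong₂ (rank z) (res-≡ {j} {k} e) (res-≡ {j} {k} e))

      from-shift : ∀ k a → from z (a + N· k) ≡ from z a + N· k
      from-shift k a = to-shift (inv z) k a

      -- x is the last position of a block preserved by z, and y the first one
      last≥ : ∀ p q → res p ≡ res x → 0ℤ ≤ φ (p - q) - φ (from z p - from z q)
      last≥ p q e = linear (φ (from z p - from z q) ∷ φ (p - q) ∷ []) (λ x y → x :≤ y ⇒ ⊢ con 0ℤ :≤ y :- x)
          φ-compare
        where
        module U = Uncrossed Bz {p} (flat-class {p} {x} e flat-x)
        k : ℤ
        k = φ (p - q)
        k≡ : k ≡ φ (p - q)
        k≡ = refl
        high : from z p - from z q < N· (k + 1ℤ)
        high = linear (from z p ∷ p ∷ from z (q + N· (k + 1ℤ)) ∷ from z q ∷ N· (k + 1ℤ) ∷ [])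
            (λ x y z u v → x :≤ y ⇒ y :< z ⇒ z :≡ u :+ v ⇒ ⊢ x :- u :< v) (U.from-≤ {p} ≤-refl)
            (U.from-> {q + N· (k + 1ℤ)} (linear-by (byCombination (1ℤ ∷ 1ℤ ∷ -1ℤ ∷ []))
            (p ∷ q ∷ N· k ∷ N ∷ N· (k + 1ℤ) ∷ []) (λ x y z u v → x :- y :< z :+ u ⇒ v :≡ z :+ u ⇒ ⊢ x :< y :+ v)
            up (N·-+1 k))) (from-shift (k + 1ℤ) q)
          where
          up : p - q < N· k + N
          up = φ-upper (p - q)
        φ-compare : φ (from z p - from z q) ≤ φ (p - q)
        φ-compare = ≮⇒≥ λ l → 1≰0 (linear (N· φ (from z p - from z q) ∷ from z p ∷ from z q ∷ N· (k + 1ℤ) ∷ [])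
            (λ x y z u → x :≤ y :- z ⇒ y :- z :< u ⇒ u :≤ x ⇒ ⊢ con 1ℤ :≤ con 0ℤ) (φ-lower (from z p - from z q))
            high (N·-mono {k + 1ℤ} {φ (from z p - from z q)} (linear
            (φ (p - q) ∷ φ (from z p - from z q) ∷ k ∷ []) (λ x y z → x :< y ⇒ z :≡ x ⇒ ⊢ z :+ con 1ℤ :≤ y) l
            k≡)))

      last≤ : ∀ p q → res q ≡ res x → φ (p - q) - φ (from z p - from z q) ≤ 0ℤ
      last≤ p q e = linear (φ (p - q) ∷ φ (from z p - from z q) ∷ []) (λ x y → x :≤ y ⇒ ⊢ x :- y :≤ con 0ℤ)
          φ-compare
        where
        module U = Uncrossed Bz {q} (flat-class {q} {x} e flat-x)
        k : ℤ
        k = φ (p - q)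
        k≡ : k ≡ φ (p - q)
        k≡ = refl
        low : N· k ≤ from z p - from z q
        low = go (<-cmp (p + N· (- k)) q)
          where
          lo : N· k ≤ p - q
          lo = φ-lower (p - q)
          go : _ → N· k ≤ from z p - from z q
          go (tri< l _ _) = ⊥-elim (1≰0 (linear-by (byCombination (1ℤ ∷ 1ℤ ∷ 1ℤ ∷ -1ℤ ∷ []))
              (p ∷ N· (- k) ∷ q ∷ N· k ∷ []) (λ x y z u → x :+ y :< z ⇒ u :≤ x :- z ⇒ y :≡ opp u ⇒ ⊢ con 1ℤ :≤
              con 0ℤ) l lo (N·-neg k)))
          go (tri≈ _ f _) = linear-by (byCombination (1ℤ ∷ -1ℤ ∷ []))
              (from z (p + N· (- k)) ∷ from z q ∷ from z p ∷ N· (- k) ∷ N· k ∷ [])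
              (λ x y z u v → x :≡ y ⇒ x :≡ z :+ u ⇒ u :≡ opp v ⇒ ⊢ v :≤ z :- y) (cong (from z) f)
              (from-shift (- k) p) (N·-neg k)
          go (tri> _ _ l) = linear (q ∷ from z (p + N· (- k)) ∷ from z q ∷ from z p ∷ N· (- k) ∷ N· k ∷ [])
              (λ x y z u v w → x :< y ⇒ z :≤ x ⇒ y :≡ u :+ v ⇒ v :≡ opp w ⇒ ⊢ w :≤ u :- z) (U.from-> l)
              (U.from-≤ {q} ≤-refl) (from-shift (- k) p) (N·-neg k)
        φ-compare : φ (p - q) ≤ φ (from z p - from z q)
        φ-compare = ≮⇒≥ λ l → 1≰0 (linear (from z p ∷ from z q ∷ N· φ (from z p - from z q) ∷ N ∷ N· k ∷ [])
            (λ x y z u v → x :- y :< z :+ u ⇒ v :≤ x :- y ⇒ z :+ u :≤ v ⇒ ⊢ con 1ℤ :≤ con 0ℤ)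
            (φ-upper (from z p - from z q)) low (N·-< {φ (from z p - from z q)} {k}
            (linear-by (byCombination (1ℤ ∷ 1ℤ ∷ -1ℤ ∷ [])) (φ (from z p - from z q) ∷ φ (p - q) ∷ k ∷ [])
            (λ x y z → x :< y ⇒ z :≡ y ⇒ ⊢ x :< z) l k≡)))

      first≥ : ∀ p q → res q ≡ res y → 0ℤ ≤ φ (p - q) - φ (from z p - from z q)
      first≥ p q e = linear (φ (from z p - from z q) ∷ φ (p - q) ∷ []) (λ x y → x :≤ y ⇒ ⊢ con 0ℤ :≤ y :- x)
          φ-compare
        where
        module U = Uncrossed Bz {q - 1ℤ} (flat-class {q - 1ℤ} {y - 1ℤ} (res-+ -1ℤ e) flat-y)
        k : ℤ
        k = φ (p - q)
        k≡ : k ≡ φ (p - q)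
        k≡ = refl
        high : from z p - from z q < N· (k + 1ℤ)
        high = linear-by (byCombination (1ℤ ∷ 1ℤ ∷ 1ℤ ∷ -1ℤ ∷ -1ℤ ∷ []))
            (q ∷ from z q ∷ from z (p + N· (- (k + 1ℤ))) ∷ from z p ∷ N· (- (k + 1ℤ)) ∷ N· (k + 1ℤ) ∷ [])
            (λ x y z u v w → x :- con 1ℤ :< y ⇒ z :≤ x :- con 1ℤ ⇒ z :≡ u :+ v ⇒ v :≡ opp w ⇒ ⊢ u :- y :< w)
            (U.from-> {q} (linear (q ∷ []) (λ x → ⊢ x :- con 1ℤ :< x)))
            (U.from-≤ {p + N· (- (k + 1ℤ))} (linear-by (byCombination (1ℤ ∷ 1ℤ ∷ -1ℤ ∷ []))
            (p ∷ q ∷ N· k ∷ N ∷ N· (k + 1ℤ) ∷ N· (- (k + 1ℤ)) ∷ [])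
            (λ x y z u v w → x :- y :< z :+ u ⇒ v :≡ z :+ u ⇒ w :≡ opp v ⇒ ⊢ x :+ w :≤ y :- con 1ℤ) up (N·-+1 k)
            (N·-neg (k + 1ℤ)))) (from-shift (- (k + 1ℤ)) p) (N·-neg (k + 1ℤ))
          where
          up : p - q < N· k + N
          up = φ-upper (p - q)
        φ-compare : φ (from z p - from z q) ≤ φ (p - q)
        φ-compare = ≮⇒≥ λ l → 1≰0 (linear (N· φ (from z p - from z q) ∷ from z p ∷ from z q ∷ N· (k + 1ℤ) ∷ [])
            (λ x y z u → x :≤ y :- z ⇒ y :- z :< u ⇒ u :≤ x ⇒ ⊢ con 1ℤ :≤ con 0ℤ) (φ-lower (from z p - from z q))
            high (N·-mono {k + 1ℤ} {φ (from z p - from z q)} (linear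
            (φ (p - q) ∷ φ (from z p - from z q) ∷ k ∷ []) (λ x y z → x :< y ⇒ z :≡ x ⇒ ⊢ z :+ con 1ℤ :≤ y) l
            k≡)))

      first≤ : ∀ p q → res p ≡ res y → φ (p - q) - φ (from z p - from z q) ≤ 0ℤ
      first≤ p q e = linear (φ (p - q) ∷ φ (from z p - from z q) ∷ []) (λ x y → x :≤ y ⇒ ⊢ x :- y :≤ con 0ℤ)
          φ-compare
        where
        module U = Uncrossed Bz {p - 1ℤ} (flat-class {p - 1ℤ} {y - 1ℤ} (res-+ -1ℤ e) flat-y)
        k : ℤ
        k = φ (p - q)
        k≡ : k ≡ φ (p - q)
        k≡ = refl
        low : N· k ≤ from z p - from z q
        low = go (<-cmp (q + N· k) p)
          where
          lo : N· k ≤ p - q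
          lo = φ-lower (p - q)
          go : _ → N· k ≤ from z p - from z q
          go (tri> _ _ l) = ⊥-elim (1≰0 (linear (p ∷ q ∷ N· k ∷ [])
              (λ x y z → x :< y :+ z ⇒ z :≤ x :- y ⇒ ⊢ con 1ℤ :≤ con 0ℤ) l lo))
          go (tri≈ _ f _) = linear-by (byCombination (1ℤ ∷ 1ℤ ∷ -1ℤ ∷ []))
              (from z (q + N· k) ∷ from z p ∷ from z q ∷ N· k ∷ [])
              (λ x y z u → x :≡ y ⇒ x :≡ z :+ u ⇒ ⊢ u :≤ y :- z) (cong (from z) f) (from-shift k q)
          go (tri< l _ _) = linear-by (byCombination (1ℤ ∷ 1ℤ ∷ 1ℤ ∷ -1ℤ ∷ []))
              (from z (q + N· k) ∷ p ∷ from z p ∷ from z q ∷ N· k ∷ [])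
              (λ x y z u v → x :≤ y :- con 1ℤ ⇒ y :- con 1ℤ :< z ⇒ x :≡ u :+ v ⇒ ⊢ v :≤ z :- u)
              (U.from-≤ {q + N· k} (linear (q ∷ N· k ∷ p ∷ []) (λ x y z → x :+ y :< z ⇒ ⊢ x :+ y :≤ z :- con 1ℤ)
              l)) (U.from-> {p} (linear (p ∷ []) (λ x → ⊢ x :- con 1ℤ :< x))) (from-shift k q)
        φ-compare : φ (p - q) ≤ φ (from z p - from z q)
        φ-compare = ≮⇒≥ λ l → 1≰0 (linear (from z p ∷ from z q ∷ N· φ (from z p - from z q) ∷ N ∷ N· k ∷ [])
            (λ x y z u v → x :- y :< z :+ u ⇒ v :≤ x :- y ⇒ z :+ u :≤ v ⇒ ⊢ con 1ℤ :≤ con 0ℤ)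
            (φ-upper (from z p - from z q)) low (N·-< {φ (from z p - from z q)} {k}
            (linear-by (byCombination (1ℤ ∷ 1ℤ ∷ -1ℤ ∷ [])) (φ (from z p - from z q) ∷ φ (p - q) ∷ k ∷ [])
            (λ x y z → x :< y ⇒ z :≡ y ⇒ ⊢ x :< z) l k≡)))

      -- The summand for `z` and the shift due to the translation never have opposite signs, so
      -- their positive parts add up. This is the reason why the lengths of translation and `z` add.
      data Aligned (e d : ℤ) : Set where
        up   : 0ℤ ≤ e → 0ℤ ≤ d → Aligned e d
        down : e ≤ 0ℤ → d ≤ 0ℤ → Aligned e d
        flat : d ≡ 0ℤ → Aligned e d

      aligned-split : ∀ {e d} → Aligned e d → (e + d) ⁺ ≡ d ⁺ + e ⁺
      aligned-split {e} {d} (up s t)   = linear-by (byEquations (1ℤ ∷ -1ℤ ∷ -1ℤ ∷ []))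
          ((e + d) ⁺ ∷ e ∷ d ∷ e ⁺ ∷ d ⁺ ∷ []) (λ x y z u v → x :≡ y :+ z ⇒ u :≡ y ⇒ v :≡ z ⇒ ⊢ x :≡ v :+ u)
          (⁺-pos {e + d} (linear (e ∷ d ∷ []) (λ x y → con 0ℤ :≤ x ⇒ con 0ℤ :≤ y ⇒ ⊢ con 0ℤ :≤ x :+ y) s t))
          (⁺-pos s) (⁺-pos t)
      aligned-split {e} {d} (down s t) = linear-by (byEquations (1ℤ ∷ -1ℤ ∷ -1ℤ ∷ []))
          ((e + d) ⁺ ∷ e ⁺ ∷ d ⁺ ∷ []) (λ x y z → x :≡ con 0ℤ ⇒ y :≡ con 0ℤ ⇒ z :≡ con 0ℤ ⇒ ⊢ x :≡ z :+ y)
          (⁺-neg {e + d} (linear (e ∷ d ∷ []) (λ x y → x :≤ con 0ℤ ⇒ y :≤ con 0ℤ ⇒ ⊢ x :+ y :≤ con 0ℤ) s t))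
          (⁺-neg s) (⁺-neg t)
      aligned-split {e} {d} (flat t)   = linear-by (byEquations (1ℤ ∷ -1ℤ ∷ [])) ((e + d) ⁺ ∷ e ⁺ ∷ d ⁺ ∷ [])
          (λ x y z → x :≡ y ⇒ z :≡ con 0ℤ ⇒ ⊢ x :≡ z :+ y) (cong _⁺ {e + d} {e}
          (linear (d ∷ e ∷ []) (λ x y → x :≡ con 0ℤ ⇒ ⊢ y :+ x :≡ y) t))
          (⁺-neg {d} (linear (d ∷ []) (λ x → x :≡ con 0ℤ ⇒ ⊢ x :≤ con 0ℤ) t))

      m≥0 : 0ℤ ≤ + m
      m≥0 = +≤+ z≤n

      aligned : ∀ p q → Aligned (φ (p - q) - φ (from z p - from z q)) (weight m x y p - weight m x y q)
      aligned p q = go (classify x y p) (classify x y q)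
        where
        go : Class x y p → Class x y q → Aligned (φ (p - q) - φ (from z p - from z q))
            (weight m x y p - weight m x y q)
        go (is-a e)    (is-a f)    = flat (linear-by (byEquations (1ℤ ∷ -1ℤ ∷ []))
            (weight m x y p ∷ + m ∷ weight m x y q ∷ []) (λ x y z → x :≡ y ⇒ z :≡ y ⇒ ⊢ x :- z :≡ con 0ℤ)
            (weight-x m ne e) (weight-x m ne f))
        go (is-a e)    (is-b _ f)  = up (last≥ p q e) (linear-by (byCombination (1ℤ ∷ -1ℤ ∷ 1ℤ ∷ (+ 2) ∷ []))
            (weight m x y p ∷ + m ∷ weight m x y q ∷ []) (λ x y z → x :≡ y ⇒ z :≡ opp y ⇒ con 0ℤ :≤ y ⇒ ⊢ con 0ℤ
            :≤ x :- z) (weight-x m ne e) (weight-y m ne f) m≥0)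
        go (is-a e)    (other f g) = up (last≥ p q e) (linear-by (byCombination (1ℤ ∷ -1ℤ ∷ []))
            (weight m x y p ∷ + m ∷ weight m x y q ∷ []) (λ x y z → x :≡ y ⇒ z :≡ con 0ℤ ⇒ con 0ℤ :≤ y ⇒ ⊢ con 0ℤ
            :≤ x :- z) (weight-x m ne e) (weight-o m f g) m≥0)
        go (is-b _ e)  (is-a f)    = down (first≤ p q e) (linear-by (byCombination (1ℤ ∷ 1ℤ ∷ -1ℤ ∷ (+ 2) ∷ []))
            (weight m x y p ∷ + m ∷ weight m x y q ∷ []) (λ x y z → x :≡ opp y ⇒ z :≡ y ⇒ con 0ℤ :≤ y ⇒ ⊢ x :- z
            :≤ con 0ℤ) (weight-y m ne e) (weight-x m ne f) m≥0)
        go (is-b _ e)  (is-b _ f)  = flat (linear-by (byEquations (1ℤ ∷ -1ℤ ∷ []))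
            (weight m x y p ∷ + m ∷ weight m x y q ∷ []) (λ x y z → x :≡ opp y ⇒ z :≡ opp y ⇒ ⊢ x :- z :≡ con 0ℤ)
            (weight-y m ne e) (weight-y m ne f))
        go (is-b _ e)  (other f g) = down (first≤ p q e) (linear-by (byCombination (1ℤ ∷ 1ℤ ∷ -1ℤ ∷ []))
            (weight m x y p ∷ + m ∷ weight m x y q ∷ []) (λ x y z → x :≡ opp y ⇒ z :≡ con 0ℤ ⇒ con 0ℤ :≤ y ⇒ ⊢ x
            :- z :≤ con 0ℤ) (weight-y m ne e) (weight-o m f g) m≥0)
        go (other e h) (is-a f)    = down (last≤ p q f) (linear-by (byCombination (1ℤ ∷ 1ℤ ∷ -1ℤ ∷ []))
            (weight m x y p ∷ weight m x y q ∷ + m ∷ []) (λ x y z → x :≡ con 0ℤ ⇒ y :≡ z ⇒ con 0ℤ :≤ z ⇒ ⊢ x :- y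
            :≤ con 0ℤ) (weight-o m e h) (weight-x m ne f) m≥0)
        go (other e h) (is-b _ f)  = up (first≥ p q f) (linear-by (byCombination (1ℤ ∷ -1ℤ ∷ []))
            (weight m x y p ∷ weight m x y q ∷ + m ∷ []) (λ x y z → x :≡ con 0ℤ ⇒ y :≡ opp z ⇒ con 0ℤ :≤ z ⇒ ⊢
            con 0ℤ :≤ x :- y) (weight-o m e h) (weight-y m ne f) m≥0)
        go (other e h) (other f g) = flat (linear-by (byEquations (1ℤ ∷ -1ℤ ∷ []))
            (weight m x y p ∷ weight m x y q ∷ []) (λ x y → x :≡ con 0ℤ ⇒ y :≡ con 0ℤ ⇒ ⊢ x :- y :≡ con 0ℤ)
            (weight-o m e h) (weight-o m f g))

      weightTerm-periodic : ∀ c → Periodic (λ q → (c - weight m x y q) ⁺)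
      weightTerm-periodic c q = cong (λ t → (c - t) ⁺) (weight-cong m x y (res-N q))

      row-o : ∀ {p} → res p ≢ res x → res p ≢ res y → ΣR (λ q → (weight m x y p - weight m x y q) ⁺) ≡ + m
      row-o {p} f g = linear-by (byEquations (1ℤ ∷ 1ℤ ∷ 1ℤ ∷ 1ℤ ∷ 1ℤ ∷ -1ℤ ∷ []))
          (ΣR (λ v → (weight m x y p - weight m x y v) ⁺) ∷ ΣR (λ z₁ → 0ℤ) ∷ (weight m x y p - weight m x y x) ⁺
          ∷ (weight m x y p - weight m x y y) ⁺ ∷ weight m x y p ∷ weight m x y y ∷ + m ∷ [])
          (λ x y z u v w p → x :+ (con 0ℤ :+ con 0ℤ) :≡ y :+ (z :+ u) ⇒ y :≡ con 0ℤ ⇒ z :≡ con 0ℤ ⇒ u :≡ v :- w ⇒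
          v :≡ con 0ℤ ⇒ w :≡ opp p ⇒ ⊢ x :≡ p) (ΣR-update₂ {G = λ _ → 0ℤ} (weightTerm-periodic (weight m x y p))
          (λ _ → refl) x y ne (λ q h k → ⁺-neg (linear-by (byCombination (1ℤ ∷ 1ℤ ∷ -1ℤ ∷ []))
          (weight m x y p ∷ weight m x y q ∷ []) (λ x y → x :≡ con 0ℤ ⇒ y :≡ con 0ℤ ⇒ ⊢ x :- y :≤ con 0ℤ)
          (weight-o m f g) (weight-o m h k)))) ΣR-0 (⁺-neg {weight m x y p - weight m x y x}
          (linear-by (byCombination (1ℤ ∷ 1ℤ ∷ -1ℤ ∷ [])) (weight m x y p ∷ weight m x y x ∷ + m ∷ [])
          (λ x y z → x :≡ con 0ℤ ⇒ y :≡ z ⇒ con 0ℤ :≤ z ⇒ ⊢ x :- y :≤ con 0ℤ) (weight-o m f g)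
          (weight-x m ne {x} refl) m≥0)) (⁺-pos {weight m x y p - weight m x y y}
          (linear-by (byCombination (1ℤ ∷ -1ℤ ∷ [])) (weight m x y p ∷ weight m x y y ∷ + m ∷ [])
          (λ x y z → x :≡ con 0ℤ ⇒ y :≡ opp z ⇒ con 0ℤ :≤ z ⇒ ⊢ con 0ℤ :≤ x :- y) (weight-o m f g)
          (weight-y m ne {y} refl) m≥0)) (weight-o m f g) (weight-y m ne {y} refl)

      row-x : ΣR (λ q → (weight m x y x - weight m x y q) ⁺) ≡ ΣR (λ _ → + m)
      row-x = linear-by (byEquations (1ℤ ∷ 1ℤ ∷ 1ℤ ∷ 1ℤ ∷ -1ℤ ∷ []))
          (ΣR (λ v → (weight m x y x - weight m x y v) ⁺) ∷ + m ∷ ΣR (λ z₁ → + m) ∷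
          (weight m x y x - weight m x y x) ⁺ ∷ (weight m x y x - weight m x y y) ⁺ ∷ weight m x y x ∷ weight m x
          y y ∷ []) (λ x y z u v w p → x :+ (y :+ y) :≡ z :+ (u :+ v) ⇒ u :≡ con 0ℤ ⇒ v :≡ w :- p ⇒ w :≡ y ⇒ p :≡
          opp y ⇒ ⊢ x :≡ z) (ΣR-update₂ {G = λ _ → + m} (weightTerm-periodic (weight m x y x)) (λ _ → refl) x y
          ne (λ q h k → trans (⁺-pos (linear-by (byCombination (1ℤ ∷ -1ℤ ∷ []))
          (weight m x y x ∷ + m ∷ weight m x y q ∷ []) (λ x y z → x :≡ y ⇒ z :≡ con 0ℤ ⇒ con 0ℤ :≤ y ⇒ ⊢ con 0ℤ
          :≤ x :- z) (weight-x m ne {x} refl) (weight-o m h k) m≥0))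
          (linear-by (byEquations (1ℤ ∷ -1ℤ ∷ [])) (weight m x y x ∷ + m ∷ weight m x y q ∷ [])
          (λ x y z → x :≡ y ⇒ z :≡ con 0ℤ ⇒ ⊢ x :- z :≡ y) (weight-x m ne {x} refl) (weight-o m h k))))
          (⁺-neg {weight m x y x - weight m x y x} (linear (weight m x y x ∷ []) (λ x → ⊢ x :- x :≤ con 0ℤ)))
          (⁺-pos {weight m x y x - weight m x y y} (linear-by (byCombination (1ℤ ∷ -1ℤ ∷ 1ℤ ∷ (+ 2) ∷ []))
          (weight m x y x ∷ + m ∷ weight m x y y ∷ []) (λ x y z → x :≡ y ⇒ z :≡ opp y ⇒ con 0ℤ :≤ y ⇒ ⊢ con 0ℤ :≤
          x :- z) (weight-x m ne {x} refl) (weight-y m ne {y} refl) m≥0)) (weight-x m ne {x} refl)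
          (weight-y m ne {y} refl)

      row-y : ΣR (λ q → (weight m x y y - weight m x y q) ⁺) ≡ 0ℤ
      row-y = trans (ΣR-cong (λ q → ⁺-neg (go q (classify x y q)))) ΣR-0
        where
        go : ∀ q → Class x y q → weight m x y y - weight m x y q ≤ 0ℤ
        go q (is-a f)    = linear-by (byCombination (1ℤ ∷ 1ℤ ∷ -1ℤ ∷ (+ 2) ∷ []))
            (weight m x y y ∷ + m ∷ weight m x y q ∷ []) (λ x y z → x :≡ opp y ⇒ z :≡ y ⇒ con 0ℤ :≤ y ⇒ ⊢ x :- z
            :≤ con 0ℤ) (weight-y m ne {y} refl) (weight-x m ne f) m≥0
        go q (is-b _ f)  = linear-by (byCombination (1ℤ ∷ 1ℤ ∷ -1ℤ ∷ []))
            (weight m x y y ∷ + m ∷ weight m x y q ∷ []) (λ x y z → x :≡ opp y ⇒ z :≡ opp y ⇒ ⊢ x :- z :≤ con 0ℤ)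
            (weight-y m ne {y} refl) (weight-y m ne f)
        go q (other f g) = linear-by (byCombination (1ℤ ∷ 1ℤ ∷ -1ℤ ∷ []))
            (weight m x y y ∷ + m ∷ weight m x y q ∷ []) (λ x y z → x :≡ opp y ⇒ z :≡ con 0ℤ ⇒ con 0ℤ :≤ y ⇒ ⊢ x
            :- z :≤ con 0ℤ) (weight-y m ne {y} refl) (weight-o m f g) m≥0

      -- The row of `x` contributes `n m`, the row of `y` contributes 0 and each of the `n − 2`
      -- others contributes `m`, in total `2 m (n − 1)`. The two terms `+ m` avoid a subtraction.
      weights : ΣR (λ p → ΣR (λ q → (weight m x y p - weight m x y q) ⁺)) + + m + + m ≡ ΣR (λ _ → + m) + ΣR
          (λ _ → + m)
      weights = linear (ΣR (λ p → ΣR (λ q → (weight m x y p - weight m x y q) ⁺)) ∷ + m ∷ ΣR (λ z₁ → + m) ∷ ΣR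
          (λ q → (weight m x y x - weight m x y q) ⁺) ∷ ΣR (λ q → (weight m x y y - weight m x y q) ⁺) ∷ [])
          (λ x y z u v → x :+ (y :+ y) :≡ z :+ (u :+ v) ⇒ u :≡ z ⇒ v :≡ con 0ℤ ⇒ ⊢ x :+ y :+ y :≡ z :+ z)
          (ΣR-update₂ {λ p → ΣR (λ q → (weight m x y p - weight m x y q) ⁺)} {λ _ → + m}
          (λ p → ΣR-cong (λ q → cong (λ t → (t - weight m x y q) ⁺) (weight-cong m x y (res-N p)))) (λ _ → refl)
          x y ne (λ p f g → row-o f g)) row-x row-y

    inversions-translate : ∀ {w} → Translates w z m x y →
      inversions w + + m + + m ≡ ΣR (λ _ → + m) + ΣR (λ _ → + m) + inversions z
    inversions-translate {w} T = linear (inversions w ∷ ΣR (λ p → ΣR (λ q → (weight m x y p - weight m x y q) ⁺))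
        ∷ inversions z ∷ + m ∷ ΣR (λ z₁ → + m) ∷ []) (λ x y z u v → x :≡ y :+ z ⇒ y :+ u :+ u :≡ v :+ v ⇒ ⊢ x :+
        u :+ u :≡ v :+ v :+ z) total weights
      where
      from-w : ∀ p → from w (p + N· weight m x y p) ≡ from z p
      from-w p = trans (cong (from w) (sym (trans (T (from z p))
          (cong (λ t → t + N· weight m x y t) (to-from z p))))) (from-to w (from z p))
      term : ∀ p q → (φ (p - q) - φ (from w p - from w q)) ⁺ ≡ (weight m x y p - weight m x y q) ⁺ +
          (φ (p - q) - φ (from z p - from z q)) ⁺
      -- Each index is moved within its class by its own weight, to the point where the preimage
      -- under `w` is the old preimage under `z`.
      term p q = trans (sym (periodic-shift (inversion-periodicˡ w q) (weight m x y p) p))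
        (trans (sym (periodic-shift (inversion-periodicʳ w (p + N· weight m x y p)) (weight m x y q) q))
          (trans (cong _⁺ shifted) (aligned-split (aligned p q))))
        where
        φ-shifted : φ (p + N· weight m x y p - (q + N· weight m x y q)) ≡ φ (p - q) +
            (weight m x y p - weight m x y q)
        φ-shifted = trans (cong φ {p + N· weight m x y p - (q + N· weight m x y q)}
            {p - q + N· (weight m x y p - weight m x y q)}
          (linear-by (byEquations (-1ℤ ∷ [])) (N· (weight m x y p - weight m x y q) ∷ N· weight m x y p ∷ N·
              weight m x y q ∷ p ∷ q ∷ []) (λ x y z u v → x :≡ y :- z ⇒ ⊢ u :+ y :- (v :+ z) :≡ u :- v :+ x)
              (N·-- (weight m x y p) (weight m x y q)))) (φ-shift (p - q) (weight m x y p - weight m x y q))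
        shifted : φ (p + N· weight m x y p - (q + N· weight m x y q)) - φ
            (from w (p + N· weight m x y p) - from w (q + N· weight m x y q)) ≡
                  φ (p - q) - φ (from z p - from z q) + (weight m x y p - weight m x y q)
        shifted = linear-by (byEquations (1ℤ ∷ -1ℤ ∷ [])) (φ (p + N· weight m x y p - (q + N· weight m x y q)) ∷
            φ (p - q) ∷ weight m x y p ∷ weight m x y q ∷ φ (from w (p + N· weight m x y p) - from w
            (q + N· weight m x y q)) ∷ φ (from z p - from z q) ∷ [])
            (λ x y z u v w → x :≡ y :+ (z :- u) ⇒ v :≡ w ⇒ ⊢ x :- v :≡ y :- w :+ (z :- u)) φ-shifted
            (cong₂ (λ s t → φ (s - t)) (from-w p) (from-w q))
      total : inversions w ≡ ΣR (λ p → ΣR (λ q → (weight m x y p - weight m x y q) ⁺)) + inversions z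
      total = trans (ΣR-cong (λ p → trans (ΣR-cong (term p)) (ΣR-+ (λ q → (weight m x y p - weight m x y q) ⁺)
          _))) (ΣR-+ (λ p → ΣR (λ q → (weight m x y p - weight m x y q) ⁺)) _)

  ΣR-constant : ∀ m → ΣR (λ _ → + m) ≡ + (n ℕ.* m)
  ΣR-constant m = trans (ΣR-sum (λ _ → + m)) (go n)
    where
    go : ∀ k → sum {k} (λ _ → + m) ≡ + (k ℕ.* m)
    go zero    = refl
    go (suc k) = cong (λ t → + m + t) (go k)

  translate-length : ∀ {z w : W n} {m x y} → rank (perm z) x x ≤ 0ℤ → rank (perm z) (y - 1ℤ) (y - 1ℤ) ≤ 0ℤ → res
      x ≢ res y →
    Translates (perm w) (perm z) m x y → ∀ {l} → HasLength z l → HasLength w (2 ℕ.* m ℕ.* (n ℕ.∸ 1) ℕ.+ l)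
  translate-length {z} {w} {m} {x} {y} fx fy ne T {l} L = subst (HasLength w) (+-injective total)
      (proj₂ (length-exists w))
    where
    k : ℕ
    k = proj₁ (length-exists w)
    n·m : + (n ℕ.* m) ≡ + m + + ((n ℕ.∸ 1) ℕ.* m)
    n·m = cong (λ t → + (t ℕ.* m)) (sym (ℕP.m+[n∸m]≡n {1} {n} (ℕP.≤-trans (s≤s z≤n) 3≤n)))
    double : ∀ m r l → 2 ℕ.* m ℕ.* r ℕ.+ l ≡ r ℕ.* m ℕ.+ r ℕ.* m ℕ.+ l
    double = ℕSolver.solve-∀
    counted : + k ≡ + ((n ℕ.∸ 1) ℕ.* m) + + ((n ℕ.∸ 1) ℕ.* m) + + l
    counted = linear-by (byBoth ((+ 2) ∷ (+ 2) ∷ (+ 4) ∷ (+ 4) ∷ (+ 2) ∷ -[1+ 1 ] ∷ [])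
        ((+ 2) ∷ -[1+ 1 ] ∷ -[1+ 3 ] ∷ -[1+ 3 ] ∷ -[1+ 1 ] ∷ (+ 2) ∷ []))
        (inversions (perm w) ∷ + m ∷ ΣR (λ z₁ → + m) ∷ inversions (perm z) ∷ + (n ℕ.* m) ∷ + ((n ℕ.∸ 1) ℕ.* m) ∷
        + proj₁ (length-exists w) ∷ + l ∷ []) (λ x y z u v w p q → x :+ y :+ y :≡ z :+ z :+ u ⇒ z :≡ v ⇒ v :≡ y
        :+ w ⇒ p :≡ x ⇒ q :≡ u ⇒ ⊢ p :≡ w :+ w :+ q) (TranslateLength.inversions-translate (balanced-word z) {m}
        fx fy ne {perm w} T) (ΣR-constant m) n·m (hasLength-inversions {w} (proj₂ (length-exists w)))
        (hasLength-inversions {z} L)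
    total : + k ≡ + (2 ℕ.* m ℕ.* (n ℕ.∸ 1) ℕ.+ l)
    total = trans counted (cong +_ (sym (double m (n ℕ.∸ 1) l)))

  -- Products of reflections with disjoint ends

  left right : {β : Q n} → IsRoot β → ℤ
  left (a , _)      = a
  right (_ , b , _) = b

  left<right : {β : Q n} (P : IsRoot β) → left P < right P
  left<right (_ , _ , l , _) = l

  left≢right : {β : Q n} (P : IsRoot β) → res (left P) ≢ res (right P)
  left≢right (_ , _ , _ , ne , _) = ne

  ends≗ : {β : Q n} (P : IsRoot β) → β ≗ root (left P) (right P)
  ends≗ (_ , _ , _ , _ , e) = e

  hat-ends : {β : Q n} (P : IsRoot β) → ∀ k → hat β k ≡ φ (k - left P) - φ (k - right P)
  hat-ends P k = trans (ends≗ P (cls k)) (hat-root (left P) (right P) k)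

  jump-ends : {β : Q n} (P : IsRoot β) → ∀ k → hat β k - hat β (k - 1ℤ) ≡ δ k (left P) - δ k (right P)
  jump-ends {β} P k = trans (cong₂ _-_ (ends≗ P (cls k)) (ends≗ P (cls (k - 1ℤ))))
      (jump-root (left P) (right P) k)

  hat-nonNeg : {β : Q n} (P : IsRoot β) → ∀ k → 0ℤ ≤ hat β k
  hat-nonNeg P k = subst (0ℤ ≤_) (sym (hat-ends P k)) (root-nonNeg (<⇒≤ (left<right P)) k)

  -- Reflections without a common end class move disjoint sets of points, so that their crossings of
  -- a wall simply add up.
  record Apart {β γ : Q n} (P : IsRoot β) (R : IsRoot γ) : Set where
    field
      ll : res (left P) ≢ res (left R)
      lr : res (left P) ≢ res (right R)
      rl : res (right P) ≢ res (left R)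
      rr : res (right P) ≢ res (right R)

  supp-left : {β : Q n} (P : IsRoot β) → 1ℤ ≤ hat β (left P)
  supp-left {β} P = linear-by (byCombination (1ℤ ∷ -1ℤ ∷ -1ℤ ∷ []))
      (hat β (left P) ∷ hat β (left P - 1ℤ) ∷ δ (left P) (left P) ∷ δ (left P) (right P) ∷ [])
      (λ x y z u → x :- y :≡ z :- u ⇒ z :≡ con 1ℤ ⇒ u :≡ con 0ℤ ⇒ con 0ℤ :≤ y ⇒ ⊢ con 1ℤ :≤ x)
      (jump-ends P (left P)) (δ-yes {left P} {left P} refl) (δ-no {left P} {right P} (left≢right P))
      (hat-nonNeg P (left P - 1ℤ))

  supp-right : {β : Q n} (P : IsRoot β) → 1ℤ ≤ hat β (right P - 1ℤ)
  supp-right {β} P = linear-by (byCombination (1ℤ ∷ 1ℤ ∷ -1ℤ ∷ []))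
      (hat β (right P) ∷ hat β (right P - 1ℤ) ∷ δ (right P) (left P) ∷ δ (right P) (right P) ∷ [])
      (λ x y z u → x :- y :≡ z :- u ⇒ u :≡ con 1ℤ ⇒ z :≡ con 0ℤ ⇒ con 0ℤ :≤ x ⇒ ⊢ con 1ℤ :≤ y)
      (jump-ends P (right P)) (δ-yes {right P} {right P} refl) (δ-no {right P} {left P} (left≢right P ∘ sym))
      (hat-nonNeg P (right P))

  supp : {β : Q n} {k : ℤ} → 1ℤ ≤ hat β k → cls k ∈supp β
  supp p e = 1≰0′ (subst (1ℤ ≤_) e p)
    where
    1≰0′ : ¬ 1ℤ ≤ 0ℤ
    1≰0′ (+≤+ ())

  -- A root has `left` and `right − 1` in its support. Equal ends on the same side give a common
  -- simple root, and a left end that meets a right end gives two adjacent ones.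
  disconnected⇒apart : {β γ : Q n} (P : IsRoot β) (R : IsRoot γ) → Disconnected β γ → Apart P R
  disconnected⇒apart {β} {γ} P R (disjoint , far) = record
    { ll = λ e → disjoint (cls (left P)) (supp {β} {left P} (supp-left P) ,
        supp {γ} {left P} (subst (1ℤ ≤_) (sym (hat-cong γ {left P} {left R} e)) (supp-left R)))
    ; lr = λ e → far (cls (left P)) (cls (right R - 1ℤ)) (supp {β} {left P} (supp-left P))
        (supp {γ} {right R - 1ℤ} (supp-right R))
        (inj₂ (next (right R) (left P) e))
    ; rl = λ e → far (cls (right P - 1ℤ)) (cls (left R)) (supp {β} {right P - 1ℤ} (supp-right P))
        (supp {γ} {left R} (supp-left R))
        (inj₁ (next (right P) (left R) (sym e)))
    ; rr = λ e → disjoint (cls (right P - 1ℤ)) (supp {β} {right P - 1ℤ} (supp-right P) ,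
        supp {γ} {right P - 1ℤ} (subst (1ℤ ≤_) (sym (hat-cong γ {right P - 1ℤ} {right R - 1ℤ} (res-+ -1ℤ e)))
            (supp-right R)))
    }
    where
    next : ∀ x y → res y ≡ res x → Next (cls (x - 1ℤ)) (cls y)
    next x y e = res-next (trans (res-cls y) (trans e
        (trans (cong res {x} {x - 1ℤ + 1ℤ} (linear (x ∷ []) (λ x → ⊢ x :≡ x :- con 1ℤ :+ con 1ℤ)))
        (res-+ 1ℤ (sym (res-cls (x - 1ℤ)))))))

  -- A common end on the same side makes the pairing at least 1; a left end that meets a right end
  -- makes it at most -1.
  orthogonal⇒apart : {β γ : Q n} (P : IsRoot β) (R : IsRoot γ) → β ⊥ γ → Apart P R
  orthogonal⇒apart {β} {γ} P R o = record
    { ll = λ e → ⊥-elim (1≰0 (linear-by (byCombination (1ℤ ∷ 1ℤ ∷ -1ℤ ∷ [])) (δ a x ∷ δ a y ∷ δ b x ∷ δ b y ∷ [])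
        (λ x y z u → x :- y :- (z :- u) :≡ con 0ℤ ⇒ x :≡ con 1ℤ ⇒ y :≡ con 0ℤ ⇒ z :≡ con 0ℤ ⇒ con 0ℤ :≤ u ⇒ ⊢ con
        1ℤ :≤ con 0ℤ) pairing (δ-yes {a} {x} (sym e)) (δ-no {a} {y} (λ f → xy (trans e f)))
        (δ-no {b} {x} (λ f → ab (trans (sym e) (sym f)))) (proj₁ (δ-range b y))))
    ; lr = λ e → ⊥-elim (1≰0 (linear-by (byCombination (1ℤ ∷ -1ℤ ∷ -1ℤ ∷ []))
        (δ a x ∷ δ a y ∷ δ b x ∷ δ b y ∷ []) (λ x y z u → x :- y :- (z :- u) :≡ con 0ℤ ⇒ z :≡ con 1ℤ ⇒ x :≡ con
        0ℤ ⇒ u :≡ con 0ℤ ⇒ con 0ℤ :≤ y ⇒ ⊢ con 1ℤ :≤ con 0ℤ) pairing (δ-yes {b} {x} (sym e))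
        (δ-no {a} {x} (λ f → ab (trans f e))) (δ-no {b} {y} (λ f → xy (trans e f))) (proj₁ (δ-range a y))))
    ; rl = λ e → ⊥-elim (1≰0 (linear-by (byCombination (1ℤ ∷ -1ℤ ∷ -1ℤ ∷ []))
        (δ a x ∷ δ a y ∷ δ b x ∷ δ b y ∷ []) (λ x y z u → x :- y :- (z :- u) :≡ con 0ℤ ⇒ y :≡ con 1ℤ ⇒ x :≡ con
        0ℤ ⇒ u :≡ con 0ℤ ⇒ con 0ℤ :≤ z ⇒ ⊢ con 1ℤ :≤ con 0ℤ) pairing (δ-yes {a} {y} (sym e))
        (δ-no {a} {x} (λ f → xy (trans (sym f) (sym e)))) (δ-no {b} {y} (λ f → ab (trans (sym e) (sym f))))
        (proj₁ (δ-range b x))))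
    ; rr = λ e → ⊥-elim (1≰0 (linear-by (byCombination (1ℤ ∷ 1ℤ ∷ -1ℤ ∷ [])) (δ a x ∷ δ a y ∷ δ b x ∷ δ b y ∷ [])
        (λ x y z u → x :- y :- (z :- u) :≡ con 0ℤ ⇒ u :≡ con 1ℤ ⇒ z :≡ con 0ℤ ⇒ y :≡ con 0ℤ ⇒ con 0ℤ :≤ x ⇒ ⊢ con
        1ℤ :≤ con 0ℤ) pairing (δ-yes {b} {y} (sym e)) (δ-no {b} {x} (λ f → xy (trans (sym f) (sym e))))
        (δ-no {a} {y} (λ f → ab (trans f e))) (proj₁ (δ-range a x))))
    }
    where
    x y a b : ℤ
    x = left P
    y = right P
    a = left R
    b = right R
    xy : res x ≢ res y
    xy = left≢right P
    ab : res a ≢ res b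
    ab = left≢right R
    pairing : (δ a x - δ a y) - (δ b x - δ b y) ≡ 0ℤ
    pairing = trans (sym (form-root-root x y a b)) (trans
        (sym (trans (form-congˡ {β} {root x y} γ (ends≗ P)) (form-congʳ (root x y) (ends≗ R)))) o)

  prodₚ : ∀ {k} (γ : Vector (Q n) k) → (∀ i → IsRoot (γ i)) → Perm
  prodₚ {zero}  γ P = 1ₚ
  prodₚ {suc k} γ P = transposition _ _ (left≢right (P Fin.zero)) · prodₚ (γ ∘ Fin.suc) (P ∘ Fin.suc)

  balanced-prod : ∀ {k} (γ : Vector (Q n) k) P → Balanced (prodₚ γ P)
  balanced-prod {zero}  γ P = balanced-1
  balanced-prod {suc k} γ P = balanced-· (balanced-transposition _ _ _)
      (balanced-prod (γ ∘ Fin.suc) (P ∘ Fin.suc))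

  rep-prod : ∀ {k} (γ : Vector (Q n) k) P → Rep (reflections γ) (prodₚ γ P)
  rep-prod {zero}  γ P = rep-id
  rep-prod {suc k} γ P = rep-∘ (rep-reflection (left≢right (P Fin.zero)) (ends≗ (P Fin.zero)))
      (rep-prod (γ ∘ Fin.suc) (P ∘ Fin.suc))

  prod-fixes : ∀ {k} (γ : Vector (Q n) k) P {c} → (∀ i → res c ≢ res (left (P i)) × res c ≢ res (right (P i))) →
      to (prodₚ γ P) c ≡ c
  prod-fixes {zero}  γ P f = refl
  prod-fixes {suc k} γ P f = trans (cong (transpose _ _) (prod-fixes (γ ∘ Fin.suc) (P ∘ Fin.suc) (f ∘ Fin.suc)))
    (transpose-o _ _ (proj₁ (f Fin.zero)) (proj₂ (f Fin.zero)))

  rank-disjoint : ∀ {a b} (ne : res a ≢ res b) v → (∀ c → res c ≡ res a ⊎ res c ≡ res b → to v c ≡ c) → ∀ k →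
                  rank (transposition a b ne · v) k k ≡ rank v k k + rank (transposition a b ne) k k
  rank-disjoint {a} {b} ne v fix k = trans (ΣR-cong (λ c → term c (classify a b c))) (ΣR-+ _ _)
    where
    self : ∀ c → (φ (k - c) - φ (k - c)) ⁺ ≡ 0ℤ
    self c = trans (cong _⁺ (+-inverseʳ (φ (k - c)))) (⁺-pos ≤-refl)
    t : ℤ → ℤ
    t = transpose a b
    fixed : ∀ c → to v c ≡ c → (φ (k - c) - φ (k - t (to v c))) ⁺ ≡ (φ (k - c) - φ (k - to v c)) ⁺ +
        (φ (k - c) - φ (k - t c)) ⁺
    fixed c e = trans (cong (λ s → (φ (k - c) - φ (k - t s)) ⁺) e)
      (sym (trans (cong (λ s → s + (φ (k - c) - φ (k - t c)) ⁺)
          (trans (cong (λ s → (φ (k - c) - φ (k - s)) ⁺) e) (self c))) (+-identityˡ _)))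
    term : ∀ c → Class a b c → (φ (k - c) - φ (k - t (to v c))) ⁺ ≡ (φ (k - c) - φ (k - to v c)) ⁺ +
        (φ (k - c) - φ (k - t c)) ⁺
    term c (is-a e)    = fixed c (fix c (inj₁ e))
    term c (is-b _ e)  = fixed c (fix c (inj₂ e))
    term c (other f g) = trans (cong (λ s → (φ (k - c) - φ (k - s)) ⁺)
        (transpose-o a b (away a inj₁ f) (away b inj₂ g)))
      (sym (trans (cong (λ s → (φ (k - c) - φ (k - to v c)) ⁺ + s)
          (trans (cong (λ s → (φ (k - c) - φ (k - s)) ⁺) (transpose-o a b f g)) (self c))) (+-identityʳ _)))
      where
      away : ∀ x → (∀ {d} → res d ≡ res x → res d ≡ res a ⊎ res d ≡ res b) → res c ≢ res x → res (to v c) ≢ res x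
      away x inj h e = h (trans (cong res (sym (to-injective v (fix (to v c) (inj e))))) e)

  -- Each class is moved by at most one factor, and a single reflection crosses the wall `x` as
  -- often as the coefficient of its root at `x` says.
  prod-flux : ∀ {k} (γ : Vector (Q n) k) P → (∀ i j → i ≢ j → Apart (P i) (P j)) → ∀ x →
              rank (prodₚ γ P) x x ≡ hat (sumQ γ) x
  prod-flux {zero}  γ P A x = rank-1 x
  prod-flux {suc k} γ P A x = begin
    rank (prodₚ γ P) x x
      ≡⟨ rank-disjoint (left≢right (P Fin.zero)) rest fix x ⟩
    rank rest x x + rank (transposition _ _ (left≢right (P Fin.zero))) x x
      ≡⟨ cong₂ _+_ (prod-flux (γ ∘ Fin.suc) (P ∘ Fin.suc) (λ i j f → A (Fin.suc i) (Fin.suc j)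
          (f ∘ Data.Fin.Properties.suc-injective)) x)
          (trans (rank-transposition (left≢right (P Fin.zero)) (<⇒≤ (left<right (P Fin.zero))) x)
              (sym (hat-ends (P Fin.zero) x))) ⟩
    hat (sumQ (γ ∘ Fin.suc)) x + hat (γ Fin.zero) x
      ≡⟨ +-comm (hat (sumQ (γ ∘ Fin.suc)) x) (hat (γ Fin.zero) x) ⟩
    hat (sumQ γ) x ∎
    where
    open ≡-Reasoning
    import Data.Fin.Properties
    rest : Perm
    rest = prodₚ (γ ∘ Fin.suc) (P ∘ Fin.suc)
    fix : ∀ c → res c ≡ res (left (P Fin.zero)) ⊎ res c ≡ res (right (P Fin.zero)) → to rest c ≡ c
    fix c (inj₁ e) = prod-fixes (γ ∘ Fin.suc) (P ∘ Fin.suc) λ i →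
      (λ f → Apart.ll (A Fin.zero (Fin.suc i) λ ()) (trans (sym e) f)) ,
          (λ f → Apart.lr (A Fin.zero (Fin.suc i) λ ()) (trans (sym e) f))
    fix c (inj₂ e) = prod-fixes (γ ∘ Fin.suc) (P ∘ Fin.suc) λ i →
      (λ f → Apart.rl (A Fin.zero (Fin.suc i) λ ()) (trans (sym e) f)) ,
          (λ f → Apart.rr (A Fin.zero (Fin.suc i) λ ()) (trans (sym e) f))

  -- Chains in the moment graph

  act-++ : ∀ u w a → act (u ++ w) a ≡ act u (act w a)
  act-++ []      w a = refl
  act-++ (i ∷ u) w a = cong (to (simpleₚ i)) (act-++ u w a)

  -- Conjugation by the simple reflection at `a` moves `a` one step towards `b` and does not move
  -- `b` away, so the distance shrinks.
  reflection-word : ∀ fuel {a b} → a < b → res a ≢ res b → b - a ≤ + fuel → ∃[ w ]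
      (∀ c → act w c ≡ transpose a b c)
  reflection-word zero {a} {b} l ne s = ⊥-elim (1≰0
      (linear (a ∷ b ∷ []) (λ x y → x :< y ⇒ y :- x :≤ con 0ℤ ⇒ ⊢ con 1ℤ :≤ con 0ℤ) l s))
  reflection-word (suc fuel) {a} {b} l ne s = go (b ≟ a + 1ℤ)
    where
    i : Fin n
    i = cls a
    S : Perm
    S = simpleₚ i
    at-i : res a ≡ res (pt i)
    at-i = sym (res-cls a)
    S-a : to (simpleₚ i) a ≡ a + 1ℤ
    S-a = trans (sym (simple-as-transpose i at-i refl a)) (transpose-at-a a (a + 1ℤ) (res-suc≢ a))
    go : Dec (b ≡ a + 1ℤ) → ∃[ w ] (∀ c → act w c ≡ transpose a b c)
    go (yes e) = i ∷ [] , λ c → sym (simple-as-transpose i at-i e c)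
    go (no f)  = i ∷ (proj₁ IH ∷ʳ i) , λ c → trans (cong (to S)
        (trans (act-snoc (proj₁ IH) i c) (proj₂ IH (to S c))))
      (trans (cong (to S) (sym (transpose-conj a b ne S c))) (transpose-involutive _ _ (res-suc≢ (pt i))
          (transpose a b c)))
      where
      b>a+1 : a + 1ℤ < b
      b>a+1 = ≤∧≢⇒< (linear (a ∷ b ∷ []) (λ x y → x :< y ⇒ ⊢ x :+ con 1ℤ :≤ y) l) (f ∘ sym)
      S-b : (to (simpleₚ i) b ≤ b) × (a + 1ℤ < to (simpleₚ i) b)
      S-b = decide (simple-range i b)
        where
        decide : _ → (to (simpleₚ i) b ≤ b) × (a + 1ℤ < to (simpleₚ i) b)
        decide (inj₁ (_ , e))        = ⊥-elim (ne (trans at-i (sym e)))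
        decide (inj₂ (inj₂ e))       = linear (to (simpleₚ i) b ∷ b ∷ []) (λ x y → x :≡ y ⇒ ⊢ x :≤ y) e ,
            linear-by (byCombination (1ℤ ∷ -1ℤ ∷ [])) (to (simpleₚ i) b ∷ b ∷ a ∷ [])
            (λ x y z → x :≡ y ⇒ z :+ con 1ℤ :< y ⇒ ⊢ z :+ con 1ℤ :< x) e b>a+1
        decide (inj₂ (inj₁ e))       = linear (to (simpleₚ i) b ∷ b ∷ []) (λ x y → x :≡ y :- con 1ℤ ⇒ ⊢ x :≤ y) e
            , ≤∧≢⇒< (linear-by (byCombination (1ℤ ∷ -1ℤ ∷ [])) (to (simpleₚ i) b ∷ b ∷ a ∷ [])
            (λ x y z → x :≡ y :- con 1ℤ ⇒ z :+ con 1ℤ :< y ⇒ ⊢ z :+ con 1ℤ :≤ x) e b>a+1) λ g → ne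
          (to-res⁻¹ S (cong res (trans S-a g)))
      IH : ∃[ w ] (∀ c → act w c ≡ transpose (to S a) (to S b) c)
      IH = reflection-word fuel (linear (to (simpleₚ i) a ∷ a ∷ to (simpleₚ i) b ∷ [])
          (λ x y z → x :≡ y :+ con 1ℤ ⇒ y :+ con 1ℤ :< z ⇒ ⊢ x :< z) S-a (proj₂ S-b)) (λ e → ne (to-res⁻¹ S e))
          (linear-by (byCombination (1ℤ ∷ -1ℤ ∷ [])) (to (simpleₚ i) a ∷ a ∷ to (simpleₚ i) b ∷ b ∷ + fuel ∷ [])
          (λ x y z u v → x :≡ y :+ con 1ℤ ⇒ z :≤ u ⇒ u :- y :≤ con 1ℤ :+ v ⇒ ⊢ z :- x :≤ v) S-a (proj₁ S-b) s)

  reflect-edge : ∀ u {a b} → a < b → res a ≢ res b → ∃[ v ] Reflects u v a b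
  reflect-edge u {a} {b} l ne = u ++ proj₁ word , l , ne , λ c → trans (act-++ u (proj₁ word) c)
      (cong (act u) (proj₂ word c))
    where
    word : ∃[ w ] (∀ c → act w c ≡ transpose a b c)
    word = reflection-word (∣ b - a ∣) l ne (≤-reflexive
        (sym (0≤i⇒+∣i∣≡i {b - a} (linear (a ∷ b ∷ []) (λ x y → x :< y ⇒ ⊢ con 0ℤ :≤ y :- x) l))))

  -- Edges multiply on the right, so a chain from `u` ends at `u π`. The end is a word of no
  -- particular form, and only its action is prescribed.
  record Path (u : W n) (π : ℤ → ℤ) (D : Q n) : Set where
    field
      end    : W n
      chain  : Chain u end
      degree : chainDegree chain ≗ D
      action : ∀ c → act end c ≡ act u (π c)

  open Path

  chainDegree-◅◅ : {u v w : W n} (es : Chain u v) (fs : Chain v w) → chainDegree (es ◅◅ fs) ≗ chainDegree es +Q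
      chainDegree fs
  chainDegree-◅◅ ε              fs i = sym (+-identityˡ _)
  chainDegree-◅◅ ((α , _) ◅ es) fs i = trans (cong (λ t → α i + t) (chainDegree-◅◅ es fs i))
      (sym (+-assoc (α i) _ _))

  path-∘ : ∀ {u π ρ D E} → (p : Path u π D) → Path (end p) ρ E → Path u (π ∘ ρ) (D +Q E)
  path-∘ p q = record
    { end    = end q
    ; chain  = chain p ◅◅ chain q
    ; degree = λ i → trans (chainDegree-◅◅ (chain p) (chain q) i) (cong₂ _+_ (degree p i) (degree q i))
    ; action = λ c → trans (action q c) (action p _)
    }

  path-edge : ∀ u {a b} → a < b → res a ≢ res b → Path u (transpose a b) (root a b)
  path-edge u {a} {b} l ne = record
    { end    = proj₁ e
    ; chain  = reflects⇒edge {u} {proj₁ e} (proj₂ e) ◅ ε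
    ; degree = λ i → +-identityʳ _
    ; action = proj₂ (proj₂ (proj₂ e))
    }
    where
    e : ∃[ v ] Reflects u v a b
    e = reflect-edge u l ne

  path-id : ∀ u → Path u id 0Q
  path-id u = record { end = u ; chain = ε ; degree = λ _ → refl ; action = λ _ → refl }

  path-cong : ∀ {u π ρ D E} → (∀ c → π c ≡ ρ c) → D ≗ E → Path u π D → Path u ρ E
  path-cong {u} f e p = record
    { end = end p ; chain = chain p ; degree = λ i → trans (degree p i) (e i) ; action = λ c → trans (action p c)
        (cong (act u) (f c)) }

  path-prod : ∀ {k} (γ : Vector (Q n) k) P u → Path u (to (prodₚ γ P)) (sumQ γ)
  path-prod {zero}  γ P u = path-id u
  path-prod {suc k} γ P u = path-cong (λ _ → refl) (λ i → cong (λ t → t + sumQ (γ ∘ Fin.suc) i)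
      (sym (ends≗ (P Fin.zero) i)))
    (path-∘ first (path-prod (γ ∘ Fin.suc) (P ∘ Fin.suc) (end first)))
    where
    first : Path u _ _
    first = path-edge u (left<right (P Fin.zero)) (left≢right (P Fin.zero))

  -- s_{[x,y)} and s_{c − [x,y)} compose to the translation t_{e_x − e_y}.
  module _ {x y : ℤ} (x<y : x < y) (y<x+N : y < x + N) where

    window≢ : res x ≢ res y
    window≢ = res≢-offset (linear (x ∷ y ∷ []) (λ x y → x :< y ⇒ ⊢ con 0ℤ :< y :- x) x<y)
        (linear (y ∷ x ∷ N ∷ []) (λ x y z → x :< y :+ z ⇒ ⊢ x :- y :< z) y<x+N)

    private
      ne′ : res y ≢ res (x + N)
      ne′ e = window≢ (sym (trans e (res-N x)))

    translate-once : ∀ c → transpose y (x + N) (transpose x y c) ≡ c + N· weight 1 x y c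
    translate-once c = go (classify x y c)
      where
      go : Class x y c → transpose y (x + N) (transpose x y c) ≡ c + N· weight 1 x y c
      go (is-a e)    = trans (cong (transpose y (x + N)) (transpose-a x y e))
        (trans (transpose-a y (x + N) (trans (res-+ (y - x) e)
            (cong res {x + (y - x)} {y} (linear (x ∷ y ∷ []) (λ x y → ⊢ x :+ (y :- x) :≡ y)))))
          (linear-by (byEquations (-1ℤ ∷ -1ℤ ∷ [])) (N· weight 1 x y c ∷ N· (+ 1) ∷ N ∷ c ∷ y ∷ x ∷ [])
              (λ x y z u v w → x :≡ y ⇒ y :≡ z ⇒ ⊢ u :+ (v :- w) :+ (w :+ z :- v) :≡ u :+ x)
              (cong N·_ (weight-x 1 window≢ e)) N·-1))
      go (is-b _ e)  = trans (cong (transpose y (x + N)) (transpose-b x y window≢ e))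
        (trans (transpose-b y (x + N) ne′ (trans (res-+ (- (y - x)) e)
            (trans (cong res {y - (y - x)} {x} (linear (y ∷ x ∷ []) (λ x y → ⊢ x :- (x :- y) :≡ y)))
            (sym (res-N x)))))
          (linear-by (byEquations (-1ℤ ∷ -1ℤ ∷ [])) (N· weight 1 x y c ∷ N· (- (+ 1)) ∷ N ∷ c ∷ y ∷ x ∷ [])
              (λ x y z u v w → x :≡ y ⇒ y :≡ opp z ⇒ ⊢ u :- (v :- w) :- (w :+ z :- v) :≡ u :+ x)
              (cong N·_ (weight-y 1 window≢ e)) N·-−1))
      go (other f g) = trans (cong (transpose y (x + N)) (transpose-o x y f g))
        (trans (transpose-o y (x + N) g (λ h → f (trans h (res-N x))))
            (linear-by (byEquations (-1ℤ ∷ -1ℤ ∷ [])) (N· weight 1 x y c ∷ N· 0ℤ ∷ c ∷ [])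
            (λ x y z → x :≡ y ⇒ y :≡ con 0ℤ ⇒ ⊢ z :≡ z :+ x) (cong N·_ (weight-o 1 f g)) N·-0))

    -- The intervals `[x, y)` and `[y, x + n)` fill one period, so each pair of edges has degree
    -- `c`, and `m` pairs are needed.
    path-translate : ∀ m u → Path u (λ c → c + N· weight m x y c) (+ m *Q c)
    path-translate zero    u = path-cong (λ a → sym (linear (N· (0ℤ * (δ a x - δ a y)) ∷ a ∷ [])
        (λ x y → x :≡ con 0ℤ ⇒ ⊢ y :+ x :≡ y) N·-0)) (λ i → refl) (path-id u)
    path-translate (suc m) u = path-cong combine degrees (path-∘ (path-∘ first second)
        (path-translate m (end second)))
      where
      first : Path u (transpose y (x + N)) (root y (x + N))
      first = path-edge u y<x+N ne′
      second : Path (end first) (transpose x y) (root x y)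
      second = path-edge (end first) x<y window≢
      combine : ∀ a → transpose y (x + N) (transpose x y (a + N· weight m x y a)) ≡ a + N· weight (suc m) x y a
      combine a = trans (translate-once (a + N· weight m x y a))
        (linear-by (byEquations (1ℤ ∷ -1ℤ ∷ -1ℤ ∷ [])) (N· weight 1 x y (a + N· weight m x y a) ∷ N· weight 1 x y
            a ∷ N· (+ suc m * (δ a x - δ a y)) ∷ N· (+ m * (δ a x - δ a y) + 1ℤ * (δ a x - δ a y)) ∷ N· weight m
            x y a ∷ a ∷ []) (λ x y z u v w → x :≡ y ⇒ z :≡ u ⇒ u :≡ v :+ y ⇒ ⊢ w :+ v :+ x :≡ w :+ z)
            (cong N·_ (weight-cong 1 x y (res-shift a (weight m x y a)))) (cong N·_ (suc-weight (δ a x - δ a y)))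
            (N·-+ (weight m x y a) (weight 1 x y a)))
        where
        suc-weight : ∀ t → + suc m * t ≡ + m * t + 1ℤ * t
        suc-weight t = trans (*-distribʳ-+ t 1ℤ (+ m)) (+-comm (1ℤ * t) (+ m * t))
      degrees : root y (x + N) +Q root x y +Q + m *Q c ≗ + suc m *Q c
      degrees i = total (+ toℕ i)
        where
        total : ∀ k → φ (k - y) - φ (k - (x + N)) + (φ (k - x) - φ (k - y)) + + m * 1ℤ ≡ + suc m * 1ℤ
        total k = linear-by (byEquations (-1ℤ ∷ 1ℤ ∷ -1ℤ ∷ []))
            (φ (k - (x + N)) ∷ φ (k - x) ∷ + m * 1ℤ ∷ + m ∷ + suc m * 1ℤ ∷ φ (k - y) ∷ [])
            (λ x y z u v w → x :≡ y :- con 1ℤ ⇒ z :≡ u ⇒ v :≡ con 1ℤ :+ u ⇒ ⊢ w :- x :+ (y :- w) :+ z :≡ v)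
            (φ--N k x) (*-identityʳ (+ m)) (*-identityʳ (+ suc m))

  -- An edge multiplies by a reflection, whose crossings of the wall `k` are the coefficient of its
  -- root at `k`; subadditivity adds them up along the chain.
  chain-flux : {u v : W n} (es : Chain u v) → ∀ k → rank (perm v) k k ≤ rank (perm u) k k + hat (chainDegree es) k
  chain-flux {u} ε k = ≤-reflexive (sym (+-identityʳ _))
  chain-flux {u} {v} (_◅_ {j = y} (α , P , e) es) k = go (edge⇒reflects {u} {y} (α , P , e))
    where
    go : _ → rank (perm v) k k ≤ rank (perm u) k k + (hat α k + hat (chainDegree es) k)
    go (a , b , (l , ne , f) , g) = linear-by (byCombination (1ℤ ∷ 1ℤ ∷ 1ℤ ∷ 1ℤ ∷ 1ℤ ∷ -1ℤ ∷ []))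
        (rank (perm v) k k ∷ rank (perm y) k k ∷ hat (chainDegree es) k ∷ rank (perm u · transposition a b ne) k
        k ∷ rank (transposition a b ne) k k ∷ rank (perm u) k k ∷ φ (k - a) ∷ φ (k - b) ∷ α (cls k) ∷ [])
        (λ x y z u v w p q r → x :≤ y :+ z ⇒ y :≡ u ⇒ u :≤ v :+ w ⇒ v :≡ p :- q ⇒ r :≡ p :- q ⇒ ⊢ x :≤ w :+
        (r :+ z)) (chain-flux es k) (rank-cong {perm y} {perm u · transposition a b ne} f k k)
        (rank-subadd (perm u) (transposition a b ne) k k k) (rank-transposition ne (<⇒≤ l) k)
        (trans (g (cls k)) (hat-root a b k))

  ≤B-[] : {u : W n} → u ≤B [] → u ≈ []
  ≤B-[] {u} p = go (≤B⇒≈⊎<ℓ {u} {[]} p)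
    where
    go : u ≈ [] ⊎ u <ℓ [] → u ≈ []
    go (inj₁ e) = e
    go (inj₂ (k , l , _ , q , r)) = ⊥-elim (ℕP.n≮0 (subst (k ℕ.<_) (length-unique {[]} q length-[]) r))

  joined-flux : ∀ {d : Degree n} {v} → Joined d [] v → ∀ k → rank (perm v) k k ≤ deg d k
  joined-flux {d} {v} (u , p , es , q) k = linear (rank (perm v) k k ∷ rank (perm u) k k ∷ hat (chainDegree es) k
      ∷ rank 1ₚ k k ∷ deg d k ∷ []) (λ x y z u v → x :≤ y :+ z ⇒ y :≡ u ⇒ u :≡ con 0ℤ ⇒ z :≤ v ⇒ ⊢ x :≤ v)
      (chain-flux es k) (rank-cong {perm u} {1ₚ} (≈⇒≃ {u} {[]} (≤B-[] {u} p)) k k) (rank-1 k) bound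
    where
    bound : hat (chainDegree es) k ≤ deg d k
    bound = q (cls k)

  -- Translations

  form-scale : ∀ (ν β : Q n) k → ⟨ ν , k *Q β ⟩ ≡ k * ⟨ ν , β ⟩
  form-scale ν β k = trans (sum-ext (λ i → trans (sum-ext (λ j → regroup (ν i) (cartan i j) k (β j)))
      (sum-scale k (λ j → ν i * cartan i j * β j))))
    (sum-scale k (λ i → sum (λ j → ν i * cartan i j * β j)))
    where
    regroup : ∀ x y k z → x * y * (k * z) ≡ k * (x * y * z)
    regroup = solve-∀

  form-translation : ∀ {β : Q n} {x y} k → β ≗ root x y → ∀ ν → ⟨ k *Q β , ν ⟩ ≡ k * (jump ν x - jump ν y)
  form-translation {β} {x} {y} k e ν = trans (form-sym (k *Q β) ν) (trans (form-scale ν β k)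
    (cong (λ t → k * t) (trans (form-congʳ ν e) (form-root ν x y))))

  -- The vector `c` lies in the radical of the form, since the Laplacian annihilates constants.
  form-translation-c : ∀ {β : Q n} {x y} k → β ≗ root x y → ∀ ν → ⟨ k *Q (β -Q c) , ν ⟩ ≡ k *
      (jump ν x - jump ν y)
  form-translation-c {β} k e ν = trans (form-sym (k *Q (β -Q c)) ν)
    (trans (form-Δ-cong ν {k *Q (β -Q c)} {k *Q β} (λ a → regroup k (hat β a) (hat β (a + 1ℤ)) (hat β (a - 1ℤ))))
      (trans (form-sym ν (k *Q β)) (form-translation k e ν)))
    where
    regroup : ∀ k x y z → + 2 * (k * (x - 1ℤ)) - k * (y - 1ℤ) - k * (z - 1ℤ) ≡ + 2 * (k * x) - k * y - k * z
    regroup = solve-∀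

  δ-sym : ∀ a b → δ a b ≡ δ b a
  δ-sym a b = go (res a ℕ.≟ res b)
    where
    go : Dec (res a ≡ res b) → δ a b ≡ δ b a
    go (yes e) = trans (δ-yes {a} {b} e) (sym (δ-yes {b} {a} (sym e)))
    go (no e)  = trans (δ-no {a} {b} e) (sym (δ-no {b} {a} (e ∘ sym)))

  shift-perm : ℕ → ℤ → ℤ → Perm
  shift-perm m x y = record
    { to      = λ a → a + N· weight m x y a
    ; from    = λ a → a + N· (- weight m x y a)
    ; to-from = λ a → linear (N· weight m x y (a + N· (- weight m x y a)) ∷ N· weight m x y a ∷ N·
        (- weight m x y a) ∷ a ∷ []) (λ x y z u → x :≡ y ⇒ z :≡ opp y ⇒ ⊢ u :+ z :+ x :≡ u)
        (cong N·_ (weight-cong m x y (res-shift a (- weight m x y a)))) (N·-neg (weight m x y a))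
    ; from-to = λ a → linear (N· (- weight m x y (a + N· weight m x y a)) ∷ N· weight m x y a ∷ a ∷ [])
        (λ x y z → x :≡ opp y ⇒ ⊢ z :+ y :+ x :≡ z) (trans
        (cong N·_ (cong -_ (weight-cong m x y (res-shift a (weight m x y a))))) (N·-neg (weight m x y a)))
    ; to-N    = λ a → linear (N· weight m x y (a + N) ∷ N· weight m x y a ∷ a ∷ N ∷ [])
        (λ x y z u → x :≡ y ⇒ ⊢ z :+ u :+ x :≡ z :+ y :+ u) (cong N·_ (weight-cong m x y (res-N a)))
    }

  rep-translation : ∀ {μ : Q n} {m x y} → (∀ ν → ⟨ μ , ν ⟩ ≡ + m * (jump ν x - jump ν y)) → Rep (translation μ)
      (shift-perm m x y)
  rep-translation {μ} {m} {x} {y} e = record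
    { f-cong = λ {ν} {ν′} p i → cong₂ (λ s t → s - t * 1ℤ) (p i) (form-congʳ μ p)
    ; f-+    = λ ν ν′ i → trans (cong (λ t → ν i + ν′ i - t * 1ℤ)
        (trans (e (ν +Q ν′)) (cong (λ t → + m * t) (cong₂ _-_ (jump-+ ν ν′ x) (jump-+ ν ν′ y)))))
        (trans (additive (ν i) (ν′ i) (+ m) (jump ν x) (jump ν′ x) (jump ν y) (jump ν′ y))
          (sym (cong₂ (λ s t → ν i - s * 1ℤ + (ν′ i - t * 1ℤ)) (e ν) (e ν′))))
    ; f-*    = λ k ν i → trans (cong (λ t → k * ν i - t * 1ℤ) (trans (e (k *Q ν))
        (cong (λ t → + m * t) (cong₂ _-_ (jump-* k ν x) (jump-* k ν y)))))
        (trans (homogeneous k (ν i) (+ m) (jump ν x) (jump ν y)) (cong (λ t → k * (ν i - t * 1ℤ)) (sym (e ν))))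
    ; f-root = λ a b i → trans (cong (λ t → root a b i - t * 1ℤ) (trans (e (root a b))
        (cong (λ t → + m * t) (cong₂ _-_ (trans (jump-root a b x) (cong₂ _-_ (δ-sym x a) (δ-sym x b)))
            (trans (jump-root a b y) (cong₂ _-_ (δ-sym y a) (δ-sym y b)))))))
        (trans (regroup (φ (pt i - a)) (φ (pt i - b)) (+ m) (δ a x) (δ b x) (δ a y) (δ b y))
          (sym (cong₂ _-_ (φ--N· (pt i) a (weight m x y a)) (φ--N· (pt i) b (weight m x y b)))))
    }
    where
    additive : ∀ u v k p q r s → u + v - k * (p + q - (r + s)) * 1ℤ ≡ u - k * (p - r) * 1ℤ +
        (v - k * (q - s) * 1ℤ)
    additive = solve-∀
    homogeneous : ∀ k u m p q → k * u - m * (k * p - k * q) * 1ℤ ≡ k * (u - m * (p - q) * 1ℤ)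
    homogeneous = solve-∀
    regroup : ∀ u v k p q r s → u - v - k * (p - q - (r - s)) * 1ℤ ≡ u - k * (p - r) - (v - k * (q - s))
    regroup = solve-∀

  -- The curve neighborhood of the identity

  module Main (d : Degree n) (c<d : c <Q fromDegree d) (m : ℕ) (min : IsMin d m) (z : W n) (Z : IsZ (d ⊖c m) z)
    {k : ℕ} (γ : Vector (Q n) k) (γ-positive : ∀ i → PositiveReal (γ i)) (γ-separated : Separated γ)
        (γ-product : ⟦ z ⟧ ≐ reflections γ) where

    D : ℤ → ℤ
    D = deg (d ⊖c m)

    deg-split : ∀ a → deg d a ≡ + m + deg (d ⊖c m) a
    deg-split a = sym (cong +_ (ℕP.m+[n∸m]≡n (proj₂ min (cls a))))

    m≥1 : 1ℤ ≤ + m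
    m≥1 = go (proj₁ min)
      where
      go : _ → 1ℤ ≤ + m
      go (i , refl) = proj₁ c<d i

    x₀ : ℤ
    x₀ = pt (proj₁ (proj₁ min))

    zero₀ : deg (d ⊖c m) x₀ ≡ 0ℤ
    zero₀ = go (proj₁ min)
      where
      go : (q : ∃[ i ] m ≡ d i) → deg (d ⊖c m) (pt (proj₁ q)) ≡ 0ℤ
      go (i , e) = cong +_ (trans (cong (λ t → t ℕ.∸ m) (trans (cong d (cls-toℕ i)) (sym e))) (ℕP.n∸n≡0 m))

    z-is : RankIs (d ⊖c m) (perm z)
    z-is = z-rank Z x₀ zero₀

    P : ∀ i → IsRoot (γ i)
    P i = positive⇒root (γ-positive i)

    apart : ∀ i j → i ≢ j → Apart (P i) (P j)
    apart i j ne = [ disconnected⇒apart (P i) (P j) , (λ o → orthogonal⇒apart (P i) (P j) (proj₁ o)) ]′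
        (γ-separated i j ne)

    z≃prod : perm z ≃ prodₚ γ P
    z≃prod = rep-faithful (rep-word z) (rep-prod γ P) (balanced-word z) (balanced-prod γ P) γ-product

    γ-flux : ∀ a → rank (perm z) a a ≡ hat (sumQ γ) a
    γ-flux a = trans (rank-cong {perm z} {prodₚ γ P} z≃prod a a) (prod-flux γ P apart a)

    -- The coefficients of the `γ i` at `a` add up to the crossings of `z` at that wall, which `D`
    -- bounds.
    γ≤D : ∀ i a → hat (γ i) a ≤ deg (d ⊖c m) a
    γ≤D i a = linear-by (byCombination (1ℤ ∷ 1ℤ ∷ -1ℤ ∷ -1ℤ ∷ []))
        (hat (γ i) a ∷ sum (λ j → hat (γ j) a) ∷ hat (sumQ γ) a ∷ rank (perm z) a a ∷ deg (d ⊖c m) a ∷ [])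
        (λ x y z u v → x :≤ y ⇒ z :≡ y ⇒ u :≡ z ⇒ u :≤ v ⇒ ⊢ x :≤ v)
        (member (λ j → hat (γ j) a) (λ j → hat-nonNeg (P j) a) i) sum≡ (γ-flux a) (flux z-is a)
      where
      sum≡ : hat (sumQ γ) a ≡ sum (λ j → hat (γ j) a)
      sum≡ = refl
      member : ∀ {k} (f : Fin k → ℤ) → (∀ j → 0ℤ ≤ f j) → ∀ i → f i ≤ sum f
      member {suc k} f p Fin.zero    = linear-by (byCombination (1ℤ ∷ 1ℤ ∷ -1ℤ ∷ []))
          (sum (λ z₁ → f (Fin.suc z₁)) ∷ sum f ∷ f Fin.zero ∷ [])
          (λ x y z → con 0ℤ :≤ x ⇒ y :≡ z :+ x ⇒ ⊢ z :≤ y) (sum-nonNeg (p ∘ Fin.suc)) s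
        where
        s : sum f ≡ f Fin.zero + sum (f ∘ Fin.suc)
        s = refl
      member {suc k} f p (Fin.suc i) = linear-by (byCombination (1ℤ ∷ 1ℤ ∷ 1ℤ ∷ -1ℤ ∷ []))
          (f (Fin.suc i) ∷ sum (λ x → f (Fin.suc x)) ∷ f Fin.zero ∷ sum f ∷ [])
          (λ x y z u → x :≤ y ⇒ con 0ℤ :≤ z ⇒ u :≡ z :+ y ⇒ ⊢ x :≤ u) (member (f ∘ Fin.suc) (p ∘ Fin.suc) i)
          (p Fin.zero) s
        where
        s : sum f ≡ f Fin.zero + sum (f ∘ Fin.suc)
        s = refl

    -- Where all `γ i` vanish, `z` crosses nothing; the minimum formula attains the value 0 only for
    -- `l = a` and `D a = 0`.
    D-zero : ∀ a → (∀ i → hat (γ i) a ≡ 0ℤ) → deg (d ⊖c m) a ≡ 0ℤ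
    D-zero a h = go (attain z-is a a)
      where
      flat : rank (perm z) a a ≡ 0ℤ
      flat = trans (γ-flux a) (trans (sum-ext h) (sum-zero k))
      go : _ → deg (d ⊖c m) a ≡ 0ℤ
      go (l , p) = trans (cong (deg (d ⊖c m)) {a} {l} (≤-antisym
          (linear (deg (d ⊖c m) l ∷ (a - l) ⁺ ∷ (l - a) ⁺ ∷ rank (perm z) a a ∷ a ∷ l ∷ [])
              (λ x y z u v w → x :+ y :+ z :≤ u ⇒ u :≡ con 0ℤ ⇒ con 0ℤ :≤ x ⇒ v :- w :≤ y ⇒ con 0ℤ :≤ z ⇒ ⊢ v :≤
              w) p flat (deg≥0 (d ⊖c m) l) (⁺-upper (a - l)) (⁺-nonNeg (l - a)))
          (linear (deg (d ⊖c m) l ∷ (a - l) ⁺ ∷ (l - a) ⁺ ∷ rank (perm z) a a ∷ l ∷ a ∷ [])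
              (λ x y z u v w → x :+ y :+ z :≤ u ⇒ u :≡ con 0ℤ ⇒ con 0ℤ :≤ x ⇒ v :- w :≤ z ⇒ con 0ℤ :≤ y ⇒ ⊢ v :≤
              w) p flat (deg≥0 (d ⊖c m) l) (⁺-upper (l - a)) (⁺-nonNeg (a - l)))))
        (≤-antisym (linear (deg (d ⊖c m) l ∷ (a - l) ⁺ ∷ (l - a) ⁺ ∷ rank (perm z) a a ∷ [])
            (λ x y z u → x :+ y :+ z :≤ u ⇒ u :≡ con 0ℤ ⇒ con 0ℤ :≤ y ⇒ con 0ℤ :≤ z ⇒ ⊢ x :≤ con 0ℤ) p flat
            (⁺-nonNeg (a - l)) (⁺-nonNeg (l - a))) (deg≥0 (d ⊖c m) l))

    setting : ∀ {w} → Joined d [] w → Setting (perm w) (perm z) m D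
    setting {w} J = record
      { v-balanced = balanced-word w
      ; z-balanced = balanced-word z
      ; m-positive = m≥1
      ; D-nonNeg   = deg≥0 (d ⊖c m)
      ; D-cong     = λ {a} {b} → deg-cong (d ⊖c m) {a} {b}
      ; v-flux     = λ a → linear (rank (perm w) a a ∷ deg d a ∷ + m ∷ deg (d ⊖c m) a ∷ [])
          (λ x y z u → x :≤ y ⇒ y :≡ z :+ u ⇒ ⊢ x :≤ z :+ u) (joined-flux {d} {w} J a) (deg-split a)
      ; z-flux     = flux z-is
      ; z-attain   = attain z-is
      }

    -- The admissible roots are the e_x − e_y with minimal d at the walls x and y − 1.
    record Gap (x y : ℤ) : Set where
      constructor gap
      field
        x<y   : x < y
        y<x+N : y < x + N
        Dx    : deg (d ⊖c m) x ≡ 0ℤ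
        Dy    : deg (d ⊖c m) (y - 1ℤ) ≡ 0ℤ
    open Gap

    -- A `γ i` below `β` with a nonzero coefficient at `x` would start there, because `β` vanishes
    -- at `x − 1`, and roots with a common left end are not orthogonal. A disjoint `γ i` vanishes at
    -- `x` anyway, and the same reasoning applies at `y − 1`. Then `D-zero` gives the two walls.
    admissible⇒gap : ∀ {β} → Admissible γ β → ∃[ x ] ∃[ y ] Gap x y × β ≗ root x y
    admissible⇒gap {β} (pos-β , (β≤c , β≢c) , cond) = go (positive⇒root pos-β)
      where
      go : IsRoot β → _
      go R@(x , y , x<y , ne , e) = x , y , gap x<y short (D-zero x at-x) (D-zero (y - 1ℤ) at-y) , e
        where
        hatβ : ∀ k → hat β k ≡ φ (k - x) - φ (k - y)
        hatβ = hat-ends R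
        β≤1 : ∀ k → hat β k ≤ 1ℤ
        β≤1 k = β≤c (cls k)
        short : y < x + N
        short = ≰⇒> λ l → β≢c λ i → trans (cong β (sym (cls-toℕ i)))
          (≤-antisym (β≤1 (pt i)) (linear-by (byCombination (1ℤ ∷ -1ℤ ∷ []))
              (hat β (pt i) ∷ φ (pt i - x) ∷ φ (pt i - y) ∷ φ (pt i - (x + N)) ∷ [])
              (λ x y z u → x :≡ y :- z ⇒ z :≤ u ⇒ u :≡ y :- con 1ℤ ⇒ ⊢ con 1ℤ :≤ x) (hatβ (pt i))
              (φ-mono {pt i - y} {pt i - (x + N)} (linear (x ∷ N ∷ y ∷ pt i ∷ [])
              (λ x y z u → x :+ y :≤ z ⇒ ⊢ u :- z :≤ u :- (x :+ y)) l)) (φ--N (pt i) x)))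
        outside-x : hat β (x - 1ℤ) ≡ 0ℤ
        outside-x = linear-by (byEquations (1ℤ ∷ 1ℤ ∷ -1ℤ ∷ []))
            (hat β (x - 1ℤ) ∷ φ (x - 1ℤ - x) ∷ φ (x - 1ℤ - y) ∷ [])
            (λ x y z → x :≡ y :- z ⇒ y :≡ con -1ℤ ⇒ z :≡ con -1ℤ ⇒ ⊢ x :≡ con 0ℤ) (hatβ (x - 1ℤ))
            (φ-minus {x - 1ℤ - x} (linear (N ∷ x ∷ []) (λ x y → con (+ 3) :≤ x ⇒ ⊢ opp x :≤ y :- con 1ℤ :- y)
            3≤N) (linear (x ∷ []) (λ x → ⊢ x :- con 1ℤ :- x :< con 0ℤ)))
            (φ-minus {x - 1ℤ - y} (linear (y ∷ x ∷ N ∷ []) (λ x y z → x :< y :+ z ⇒ ⊢ opp z :≤ y :- con 1ℤ :- x)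
            short) (linear (x ∷ y ∷ []) (λ x y → x :< y ⇒ ⊢ x :- con 1ℤ :- y :< con 0ℤ) x<y))
        outside-y : hat β y ≡ 0ℤ
        outside-y = linear-by (byEquations (1ℤ ∷ 1ℤ ∷ -1ℤ ∷ [])) (hat β y ∷ φ (y - x) ∷ φ (y - y) ∷ [])
            (λ x y z → x :≡ y :- z ⇒ y :≡ con 0ℤ ⇒ z :≡ con 0ℤ ⇒ ⊢ x :≡ con 0ℤ) (hatβ y)
            (φ-small {y - x} (linear (x ∷ y ∷ []) (λ x y → x :< y ⇒ ⊢ con 0ℤ :≤ y :- x) x<y)
            (linear (y ∷ x ∷ N ∷ []) (λ x y z → x :< y :+ z ⇒ ⊢ x :- y :< z) short))
            (φ-small {y - y} (linear (y ∷ []) (λ x → ⊢ con 0ℤ :≤ x :- x))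
            (linear (N ∷ y ∷ []) (λ x y → con (+ 3) :≤ x ⇒ ⊢ y :- y :< x) 3≤N))
        module _ (i : Fin k) where
          p q : ℤ
          p = left (P i)
          q = right (P i)
          pq : res p ≢ res q
          pq = left≢right (P i)
          pairing : β ⊥ γ i → (δ p x - δ p y) - (δ q x - δ q y) ≡ 0ℤ
          pairing o = trans (sym (form-root-root x y p q)) (trans
              (sym (trans (form-congˡ {β} {root x y} (γ i) e) (form-congʳ (root x y) (ends≗ (P i))))) o)
          γ≤β : γ i <Q β → ∀ k → hat (γ i) k ≤ hat β k
          γ≤β l k = proj₁ l (cls k)
          meets : ∀ a → 1ℤ ≤ hat β a → hat (γ i) a ≢ 0ℤ → ¬ Disjoint β (γ i)
          meets a b ne′ dis = dis (cls a) (supp {β} {a} b , ne′)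
          at-x′ : hat (γ i) x ≢ 0ℤ → Empty
          at-x′ ne′ = [ meets x (supp-left R) ne′ , inside ]′ (cond i)
            where
            inside : γ i <Q β × β ⊥ γ i → Empty
            inside (l , o) = 1≰0 (linear-by (byCombination (1ℤ ∷ 1ℤ ∷ -1ℤ ∷ []))
                (δ p x ∷ δ p y ∷ δ q x ∷ δ q y ∷ []) (λ x y z u → x :- y :- (z :- u) :≡ con 0ℤ ⇒ x :≡ con 1ℤ ⇒ y
                :≡ con 0ℤ ⇒ z :≡ con 0ℤ ⇒ con 0ℤ :≤ u ⇒ ⊢ con 1ℤ :≤ con 0ℤ) (pairing o) (δ-yes {p} {x} px)
                (δ-no {p} {y} (λ f → ne (trans (sym px) f))) (δ-no {q} {x} (λ f → pq (trans px (sym f))))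
                (proj₁ (δ-range q y)))
              where
              positive : 1ℤ ≤ hat (γ i) x
              positive = i<j⇒suc[i]≤j (≤∧≢⇒< (hat-nonNeg (P i) x) (ne′ ∘ sym))
              px : res p ≡ res x
              px = sym (δ-one {x} {p} (linear (hat (γ i) x ∷ hat (γ i) (x - 1ℤ) ∷ δ x (left (P i)) ∷ δ x
                  (right (P i)) ∷ hat β (x - 1ℤ) ∷ []) (λ x y z u v → x :- y :≡ z :- u ⇒ con 1ℤ :≤ x ⇒ y :≤ v ⇒ v
                  :≡ con 0ℤ ⇒ con 0ℤ :≤ u ⇒ ⊢ con 1ℤ :≤ z) (jump-ends (P i) x) positive (γ≤β l (x - 1ℤ))
                  outside-x (proj₁ (δ-range x q))))
          at-y′ : hat (γ i) (y - 1ℤ) ≢ 0ℤ → Empty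
          at-y′ ne′ = [ meets (y - 1ℤ) (supp-right R) ne′ , inside ]′ (cond i)
            where
            inside : γ i <Q β × β ⊥ γ i → Empty
            inside (l , o) = 1≰0 (linear-by (byCombination (1ℤ ∷ 1ℤ ∷ -1ℤ ∷ []))
                (δ p x ∷ δ p y ∷ δ q x ∷ δ q y ∷ []) (λ x y z u → x :- y :- (z :- u) :≡ con 0ℤ ⇒ u :≡ con 1ℤ ⇒ z
                :≡ con 0ℤ ⇒ y :≡ con 0ℤ ⇒ con 0ℤ :≤ x ⇒ ⊢ con 1ℤ :≤ con 0ℤ) (pairing o) (δ-yes {q} {y} qy)
                (δ-no {q} {x} (λ f → ne (trans (sym f) qy))) (δ-no {p} {y} (λ f → pq (trans f (sym qy))))
                (proj₁ (δ-range p x)))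
              where
              positive : 1ℤ ≤ hat (γ i) (y - 1ℤ)
              positive = i<j⇒suc[i]≤j (≤∧≢⇒< (hat-nonNeg (P i) (y - 1ℤ)) (ne′ ∘ sym))
              qy : res q ≡ res y
              qy = sym (δ-one {y} {q} (linear-by (byCombination (1ℤ ∷ -1ℤ ∷ []))
                  (hat (γ i) y ∷ hat (γ i) (y - 1ℤ) ∷ δ y (left (P i)) ∷ δ y (right (P i)) ∷ hat β y ∷ [])
                  (λ x y z u v → x :- y :≡ z :- u ⇒ con 1ℤ :≤ y ⇒ x :≤ v ⇒ v :≡ con 0ℤ ⇒ con 0ℤ :≤ z ⇒ ⊢ con 1ℤ
                  :≤ u) (jump-ends (P i) y) positive (γ≤β l y) outside-y (proj₁ (δ-range y p))))
        at-x : ∀ i → hat (γ i) x ≡ 0ℤ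
        at-x i = decide (hat (γ i) x ≟ 0ℤ)
          where
          decide : Dec (hat (γ i) x ≡ 0ℤ) → hat (γ i) x ≡ 0ℤ
          decide (yes f) = f
          decide (no f)  = ⊥-elim (at-x′ i f)
        at-y : ∀ i → hat (γ i) (y - 1ℤ) ≡ 0ℤ
        at-y i = decide (hat (γ i) (y - 1ℤ) ≟ 0ℤ)
          where
          decide : Dec (hat (γ i) (y - 1ℤ) ≡ 0ℤ) → hat (γ i) (y - 1ℤ) ≡ 0ℤ
          decide (yes f) = f
          decide (no f)  = ⊥-elim (at-y′ i f)

    -- Each `γ i` is bounded by `D`, hence vanishes at the walls `x` and `y − 1`. Within the period
    -- that starts after `x` its interval lies strictly between these walls, and is then nested
    -- without a common end, or from `y` on, and is then disjoint.
    gap⇒admissible : ∀ {x y} → Gap x y → Admissible γ (root x y)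
    gap⇒admissible {x} {y} G = root⇒positive (x<y G) ne (λ _ → refl) , (below , strict) , cond
      where
      β : Q n
      β = root x y
      ne : res x ≢ res y
      ne = window≢ (x<y G) (y<x+N G)
      R : IsRoot β
      R = x , y , x<y G , ne , λ _ → refl
      hatβ : ∀ k → hat (root x y) k ≡ φ (k - x) - φ (k - y)
      hatβ = hat-root x y
      β≤1 : ∀ k → hat (root x y) k ≤ 1ℤ
      β≤1 k = linear-by (byCombination (1ℤ ∷ 1ℤ ∷ 1ℤ ∷ -1ℤ ∷ []))
          (hat (root x y) k ∷ φ (k - x) ∷ φ (k - y) ∷ φ (k - (x + N)) ∷ [])
          (λ x y z u → x :≡ y :- z ⇒ u :≤ z ⇒ u :≡ y :- con 1ℤ ⇒ ⊢ x :≤ con 1ℤ) (hatβ k)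
          (φ-mono {k - (x + N)} {k - y} (linear (y ∷ x ∷ N ∷ k ∷ [])
          (λ x y z u → x :< y :+ z ⇒ ⊢ u :- (y :+ z) :≤ u :- x) (y<x+N G))) (φ--N k x)
      below : root x y ≤Q c
      below i = subst (λ t → root x y t ≤ 1ℤ) (cls-toℕ i) (β≤1 (pt i))
      β-y : hat (root x y) y ≡ 0ℤ
      β-y = linear-by (byEquations (1ℤ ∷ 1ℤ ∷ -1ℤ ∷ [])) (hat (root x y) y ∷ φ (y - x) ∷ φ (y - y) ∷ [])
          (λ x y z → x :≡ y :- z ⇒ y :≡ con 0ℤ ⇒ z :≡ con 0ℤ ⇒ ⊢ x :≡ con 0ℤ) (hatβ y)
          (φ-small {y - x} (linear (x ∷ y ∷ []) (λ x y → x :< y ⇒ ⊢ con 0ℤ :≤ y :- x) (x<y G))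
          (linear (y ∷ x ∷ N ∷ []) (λ x y z → x :< y :+ z ⇒ ⊢ x :- y :< z) (y<x+N G)))
          (φ-small {y - y} (linear (y ∷ []) (λ x → ⊢ con 0ℤ :≤ x :- x))
          (linear (N ∷ y ∷ []) (λ x y → con (+ 3) :≤ x ⇒ ⊢ y :- y :< x) 3≤N))
      strict : ¬ (root x y ≗ c)
      strict e = 1≢0 (trans (sym (e (cls y))) β-y)
        where
        1≢0 : ¬ 1ℤ ≡ 0ℤ
        1≢0 ()
      cond : ∀ i → Disjoint (root x y) (γ i) ⊎ (γ i <Q root x y × root x y ⊥ γ i)
      cond i = go (y ≤? p₁)
        where
        -- `p₁` is the first translate of the left end of `γ i` beyond `x`.
        p q s p₁ q₁ : ℤ
        p = left (P i)
        q = right (P i)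
        s = φ (x - p) + 1ℤ
        p₁ = p + N· s
        q₁ = q + N· s
        p₁≡ : p₁ ≡ p + N· s
        p₁≡ = refl
        q₁≡ : q₁ ≡ q + N· s
        q₁≡ = refl
        pq : p < q
        pq = left<right (P i)
        γ≗ : γ i ≗ root p₁ q₁
        γ≗ a = trans (ends≗ (P i) a) (sym (root-shift p q s a))
        hatγ : ∀ a → hat (γ i) a ≡ φ (a - p₁) - φ (a - q₁)
        hatγ a = trans (γ≗ (cls a)) (hat-root p₁ q₁ a)
        vanishes : ∀ a → deg (d ⊖c m) a ≡ 0ℤ → hat (γ i) a ≡ 0ℤ
        vanishes a e = ≤-antisym (linear (hat (γ i) a ∷ deg (d ⊖c m) a ∷ [])
            (λ x y → x :≤ y ⇒ y :≡ con 0ℤ ⇒ ⊢ x :≤ con 0ℤ) (γ≤D i a) e) (hat-nonNeg (P i) a)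
        same : φ (x - p) ≡ φ (x - q)
        same = linear-by (byEquations (1ℤ ∷ -1ℤ ∷ [])) (hat (γ i) x ∷ φ (x - left (P i)) ∷ φ (x - right (P i)) ∷
            []) (λ x y z → x :≡ con 0ℤ ⇒ x :≡ y :- z ⇒ ⊢ y :≡ z) (vanishes x (Dx G)) (hat-ends (P i) x)
        N·s : N· s ≡ N· φ (x - p) + N
        N·s = N·-+1 (φ (x - p))
        x<p₁ : x < p₁
        x<p₁ = linear-by (byCombination (1ℤ ∷ -1ℤ ∷ -1ℤ ∷ [])) (p₁ ∷ p ∷ N· s ∷ N· φ (x - p) ∷ N ∷ x ∷ [])
            (λ x y z u v w → x :≡ y :+ z ⇒ z :≡ u :+ v ⇒ w :- y :< u :+ v ⇒ ⊢ w :< x) p₁≡ N·s (φ-upper (x - p))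
        p₁<q₁ : p₁ < q₁
        p₁<q₁ = linear-by (byCombination (1ℤ ∷ 1ℤ ∷ -1ℤ ∷ [])) (p₁ ∷ p ∷ N· s ∷ q₁ ∷ q ∷ [])
            (λ x y z u v → x :≡ y :+ z ⇒ u :≡ v :+ z ⇒ y :< v ⇒ ⊢ x :< u) p₁≡ q₁≡ pq
        q₁≤x+N : q₁ ≤ x + N
        q₁≤x+N = linear (q₁ ∷ q ∷ N· s ∷ N· φ (x - p) ∷ N ∷ N· φ (x - q) ∷ x ∷ [])
            (λ x y z u v w p → x :≡ y :+ z ⇒ z :≡ u :+ v ⇒ w :≤ p :- y ⇒ u :≡ w ⇒ ⊢ x :≤ p :+ v) q₁≡ N·s
            (φ-lower (x - q)) (cong N·_ same)
        same-y : φ (y - 1ℤ - p₁) ≡ φ (y - 1ℤ - q₁)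
        same-y = linear-by (byEquations (1ℤ ∷ -1ℤ ∷ [])) (hat (γ i) (y - 1ℤ) ∷ φ (y - 1ℤ - p₁) ∷ φ (y - 1ℤ - q₁)
            ∷ []) (λ x y z → x :≡ con 0ℤ ⇒ x :≡ y :- z ⇒ ⊢ y :≡ z) (vanishes (y - 1ℤ) (Dy G)) (hatγ (y - 1ℤ))
        go : Dec (y ≤ p₁) → _
        go (yes l) = inj₁ λ a (b , g) → clash a b g
          where
          clash : ∀ a → root x y a ≢ 0ℤ → γ i a ≢ 0ℤ → Empty
          clash a b g = 1≰0 (linear-by (byCombination (1ℤ ∷ 1ℤ ∷ 1ℤ ∷ 1ℤ ∷ 1ℤ ∷ 1ℤ ∷ 1ℤ ∷ -1ℤ ∷ []))
              (hat (root x y) (pt a) ∷ hat (γ i) (pt a) ∷ φ (pt a - p₁) ∷ φ (pt a - q₁) ∷ φ (pt a - x) ∷ φ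
              (pt a - y) ∷ φ (pt a - (x + N)) ∷ []) (λ x y z u v w p → con 1ℤ :≤ x ⇒ con 1ℤ :≤ y ⇒ y :≡ z :- u ⇒
              x :≡ v :- w ⇒ z :≤ w ⇒ p :≤ u ⇒ p :≡ v :- con 1ℤ ⇒ ⊢ con 1ℤ :≤ con 0ℤ) big-β big-γ (hatγ (pt a))
              (hatβ (pt a)) (φ-mono {pt a - p₁} {pt a - y} (linear (y ∷ p₁ ∷ pt a ∷ [])
              (λ x y z → x :≤ y ⇒ ⊢ z :- y :≤ z :- x) l)) (φ-mono {pt a - (x + N)} {pt a - q₁}
              (linear (q₁ ∷ x ∷ N ∷ pt a ∷ []) (λ x y z u → x :≤ y :+ z ⇒ ⊢ u :- (y :+ z) :≤ u :- x) q₁≤x+N))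
              (φ--N (pt a) x))
            where
            big-β : 1ℤ ≤ hat (root x y) (pt a)
            big-β = i<j⇒suc[i]≤j (≤∧≢⇒< (hat-nonNeg R (pt a)) (λ e → b
                (trans (cong (root x y) (sym (cls-toℕ a))) (sym e))))
            big-γ : 1ℤ ≤ hat (γ i) (pt a)
            big-γ = i<j⇒suc[i]≤j (≤∧≢⇒< (hat-nonNeg (P i) (pt a))
                (λ e → g (trans (cong (γ i) (sym (cls-toℕ a))) (sym e))))
        go (no l) = inj₂ ((γ≤β , γ≢β) , orthogonal)
          where
          q₁<y : q₁ < y
          q₁<y = ≰⇒> λ h → 1≰0 (linear-by (byCombination (1ℤ ∷ 1ℤ ∷ -1ℤ ∷ []))
              (φ (y - 1ℤ - p₁) ∷ φ (y - 1ℤ - q₁) ∷ []) (λ x y → x :≡ y ⇒ x :≡ con 0ℤ ⇒ y :< con 0ℤ ⇒ ⊢ con 1ℤ :≤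
              con 0ℤ) same-y (φ-small {y - 1ℤ - p₁} (linear (p₁ ∷ y ∷ [])
              (λ x y → x :< y ⇒ ⊢ con 0ℤ :≤ y :- con 1ℤ :- x) (≰⇒> l))
              (linear (x ∷ p₁ ∷ y ∷ N ∷ []) (λ x y z u → x :< y ⇒ z :< x :+ u ⇒ ⊢ z :- con 1ℤ :- y :< u) x<p₁
              (y<x+N G))) (φ-neg {y - 1ℤ - q₁} (linear (y ∷ q₁ ∷ [])
              (λ x y → x :≤ y ⇒ ⊢ x :- con 1ℤ :- y :< con 0ℤ) h)))
          γ≤β : γ i ≤Q root x y
          γ≤β a = subst (λ t → γ i t ≤ root x y t) (cls-toℕ a)
            (linear-by (byCombination (1ℤ ∷ 1ℤ ∷ -1ℤ ∷ [])) (hat (γ i) (pt a) ∷ φ (pt a - p₁) ∷ φ (pt a - q₁) ∷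
                hat (root x y) (pt a) ∷ φ (pt a - x) ∷ φ (pt a - y) ∷ [])
                (λ x y z u v w → x :≡ y :- z ⇒ u :≡ v :- w ⇒ y :≤ v ⇒ w :≤ z ⇒ ⊢ x :≤ u) (hatγ (pt a))
                (hatβ (pt a)) (φ-mono {pt a - p₁} {pt a - x} (linear (x ∷ p₁ ∷ pt a ∷ [])
                (λ x y z → x :< y ⇒ ⊢ z :- y :≤ z :- x) x<p₁))
                (φ-mono {pt a - y} {pt a - q₁} (linear (q₁ ∷ y ∷ pt a ∷ [])
                (λ x y z → x :< y ⇒ ⊢ z :- y :≤ z :- x) q₁<y)))
          γ≢β : ¬ (γ i ≗ root x y)
          γ≢β e = 1≰0 (linear-by (byCombination (1ℤ ∷ 1ℤ ∷ 1ℤ ∷ -1ℤ ∷ [])) (hat β (left R) ∷ hat (γ i) x ∷ [])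
              (λ x y → con 1ℤ :≤ x ⇒ y :≡ con 0ℤ ⇒ y :≡ x ⇒ ⊢ con 1ℤ :≤ con 0ℤ) (supp-left R) (vanishes x (Dx G))
              same-x)
            where
            same-x : hat (γ i) x ≡ hat (root x y) x
            same-x = e (cls x)
          orthogonal : root x y ⊥ γ i
          orthogonal = trans (form-congʳ (root x y) γ≗) (trans (form-root-root x y p₁ q₁)
            (linear-by (byEquations (1ℤ ∷ -1ℤ ∷ -1ℤ ∷ 1ℤ ∷ [])) (δ p₁ x ∷ δ p₁ y ∷ δ q₁ x ∷ δ q₁ y ∷ [])
                (λ x y z u → x :≡ con 0ℤ ⇒ y :≡ con 0ℤ ⇒ z :≡ con 0ℤ ⇒ u :≡ con 0ℤ ⇒ ⊢ x :- y :- (z :- u) :≡ con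
                0ℤ) (δ-no {p₁} {x} (λ f → res≢-offset {x} {p₁}
                (linear (x ∷ p₁ ∷ []) (λ x y → x :< y ⇒ ⊢ con 0ℤ :< y :- x) x<p₁)
                (linear (p₁ ∷ q₁ ∷ x ∷ N ∷ []) (λ x y z u → x :< y ⇒ y :≤ z :+ u ⇒ ⊢ x :- z :< u) p₁<q₁ q₁≤x+N)
                (sym f))) (δ-no {p₁} {y} (λ f → res≢-offset {p₁} {y}
                (linear (p₁ ∷ y ∷ []) (λ x y → x :< y ⇒ ⊢ con 0ℤ :< y :- x) (≰⇒> l))
                (linear (x ∷ p₁ ∷ y ∷ N ∷ []) (λ x y z u → x :< y ⇒ z :< x :+ u ⇒ ⊢ z :- y :< u) x<p₁ (y<x+N G))
                f)) (δ-no {q₁} {x} (λ f → res≢-offset {x} {q₁}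
                (linear (x ∷ p₁ ∷ q₁ ∷ []) (λ x y z → x :< y ⇒ y :< z ⇒ ⊢ con 0ℤ :< z :- x) x<p₁ p₁<q₁)
                (linear (q₁ ∷ y ∷ x ∷ N ∷ []) (λ x y z u → x :< y ⇒ y :< z :+ u ⇒ ⊢ x :- z :< u) q₁<y (y<x+N G))
                (sym f))) (δ-no {q₁} {y} (λ f → res≢-offset {q₁} {y}
                (linear (q₁ ∷ y ∷ []) (λ x y → x :< y ⇒ ⊢ con 0ℤ :< y :- x) q₁<y)
                (linear (x ∷ p₁ ∷ q₁ ∷ y ∷ N ∷ []) (λ x y z u v → x :< y ⇒ y :< z ⇒ u :< x :+ v ⇒ ⊢ u :- z :< v)
                x<p₁ p₁<q₁ (y<x+N G)) f))))

    -- The word realising t_{m(e_x − e_y)} z along a chain of degree m c + Σ γ ≤ d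
    module _ {x y : ℤ} (G : Gap x y) where

      private
        first : Path [] (λ a → a + N· weight m x y a) (+ m *Q c)
        first = path-translate (x<y G) (y<x+N G) m []

        whole : Path [] _ (+ m *Q c +Q sumQ γ)
        whole = path-∘ first (path-prod γ P (Path.end first))

      target : W n
      target = Path.end whole

      target-translates : Translates (perm target) (perm z) m x y
      target-translates a = trans (Path.action whole a) (cong (λ t → t + N· weight m x y t) (sym (z≃prod a)))

      -- The `γ i` sum to the crossings of `z`, which `d − m c` bounds, so the part `m c` spent on
      -- the translation still fits into `d`.
      target-joined : Joined d [] target
      target-joined = [] , ≈⇒≤B {[]} {[]} (≈-refl {[]}) , Path.chain whole , λ i → subst (_≤ + d i)
          (sym (Path.degree whole i)) (bound i)
        where
        bound : ∀ i → + m * 1ℤ + sumQ γ i ≤ + d i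
        bound i = subst (λ t → + m * 1ℤ + sumQ γ t ≤ + d t) (cls-toℕ i) at
          where
          γ-flux′ : rank (perm z) (pt i) (pt i) ≡ sumQ γ (cls (pt i))
          γ-flux′ = γ-flux (pt i)
          d-split : + d (cls (pt i)) ≡ + m + deg (d ⊖c m) (pt i)
          d-split = deg-split (pt i)
          at : + m * 1ℤ + sumQ γ (cls (pt i)) ≤ + d (cls (pt i))
          at = linear-by (byCombination (1ℤ ∷ 1ℤ ∷ -1ℤ ∷ 1ℤ ∷ -1ℤ ∷ []))
              (+ m * 1ℤ ∷ + m ∷ rank (perm z) (pt i) (pt i) ∷ sumQ γ (cls (pt i)) ∷ deg (d ⊖c m) (pt i) ∷ + d
              (cls (pt i)) ∷ []) (λ x y z u v w → x :≡ y ⇒ z :≡ u ⇒ z :≤ v ⇒ w :≡ y :+ v ⇒ ⊢ x :+ u :≤ w)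
              (*-identityʳ (+ m)) γ-flux′ (flux z-is (pt i)) d-split

      target-length : ∀ {l} → HasLength z l → HasLength target (2 ℕ.* m ℕ.* (n ℕ.∸ 1) ℕ.+ l)
      target-length = translate-length {z} {target} {m} {x} {y}
          (linear (rank (perm z) x x ∷ deg (d ⊖c m) x ∷ []) (λ x y → x :≤ y ⇒ y :≡ con 0ℤ ⇒ ⊢ x :≤ con 0ℤ)
          (flux z-is x) (Dx G)) (linear (rank (perm z) (y - 1ℤ) (y - 1ℤ) ∷ deg (d ⊖c m) (y - 1ℤ) ∷ [])
          (λ x y → x :≤ y ⇒ y :≡ con 0ℤ ⇒ ⊢ x :≤ con 0ℤ) (flux z-is (y - 1ℤ)) (Dy G))
        (window≢ (x<y G) (y<x+N G)) target-translates

      target-operator : ∀ {μ : Q n} → (∀ ν → ⟨ μ , ν ⟩ ≡ + m * (jump ν x - jump ν y)) → ⟦ target ⟧ ≐ translation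
          μ ∘ ⟦ z ⟧
      target-operator {μ} e = rep-determines (rep-word target)
          (rep-∘ (rep-translation {μ} {m} {x} {y} e) (rep-word z)) target-translates

    weight-norm : ∀ x y t a → weight m x y a ≡ weight m x (y + N· t) a
    weight-norm x y t a = cong (λ s → + m * (δ a x - s)) (δ-cong′ {a} {y} {y + N· t} (sym (res-shift y t)))

    below-target : ∀ {w} → Joined d [] w → ∃[ x ] ∃[ y ] Σ[ G ∈ Gap x y ] w ≤B target G
    below-target {w} J = go (dominating-translate (setting {w} J) {x₀} zero₀)
      where
      go : _ → _
      go (x , y , Dx , Dy , ne , below) = x , y′ , G , ⊑⇒≤B w (target G)
          (below {perm (target G)} (balanced-word (target G)) T)
        where
        -- The translation depends on the class of `y` only; the representative in the period after
        -- `x` makes it a gap.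
        t : ℤ
        t = - φ (y - x)
        y′ : ℤ
        y′ = y + N· t
        y′≡ : y′ ≡ y - N· φ (y - x)
        y′≡ = cong (λ s → y + s) (N·-neg (φ (y - x)))
        x≢y′ : x ≢ y′
        x≢y′ e = ne (trans (cong res e) (res-shift y t))
        G : Gap x y′
        G = gap (≤∧≢⇒< (linear-by (byCombination (1ℤ ∷ -1ℤ ∷ [])) (y′ ∷ y ∷ N· φ (y - x) ∷ x ∷ [])
            (λ x y z u → x :≡ y :- z ⇒ z :≤ y :- u ⇒ ⊢ u :≤ x) y′≡ (φ-lower (y - x))) x≢y′)
            (linear (y′ ∷ y ∷ N· φ (y - x) ∷ x ∷ N ∷ []) (λ x y z u v → x :≡ y :- z ⇒ y :- u :< z :+ v ⇒ ⊢ x :< u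
            :+ v) y′≡ (φ-upper (y - x))) Dx
          (trans (deg-cong (d ⊖c m) {y′ - 1ℤ} {y - 1ℤ} (res-+ -1ℤ (res-shift y t))) Dy)
        T : Translates (perm (target G)) (perm z) m x y
        T a = trans (target-translates G a) (cong (λ s → act z a + N· s) (sym (weight-norm x y t (act z a))))

    -- An element strictly above a target would itself lie below some target, but all targets have
    -- the same length.
    target-Γ : ∀ {x y} (G : Gap x y) → Γ d [] (target G)
    target-Γ G = target-joined G , λ w J T≤w → decide w J (≤B⇒≈⊎<ℓ {target G} {w} T≤w)
      where
      decide : ∀ w → Joined d [] w → target G ≈ w ⊎ target G <ℓ w → target G ≈ w
      decide w J (inj₁ e) = e
      decide w J (inj₂ (k , l , p , q , r)) = ⊥-elim (go (below-target {w} J))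
        where
        L : ∃[ l ] HasLength z l
        L = length-exists z
        go : _ → Empty
        go (x′ , y′ , G′ , w≤T′) = compare (≤B⇒≈⊎<ℓ {w} {target G′} w≤T′)
          where
          k≡ : k ≡ _
          k≡ = length-unique {target G} p (target-length G (proj₂ L))
          compare : w ≈ target G′ ⊎ w <ℓ target G′ → Empty
          compare (inj₁ e) = ℕP.<-irrefl (trans k≡ (length-unique {target G′} (target-length G′ (proj₂ L))
              (length-cong {w} {target G′} e q))) r
          compare (inj₂ (k′ , l′ , p′ , q′ , r′)) = ℕP.<-asym r (subst₂ ℕ._<_ (length-unique {w} p′ q)
            (trans (length-unique {target G′} q′ (target-length G′ (proj₂ L))) (sym k≡)) r′)

    Γ⇒target : ∀ {w} → Γ d [] w → ∃[ x ] ∃[ y ] Σ[ G ∈ Gap x y ] w ≈ target G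
    Γ⇒target {w} (J , max) = go (below-target {w} J)
      where
      go : _ → _
      go (x , y , G , w≤T) = x , y , G , max (target G) (target-joined G) w≤T

    Γ-length : ∀ w → Γ d [] w → ∃[ l ] HasLength z l × HasLength w (2 ℕ.* m ℕ.* (n ℕ.∸ 1) ℕ.+ l)
    Γ-length w g = go (Γ⇒target {w} g) (length-exists z)
      where
      go : _ → _ → _
      go (x , y , G , e) (l , L) = l , L , length-cong {target G} {w} (≈-sym {w} {target G} e) (target-length G L)

    α₀? : ∀ β → Dec (α₀∈supp β)
    α₀? β = go (β (cls 0ℤ) ≟ 0ℤ)
      where
      zeroth : ∀ {i : Fin n} → toℕ i ≡ 0 → i ≡ cls 0ℤ
      zeroth {i} e = trans (sym (cls-toℕ i)) (cong (λ t → cls (+ t)) e)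
      go : Dec (β (cls 0ℤ) ≡ 0ℤ) → Dec (α₀∈supp β)
      go (yes e) = no λ (i , f , ne) → ne (trans (cong β (zeroth f)) e)
      go (no ne) = yes (cls 0ℤ , trans (toℕ-cls 0ℤ) (res-id (ℕP.≤-trans (s≤s z≤n) 3≤n)) , ne)

    -- The vectors `β` and `β - c` pair equally with everything, so one computation covers both
    -- cases; the case distinction selects the vector that lies in the finite root lattice.
    Γ-description : ∀ (f : Op n) →
      (∃[ w ] Γ d [] w × f ≐ ⟦ w ⟧)
      ⇔
      ((∃[ β ] Admissible γ β × ¬ (α₀∈supp β) × f ≐ translation ((+ m) *Q β) ∘ ⟦ z ⟧)
       ⊎ (∃[ β ] Admissible γ β × α₀∈supp β × f ≐ translation ((+ m) *Q (β -Q c)) ∘ ⟦ z ⟧))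
    Γ-description f = mk⇔ forward backward
      where
      forward : _ → _
      forward (w , g , e) = go (Γ⇒target {w} g)
        where
        go : _ → _
        go (x , y , G , h) = decide (α₀? (root x y))
          where
          via : ∀ {μ : Q n} → (∀ ν → ⟨ μ , ν ⟩ ≡ + m * (jump ν x - jump ν y)) → f ≐ translation μ ∘ ⟦ z ⟧
          via {μ} F ν i = trans (e ν i) (trans (h ν i) (target-operator G {μ} F ν i))
          decide : Dec (α₀∈supp (root x y)) → _
          decide (no ne) = inj₁ (root x y , gap⇒admissible G , ne , via {+ m *Q root x y}
              (form-translation (+ m) (λ _ → refl)))
          decide (yes s) = inj₂ (root x y , gap⇒admissible G , s , via {+ m *Q (root x y -Q c)}
              (form-translation-c (+ m) (λ _ → refl)))
      realise : ∀ {β} (μ : Q n) → (∀ {x y} → β ≗ root x y → ∀ ν → ⟨ μ , ν ⟩ ≡ + m * (jump ν x - jump ν y)) →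
                Admissible γ β → f ≐ translation μ ∘ ⟦ z ⟧ → ∃[ w ] Γ d [] w × f ≐ ⟦ w ⟧
      realise μ F A e = go (admissible⇒gap A)
        where
        go : _ → _
        go (x , y , G , h) = target G , target-Γ G , λ ν i → trans (e ν i) (sym (target-operator G {μ} (F h) ν i))
      backward : _ → _
      backward (inj₁ (β , A , _ , e)) = realise {β} (+ m *Q β) (form-translation (+ m)) A e
      backward (inj₂ (β , A , _ , e)) = realise {β} (+ m *Q (β -Q c)) (form-translation-c (+ m)) A e

    -- The number of admissible roots: pairs of walls i, j of minimal degree with j + 1 ≢ i

    record Slot (i j : Fin n) : Set where
      constructor slot
      field
        Di   : deg (d ⊖c m) (pt i) ≡ 0ℤ
        Dj   : deg (d ⊖c m) (pt j) ≡ 0ℤ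
        i≢j+ : res (pt i) ≢ res (pt j + 1ℤ)

    slot? : ∀ i j → Dec (Slot i j)
    slot? i j = go (deg (d ⊖c m) (pt i) ≟ 0ℤ) (deg (d ⊖c m) (pt j) ≟ 0ℤ) (res (pt i) ℕ.≟ res (pt j + 1ℤ))
      where
      go : Dec _ → Dec _ → Dec _ → Dec (Slot i j)
      go (yes e) (yes f) (no g)  = yes (slot e f g)
      go (no e)  _       _       = no λ s → e (Slot.Di s)
      go _       (no f)  _       = no λ s → f (Slot.Dj s)
      go _       _       (yes g) = no λ s → Slot.i≢j+ s g

    -- The translate of `j + 1` in the period that starts at `i`, that is, the right end of the gap
    -- with walls `i` and `j`.
    wrap : Fin n → Fin n → ℤ
    wrap i j = pt j + 1ℤ - N· φ (pt j + 1ℤ - pt i)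

    res-wrap : ∀ i j → res (wrap i j) ≡ res (pt j + 1ℤ)
    res-wrap i j = trans (cong (λ s → res (pt j + 1ℤ + s)) (sym (N·-neg (φ (pt j + 1ℤ - pt i)))))
        (res-shift (pt j + 1ℤ) _)

    slot⇒gap : ∀ {i j} → Slot i j → Gap (pt i) (wrap i j)
    slot⇒gap {i} {j} (slot Di Dj ne) = gap
      (≤∧≢⇒< (lower (pt i) (pt j + 1ℤ)) (λ e → ne (trans (cong res e) (res-wrap i j))))
      (upper (pt i) (pt j + 1ℤ)) Di
      (trans (deg-cong (d ⊖c m) {wrap i j - 1ℤ} {pt j} (trans (res-+ -1ℤ (res-wrap i j))
          (cong res (cancel (pt j))))) Dj)
      where
      cancel : ∀ x → x + 1ℤ - 1ℤ ≡ x
      cancel x = linear (x ∷ []) (λ x → ⊢ x :+ con 1ℤ :- con 1ℤ :≡ x)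
      lower : ∀ x y → x ≤ y - N· φ (y - x)
      lower x y = linear (N· φ (y - x) ∷ y ∷ x ∷ []) (λ x y z → x :≤ y :- z ⇒ ⊢ z :≤ y :- x) (φ-lower (y - x))
      upper : ∀ x y → y - N· φ (y - x) < x + N
      upper x y = linear (y ∷ x ∷ N· φ (y - x) ∷ N ∷ []) (λ x y z u → x :- y :< z :+ u ⇒ ⊢ x :- z :< y :+ u)
          (φ-upper (y - x))

    y-1+1 : ∀ y → y - 1ℤ + 1ℤ ≡ y
    y-1+1 y = linear (y ∷ []) (λ x → ⊢ x :- con 1ℤ :+ con 1ℤ :≡ x)

    res-pred-suc : ∀ y → res (pt (cls (y - 1ℤ)) + 1ℤ) ≡ res y
    res-pred-suc y = trans (res-+ 1ℤ (res-cls (y - 1ℤ))) (cong res (y-1+1 y))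

    gap⇒slot : ∀ {x y} → Gap x y → Slot (cls x) (cls (y - 1ℤ))
    gap⇒slot {x} {y} G = slot (trans (deg-cong (d ⊖c m) {pt (cls x)} {x} (res-cls x)) (Dx G))
      (trans (deg-cong (d ⊖c m) {pt (cls (y - 1ℤ))} {y - 1ℤ} (res-cls (y - 1ℤ))) (Dy G))
      (λ e → window≢ (x<y G) (y<x+N G) (trans (sym (res-cls x)) (trans e (res-pred-suc y))))

    gap-root : ∀ {x y} → Gap x y → root x y ≗ root (pt (cls x)) (wrap (cls x) (cls (y - 1ℤ)))
    gap-root {x} {y} G k = trans (cong₂ (λ s t → root s t k) x≡
        (y≡ (pt (cls x)) (pt (cls (y - 1ℤ))) (φ x - φ (pt (cls x))) (φ (y - 1ℤ) - φ (pt (cls (y - 1ℤ)))) x≡ y-1≡))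
      (root-shift (pt (cls x)) (wrap (cls x) (cls (y - 1ℤ))) (φ x - φ (pt (cls x))) k)
      where
      x≡ : x ≡ pt (cls x) + N· (φ x - φ (pt (cls x)))
      x≡ = res-≡ {x} {pt (cls x)} (sym (res-cls x))
      y-1≡ : y - 1ℤ ≡ pt (cls (y - 1ℤ)) + N· (φ (y - 1ℤ) - φ (pt (cls (y - 1ℤ))))
      y-1≡ = res-≡ {y - 1ℤ} {pt (cls (y - 1ℤ))} (sym (res-cls (y - 1ℤ)))
      y≡ : ∀ u v a b → x ≡ u + N· a → y - 1ℤ ≡ v + N· b → y ≡ v + 1ℤ - N· φ (v + 1ℤ - u) + N· a
      y≡ u v a b e f = linear (y ∷ v ∷ N· b ∷ N· φ (v + 1ℤ - u) ∷ N· (a - b) ∷ N· a ∷ [])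
          (λ x y z u v w → x :- con 1ℤ :≡ y :+ z ⇒ u :≡ v ⇒ v :≡ w :- z ⇒ ⊢ x :≡ y :+ con 1ℤ :- u :+ w) f
          (cong N·_ level) (N·-- a b)
        where
        level : φ (v + 1ℤ - u) ≡ a - b
        level = linear-by (byEquations (1ℤ ∷ -1ℤ ∷ -1ℤ ∷ [])) (φ (y - x) ∷ φ (v + 1ℤ - u + N· (b - a)) ∷ φ
            (v + 1ℤ - u) ∷ b ∷ a ∷ []) (λ x y z u v → x :≡ con 0ℤ ⇒ x :≡ y ⇒ y :≡ z :+ (u :- v) ⇒ ⊢ z :≡ v :- u)
            (φ-small {y - x} (linear (x ∷ y ∷ []) (λ x y → x :< y ⇒ ⊢ con 0ℤ :≤ y :- x) (x<y G))
            (linear (y ∷ x ∷ N ∷ []) (λ x y z → x :< y :+ z ⇒ ⊢ x :- y :< z) (y<x+N G)))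
            (cong φ {y - x} {v + 1ℤ - u + N· (b - a)} (linear-by (byEquations (-1ℤ ∷ 1ℤ ∷ -1ℤ ∷ []))
            (x ∷ u ∷ N· a ∷ y ∷ v ∷ N· b ∷ N· (b - a) ∷ []) (λ x y z u v w p → x :≡ y :+ z ⇒ u :- con 1ℤ :≡ v :+
            w ⇒ p :≡ w :- z ⇒ ⊢ u :- x :≡ v :+ con 1ℤ :- y :+ p) e f (N·-- b a))) (φ-shift (v + 1ℤ - u) (b - a))

    target-cong : ∀ {x y x′ y′} (G : Gap x y) (G′ : Gap x′ y′) → res x ≡ res x′ → res y ≡ res y′ → target G ≈
        target G′
    target-cong {x} {y} {x′} {y′} G G′ e f = ≃⇒≈ {target G} {target G′} λ a → trans (target-translates G a)
      (trans (cong (λ s → act z a + N· s) (cong₂ (λ s t → + m * (s - t)) (δ-cong′ {act z a} {x} {x′} e)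
          (δ-cong′ {act z a} {y} {y′} f)))
        (sym (target-translates G′ a)))

    -- As `z` is a bijection, the two translations have the same weight on every class; since
    -- `m ≥ 1`, the weights `m` and `−m` single out the classes of `x` and `y`.
    target-injective : ∀ {x y x′ y′} (G : Gap x y) (G′ : Gap x′ y′) → target G ≈ target G′ → res x ≡ res x′ × res
        y ≡ res y′
    target-injective {x} {y} {x′} {y′} G G′ e = at-x (classify x′ y′ x) , at-y (classify x′ y′ y)
      where
      ne : res x ≢ res y
      ne = window≢ (x<y G) (y<x+N G)
      ne′ : res x′ ≢ res y′
      ne′ = window≢ (x<y G′) (y<x+N G′)
      N·-injective : ∀ {a b} → N· a ≡ N· b → a ≡ b
      N·-injective {a} {b} e = go (<-cmp a b)
        where
        go : _ → a ≡ b
        go (tri< l _ _) = ⊥-elim (1≰0 (linear-by (byCombination (1ℤ ∷ 1ℤ ∷ -1ℤ ∷ [])) (N· a ∷ N ∷ N· b ∷ [])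
            (λ x y z → x :+ y :≤ z ⇒ x :≡ z ⇒ con (+ 3) :≤ y ⇒ ⊢ con 1ℤ :≤ con 0ℤ) (N·-< l) e 3≤N))
        go (tri≈ _ f _) = f
        go (tri> _ _ l) = ⊥-elim (1≰0 (linear (N· b ∷ N ∷ N· a ∷ [])
            (λ x y z → x :+ y :≤ z ⇒ z :≡ x ⇒ con (+ 3) :≤ y ⇒ ⊢ con 1ℤ :≤ con 0ℤ) (N·-< l) e 3≤N))
      shifts : ∀ a → weight m x y (act z a) ≡ weight m x′ y′ (act z a)
      shifts a = N·-injective (linear-by (byEquations (-1ℤ ∷ 1ℤ ∷ 1ℤ ∷ []))
          (to (perm (target G)) a ∷ to (perm z) a ∷ N· weight m x y (to (perm z) a) ∷ to (perm (target G′)) a ∷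
          N· weight m x′ y′ (to (perm z) a) ∷ []) (λ x y z u v → x :≡ y :+ z ⇒ u :≡ y :+ v ⇒ x :≡ u ⇒ ⊢ z :≡ v)
          (target-translates G a) (target-translates G′ a) (≈⇒≃ {target G} {target G′} e a))
      weights : ∀ p → weight m x y p ≡ weight m x′ y′ p
      weights p = subst (λ t → weight m x y t ≡ weight m x′ y′ t) (act-pos z p) (shifts (pos z p))
      at-x : Class x′ y′ x → res x ≡ res x′
      at-x (is-a f)    = f
      at-x (is-b _ f)  = ⊥-elim (1≰0 (linear-by (byCombination (1ℤ ∷ 1ℤ ∷ -1ℤ ∷ 1ℤ ∷ (+ 2) ∷ []))
          (weight m x y x ∷ weight m x′ y′ x ∷ + m ∷ []) (λ x y z → x :≡ y ⇒ x :≡ z ⇒ y :≡ opp z ⇒ con 1ℤ :≤ z ⇒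
          ⊢ con 1ℤ :≤ con 0ℤ) (weights x) (weight-x m ne {x} refl) (weight-y m ne′ {x} f) m≥1))
      at-x (other f g) = ⊥-elim (1≰0 (linear-by (byCombination (1ℤ ∷ 1ℤ ∷ -1ℤ ∷ []))
          (weight m x y x ∷ weight m x′ y′ x ∷ + m ∷ []) (λ x y z → x :≡ y ⇒ x :≡ z ⇒ y :≡ con 0ℤ ⇒ con 1ℤ :≤ z ⇒
          ⊢ con 1ℤ :≤ con 0ℤ) (weights x) (weight-x m ne {x} refl) (weight-o m {x′} {y′} {x} f g) m≥1))
      at-y : Class x′ y′ y → res y ≡ res y′
      at-y (is-a f)    = ⊥-elim (1≰0 (linear-by (byCombination (1ℤ ∷ -1ℤ ∷ 1ℤ ∷ -1ℤ ∷ (+ 2) ∷ []))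
          (weight m x y y ∷ weight m x′ y′ y ∷ + m ∷ []) (λ x y z → x :≡ y ⇒ x :≡ opp z ⇒ y :≡ z ⇒ con 1ℤ :≤ z ⇒
          ⊢ con 1ℤ :≤ con 0ℤ) (weights y) (weight-y m ne {y} refl) (weight-x m ne′ {y} f) m≥1))
      at-y (is-b _ f)  = f
      at-y (other f g) = ⊥-elim (1≰0 (linear-by (byCombination (1ℤ ∷ -1ℤ ∷ 1ℤ ∷ -1ℤ ∷ []))
          (weight m x y y ∷ weight m x′ y′ y ∷ + m ∷ []) (λ x y z → x :≡ y ⇒ x :≡ opp z ⇒ y :≡ con 0ℤ ⇒ con 1ℤ :≤
          z ⇒ ⊢ con 1ℤ :≤ con 0ℤ) (weights y) (weight-y m ne {y} refl) (weight-o m {x′} {y′} {y} f g) m≥1))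

    root-injective : ∀ {x y x′ y′} → res x ≢ res y → root x y ≗ root x′ y′ → res x ≡ res x′ × res y ≡ res y′
    root-injective {x} {y} {x′} {y′} ne e = root-determines {x} {y} {x′} {y′} ne e ,
      root-determines {y} {x} {y′} {x′} (ne ∘ sym) λ i →
        trans (sym (neg-sub (φ (pt i - x)) (φ (pt i - y)))) (trans (cong -_ (e i))
            (neg-sub (φ (pt i - x′)) (φ (pt i - y′))))

    row column : Fin (n ℕ.* n) → Fin n
    row s    = proj₁ (Fin.remQuot {n} n s)
    column s = proj₂ (Fin.remQuot {n} n s)

    row-combine : ∀ i j → row (Fin.combine i j) ≡ i
    row-combine i j = cong proj₁ (remQuot-combine {n} {n} i j)

    column-combine : ∀ i j → column (Fin.combine i j) ≡ j
    column-combine i j = cong proj₂ (remQuot-combine {n} {n} i j)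

    row-column : ∀ s t → row s ≡ row t → column s ≡ column t → s ≡ t
    row-column s t e f = trans (sym (combine-remQuot {n} n s))
        (trans (cong₂ Fin.combine e f) (combine-remQuot {n} n t))

    -- One enumeration serves both for the admissible roots and for the curve neighborhood, which is
    -- what equates their cardinalities.
    slots : Enumeration (λ s → Slot (row s) (column s))
    slots = enumerate (λ s → Slot (row s) (column s)) (λ s → slot? (row s) (column s))

    slot-at : ∀ {i j} → Slot i j → Slot (row (Fin.combine i j)) (column (Fin.combine i j))
    slot-at {i} {j} = subst₂ Slot (sym (row-combine i j)) (sym (column-combine i j))

    same-slot : ∀ s t → res (pt (row s)) ≡ res (pt (row t)) → res (wrap (row s) (column s)) ≡ res
        (wrap (row t) (column t)) → s ≡ t
    same-slot s t e f = row-column s t (same e)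
      (same (res-+-cancel 1ℤ (trans (sym (res-wrap (row s) (column s))) (trans f (res-wrap (row t) (column t))))))
      where
      same : ∀ {i j : Fin n} → res (pt i) ≡ res (pt j) → i ≡ j
      same {i} {j} e = toℕ-injective (trans (sym (res-toℕ i)) (trans e (res-toℕ j)))

    admissible-cardinality : HasCardinality (qSetoid n) (Admissible γ) (Enumeration.size slots)
    admissible-cardinality = cardinality (qSetoid n) slots (λ s _ → root (pt (row s)) (wrap (row s) (column s)))
      (λ s p → gap⇒admissible (slot⇒gap p)) (λ s p q i → refl) surjective
      (λ s t p q e → let G = slot⇒gap p ; f , g = root-injective (window≢ (x<y G) (y<x+N G)) e in same-slot s t f g)
      where
      surjective : ∀ β → Admissible γ β → ∃[ s ] Σ[ p ∈ Slot (row s) (column s) ] β ≗ root (pt (row s))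
          (wrap (row s) (column s))
      surjective β A = go (admissible⇒gap A)
        where
        go : _ → _
        go (x , y , G , e) = Fin.combine (cls x) (cls (y - 1ℤ)) , slot-at (gap⇒slot G) ,
          subst₂ (λ i j → β ≗ root (pt i) (wrap i j)) (sym (row-combine _ _)) (sym (column-combine _ _))
            (λ k → trans (e k) (gap-root G k))

    Γ-cardinality : HasCardinality (wSetoid n) (Γ d []) (Enumeration.size slots)
    Γ-cardinality = cardinality (wSetoid n) slots (λ s p → target (slot⇒gap p)) (λ s p → target-Γ (slot⇒gap p))
      (λ s p q → target-cong (slot⇒gap p) (slot⇒gap q) refl refl) surjective
      (λ s t p q e → let f , g = target-injective (slot⇒gap p) (slot⇒gap q) e in same-slot s t f g)
      where
      surjective : ∀ w → Γ d [] w → ∃[ s ] Σ[ p ∈ Slot (row s) (column s) ] w ≈ target (slot⇒gap p)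
      surjective w g = go (Γ⇒target {w} g)
        where
        go : _ → _
        go (x , y , G , e) = Fin.combine (cls x) (cls (y - 1ℤ)) , p , ≈-trans {w} {target G}
            {target (slot⇒gap p)} e
          (target-cong G (slot⇒gap p)
            (trans (sym (res-cls x)) (cong (λ i → res (pt i)) (sym (row-combine (cls x) (cls (y - 1ℤ))))))
            (trans (sym (trans (res-wrap (cls x) (cls (y - 1ℤ))) (res-pred-suc y)))
              (cong₂ (λ i j → res (wrap i j)) (sym (row-combine (cls x) (cls (y - 1ℤ))))
                  (sym (column-combine (cls x) (cls (y - 1ℤ)))))))
          where
          p : Slot (row (Fin.combine (cls x) (cls (y - 1ℤ)))) (column (Fin.combine (cls x) (cls (y - 1ℤ))))
          p = slot-at (gap⇒slot G)

-- The theorem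

open import Defs
open import Data.Fin using (Fin)
open import Data.Integer using (ℤ; +_)
open import Data.List using ([])
open import Data.Nat using (_≤_; _+_; _*_; _∸_)
open import Data.Product using (∃-syntax; _×_)
open import Data.Sum using (_⊎_)
open import Data.Vec.Functional using (Vector)
open import Function using (_∘_; _⇔_)
open import Relation.Nullary using (¬_)

theorem1p14 : (n : ℕ) → 3 ≤ n →
    (d : Degree n) → c <Q fromDegree d →
    (m : ℕ) → IsMin d m →
    (z : W n) → IsZ (d ⊖c m) z →
    (k : ℕ) (γ : Vector (Q n) k) →
    (∀ i → PositiveReal (γ i)) → Separated γ →
    ⟦ z ⟧ ≐ reflections γ →
    (∀ (f : Op n) →
    (∃[ w ] Γ d [] w × f ≐ ⟦ w ⟧)
    ⇔
    ((∃[ β ] Admissible γ β × ¬ (α₀∈supp β) ×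
    f ≐ translation ((+ m) *Q β) ∘ ⟦ z ⟧)
    ⊎
    (∃[ β ] Admissible γ β × α₀∈supp β ×
    f ≐ translation ((+ m) *Q (β -Q c)) ∘ ⟦ z ⟧)))
    × (∃[ N ] HasCardinality (wSetoid n) (Γ d []) N
    × HasCardinality (qSetoid n) (Admissible γ) N)
    × (∀ w → Γ d [] w →
    ∃[ l ] HasLength z l × HasLength w (2 * m * (n ∸ 1) + l))
theorem1p14 n 3≤n d c<d m min z Z k γ γ-positive γ-separated γ-product =
  Γ-description , (_ , Γ-cardinality , admissible-cardinality) , Γ-length
  where
  open import Data.Product using (_,_)
  open Affine.Main n 3≤n d c<d m min z Z γ γ-positive γ-separated γ-product
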